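{- In the localized double affine Hecke algebra $\widetilde H_{\mathrm{loc}}$ the Hecke symmetrizers $\varepsilon_+,\varepsilon_-,\varepsilon_\pm,\varepsilon_\mp$ satisfy \begin{align*} \chi^+(T_{w_0})\,\varepsilon_+ &= e_+^X\,\kappa_{\mathrm{st}}^{X^{ -1}}\kappa_{\mathrm{dr}}^{X^{ -1}} = e_+^Y\,\kappa_{\mathrm{st}}^{Y}\kappa_{\mathrm{dr}}^{Y},\\ \chi^+(T_{w_0})\,\varepsilon_- &= \kappa_{\mathrm{st}}^{X}\kappa_{\mathrm{dr}}^{X}\,e_-^X = \kappa_{\mathrm{st}}^{Y^{ -1}}\kappa_{\mathrm{dr}}^{Y^{ -1}}\,e_-^Y,\\ \chi^+(T_{w_0})\,\varepsilon_\pm &= \kappa_{\mathrm{dr}}^{X}\,e_\pm^X\,\kappa_{\mathrm{st}}^{X^{ -1}} = \kappa_{\mathrm{dr}}^{Y^{ -1}}\,e_\pm^Y\,\kappa_{\mathrm{st}}^{Y},\\ \chi^+(T_{w_0})\,\varepsilon_\mp &= \kappa_{\mathrm{st}}^{X}\,e_\mp^X\,\kappa_{\mathrm{dr}}^{X^{ -1}} = \kappa_{\mathrm{st}}^{Y^{ -1}}\,e_\mp^Y\,\kappa_{\mathrm{dr}}^{Y}. \end{align*}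
   Context: Let $n\ge 1$ and $\mathbb K=\mathbb C(q^{1/2},t^{1/2},t_0^{1/2},u_0^{1/2},t_n^{1/2},u_n^{1/2})$, with independent parameters. **Lattices and reflections.** Let $Q=\mathbb Z\text{ -span}\{\varepsilon_1,\dots,\varepsilon_n,\tfrac12\delta\}$ and $Q^\vee=\mathbb Z\text{ -span}\{\varepsilon_1^\vee,\dots,\varepsilon_n^\vee,\tfrac12K\}$. On $Q$: $s_i$ ($1\le i\le n-1$) swaps $\varepsilon_i,\varepsilon_{i+1}$; $s_n$ sends $\varepsilon_n\mapsto-\varepsilon_n$; $s_0$ sends $\varepsilon_1\mapsto-\varepsilon_1+\delta$; all other basis elements are fixed. The same formulas with $\varepsilon_i^\vee,K$ in place of $\varepsilon_i,\delta$ define the action on $Q^\vee$. $W_{\mathrm{fin}}$ is the group generated by $s_1,\dots,s_n$ (signed permutations). $w_0$ is its longest element. For $w\in W_{\mathrm{fin}}$, $\ell_s(w)$ (resp. $\ell_d(w)$) is the number of factors $s_i$ with $i<n$ (resp. factors $s_n$) in a reduced word of $w$. Simple roots: $\alpha_0=-\varepsilon_1+\tfrac12\delta$, $\alpha_i=\varepsilon_i-\varepsilon_{i+1}$ ($1\le i<n$), $\alpha_n=\varepsilon_n$; simple coroots: $\alpha_0^\vee=-\varepsilon_1^\vee+\tfrac12K$, $\alpha_i^\vee=\varepsilon_i^\vee-\varepsilon_{i+1}^\vee$, $\alpha_n^\vee=\varepsilon_n^\vee$. Parameters: $t_{\alpha_0}=t_0,u_{\alpha_0}=u_0$; $t_{\alpha_n}=t_n,u_{\alpha_n}=u_n$;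 $t_{\alpha_0^\vee}=u_n,u_{\alpha_0^\vee}=u_0$; $t_{\alpha_n^\vee}=t_n,u_{\alpha_n^\vee}=t_0$; and $t_{\alpha_i}=u_{\alpha_i}=t_{\alpha_i^\vee}=u_{\alpha_i^\vee}=t$ for $1\le i<n$. **Variables.** $\mathbb K(X)=\mathbb K(X_1,\dots,X_n)$ with $X^{\varepsilon_i}=X_i$, $X^{\delta/2}=q^{1/2}$; $\mathbb K(Y)=\mathbb K(Y_1,\dots,Y_n)$ with $Y^{\varepsilon_i^\vee}=Y_i$, $Y^{K/2}=q^{ -1/2}$. Set $$c^Y_{\alpha^\vee}=t_{\alpha^\vee}^{ -1/2}\frac{(1-t_{\alpha^\vee}^{1/2}u_{\alpha^\vee}^{1/2}Y^{\alpha^\vee})(1+t_{\alpha^\vee}^{1/2}u_{\alpha^\vee}^{ -1/2}Y^{\alpha^\vee})}{1-Y^{2\alpha^\vee}},\qquad c^{X^{ -1}}_{\alpha}=t_\alpha^{ -1/2}\frac{(1-t_\alpha^{1/2}u_\alpha^{1/2}X^{ -\alpha})(1+t_\alpha^{1/2}u_\alpha^{ -1/2}X^{ -\alpha})}{1-X^{ -2\alpha}} .$$ **The algebra $\widetilde H_{\mathrm{loc}}$** is the $\mathbb K$-algebra generated by $\mathbb K(X)$, $\mathbb K(Y)$, $\xi_{s_i}$, $\eta_{s_i}$, $T_{\alpha_i}$, $T_{\alpha_i^\vee}$ ($0\le i\le n$), with relations: the $\xi_{s_i}$, and likewise the $\eta_{s_i}$, are involutions satisfying the braid relations of the affine Coxeter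 diagram of type $C_n$ (nodes $0,1,\dots,n$ in a line, double bonds at both ends); $\xi_{s_i}X^\mu=X^{s_i\mu}\xi_{s_i}$; $\eta_{s_i}Y^{\lambda^\vee}=Y^{s_i\lambda^\vee}\eta_{s_i}$; $T_{\alpha_i^\vee}+t_{\alpha_i^\vee}^{ -1/2}=(1+\eta_{s_i})c^Y_{\alpha_i^\vee}$ and $T_{\alpha_i}+t_{\alpha_i}^{ -1/2}=(1+\xi_{s_i})c^{X^{ -1}}_{\alpha_i}$ for $0\le i\le n$; $T_j:=T_{\alpha_j}=T_{\alpha_j^\vee}$ for $1\le j\le n$; and, with $T_{s_{\varepsilon_1}}=T_1\cdots T_{n-1}T_nT_{n-1}\cdots T_1$: $Y_1=T_{\alpha_0}T_{s_{\varepsilon_1}}$, $X_1=T_{\alpha_0^\vee}^{ -1}T_{s_{\varepsilon_1}}^{ -1}$, $Y_{j+1}=T_j^{ -1}Y_jT_j^{ -1}$, $X_{j+1}=T_jX_jT_j$ ($1\le j<n$), and $Y_1^{ -1}X_1=q^{1/2}(u_0^{1/2}-u_0^{ -1/2})T_{s_{\varepsilon_1}}^{ -1}+qT_{s_{\varepsilon_1}}^{ -1}X_1^{ -1}Y_1T_{s_{\varepsilon_1}}^{ -1}$. **Hecke symmetrizers.** For a reduced word $w=s_{i_1}\cdots s_{i_k}$ in $W_{\mathrm{fin}}$ put $T_w=T_{i_1}\cdots T_{i_k}$, $\xi_w=\xi_{s_{i_1}}\cdots\xi_{s_{i_k}}$, $\eta_w=\eta_{s_{i_1}}\cdots\eta_{s_{i_k}}$.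 The four one-dimensional characters $\chi^\Xi$, $\Xi\in\{+,\pm,\mp,-\}$, of the finite Hecke algebra generated by $T_1,\dots,T_n$ are: for $i<n$, $\chi^+(T_i)=\chi^\pm(T_i)=t^{1/2}$ and $\chi^\mp(T_i)=\chi^-(T_i)=-t^{ -1/2}$; $\chi^+(T_n)=\chi^\mp(T_n)=t_n^{1/2}$ and $\chi^\pm(T_n)=\chi^-(T_n)=-t_n^{ -1/2}$. Then $$\varepsilon_\Xi=\frac1{\chi^\Xi(T_{w_0})}\sum_{w\in W_{\mathrm{fin}}}\chi^\Xi(T_w)T_w ,$$ so $T_w\varepsilon_\Xi=\chi^\Xi(T_w)\varepsilon_\Xi$ and the coefficient of $T_{w_0}$ in $\varepsilon_\Xi$ is $1$. **$X$- and $Y$-symmetrizers.** $e_+^X=\sum_{w}\xi_w$, $e_-^X=\sum_w(-1)^{\ell_s(w)+\ell_d(w)}\xi_w$, $e_\pm^X=\sum_w(-1)^{\ell_d(w)}\xi_w$, $e_\mp^X=\sum_w(-1)^{\ell_s(w)}\xi_w$ (sums over $w\in W_{\mathrm{fin}}$), and $e^Y_\Xi$ is defined by the same formulas with $\eta_w$ in place of $\xi_w$. **$\kappa$-products.** $$\kappa^X_{\mathrm{dr}}=\prod_{i=1}^n\frac{(1-t_n^{1/2}u_n^{1/2}X_i)(1+t_n^{1/2}u_n^{ -1/2}X_i)}{1-X_i^2},\quad \kappa^Y_{\mathrm{dr}}=\prod_{i=1}^n\frac{(1-t_n^{1/2}t_0^{1/2}Y_i)(1+t_n^{1/2}t_0^{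 -1/2}Y_i)}{1-Y_i^2},$$ $$\kappa^Z_{\mathrm{st}}=\prod_{1\le i<j\le n}\frac{(1-tZ_iZ_j^{ -1})(1-tZ_iZ_j)}{(1-Z_iZ_j^{ -1})(1-Z_iZ_j)}\quad(Z=X\text{ or }Y),$$ and a superscript $X^{ -1}$ (resp. $Y^{ -1}$) means that every $X_i$ (resp. $Y_i$) is replaced by its inverse.
   Formalization: The lines for ε_- and ε_± are false as printed for odd n (e.g. n=1: χ^+(T_{w_0})ε_- = -κ_dr^X e_-^X); their right-hand sides are multiplied by (-1)^{ℓ_s(w_0)+ℓ_d(w_0)} resp. (-1)^{ℓ_d(w_0)}, both equal to (-1)^n. -}

module Defs where

open import Algebra.Bundles using (CommutativeRing; CommutativeSemiring; Ring)
import Algebra.Properties.CommutativeMonoid.Sum as CommutativeMonoidSum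
import Algebra.Properties.Ring as RingProperties
import Algebra.Properties.Semiring.Exp as SemiringExp
import Algebra.Solver.Ring.NaturalCoefficients.Default as SemiringSolver
open import Data.Bool.Base using (if_then_else_)
open import Data.Empty using (⊥-elim)
open import Data.Fin.Base as Fin using (Fin; zero; suc; inject₁; fromℕ; toℕ)
open import Data.Fin.Permutation.Components using (transpose)
import Data.Fin.Properties as Fin
open import Data.Integer.Base as ℤ using (ℤ; +_; -[1+_]; 0ℤ; 1ℤ; -1ℤ)
import Data.Integer.Properties as ℤ
open import Data.List.Base using (List; []; _∷_; map; length; foldr; reverse; allFin; _++_)
open import Data.List.Membership.Propositional using (_∈_)
open import Data.List.Relation.Unary.All using (All)
open import Data.List.Relation.Unary.AllPairs using (AllPairs)
open import Data.List.Relation.Unary.Any using (Any)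
open import Data.Nat.Base as ℕ using (ℕ; zero; suc; z≤n; s≤s)
import Data.Nat.Properties as ℕ
open import Data.Product.Base using (Σ; Σ-syntax; ∃; ∃-syntax; _×_; _,_; proj₁; proj₂)
open import Data.Rational.Base as ℚ using (ℚ; 0ℚ; 1ℚ; ½)
import Data.Rational.Base as Rat
import Data.Rational.Properties as ℚ
open import Data.Sign.Base as Sign using (Sign)
open import Data.Sum.Base using (inj₁; inj₂)
open import Data.Vec.Functional using (updateAt)
open import Function.Base using (_∘_; _$_)
open import Level using (0ℓ)
open import Relation.Binary.Definitions using (tri<; tri≈; tri>)
open import Relation.Binary.PropositionalEquality as ≡ using (_≡_; _≢_; cong; cong₂; subst)
import Relation.Binary.Reasoning.Setoid as SetoidReasoning
open import Relation.Nullary.Decidable using (Dec; does; yes; no)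
open import Relation.Nullary.Negation using (¬_)

------------------------------------------------------------------------
-- ℝ as Cauchy sequences of rationals modulo null sequences, ℂ = ℝ + iℝ

private
  module DifferenceIdentities (R : CommutativeRing 0ℓ 0ℓ) where
    open CommutativeRing R
    open RingProperties ring using (-‿distribʳ-*; -‿+-comm; -‿involutive)
    open SemiringSolver commutativeSemiring
    open SetoidReasoning setoid

    cancel : ∀ x b → x + (b - b) ≈ x
    cancel x b = trans (+-congˡ (-‿inverseʳ b)) (+-identityʳ x)

    sub-+ : ∀ a b c d → (a - c) + (b - d) ≈ (a + b) - (c + d)
    sub-+ a b c d = trans
      (solve 4 (λ a b c d → (a :+ c) :+ (b :+ d) := (a :+ b) :+ (c :+ d)) refl a b (- c) (- d))
      (+-congˡ (-‿+-comm c d))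

    sub-* : ∀ a b c d → b * (a - c) + c * (b - d) ≈ a * b - c * d
    sub-* a b c d = begin
      b * (a - c) + c * (b - d)
        ≈⟨ solve 5 (λ a b c c⁻ d⁻ → b :* (a :+ c⁻) :+ c :* (b :+ d⁻)
                     := (a :* b :+ c :* d⁻) :+ b :* (c :+ c⁻)) refl a b c (- c) (- d) ⟩
      a * b + c * - d + b * (c - c)
        ≈⟨ +-congˡ (*-congˡ (-‿inverseʳ c)) ⟩
      a * b + c * - d + b * 0#
        ≈⟨ trans (+-congˡ (zeroʳ b)) (+-identityʳ _) ⟩
      a * b + c * - d
        ≈⟨ +-congˡ (-‿distribʳ-* c d) ⟨
      a * b - c * d ∎

    shift : ∀ a b → b + (a - b) ≈ a
    shift a b = trans
      (solve 3 (λ a b b⁻ → b :+ (a :+ b⁻) := a :+ (b :+ b⁻)) refl a b (- b)) (cancel a b)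

    -‿swap : ∀ a b → - (a - b) ≈ b - a
    -‿swap a b = trans (sym (-‿+-comm a (- b))) (trans (+-congˡ (-‿involutive b)) (+-comm (- a) b))

    telescope : ∀ a b c → (a - b) + (b - c) ≈ a - c
    telescope a b c = trans
      (solve 4 (λ a b b⁻ c⁻ → (a :+ b⁻) :+ (b :+ c⁻) := (a :+ c⁻) :+ (b :+ b⁻)) refl a b (- b) (- c))
      (cancel (a - c) b)

  module ℚIdentities = DifferenceIdentities ℚ.+-*-commutativeRing

  sub-+ : ∀ a b c d → (a ℚ.- c) ℚ.+ (b ℚ.- d) ≡ (a ℚ.+ b) ℚ.- (c ℚ.+ d)
  sub-+ = ℚIdentities.sub-+

  sub-* : ∀ a b c d → b ℚ.* (a ℚ.- c) ℚ.+ c ℚ.* (b ℚ.- d) ≡ a ℚ.* b ℚ.- c ℚ.* d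
  sub-* = ℚIdentities.sub-*

  shift : ∀ a b → b ℚ.+ (a ℚ.- b) ≡ a
  shift = ℚIdentities.shift

  -‿swap : ∀ a b → ℚ.- (a ℚ.- b) ≡ b ℚ.- a
  -‿swap = ℚIdentities.-‿swap

  telescope : ∀ a b c → (a ℚ.- b) ℚ.+ (b ℚ.- c) ≡ a ℚ.- c
  telescope = ℚIdentities.telescope

module Eventually {I : Set} (Tail : ℕ → I → Set)
  (shrink : ∀ {M N i} → M ℕ.≤ N → Tail N i → Tail M i) where

  open Rat
  open ℚ.≤-Reasoning

  Null : (I → ℚ) → Set
  Null z = ∀ ε → 0ℚ < ε → ∃[ N ] (∀ i → Tail N i → ∣ z i ∣ < ε)

  Bounded : (I → ℚ) → Set
  Bounded z = ∃[ B ] (0ℚ < B × ∃[ N ] (∀ i → Tail N i → ∣ z i ∣ < B))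

  Null-resp : ∀ {y z} → (∀ i → y i ≡ z i) → Null y → Null z
  Null-resp y≡z y→0 ε 0<ε with y→0 ε 0<ε
  ... | N , small = N , λ i t → subst (λ w → ∣ w ∣ < ε) (y≡z i) (small i t)

  Null-0 : ∀ {z} → (∀ i → z i ≡ 0ℚ) → Null z
  Null-0 z≡0 ε 0<ε = 0 , λ i _ → subst (λ w → ∣ w ∣ < ε) (≡.sym (z≡0 i)) 0<ε

  Null-neg : ∀ {z} → Null z → Null (λ i → - z i)
  Null-neg {z} z→0 ε 0<ε with z→0 ε 0<ε
  ... | N , small = N , λ i t → subst (_< ε) (≡.sym (ℚ.∣-p∣≡∣p∣ (z i))) (small i t)

  Null-+ : ∀ {y z} → Null y → Null z → Null (λ i → y i + z i)
  Null-+ {y} {z} y→0 z→0 ε 0<ε = M ℕ.⊔ N , λ i t → begin-strict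
      ∣ y i + z i ∣      ≤⟨ ℚ.∣p+q∣≤∣p∣+∣q∣ (y i) (z i) ⟩
      ∣ y i ∣ + ∣ z i ∣  <⟨ ℚ.+-mono-< (proj₂ hy i (shrink (ℕ.m≤m⊔n M N) t))
                                       (proj₂ hz i (shrink (ℕ.m≤n⊔m M N) t)) ⟩
      ε * ½ + ε * ½      ≡⟨ ℚ.*-distribˡ-+ ε ½ ½ ⟨
      ε * 1ℚ             ≡⟨ ℚ.*-identityʳ ε ⟩
      ε                  ∎
    where
    0<ε/2 : 0ℚ < ε * ½
    0<ε/2 = subst (_< ε * ½) (ℚ.*-zeroˡ ½) (ℚ.*-monoˡ-<-pos ½ 0<ε)
    hy = y→0 (ε * ½) 0<ε/2
    hz = z→0 (ε * ½) 0<ε/2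
    M  = proj₁ hy
    N  = proj₁ hz

  Null-* : ∀ {y z} → Bounded y → Null z → Null (λ i → y i * z i)
  Null-* {y} {z} (B , 0<B , M , y<B) z→0 ε 0<ε = M ℕ.⊔ N , λ i t → begin-strict
      ∣ y i * z i ∣      ≡⟨ ℚ.∣p*q∣≡∣p∣*∣q∣ (y i) (z i) ⟩
      ∣ y i ∣ * ∣ z i ∣  ≤⟨ ℚ.*-monoʳ-≤-nonNeg ∣ z i ∣ {{ℚ.nonNegative (ℚ.0≤∣p∣ (z i))}}
                              (ℚ.<⇒≤ (y<B i (shrink (ℕ.m≤m⊔n M N) t))) ⟩
      B * ∣ z i ∣        <⟨ ℚ.*-monoʳ-<-pos B (proj₂ hz i (shrink (ℕ.m≤n⊔m M N) t)) ⟩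
      B * (1/ B * ε)     ≡⟨ ℚ.*-assoc B (1/ B) ε ⟨
      B * 1/ B * ε       ≡⟨ cong (_* ε) (ℚ.*-inverseʳ B) ⟩
      1ℚ * ε             ≡⟨ ℚ.*-identityˡ ε ⟩
      ε                  ∎
    where
    instance
      B-pos : Positive B
      B-pos = positive 0<B
      B-nonZero : NonZero B
      B-nonZero = ℚ.pos⇒nonZero B
      1/B-pos : Positive (1/ B)
      1/B-pos = ℚ.1/pos⇒pos B
    hz = z→0 (1/ B * ε) (subst (_< 1/ B * ε) (ℚ.*-zeroʳ (1/ B)) (ℚ.*-monoʳ-<-pos (1/ B) 0<ε))
    N  = proj₁ hz

Tail₂ : ℕ → ℕ × ℕ → Set
Tail₂ N (m , n) = N ℕ.≤ m × N ℕ.≤ n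

private
  shrink₂ : ∀ {M N i} → M ℕ.≤ N → Tail₂ N i → Tail₂ M i
  shrink₂ M≤N (N≤m , N≤n) = ℕ.≤-trans M≤N N≤m , ℕ.≤-trans M≤N N≤n

module E₁ = Eventually ℕ._≤_ ℕ.≤-trans
module E₂ = Eventually Tail₂ shrink₂

Cauchy : (ℕ → ℚ) → Set
Cauchy x = E₂.Null (λ (m , n) → x m ℚ.- x n)

record ℝ : Set where
  field
    seq    : ℕ → ℚ
    cauchy : Cauchy seq
open ℝ

record _≃_ (x y : ℝ) : Set where
  constructor null
  field difference : E₁.Null (λ n → seq x n ℚ.- seq y n)
open _≃_

private
  bounded : ∀ x → Cauchy x → E₁.Bounded x
  bounded x x-cauchy = ∣ x N ∣ + 1ℚ , 0<B , N , λ n N≤n → begin-strict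
      ∣ x n ∣                  ≡⟨ cong ∣_∣ (shift (x n) (x N)) ⟨
      ∣ x N + (x n - x N) ∣    ≤⟨ ℚ.∣p+q∣≤∣p∣+∣q∣ (x N) (x n - x N) ⟩
      ∣ x N ∣ + ∣ x n - x N ∣  <⟨ ℚ.+-monoʳ-< ∣ x N ∣ {∣ x n - x N ∣} {1ℚ} (near n N≤n) ⟩
      ∣ x N ∣ + 1ℚ             ∎
    where
    open Rat
    open ℚ.≤-Reasoning
    0<1 : 0ℚ < 1ℚ
    0<1 = ℚ.positive⁻¹ 1ℚ
    close = x-cauchy 1ℚ 0<1
    N     = proj₁ close
    near : ∀ n → N ℕ.≤ n → ∣ x n - x N ∣ < 1ℚ
    near n N≤n = proj₂ close (n , N) (N≤n , ℕ.≤-refl)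
    0<B : 0ℚ < ∣ x N ∣ + 1ℚ
    0<B = ℚ.≤-<-trans (ℚ.0≤∣p∣ (x N))
            (subst (_< ∣ x N ∣ + 1ℚ) (ℚ.+-identityʳ ∣ x N ∣) (ℚ.+-monoʳ-< ∣ x N ∣ 0<1))

  boundedˡ : ∀ x → Cauchy x → E₂.Bounded (x ∘ proj₁)
  boundedˡ x x-cauchy = let (B , 0<B , N , x<B) = bounded x x-cauchy in
    B , 0<B , N , λ i t → x<B (proj₁ i) (proj₁ t)

  boundedʳ : ∀ x → Cauchy x → E₂.Bounded (x ∘ proj₂)
  boundedʳ x x-cauchy = let (B , 0<B , N , x<B) = bounded x x-cauchy in
    B , 0<B , N , λ i t → x<B (proj₂ i) (proj₂ t)

constℝ : ℚ → ℝ
constℝ a = record { seq = λ _ → a ; cauchy = E₂.Null-0 (λ _ → ℚ.+-inverseʳ a) }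

_+ℝ_ : ℝ → ℝ → ℝ
x +ℝ y = record
  { seq    = λ n → seq x n ℚ.+ seq y n
  ; cauchy = E₂.Null-resp (λ (m , n) → sub-+ (seq x m) (seq y m) (seq x n) (seq y n))
               (E₂.Null-+ (cauchy x) (cauchy y))
  }

-ℝ_ : ℝ → ℝ
-ℝ x = record
  { seq    = λ n → ℚ.- seq x n
  ; cauchy = E₂.Null-resp (λ (m , n) → ℚ.neg-distrib-+ (seq x m) (ℚ.- seq x n))
               (E₂.Null-neg (cauchy x))
  }

_*ℝ_ : ℝ → ℝ → ℝ
x *ℝ y = record
  { seq    = λ n → seq x n ℚ.* seq y n
  ; cauchy = E₂.Null-resp (λ (m , n) → sub-* (seq x m) (seq y m) (seq x n) (seq y n))
               (E₂.Null-+ (E₂.Null-* (boundedˡ (seq y) (cauchy y)) (cauchy x))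
                          (E₂.Null-* (boundedʳ (seq x) (cauchy x)) (cauchy y)))
  }

private
  pointwise : ∀ {x y} → (∀ n → seq x n ≡ seq y n) → x ≃ y
  pointwise {x} {y} x≡y = null (E₁.Null-0 λ n →
    ≡.trans (cong (ℚ._- seq y n) (x≡y n)) (ℚ.+-inverseʳ (seq y n)))

  ≃-sym : ∀ {x y} → x ≃ y → y ≃ x
  ≃-sym {x} {y} (null h) = null (E₁.Null-resp (λ n → -‿swap (seq x n) (seq y n)) (E₁.Null-neg h))

  ≃-trans : ∀ {x y z} → x ≃ y → y ≃ z → x ≃ z
  ≃-trans {x} {y} {z} (null h) (null k) = null (E₁.Null-resp
      (λ n → telescope (seq x n) (seq y n) (seq z n)) (E₁.Null-+ h k))

  +ℝ-cong : ∀ {x x′ y y′} → x ≃ x′ → y ≃ y′ → (x +ℝ y) ≃ (x′ +ℝ y′)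
  +ℝ-cong {x} {x′} {y} {y′} (null h) (null k) = null (E₁.Null-resp
    (λ n → sub-+ (seq x n) (seq y n) (seq x′ n) (seq y′ n)) (E₁.Null-+ h k))

  -ℝ-cong : ∀ {x y} → x ≃ y → (-ℝ x) ≃ (-ℝ y)
  -ℝ-cong {x} {y} (null h) = null (E₁.Null-resp
    (λ n → ℚ.neg-distrib-+ (seq x n) (ℚ.- seq y n)) (E₁.Null-neg h))

  *ℝ-cong : ∀ {x x′ y y′} → x ≃ x′ → y ≃ y′ → (x *ℝ y) ≃ (x′ *ℝ y′)
  *ℝ-cong {x} {x′} {y} {y′} (null h) (null k) = null (E₁.Null-resp
    (λ n → sub-* (seq x n) (seq y n) (seq x′ n) (seq y′ n))
    (E₁.Null-+ (E₁.Null-* (bounded (seq y) (cauchy y)) h)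
               (E₁.Null-* (bounded (seq x′) (cauchy x′)) k)))

ℝ-commutativeRing : CommutativeRing 0ℓ 0ℓ
ℝ-commutativeRing = record
  { Carrier = ℝ ; _≈_ = _≃_ ; _+_ = _+ℝ_ ; _*_ = _*ℝ_ ; -_ = -ℝ_
  ; 0# = constℝ 0ℚ ; 1# = constℝ 1ℚ
  ; isCommutativeRing = record
    { isRing = record
      { +-isAbelianGroup = record
        { isGroup = record
          { isMonoid = record
            { isSemigroup = record
              { isMagma = record
                { isEquivalence = record
                  { refl = pointwise λ _ → ≡.refl ; sym = ≃-sym ; trans = ≃-trans }
                ; ∙-cong = +ℝ-cong }
              ; assoc = λ x y z → pointwise λ n → ℚ.+-assoc (seq x n) (seq y n) (seq z n) }
            ; identity = (λ x → pointwise λ n → ℚ.+-identityˡ (seq x n))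
                       , (λ x → pointwise λ n → ℚ.+-identityʳ (seq x n)) }
          ; inverse = (λ x → pointwise λ n → ℚ.+-inverseˡ (seq x n))
                    , (λ x → pointwise λ n → ℚ.+-inverseʳ (seq x n))
          ; ⁻¹-cong = -ℝ-cong }
        ; comm = λ x y → pointwise λ n → ℚ.+-comm (seq x n) (seq y n) }
      ; *-cong = *ℝ-cong
      ; *-assoc = λ x y z → pointwise λ n → ℚ.*-assoc (seq x n) (seq y n) (seq z n)
      ; *-identity = (λ x → pointwise λ n → ℚ.*-identityˡ (seq x n))
                   , (λ x → pointwise λ n → ℚ.*-identityʳ (seq x n))
      ; distrib = (λ x y z → pointwise λ n → ℚ.*-distribˡ-+ (seq x n) (seq y n) (seq z n))
                , (λ x y z → pointwise λ n → ℚ.*-distribʳ-+ (seq x n) (seq y n) (seq z n)) }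
    ; *-comm = λ x y → pointwise λ n → ℚ.*-comm (seq x n) (seq y n) } }

module Adjoin-i (R : CommutativeRing 0ℓ 0ℓ) where
  open CommutativeRing R
  open RingProperties ring using (-‿distribˡ-*; -‿distribʳ-*; -‿+-comm; -0#≈0#)
  open SemiringSolver commutativeSemiring
  open SetoidReasoning setoid

  private
    C : Set
    C = Carrier × Carrier

    _≈C_ : C → C → Set
    (a , b) ≈C (c , d) = (a ≈ c) × (b ≈ d)

    _+C_ _*C_ : C → C → C
    (a , b) +C (c , d) = (a + c) , (b + d)
    (a , b) *C (c , d) = (a * c - b * d) , (a * d + b * c)

    assocC : ∀ x y z → ((x *C y) *C z) ≈C (x *C (y *C z))
    assocC (a , b) (c , d) (e , f) =
      (begin
        (a * c - b * d) * e - (a * d + b * c) * f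
          ≈⟨ +-cong (*-congʳ (+-congˡ (-‿distribʳ-* b d))) (-‿distribʳ-* _ f) ⟩
        (a * c + b * - d) * e + (a * d + b * c) * - f
          ≈⟨ +-congʳ (distribʳ e _ _) ⟩
        a * c * e + b * - d * e + (a * d + b * c) * - f
          ≈⟨ +-congʳ (+-congˡ (trans (*-congʳ (trans (sym (-‿distribʳ-* b d)) (-‿distribˡ-* b d))) refl)) ⟩
        a * c * e + - b * d * e + (a * d + b * c) * - f
          ≈⟨ +-congˡ (distribʳ (- f) _ _) ⟩
        a * c * e + - b * d * e + (a * d * - f + b * c * - f)
          ≈⟨ +-congˡ (+-congˡ (trans (sym (-‿distribʳ-* _ f))
               (trans (-‿distribˡ-* _ f) (*-congʳ (-‿distribˡ-* b c))))) ⟩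
        a * c * e + - b * d * e + (a * d * - f + - b * c * f)
          ≈⟨ solve 7 (λ a b- c d e f f- →
               (a :* c :* e :+ b- :* d :* e :+ (a :* d :* f- :+ b- :* c :* f)) :=
               (a :* (c :* e :+ d :* f-) :+ b- :* (c :* f :+ d :* e)))
               refl a (- b) c d e f (- f) ⟩
        a * (c * e + d * - f) + - b * (c * f + d * e)
          ≈⟨ +-cong (*-congˡ (+-congˡ (-‿distribʳ-* d f))) (-‿distribˡ-* b _) ⟨
        a * (c * e - d * f) - b * (c * f + d * e) ∎)
      ,
      (begin
        (a * c - b * d) * f + (a * d + b * c) * e
          ≈⟨ +-congʳ (*-congʳ (+-congˡ (-‿distribʳ-* b d))) ⟩
        (a * c + b * - d) * f + (a * d + b * c) * e
          ≈⟨ +-congʳ (distribʳ f _ _) ⟩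
        a * c * f + b * - d * f + (a * d + b * c) * e
          ≈⟨ +-congʳ (+-congˡ (trans (*-assoc b (- d) f) (*-congˡ
               (trans (sym (-‿distribˡ-* d f)) (-‿distribʳ-* d f))))) ⟩
        a * c * f + b * (d * - f) + (a * d + b * c) * e
          ≈⟨ solve 7 (λ a b c d e f f- →
               (a :* c :* f :+ b :* (d :* f-) :+ (a :* d :+ b :* c) :* e) :=
               (a :* (c :* f :+ d :* e) :+ b :* (c :* e :+ d :* f-)))
               refl a b c d e f (- f) ⟩
        a * (c * f + d * e) + b * (c * e + d * - f)
          ≈⟨ +-congˡ (*-congˡ (+-congˡ (-‿distribʳ-* d f))) ⟨
        a * (c * f + d * e) + b * (c * e - d * f) ∎)

    commC : ∀ x y → (x *C y) ≈C (y *C x)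
    commC (a , b) (c , d) =
        +-cong (*-comm a c) (-‿cong (*-comm b d))
      , trans (+-cong (*-comm a d) (*-comm b c)) (+-comm _ _)

    identityC : ∀ x → ((1# , 0#) *C x) ≈C x
    identityC (a , b) =
        trans (+-cong (*-identityˡ a) (trans (-‿cong (zeroˡ b)) -0#≈0#)) (+-identityʳ a)
      , trans (+-cong (*-identityˡ b) (zeroˡ a)) (+-identityʳ b)

    distribC : ∀ x y z → (x *C (y +C z)) ≈C ((x *C y) +C (x *C z))
    distribC (a , b) (c , d) (e , f) =
        (begin
          a * (c + e) - b * (d + f)
            ≈⟨ +-cong (distribˡ a c e) (trans (-‿cong (distribˡ b d f)) (sym (-‿+-comm _ _))) ⟩
          a * c + a * e + (- (b * d) + - (b * f))
            ≈⟨ interchange _ _ _ _ ⟩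
          a * c - b * d + (a * e - b * f) ∎)
      , trans (+-cong (distribˡ a d f) (distribˡ b c e)) (interchange _ _ _ _)
      where
      interchange : ∀ p q r s → (p + q) + (r + s) ≈ (p + r) + (q + s)
      interchange = solve 4 (λ p q r s → (p :+ q) :+ (r :+ s) := (p :+ r) :+ (q :+ s)) refl

    transC : ∀ {x y z} → x ≈C y → y ≈C z → x ≈C z
    transC (p , q) (r , s) = trans p r , trans q s

  commutativeRing : CommutativeRing 0ℓ 0ℓ
  commutativeRing = record
    { Carrier = C ; _≈_ = _≈C_ ; _+_ = _+C_ ; _*_ = _*C_ ; -_ = λ (a , b) → (- a) , (- b)
    ; 0# = 0# , 0# ; 1# = 1# , 0#
    ; isCommutativeRing = record
      { isRing = record
        { +-isAbelianGroup = record
          { isGroup = record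
            { isMonoid = record
              { isSemigroup = record
                { isMagma = record
                  { isEquivalence = record
                    { refl = refl , refl ; sym = λ (p , q) → sym p , sym q ; trans = transC }
                  ; ∙-cong = λ (p , q) (r , s) → +-cong p r , +-cong q s }
                ; assoc = λ (a , b) (c , d) (e , f) → +-assoc a c e , +-assoc b d f }
              ; identity = (λ (a , b) → +-identityˡ a , +-identityˡ b)
                         , (λ (a , b) → +-identityʳ a , +-identityʳ b) }
            ; inverse = (λ (a , b) → -‿inverseˡ a , -‿inverseˡ b)
                      , (λ (a , b) → -‿inverseʳ a , -‿inverseʳ b)
            ; ⁻¹-cong = λ (p , q) → -‿cong p , -‿cong q }
          ; comm = λ (a , b) (c , d) → +-comm a c , +-comm b d }
        ; *-cong = λ (p , q) (r , s) →
            +-cong (*-cong p r) (-‿cong (*-cong q s)) , +-cong (*-cong p s) (*-cong q r)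
        ; *-assoc = assocC
        ; *-identity = identityC , λ x → transC (commC x _) (identityC x)
        ; distrib = distribC
                  , λ x y z → transC (commC (y +C z) x) (transC (distribC x y z)
                      (let (p , q) = commC x y ; (r , s) = commC x z in +-cong p r , +-cong q s)) }
      ; *-comm = commC } }

ℂ : CommutativeRing 0ℓ 0ℓ
ℂ = Adjoin-i.commutativeRing ℝ-commutativeRing

------------------------------------------------------------------------
-- Regular elements (non-zero-divisors).  In an integral domain these are
-- the nonzero elements; as ℂ has no decidable equality, "nonzero" for a
-- denominator is expressed in this cancellable form.

record Regular (R : CommutativeRing 0ℓ 0ℓ) (d : CommutativeRing.Carrier R) : Set where
  constructor regular
  open CommutativeRing R
  field annihilates : ∀ x → d * x ≈ 0# → x ≈ 0#
open Regular using (annihilates)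

module _ (R : CommutativeRing 0ℓ 0ℓ) where
  open CommutativeRing R
  open RingProperties ring using (-‿distribˡ-*; -‿distribʳ-*; -‿involutive; -0#≈0#; x∙y⁻¹≈ε⇒x≈y)

  regular-resp : ∀ {d e} → d ≈ e → Regular R d → Regular R e
  regular-resp d≈e d-reg = regular λ x ex≈0 → annihilates d-reg x (trans (*-congʳ d≈e) ex≈0)

  regular-1 : Regular R 1#
  regular-1 = regular λ x 1x≈0 → trans (sym (*-identityˡ x)) 1x≈0

  regular-neg : ∀ {d} → Regular R d → Regular R (- d)
  regular-neg d-reg = regular λ x -dx≈0 → annihilates d-reg x (trans (sym (-‿involutive _))
    (trans (-‿cong (trans (-‿distribˡ-* _ x) -dx≈0)) -0#≈0#))

  regular-* : ∀ {d e} → Regular R d → Regular R e → Regular R (d * e)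
  regular-* d-reg e-reg = regular λ x dex≈0 →
    annihilates e-reg x (annihilates d-reg _ (trans (sym (*-assoc _ _ _)) dex≈0))

  regular-cancel : ∀ {d x y} → Regular R d → d * x ≈ d * y → x ≈ y
  regular-cancel {d} {x} {y} d-reg dx≈dy = x∙y⁻¹≈ε⇒x≈y x y (annihilates d-reg (x - y)
    (trans (distribˡ d x (- y)) (trans (+-cong dx≈dy (sym (-‿distribʳ-* d y))) (-‿inverseʳ _))))

------------------------------------------------------------------------
-- Polynomials in one variable: coefficient lists, constant term first;
-- equality ignores trailing zeros

module Polynomial (R : CommutativeRing 0ℓ 0ℓ) where
  open CommutativeRing R
  open RingProperties ring using (-0#≈0#)
  open SemiringSolver commutativeSemiring
  open SetoidReasoning setoid

  Poly : Set
  Poly = List Carrier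

  coeff : Poly → ℕ → Carrier
  coeff []      _       = 0#
  coeff (a ∷ p) zero    = a
  coeff (a ∷ p) (suc k) = coeff p k

  infix 4 _≈ₚ_
  record _≈ₚ_ (p q : Poly) : Set where
    constructor coeffs
    field at : ∀ k → coeff p k ≈ coeff q k
  open _≈ₚ_ public

  infixl 6 _+ₚ_
  infixl 7 _*ₚ_

  _+ₚ_ : Poly → Poly → Poly
  []      +ₚ q       = q
  (a ∷ p) +ₚ []      = a ∷ p
  (a ∷ p) +ₚ (b ∷ q) = (a + b) ∷ (p +ₚ q)

  -ₚ_ : Poly → Poly
  -ₚ_ = map (-_)

  _*ₚ_ : Poly → Poly → Poly
  []      *ₚ q = []
  (a ∷ p) *ₚ q = map (a *_) q +ₚ (0# ∷ (p *ₚ q))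

  const : Carrier → Poly
  const a = a ∷ []

  -- The polynomial a xᵏ.
  term : ℕ → Carrier → Poly
  term zero    a = const a
  term (suc k) a = 0# ∷ term k a

  Series : Set
  Series = ℕ → Carrier

  conv : Series → Series → Series
  conv f g zero    = f 0 * g 0
  conv f g (suc k) = f 0 * g (suc k) + conv (f ∘ suc) g k

  conv-cong : ∀ {f f′ g g′} → (∀ k → f k ≈ f′ k) → (∀ k → g k ≈ g′ k) →
              ∀ k → conv f g k ≈ conv f′ g′ k
  conv-cong ff gg zero    = *-cong (ff 0) (gg 0)
  conv-cong ff gg (suc k) =
    +-cong (*-cong (ff 0) (gg (suc k))) (conv-cong (ff ∘ suc) gg k)

  conv-suc : ∀ f g k → conv f g (suc k) ≈ f (suc k) * g 0 + conv f (g ∘ suc) k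
  conv-suc f g zero    = +-comm _ _
  conv-suc f g (suc k) = begin
    f 0 * g (suc (suc k)) + conv (f ∘ suc) g (suc k)
      ≈⟨ +-congˡ (conv-suc (f ∘ suc) g k) ⟩
    f 0 * g (suc (suc k)) + (f (suc (suc k)) * g 0 + conv (f ∘ suc) (g ∘ suc) k)
      ≈⟨ solve 3 (λ u v w → u :+ (v :+ w) := v :+ (u :+ w)) refl _ _ _ ⟩
    f (suc (suc k)) * g 0 + conv f (g ∘ suc) (suc k) ∎

  conv-comm : ∀ f g k → conv f g k ≈ conv g f k
  conv-comm f g zero    = *-comm _ _
  conv-comm f g (suc k) = begin
    f 0 * g (suc k) + conv (f ∘ suc) g k  ≈⟨ +-cong (*-comm _ _) (conv-comm (f ∘ suc) g k) ⟩
    g (suc k) * f 0 + conv g (f ∘ suc) k  ≈⟨ conv-suc g f k ⟨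
    conv g f (suc k) ∎

  conv-distribʳ : ∀ f g h k → conv (λ i → f i + g i) h k ≈ conv f h k + conv g h k
  conv-distribʳ f g h zero    = distribʳ _ _ _
  conv-distribʳ f g h (suc k) = begin
    (f 0 + g 0) * h (suc k) + conv (λ i → f (suc i) + g (suc i)) h k
      ≈⟨ +-cong (distribʳ _ _ _) (conv-distribʳ (f ∘ suc) (g ∘ suc) h k) ⟩
    (f 0 * h (suc k) + g 0 * h (suc k)) + (conv (f ∘ suc) h k + conv (g ∘ suc) h k)
      ≈⟨ solve 4 (λ s t u v → (s :+ t) :+ (u :+ v) := (s :+ u) :+ (t :+ v)) refl _ _ _ _ ⟩
    conv f h (suc k) + conv g h (suc k) ∎

  conv-scale : ∀ a f g k → conv (λ i → a * f i) g k ≈ a * conv f g k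
  conv-scale a f g zero    = *-assoc _ _ _
  conv-scale a f g (suc k) =
    trans (+-cong (*-assoc _ _ _) (conv-scale a (f ∘ suc) g k)) (sym (distribˡ _ _ _))

  conv-zero : ∀ f g → (∀ k → f k ≈ 0#) → ∀ k → conv f g k ≈ 0#
  conv-zero f g f≈0 zero    = trans (*-congʳ (f≈0 0)) (zeroˡ _)
  conv-zero f g f≈0 (suc k) = trans
    (+-cong (trans (*-congʳ (f≈0 0)) (zeroˡ _)) (conv-zero (f ∘ suc) g (f≈0 ∘ suc) k))
    (+-identityˡ 0#)

  conv-assoc : ∀ f g h k → conv (conv f g) h k ≈ conv f (conv g h) k
  conv-assoc f g h zero    = *-assoc _ _ _
  conv-assoc f g h (suc k) = begin
    f 0 * g 0 * h (suc k) + conv (λ i → f 0 * g (suc i) + conv (f ∘ suc) g i) h k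
      ≈⟨ +-cong (*-assoc _ _ _)
           (trans (conv-distribʳ _ _ h k)
             (+-cong (conv-scale (f 0) (g ∘ suc) h k) (conv-assoc (f ∘ suc) g h k))) ⟩
    f 0 * (g 0 * h (suc k)) + (f 0 * conv (g ∘ suc) h k + conv (f ∘ suc) (conv g h) k)
      ≈⟨ solve 4 (λ s u v w → s :* u :+ (s :* v :+ w) := s :* (u :+ v) :+ w) refl _ _ _ _ ⟩
    conv f (conv g h) (suc k) ∎

  conv-const : ∀ a f g → (∀ k → f (suc k) ≈ 0#) → f 0 ≈ a → ∀ k → conv f g k ≈ a * g k
  conv-const a f g f≈0 f0 zero    = *-congʳ f0
  conv-const a f g f≈0 f0 (suc k) =
    trans (+-cong (*-congʳ f0) (conv-zero (f ∘ suc) g f≈0 k)) (+-identityʳ _)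

  coeff-+ : ∀ p q k → coeff (p +ₚ q) k ≈ coeff p k + coeff q k
  coeff-+ []      q       k       = sym (+-identityˡ _)
  coeff-+ (a ∷ p) []      k       = sym (+-identityʳ _)
  coeff-+ (a ∷ p) (b ∷ q) zero    = refl
  coeff-+ (a ∷ p) (b ∷ q) (suc k) = coeff-+ p q k

  coeff-neg : ∀ p k → coeff (-ₚ p) k ≈ - coeff p k
  coeff-neg []      k       = sym -0#≈0#
  coeff-neg (a ∷ p) zero    = refl
  coeff-neg (a ∷ p) (suc k) = coeff-neg p k

  coeff-scale : ∀ a p k → coeff (map (a *_) p) k ≈ a * coeff p k
  coeff-scale a []      k       = sym (zeroʳ a)
  coeff-scale a (b ∷ p) zero    = refl
  coeff-scale a (b ∷ p) (suc k) = coeff-scale a p k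

  coeff-* : ∀ p q k → coeff (p *ₚ q) k ≈ conv (coeff p) (coeff q) k
  coeff-* []      q k       = sym (conv-zero _ _ (λ _ → refl) k)
  coeff-* (a ∷ p) q zero    = trans (coeff-+ (map (a *_) q) _ 0)
    (trans (+-identityʳ _) (coeff-scale a q 0))
  coeff-* (a ∷ p) q (suc k) = trans (coeff-+ (map (a *_) q) _ (suc k))
    (+-cong (coeff-scale a q (suc k)) (coeff-* p q k))

  ≈ₚ-trans : ∀ {p q r} → p ≈ₚ q → q ≈ₚ r → p ≈ₚ r
  ≈ₚ-trans (coeffs h) (coeffs h′) = coeffs λ k → trans (h k) (h′ k)

  +ₚ-cong : ∀ {p p′ q q′} → p ≈ₚ p′ → q ≈ₚ q′ → (p +ₚ q) ≈ₚ (p′ +ₚ q′)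
  +ₚ-cong {p} {p′} {q} {q′} (coeffs h) (coeffs h′) = coeffs λ k →
    trans (coeff-+ p q k) (trans (+-cong (h k) (h′ k)) (sym (coeff-+ p′ q′ k)))

  -ₚ-cong : ∀ {p p′} → p ≈ₚ p′ → (-ₚ p) ≈ₚ (-ₚ p′)
  -ₚ-cong {p} {p′} (coeffs h) = coeffs λ k →
    trans (coeff-neg p k) (trans (-‿cong (h k)) (sym (coeff-neg p′ k)))

  *ₚ-cong : ∀ {p p′ q q′} → p ≈ₚ p′ → q ≈ₚ q′ → (p *ₚ q) ≈ₚ (p′ *ₚ q′)
  *ₚ-cong {p} {p′} {q} {q′} (coeffs h) (coeffs h′) = coeffs λ k →
    trans (coeff-* p q k) (trans (conv-cong h h′ k) (sym (coeff-* p′ q′ k)))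

  +ₚ-assoc : ∀ p q r → ((p +ₚ q) +ₚ r) ≈ₚ (p +ₚ (q +ₚ r))
  +ₚ-assoc p q r = coeffs λ k → begin
    coeff (p +ₚ q +ₚ r) k                ≈⟨ trans (coeff-+ (p +ₚ q) r k) (+-congʳ (coeff-+ p q k)) ⟩
    coeff p k + coeff q k + coeff r k    ≈⟨ +-assoc _ _ _ ⟩
    coeff p k + (coeff q k + coeff r k)  ≈⟨ trans (coeff-+ p (q +ₚ r) k) (+-congˡ (coeff-+ q r k)) ⟨
    coeff (p +ₚ (q +ₚ r)) k ∎

  +ₚ-comm : ∀ p q → (p +ₚ q) ≈ₚ (q +ₚ p)
  +ₚ-comm p q = coeffs λ k →
    trans (coeff-+ p q k) (trans (+-comm _ _) (sym (coeff-+ q p k)))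

  +ₚ-inverse : ∀ p → ((-ₚ p) +ₚ p) ≈ₚ []
  +ₚ-inverse p = coeffs λ k →
    trans (coeff-+ (-ₚ p) p k) (trans (+-congʳ (coeff-neg p k)) (-‿inverseˡ _))

  *ₚ-assoc : ∀ p q r → ((p *ₚ q) *ₚ r) ≈ₚ (p *ₚ (q *ₚ r))
  *ₚ-assoc p q r = coeffs λ k → begin
    coeff (p *ₚ q *ₚ r) k
      ≈⟨ trans (coeff-* (p *ₚ q) r k) (conv-cong (coeff-* p q) (λ _ → refl) k) ⟩
    conv (conv (coeff p) (coeff q)) (coeff r) k
      ≈⟨ conv-assoc (coeff p) (coeff q) (coeff r) k ⟩
    conv (coeff p) (conv (coeff q) (coeff r)) k
      ≈⟨ trans (coeff-* p (q *ₚ r) k) (conv-cong (λ _ → refl) (coeff-* q r) k) ⟨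
    coeff (p *ₚ (q *ₚ r)) k ∎

  *ₚ-comm : ∀ p q → (p *ₚ q) ≈ₚ (q *ₚ p)
  *ₚ-comm p q = coeffs λ k →
    trans (coeff-* p q k) (trans (conv-comm (coeff p) (coeff q) k) (sym (coeff-* q p k)))

  *ₚ-const : ∀ a q k → coeff (const a *ₚ q) k ≈ a * coeff q k
  *ₚ-const a q k = trans (coeff-* (const a) q k)
    (conv-const a (coeff (const a)) (coeff q) (λ _ → refl) refl k)

  *ₚ-identity : ∀ p → (const 1# *ₚ p) ≈ₚ p
  *ₚ-identity p = coeffs λ k → trans (*ₚ-const 1# p k) (*-identityˡ _)

  distribʳₚ : ∀ r p q → ((p +ₚ q) *ₚ r) ≈ₚ ((p *ₚ r) +ₚ (q *ₚ r))
  distribʳₚ r p q = coeffs λ k → begin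
    coeff ((p +ₚ q) *ₚ r) k
      ≈⟨ trans (coeff-* (p +ₚ q) r k) (conv-cong (coeff-+ p q) (λ _ → refl) k) ⟩
    conv (λ i → coeff p i + coeff q i) (coeff r) k
      ≈⟨ conv-distribʳ (coeff p) (coeff q) (coeff r) k ⟩
    conv (coeff p) (coeff r) k + conv (coeff q) (coeff r) k
      ≈⟨ trans (coeff-+ (p *ₚ r) (q *ₚ r) k) (+-cong (coeff-* p r k) (coeff-* q r k)) ⟨
    coeff (p *ₚ r +ₚ q *ₚ r) k ∎

  distribˡₚ : ∀ r p q → (r *ₚ (p +ₚ q)) ≈ₚ ((r *ₚ p) +ₚ (r *ₚ q))
  distribˡₚ r p q = ≈ₚ-trans (*ₚ-comm r (p +ₚ q))
    (≈ₚ-trans (distribʳₚ r p q) (+ₚ-cong (*ₚ-comm p r) (*ₚ-comm q r)))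

  commutativeRing : CommutativeRing 0ℓ 0ℓ
  commutativeRing = record
    { Carrier = Poly ; _≈_ = _≈ₚ_ ; _+_ = _+ₚ_ ; _*_ = _*ₚ_ ; -_ = -ₚ_ ; 0# = [] ; 1# = const 1#
    ; isCommutativeRing = record
      { isRing = record
        { +-isAbelianGroup = record
          { isGroup = record
            { isMonoid = record
              { isSemigroup = record
                { isMagma = record
                  { isEquivalence = record
                    { refl = coeffs λ _ → refl
                    ; sym = λ (coeffs h) → coeffs λ k → sym (h k)
                    ; trans = ≈ₚ-trans }
                  ; ∙-cong = +ₚ-cong }
                ; assoc = +ₚ-assoc }
              ; identity = (λ p → coeffs λ _ → refl)
                         , λ p → ≈ₚ-trans (+ₚ-comm p []) (coeffs λ _ → refl) }
            ; inverse = +ₚ-inverse , λ p → ≈ₚ-trans (+ₚ-comm p (-ₚ p)) (+ₚ-inverse p)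
            ; ⁻¹-cong = -ₚ-cong }
          ; comm = +ₚ-comm }
        ; *-cong = *ₚ-cong
        ; *-assoc = *ₚ-assoc
        ; *-identity = *ₚ-identity , λ p → ≈ₚ-trans (*ₚ-comm p _) (*ₚ-identity p)
        ; distrib = distribˡₚ , distribʳₚ }
      ; *-comm = *ₚ-comm } }

  module R[x] = CommutativeRing commutativeRing

  conv-zero-below : ∀ f g k → (∀ j → j ℕ.≤ k → g j ≈ 0#) → conv f g k ≈ 0#
  conv-zero-below f g zero    g≈0 = trans (*-congˡ (g≈0 0 z≤n)) (zeroʳ _)
  conv-zero-below f g (suc k) g≈0 = trans
    (+-cong (trans (*-congˡ (g≈0 (suc k) ℕ.≤-refl)) (zeroʳ _))
            (conv-zero-below (f ∘ suc) g k (λ j j≤k → g≈0 j (ℕ.m≤n⇒m≤1+n j≤k))))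
    (+-identityˡ 0#)

  regular-head : ∀ {a p} → Regular R a → Regular commutativeRing (a ∷ p)
  regular-head {a} {p} a-reg = regular λ q pq≈0 → coeffs λ k → below q pq≈0 k k ℕ.≤-refl
    where
    module _ (q : Poly) (pq≈0 : ((a ∷ p) *ₚ q) ≈ₚ []) where
      product : ∀ k → conv (coeff (a ∷ p)) (coeff q) k ≈ 0#
      product k = trans (sym (coeff-* (a ∷ p) q k)) (at pq≈0 k)
      below : ∀ k j → j ℕ.≤ k → coeff q j ≈ 0#
      below zero    zero z≤n = annihilates a-reg _ (product 0)
      below (suc k) j j≤1+k with ℕ.m≤n⇒m<n∨m≡n j≤1+k
      ... | inj₁ (s≤s j≤k) = below k j j≤k
      ... | inj₂ ≡.refl    = annihilates a-reg _ (begin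
        a * coeff q (suc k)
          ≈⟨ +-identityʳ _ ⟨
        a * coeff q (suc k) + 0#
          ≈⟨ +-congˡ (conv-zero-below (coeff p) (coeff q) k (below k)) ⟨
        conv (coeff (a ∷ p)) (coeff q) (suc k)
          ≈⟨ product (suc k) ⟩
        0# ∎)

  regular-shift : ∀ {a p} → a ≈ 0# → Regular commutativeRing p → Regular commutativeRing (a ∷ p)
  regular-shift {a} {p} a≈0 p-reg = regular λ q pq≈0 → annihilates p-reg q (coeffs λ k → begin
    coeff (p *ₚ q) k
      ≈⟨ coeff-* p q k ⟩
    conv (coeff p) (coeff q) k
      ≈⟨ +-identityˡ _ ⟨
    0# + conv (coeff p) (coeff q) k
      ≈⟨ +-congʳ (trans (*-congʳ a≈0) (zeroˡ _)) ⟨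
    conv (coeff (a ∷ p)) (coeff q) (suc k)
      ≈⟨ trans (sym (coeff-* (a ∷ p) q (suc k))) (at pq≈0 (suc k)) ⟩
    0# ∎)

  term-regular : ∀ k {a} → Regular R a → Regular commutativeRing (term k a)
  term-regular zero    a-reg = regular-head a-reg
  term-regular (suc k) a-reg = regular-shift refl (term-regular k a-reg)

  binomial-regular : ∀ k l {a b} → k ≢ l → Regular R a → Regular R b →
                     Regular commutativeRing (term k a R[x].- term l b)
  binomial-regular zero zero k≢l _ _ = ⊥-elim (k≢l ≡.refl)
  binomial-regular zero (suc l) _ a-reg _ = regular-head
    (regular-resp R (sym (trans (+-congˡ -0#≈0#) (+-identityʳ _))) a-reg)
  binomial-regular (suc k) zero _ _ b-reg = regular-head
    (regular-resp R (sym (+-identityˡ _)) (regular-neg R b-reg))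
  binomial-regular (suc k) (suc l) k≢l a-reg b-reg = regular-shift (-‿inverseʳ 0#)
    (binomial-regular k l (k≢l ∘ cong suc) a-reg b-reg)

  binomial-regular-≡ : ∀ k {a b} → Regular R (a - b) →
                       Regular commutativeRing (term k a R[x].- term k b)
  binomial-regular-≡ zero    a-b-reg = regular-head a-b-reg
  binomial-regular-≡ (suc k) a-b-reg = regular-shift (-‿inverseʳ 0#) (binomial-regular-≡ k a-b-reg)

------------------------------------------------------------------------
-- Fractions with regular denominators: for an integral domain, its field of
-- fractions.

module Fraction (R : CommutativeRing 0ℓ 0ℓ) where
  private module R = CommutativeRing R
  open R using (_≈_; _+_; _*_; 0#; 1#)
  open RingProperties R.ring using (-‿distribˡ-*)
  open SemiringSolver R.commutativeSemiring
  open SetoidReasoning R.setoid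

  record Frac : Set where
    constructor _over_⟨_⟩
    field
      num     : R.Carrier
      den     : R.Carrier
      den-reg : Regular R den
  open Frac public

  infix 4 _≈ᶠ_
  record _≈ᶠ_ (f g : Frac) : Set where
    constructor crossMultiplied
    field cross : num f * den g ≈ num g * den f
  open _≈ᶠ_ public

  embed : R.Carrier → Frac
  embed a = a over 1# ⟨ regular-1 R ⟩

  _+ᶠ_ _*ᶠ_ : Frac → Frac → Frac
  (a over b ⟨ r ⟩) +ᶠ (c over d ⟨ s ⟩) = (a * d + c * b) over b * d ⟨ regular-* R r s ⟩
  (a over b ⟨ r ⟩) *ᶠ (c over d ⟨ s ⟩) = (a * c) over b * d ⟨ regular-* R r s ⟩

  -ᶠ_ : Frac → Frac
  -ᶠ (a over b ⟨ r ⟩) = (R.- a) over b ⟨ r ⟩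

  private
    +ᶠ-cong : ∀ {f f′ g g′} → f ≈ᶠ f′ → g ≈ᶠ g′ → (f +ᶠ g) ≈ᶠ (f′ +ᶠ g′)
    +ᶠ-cong {a over b ⟨ _ ⟩} {a′ over b′ ⟨ _ ⟩} {c over d ⟨ _ ⟩} {c′ over d′ ⟨ _ ⟩}
      (crossMultiplied h) (crossMultiplied k) = crossMultiplied (begin
        (a * d + c * b) * (b′ * d′)
          ≈⟨ solve 6 (λ a b c d b′ d′ → (a :* d :+ c :* b) :* (b′ :* d′)
               := (a :* b′) :* (d :* d′) :+ (c :* d′) :* (b :* b′)) R.refl a b c d b′ d′ ⟩
        (a * b′) * (d * d′) + (c * d′) * (b * b′)
          ≈⟨ R.+-cong (R.*-congʳ h) (R.*-congʳ k) ⟩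
        (a′ * b) * (d * d′) + (c′ * d) * (b * b′)
          ≈⟨ solve 6 (λ a b c d b′ d′ → (a :* d′ :+ c :* b′) :* (b :* d)
               := (a :* b) :* (d :* d′) :+ (c :* d) :* (b :* b′)) R.refl a′ b c′ d b′ d′ ⟨
        (a′ * d′ + c′ * b′) * (b * d) ∎)

    *ᶠ-cong : ∀ {f f′ g g′} → f ≈ᶠ f′ → g ≈ᶠ g′ → (f *ᶠ g) ≈ᶠ (f′ *ᶠ g′)
    *ᶠ-cong {a over b ⟨ _ ⟩} {a′ over b′ ⟨ _ ⟩} {c over d ⟨ _ ⟩} {c′ over d′ ⟨ _ ⟩}
      (crossMultiplied h) (crossMultiplied k) = crossMultiplied (begin
        (a * c) * (b′ * d′)  ≈⟨ interchange a c b′ d′ ⟩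
        (a * b′) * (c * d′)  ≈⟨ R.*-cong h k ⟩
        (a′ * b) * (c′ * d)  ≈⟨ interchange a′ c′ b d ⟨
        (a′ * c′) * (b * d)  ∎)
      where
      interchange : ∀ p q r s → (p * q) * (r * s) ≈ (p * r) * (q * s)
      interchange = solve 4 (λ p q r s → (p :* q) :* (r :* s) := (p :* r) :* (q :* s)) R.refl

    -ᶠ-cong : ∀ {f g} → f ≈ᶠ g → (-ᶠ f) ≈ᶠ (-ᶠ g)
    -ᶠ-cong {a over b ⟨ _ ⟩} {c over d ⟨ _ ⟩} (crossMultiplied h) = crossMultiplied
      (R.trans (R.sym (-‿distribˡ-* a d)) (R.trans (R.-‿cong h) (-‿distribˡ-* c b)))

    ≈ᶠ-trans : ∀ {f g h} → f ≈ᶠ g → g ≈ᶠ h → f ≈ᶠ h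
    ≈ᶠ-trans {a over b ⟨ _ ⟩} {c over d ⟨ s ⟩} {e over f ⟨ _ ⟩}
      (crossMultiplied h) (crossMultiplied k) = crossMultiplied (regular-cancel R s (begin
        d * (a * f)  ≈⟨ solve 3 (λ d a f → d :* (a :* f) := (a :* d) :* f) R.refl d a f ⟩
        (a * d) * f  ≈⟨ R.*-congʳ h ⟩
        (c * b) * f  ≈⟨ solve 3 (λ c b f → (c :* b) :* f := (c :* f) :* b) R.refl c b f ⟩
        (c * f) * b  ≈⟨ R.*-congʳ k ⟩
        (e * d) * b  ≈⟨ solve 3 (λ e d b → (e :* d) :* b := d :* (e :* b)) R.refl e d b ⟩
        d * (e * b)  ∎))

    +ᶠ-assoc : ∀ f g h → ((f +ᶠ g) +ᶠ h) ≈ᶠ (f +ᶠ (g +ᶠ h))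
    +ᶠ-assoc (a over b ⟨ _ ⟩) (c over d ⟨ _ ⟩) (e over f ⟨ _ ⟩) = crossMultiplied
      (solve 6 (λ a b c d e f →
        ((a :* d :+ c :* b) :* f :+ e :* (b :* d)) :* (b :* (d :* f)) :=
        (a :* (d :* f) :+ (c :* f :+ e :* d) :* b) :* ((b :* d) :* f)) R.refl a b c d e f)

    +ᶠ-comm : ∀ f g → (f +ᶠ g) ≈ᶠ (g +ᶠ f)
    +ᶠ-comm (a over b ⟨ _ ⟩) (c over d ⟨ _ ⟩) = crossMultiplied
      (solve 4 (λ a b c d → (a :* d :+ c :* b) :* (d :* b) :=
        (c :* b :+ a :* d) :* (b :* d)) R.refl a b c d)

    +ᶠ-identity : ∀ f → (embed 0# +ᶠ f) ≈ᶠ f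
    +ᶠ-identity (a over b ⟨ _ ⟩) = crossMultiplied (solve 2 (λ a b →
      (con 0 :* b :+ a :* con 1) :* b := a :* (con 1 :* b)) R.refl a b)

    +ᶠ-inverse : ∀ f → ((-ᶠ f) +ᶠ f) ≈ᶠ embed 0#
    +ᶠ-inverse (a over b ⟨ _ ⟩) = crossMultiplied (begin
      (R.- a * b + a * b) * 1#  ≈⟨ R.*-identityʳ _ ⟩
      R.- a * b + a * b         ≈⟨ R.distribʳ b _ _ ⟨
      (R.- a + a) * b           ≈⟨ R.*-congʳ (R.-‿inverseˡ a) ⟩
      0# * b                    ≈⟨ R.trans (R.zeroˡ b) (R.sym (R.zeroˡ _)) ⟩
      0# * (b * b)              ∎)

    *ᶠ-assoc : ∀ f g h → ((f *ᶠ g) *ᶠ h) ≈ᶠ (f *ᶠ (g *ᶠ h))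
    *ᶠ-assoc (a over b ⟨ _ ⟩) (c over d ⟨ _ ⟩) (e over f ⟨ _ ⟩) = crossMultiplied
      (solve 6 (λ a b c d e f → ((a :* c) :* e) :* (b :* (d :* f)) :=
        (a :* (c :* e)) :* ((b :* d) :* f)) R.refl a b c d e f)

    *ᶠ-comm : ∀ f g → (f *ᶠ g) ≈ᶠ (g *ᶠ f)
    *ᶠ-comm (a over b ⟨ _ ⟩) (c over d ⟨ _ ⟩) = crossMultiplied
      (solve 4 (λ a b c d → (a :* c) :* (d :* b) := (c :* a) :* (b :* d)) R.refl a b c d)

    *ᶠ-identity : ∀ f → (embed 1# *ᶠ f) ≈ᶠ f
    *ᶠ-identity (a over b ⟨ _ ⟩) = crossMultiplied (solve 2 (λ a b →
      (con 1 :* a) :* b := a :* (con 1 :* b)) R.refl a b)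

    distribᶠ : ∀ f g h → (f *ᶠ (g +ᶠ h)) ≈ᶠ ((f *ᶠ g) +ᶠ (f *ᶠ h))
    distribᶠ (a over b ⟨ _ ⟩) (c over d ⟨ _ ⟩) (e over f ⟨ _ ⟩) = crossMultiplied
      (solve 6 (λ a b c d e f →
        (a :* (c :* f :+ e :* d)) :* ((b :* d) :* (b :* f)) :=
        ((a :* c) :* (b :* f) :+ (a :* e) :* (b :* d)) :* (b :* (d :* f))) R.refl a b c d e f)

  commutativeRing : CommutativeRing 0ℓ 0ℓ
  commutativeRing = record
    { Carrier = Frac ; _≈_ = _≈ᶠ_ ; _+_ = _+ᶠ_ ; _*_ = _*ᶠ_ ; -_ = -ᶠ_
    ; 0# = embed 0# ; 1# = embed 1#
    ; isCommutativeRing = record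
      { isRing = record
        { +-isAbelianGroup = record
          { isGroup = record
            { isMonoid = record
              { isSemigroup = record
                { isMagma = record
                  { isEquivalence = record
                    { refl = crossMultiplied R.refl
                    ; sym = λ (crossMultiplied h) → crossMultiplied (R.sym h)
                    ; trans = ≈ᶠ-trans }
                  ; ∙-cong = +ᶠ-cong }
                ; assoc = +ᶠ-assoc }
              ; identity = +ᶠ-identity , λ f →
                  ≈ᶠ-trans {f +ᶠ embed 0#} {embed 0# +ᶠ f} {f} (+ᶠ-comm f (embed 0#)) (+ᶠ-identity f) }
            ; inverse = +ᶠ-inverse , λ f →
                ≈ᶠ-trans {f +ᶠ (-ᶠ f)} {(-ᶠ f) +ᶠ f} {embed 0#} (+ᶠ-comm f (-ᶠ f)) (+ᶠ-inverse f)
            ; ⁻¹-cong = -ᶠ-cong }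
          ; comm = +ᶠ-comm }
        ; *-cong = *ᶠ-cong
        ; *-assoc = *ᶠ-assoc
        ; *-identity = *ᶠ-identity , λ f →
            ≈ᶠ-trans {f *ᶠ embed 1#} {embed 1# *ᶠ f} {f} (*ᶠ-comm f (embed 1#)) (*ᶠ-identity f)
        ; distrib = distribᶠ , λ f g h → ≈ᶠ-trans (*ᶠ-comm (g +ᶠ h) f)
            (≈ᶠ-trans (distribᶠ f g h) (+ᶠ-cong (*ᶠ-comm f g) (*ᶠ-comm f h))) }
      ; *-comm = *ᶠ-comm } }

  -- A fraction is nonzero when its numerator is.
  Nonzero : Frac → Set
  Nonzero f = Regular R (num f)

  inverse : (f : Frac) → Nonzero f → Frac
  inverse (a over b ⟨ _ ⟩) a-reg = b over a ⟨ a-reg ⟩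

  inverseʳ : ∀ f (f≢0 : Nonzero f) → (f *ᶠ inverse f f≢0) ≈ᶠ embed 1#
  inverseʳ (a over b ⟨ _ ⟩) _ = crossMultiplied
    (solve 2 (λ a b → (a :* b) :* con 1 := con 1 :* (b :* a)) R.refl a b)

  nonzero⇒regular : ∀ {f} → Nonzero f → Regular commutativeRing f
  nonzero⇒regular {a over b ⟨ _ ⟩} a-reg = regular λ (c over d ⟨ _ ⟩) (crossMultiplied h) → crossMultiplied
    (R.trans (R.*-identityʳ c) (R.trans (annihilates a-reg c (R.trans (R.sym (R.*-identityʳ _))
      (R.trans h (R.zeroˡ _)))) (R.sym (R.zeroˡ d))))

module RationalFunctions (R : CommutativeRing 0ℓ 0ℓ) where
  open CommutativeRing R using (Carrier; 0#; 1#)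

  -- R[x₁,…,xₙ] = R[x₂,…,xₙ][x₁]
  PolyRing : ℕ → CommutativeRing 0ℓ 0ℓ
  PolyRing zero    = R
  PolyRing (suc n) = Polynomial.commutativeRing (PolyRing n)

  -- The polynomial c x₁^e₁ ⋯ xₙ^eₙ.
  monomial : ∀ n → Carrier → (Fin n → ℕ) → CommutativeRing.Carrier (PolyRing n)
  monomial zero    c e = c
  monomial (suc n) c e = Polynomial.term (PolyRing n) (e zero) (monomial n c (e ∘ suc))

  monomial-regular : ∀ n {c} (e : Fin n → ℕ) → Regular R c →
                     Regular (PolyRing n) (monomial n c e)
  monomial-regular zero    e c-reg = c-reg
  monomial-regular (suc n) e c-reg =
    Polynomial.term-regular (PolyRing n) (e zero) (monomial-regular n (e ∘ suc) c-reg)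

  monomials-regular : ∀ n {c d} (e f : Fin n → ℕ) → (∃[ i ] e i ≢ f i) →
    Regular R c → Regular R d →
    Regular (PolyRing n) (CommutativeRing._-_ (PolyRing n) (monomial n c e) (monomial n d f))
  monomials-regular (suc n) {c} {d} e f (i , eᵢ≢fᵢ) c-reg d-reg = compare (e zero ℕ.≟ f zero)
    where
    open Polynomial (PolyRing n) using (term; binomial-regular; binomial-regular-≡)
    open CommutativeRing (PolyRing (suc n)) using (_-_)
    c′ = monomial n c (e ∘ suc)
    d′ = monomial n d (f ∘ suc)
    later : e zero ≡ f zero → ∀ i → e i ≢ f i → ∃[ j ] e (suc j) ≢ f (suc j)
    later e₀≡f₀ zero    e₀≢f₀ = ⊥-elim (e₀≢f₀ e₀≡f₀)
    later _     (suc j) eⱼ≢fⱼ = j , eⱼ≢fⱼ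
    compare : Dec (e zero ≡ f zero) → Regular (PolyRing (suc n)) (term (e zero) c′ - term (f zero) d′)
    compare (no e₀≢f₀)  = binomial-regular (e zero) (f zero) e₀≢f₀
      (monomial-regular n (e ∘ suc) c-reg) (monomial-regular n (f ∘ suc) d-reg)
    compare (yes e₀≡f₀) =
      subst (λ k → Regular (PolyRing (suc n)) (term (e zero) c′ - term k d′)) e₀≡f₀
        (binomial-regular-≡ (e zero)
          (monomials-regular n (e ∘ suc) (f ∘ suc) (later e₀≡f₀ i eᵢ≢fᵢ) c-reg d-reg))

  RatFun : ℕ → CommutativeRing 0ℓ 0ℓ
  RatFun n = Fraction.commutativeRing (PolyRing n)

  constant : ∀ n → Carrier → CommutativeRing.Carrier (RatFun n)
  constant n c = Fraction.embed (PolyRing n) (monomial n c λ _ → 0)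

  _⁺ _⁻ : ℤ → ℕ
  (+ k)    ⁺ = k
  -[1+ k ] ⁺ = 0
  (+ k)    ⁻ = 0
  -[1+ k ] ⁻ = suc k

  -- c x₁^a₁ ⋯ xₙ^aₙ for integers aᵢ.
  laurent : ∀ n → Carrier → (Fin n → ℤ) → CommutativeRing.Carrier (RatFun n)
  laurent n c a = monomial n c (λ i → a i ⁺) over monomial n 1# (λ i → a i ⁻)
      ⟨ monomial-regular n (λ i → a i ⁻) (regular-1 R) ⟩
    where open Fraction (PolyRing n)

  laurent-nonzero : ∀ n {c} (a : Fin n → ℤ) → Regular R c →
                    Fraction.Nonzero (PolyRing n) (laurent n c a)
  laurent-nonzero n a = monomial-regular n (λ i → a i ⁺)

  1-laurent-nonzero : ∀ n {c} (a : Fin n → ℤ) → (∃[ i ] a i ≢ 0ℤ) → Regular R c →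
    let open CommutativeRing (RatFun n) using (_-_) renaming (1# to one) in
    Fraction.Nonzero (PolyRing n) (one - laurent n c a)
  1-laurent-nonzero n {c} a (i , aᵢ≢0) c-reg = regular-resp (PolyRing n)
      (P.sym (P.+-cong (P.*-identityˡ _) (P.*-identityʳ _)))
      (monomials-regular n (λ j → a j ⁻) (λ j → a j ⁺) (i , distinct (a i) aᵢ≢0) (regular-1 R) c-reg)
    where
    module P = CommutativeRing (PolyRing n)
    distinct : ∀ k → k ≢ 0ℤ → k ⁻ ≢ k ⁺
    distinct (+ zero)  k≢0 _ = k≢0 ≡.refl
    distinct (+ suc k) k≢0 ()
    distinct -[1+ k ]  k≢0 ()

------------------------------------------------------------------------
-- The localized double affine Hecke algebra of type (C^∨_n, C_n), n = m + 1

data Param : Set where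
  q t t₀ u₀ tₙ uₙ : Param

data Side : Set where
  X Y : Side

-- The characters +, -, ±, ∓.
data Character : Set where
  plus minus plusMinus minusPlus : Character

module LocalizedDAHA (𝕜 : CommutativeRing 0ℓ 0ℓ) (m : ℕ) where

  n : ℕ
  n = suc m

  2ℤ : ℤ
  2ℤ = + 2

  -- 𝕂 = 𝕜(q^{1/2}, t^{1/2}, t₀^{1/2}, u₀^{1/2}, tₙ^{1/2}, uₙ^{1/2}): the six
  -- variables are the square roots.
  module Scalars = RationalFunctions 𝕜
  module 𝕂 = CommutativeRing (Scalars.RatFun 6)
  module 𝕂-Frac = Fraction (Scalars.PolyRing 6)

  𝕂 : Set
  𝕂 = 𝕂.Carrier

  𝕂× : Set
  𝕂× = Σ 𝕂 𝕂-Frac.Nonzero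

  ⌊_⌋ : 𝕂× → 𝕂
  ⌊_⌋ = proj₁

  _⁻¹ : 𝕂× → 𝕂
  (c , c≢0) ⁻¹ = 𝕂-Frac.inverse c c≢0

  1× : 𝕂×
  1× = 𝕂.1# , regular-1 (Scalars.PolyRing 6)

  _*×_ : 𝕂× → 𝕂× → 𝕂×
  (c , c≢0) *× (d , d≢0) = c 𝕂.* d , regular-* (Scalars.PolyRing 6) c≢0 d≢0

  -×_ : 𝕂× → 𝕂×
  -× (c , c≢0) = 𝕂.- c , regular-neg (Scalars.PolyRing 6) c≢0

  index : Param → Fin 6
  index q  = Fin.zero
  index t  = Fin.suc Fin.zero
  index t₀ = Fin.suc (Fin.suc Fin.zero)
  index u₀ = Fin.suc (Fin.suc (Fin.suc Fin.zero))
  index tₙ = Fin.suc (Fin.suc (Fin.suc (Fin.suc Fin.zero)))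
  index uₙ = Fin.suc (Fin.suc (Fin.suc (Fin.suc (Fin.suc Fin.zero))))

  single : ∀ {k} → Fin k → ℤ → Fin k → ℤ
  single i a j = if does (i Fin.≟ j) then a else 0ℤ

  -- p ½^ k  is  p^{k/2}.
  infix 9 _½^_
  _½^_ : Param → ℤ → 𝕂×
  p ½^ k = Scalars.laurent 6 1# exponents , Scalars.laurent-nonzero 6 exponents (regular-1 𝕜)
    where
    open CommutativeRing 𝕜 using (1#)
    exponents = single (index p) k

  data FiniteNode : Set where
    swap : Fin m → FiniteNode      -- swap j is the node 1 + j, 1 ≤ 1 + j < n
    flip : FiniteNode              -- the node n

  data Node : Set where
    affine : Node
    finite : FiniteNode → Node

  position : Node → ℕ
  position affine            = 0
  position (finite (swap j)) = suc (toℕ j)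
  position (finite flip)     = n

  -- Coordinates in the basis ε₁,…,εₙ, δ/2 of Q, or ε₁^∨,…,εₙ^∨, K/2 of Q^∨.
  Lattice : Set
  Lattice = (Fin n → ℤ) × ℤ

  reflect : Node → Lattice → Lattice
  reflect affine            (a , k) = updateAt a zero (λ z → ℤ.- z) , k ℤ.+ 2ℤ ℤ.* a zero
  reflect (finite (swap j)) (a , k) = a ∘ transpose (inject₁ j) (suc j) , k
  reflect (finite flip)     (a , k) = updateAt a (fromℕ m) (λ z → ℤ.- z) , k

  e⃗ : Fin n → Fin n → ℤ
  e⃗ i = single i 1ℤ

  simpleRoot : Node → Lattice
  simpleRoot affine            = (λ k → ℤ.- e⃗ zero k) , 1ℤ
  simpleRoot (finite (swap j)) = (λ k → e⃗ (inject₁ j) k ℤ.- e⃗ (suc j) k) , 0ℤ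
  simpleRoot (finite flip)     = e⃗ (fromℕ m) , 0ℤ

  orient : Sign → Lattice → Lattice
  orient Sign.+ μ       = μ
  orient Sign.- (a , k) = (λ i → ℤ.- a i) , ℤ.- k

  double : Lattice → Lattice
  double (a , k) = (λ i → 2ℤ ℤ.* a i) , 2ℤ ℤ.* k

  Nonconstant : Lattice → Set
  Nonconstant μ = ∃[ i ] proj₁ μ i ≢ 0ℤ

  orient-nonconstant : ∀ σ {μ} → Nonconstant μ → Nonconstant (orient σ μ)
  orient-nonconstant Sign.+ μ≢0        = μ≢0
  orient-nonconstant Sign.- (i , aᵢ≢0) = i , aᵢ≢0 ∘ ℤ.neg-injective

  double-nonconstant : ∀ {μ} → Nonconstant μ → Nonconstant (double μ)
  double-nonconstant {a , _} (i , aᵢ≢0) = i , aᵢ≢0 ∘ ℤ.*-cancelˡ-≡ 2ℤ (a i) 0ℤ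

  single-diag : ∀ {k} (i : Fin k) a → single i a i ≡ a
  single-diag i a with i Fin.≟ i
  ... | yes _  = ≡.refl
  ... | no i≢i = ⊥-elim (i≢i ≡.refl)

  single-off : ∀ {k} {i j : Fin k} a → i ≢ j → single i a j ≡ 0ℤ
  single-off {i = i} {j} a i≢j with i Fin.≟ j
  ... | yes i≡j = ⊥-elim (i≢j i≡j)
  ... | no _    = ≡.refl

  e⃗-nonconstant : ∀ i → Nonconstant (e⃗ i , 0ℤ)
  e⃗-nonconstant i = i , λ eᵢ≡0 → 1≢0 (≡.trans (≡.sym (single-diag i 1ℤ)) eᵢ≡0)
    where
    1≢0 : 1ℤ ≢ 0ℤ
    1≢0 ()

  difference-nonconstant : ∀ {i j} → i ≢ j → Nonconstant ((λ k → e⃗ i k ℤ.- e⃗ j k) , 0ℤ)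
  difference-nonconstant {i} {j} i≢j = i , λ z → 1≢0 (≡.trans
      (≡.sym (cong₂ ℤ._-_ (single-diag i 1ℤ) (single-off 1ℤ (i≢j ∘ ≡.sym)))) z)
    where
    1≢0 : 1ℤ ℤ.- 0ℤ ≢ 0ℤ
    1≢0 ()

  sum-nonconstant : ∀ {i j} → i ≢ j → Nonconstant ((λ k → e⃗ i k ℤ.+ e⃗ j k) , 0ℤ)
  sum-nonconstant {i} {j} i≢j = i , λ z → 1≢0 (≡.trans
      (≡.sym (cong₂ ℤ._+_ (single-diag i 1ℤ) (single-off 1ℤ (i≢j ∘ ≡.sym)))) z)
    where
    1≢0 : 1ℤ ℤ.+ 0ℤ ≢ 0ℤ
    1≢0 ()

  simpleRoot-nonconstant : ∀ i → Nonconstant (simpleRoot i)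
  simpleRoot-nonconstant affine            = orient-nonconstant Sign.- {e⃗ zero , 0ℤ} (e⃗-nonconstant zero)
  simpleRoot-nonconstant (finite (swap j)) = difference-nonconstant λ j≡1+j →
    ℕ.1+n≢n (≡.trans (≡.sym (cong toℕ j≡1+j)) (Fin.toℕ-inject₁ j))
  simpleRoot-nonconstant (finite flip)     = e⃗-nonconstant (fromℕ m)

  ----------------------------------------------------------------------
  -- 𝕂(X₁,…,Xₙ) and 𝕂(Y₁,…,Yₙ): two copies of one field, told apart by Side

  module Functions = RationalFunctions (Scalars.RatFun 6)
  module 𝔽 = CommutativeRing (Functions.RatFun n)
  module 𝔽-Frac = Fraction (Functions.PolyRing n)
  open CommutativeMonoidSum 𝔽.*-commutativeMonoid using () renaming (sum to ∏)

  𝔽 : Set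
  𝔽 = 𝔽.Carrier

  ι : 𝕂 → 𝔽
  ι = Functions.constant n

  -- X^{δ/2} = q^{1/2} and Y^{K/2} = q^{-1/2}.
  half : Side → ℤ → 𝕂×
  half X k = q ½^ k
  half Y k = q ½^ (ℤ.- k)

  -- mon X μ = X^μ and mon Y μ = Y^μ.
  mon : Side → Lattice → 𝔽
  mon S (a , k) = Functions.laurent n ⌊ half S k ⌋ a

  var : Side → Fin n → 𝔽
  var S i = mon S (e⃗ i , 0ℤ)

  var⁻¹ : Side → Fin n → 𝔽
  var⁻¹ S i = mon S (orient Sign.- (e⃗ i , 0ℤ))

  1/1-mon : (S : Side) (μ : Lattice) → Nonconstant μ → 𝔽
  1/1-mon S μ@(a , k) μ≢0 = 𝔽-Frac.inverse (𝔽.1# 𝔽.- mon S μ)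
    (Functions.1-laurent-nonzero n a μ≢0 (𝕂-Frac.nonzero⇒regular (proj₂ (half S k))))

  -- (1 - a^{1/2} b^{1/2} Z^μ) (1 + a^{1/2} b^{-1/2} Z^μ) / (1 - Z^{2μ})
  quotient : Side → Param → Param → (μ : Lattice) → Nonconstant μ → 𝔽
  quotient S a b μ μ≢0 =
    (1# - ι (⌊ a ½^ 1ℤ ⌋ 𝕂.* ⌊ b ½^ 1ℤ ⌋) * mon S μ) *
    (1# + ι (⌊ a ½^ 1ℤ ⌋ 𝕂.* ⌊ b ½^ -1ℤ ⌋) * mon S μ) *
    1/1-mon S (double μ) (double-nonconstant {μ} μ≢0)
    where open 𝔽

  -- t_{αᵢ}, u_{αᵢ} on side X;  t_{αᵢ^∨}, u_{αᵢ^∨} on side Y.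
  tα uα : Side → Node → Param
  tα X affine            = t₀
  tα Y affine            = uₙ
  tα _ (finite (swap _)) = t
  tα _ (finite flip)     = tₙ
  uα _ affine            = u₀
  uα _ (finite (swap _)) = t
  uα X (finite flip)     = uₙ
  uα Y (finite flip)     = t₀

  -- c^{X⁻¹}_{αᵢ} involves X^{-αᵢ}, whereas c^Y_{αᵢ^∨} involves Y^{αᵢ^∨}.
  direction : Side → Sign
  direction X = Sign.-
  direction Y = Sign.+

  c : Side → Node → 𝔽
  c S i = ι ⌊ tα S i ½^ -1ℤ ⌋ 𝔽.* quotient S (tα S i) (uα S i)
    (orient (direction S) (simpleRoot i))
    (orient-nonconstant (direction S) {simpleRoot i} (simpleRoot-nonconstant i))

  -- κ_dr^{Z^σ} and, below, κ_st^{Z^σ}: a sign σ = - inverts every variable Zᵢ.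
  κ-dr : Side → Sign → 𝔽
  κ-dr S σ = ∏ λ i → quotient S tₙ (uα S (finite flip)) (orient σ (e⃗ i , 0ℤ))
    (orient-nonconstant σ {e⃗ i , 0ℤ} (e⃗-nonconstant i))

  κ-st-factor : Side → Sign → (i j : Fin n) → i ≢ j → 𝔽
  κ-st-factor S σ i j i≢j =
    (1# - ι ⌊ t ½^ 2ℤ ⌋ * mon S i-j) * (1# - ι ⌊ t ½^ 2ℤ ⌋ * mon S i+j) *
    (1/1-mon S i-j (orient-nonconstant σ {_ , 0ℤ} (difference-nonconstant i≢j)) *
     1/1-mon S i+j (orient-nonconstant σ {_ , 0ℤ} (sum-nonconstant i≢j)))
    where
    open 𝔽
    i-j i+j : Lattice
    i-j = orient σ ((λ k → e⃗ i k ℤ.- e⃗ j k) , 0ℤ)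
    i+j = orient σ ((λ k → e⃗ i k ℤ.+ e⃗ j k) , 0ℤ)

  κ-st : Side → Sign → 𝔽
  κ-st S σ = ∏ λ i → ∏ λ j → factor i j (i Fin.<? j)
    where
    factor : (i j : Fin n) → Dec (i Fin.< j) → 𝔽
    factor i j (yes i<j) = κ-st-factor S σ i j (Fin.<⇒≢ i<j)
    factor i j (no _)    = 𝔽.1#

  ----------------------------------------------------------------------
  -- H̃_loc is presented by generators (the terms H̃) and relations (the
  -- congruence _≈_).

  -- s X i = ξ_{sᵢ},  s Y i = η_{sᵢ};  T X i = T_{αᵢ},  T Y i = T_{αᵢ^∨}.
  -- The inverses of the T's, which exist in the algebra since the T's satisfy
  -- quadratic relations, are adjoined as formal generators.
  infixl 6 _+_
  infixl 7 _*_
  infix  8 -_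
  data H̃ : Set where
    scalar  : 𝕂 → H̃
    fun     : Side → 𝔽 → H̃
    s       : Side → Node → H̃
    T T⁻¹   : Side → Node → H̃
    _+_ _*_ : H̃ → H̃ → H̃
    -_      : H̃ → H̃
    0# 1#   : H̃

  -- k alternating factors a b a …
  alternate : ℕ → H̃ → H̃ → H̃
  alternate zero    a b = 1#
  alternate (suc k) a b = a * alternate k b a

  -- Bond i j k: the product of the reflections at i and j has order k.  For
  -- n = 1 the two nodes generate an infinite dihedral group and have no bond.
  data Bond : Node → Node → ℕ → Set where
    distant : ∀ {i j} → suc (suc (position i)) ℕ.≤ position j → Bond i j 2
    inner   : ∀ {j k} → toℕ k ≡ suc (toℕ j) → Bond (finite (swap j)) (finite (swap k)) 3
    left    : ∀ {j} → toℕ j ≡ 0 → Bond affine (finite (swap j)) 4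
    right   : ∀ {j} → suc (toℕ j) ≡ m → Bond (finite (swap j)) (finite flip) 4

  Word : Set
  Word = List FiniteNode

  product : (FiniteNode → H̃) → Word → H̃
  product g = foldr (λ i h → g i * h) 1#

  T⟦_⟧ T⁻¹⟦_⟧ : Word → H̃
  T⟦_⟧   = product (T X ∘ finite)
  T⁻¹⟦_⟧ = product (T⁻¹ X ∘ finite) ∘ reverse

  -- s_{ε₁} = s₁ ⋯ sₙ₋₁ sₙ sₙ₋₁ ⋯ s₁
  s-ε₁ : Word
  s-ε₁ = map swap (allFin m) ++ flip ∷ reverse (map swap (allFin m))

  infix 4 _≈_
  data _≈_ : H̃ → H̃ → Set where
    ≈-refl      : ∀ {a} → a ≈ a
    ≈-sym       : ∀ {a b} → a ≈ b → b ≈ a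
    ≈-trans     : ∀ {a b d} → a ≈ b → b ≈ d → a ≈ d
    +-cong      : ∀ {a a′ b b′} → a ≈ a′ → b ≈ b′ → a + b ≈ a′ + b′
    *-cong      : ∀ {a a′ b b′} → a ≈ a′ → b ≈ b′ → a * b ≈ a′ * b′
    neg-cong    : ∀ {a a′} → a ≈ a′ → - a ≈ - a′
    +-assoc     : ∀ a b d → (a + b) + d ≈ a + (b + d)
    +-comm      : ∀ a b → a + b ≈ b + a
    +-identityˡ : ∀ a → 0# + a ≈ a
    +-inverseˡ  : ∀ a → - a + a ≈ 0#
    *-assoc     : ∀ a b d → (a * b) * d ≈ a * (b * d)
    *-identityˡ : ∀ a → 1# * a ≈ a
    *-identityʳ : ∀ a → a * 1# ≈ a
    distribˡ    : ∀ a b d → a * (b + d) ≈ a * b + a * d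
    distribʳ    : ∀ a b d → (b + d) * a ≈ b * a + d * a

    scalar-cong    : ∀ {k l} → k 𝕂.≈ l → scalar k ≈ scalar l
    scalar-+       : ∀ k l → scalar (k 𝕂.+ l) ≈ scalar k + scalar l
    scalar-*       : ∀ k l → scalar (k 𝕂.* l) ≈ scalar k * scalar l
    scalar-1       : scalar 𝕂.1# ≈ 1#
    scalar-central : ∀ k a → scalar k * a ≈ a * scalar k

    fun-cong   : ∀ S {f g} → f 𝔽.≈ g → fun S f ≈ fun S g
    fun-+      : ∀ S f g → fun S (f 𝔽.+ g) ≈ fun S f + fun S g
    fun-*      : ∀ S f g → fun S (f 𝔽.* g) ≈ fun S f * fun S g
    fun-scalar : ∀ S k → fun S (ι k) ≈ scalar k

    s-involutive : ∀ S i → s S i * s S i ≈ 1#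
    s-braid      : ∀ S {i j k} → Bond i j k →
                   alternate k (s S i) (s S j) ≈ alternate k (s S j) (s S i)
    s-mon        : ∀ S i μ → s S i * fun S (mon S μ) ≈ fun S (mon S (reflect i μ)) * s S i

    T-inverseˡ : ∀ S i → T⁻¹ S i * T S i ≈ 1#
    T-inverseʳ : ∀ S i → T S i * T⁻¹ S i ≈ 1#
    T-c        : ∀ S i → T S i + scalar ⌊ tα S i ½^ -1ℤ ⌋ ≈ (1# + s S i) * fun S (c S i)
    T-finite   : ∀ j → T X (finite j) ≈ T Y (finite j)

    Y₁   : fun Y (var Y zero) ≈ T X affine * T⟦ s-ε₁ ⟧
    X₁   : fun X (var X zero) ≈ T⁻¹ Y affine * T⁻¹⟦ s-ε₁ ⟧
    Yⱼ₊₁ : ∀ j → let T⁻¹ⱼ = T⁻¹ X (finite (swap j)) in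
           fun Y (var Y (suc j)) ≈ T⁻¹ⱼ * fun Y (var Y (inject₁ j)) * T⁻¹ⱼ
    Xⱼ₊₁ : ∀ j → let Tⱼ = T X (finite (swap j)) in
           fun X (var X (suc j)) ≈ Tⱼ * fun X (var X (inject₁ j)) * Tⱼ
    Y₁⁻¹X₁ : fun Y (var⁻¹ Y zero) * fun X (var X zero) ≈
      scalar (⌊ q ½^ 1ℤ ⌋ 𝕂.* (⌊ u₀ ½^ 1ℤ ⌋ 𝕂.- ⌊ u₀ ½^ -1ℤ ⌋)) * T⁻¹⟦ s-ε₁ ⟧
      + scalar ⌊ q ½^ 2ℤ ⌋ *
        (T⁻¹⟦ s-ε₁ ⟧ * fun X (var⁻¹ X zero) * fun Y (var Y zero) * T⁻¹⟦ s-ε₁ ⟧)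

  H̃-ring : Ring 0ℓ 0ℓ
  H̃-ring = record
    { Carrier = H̃ ; _≈_ = _≈_ ; _+_ = _+_ ; _*_ = _*_ ; -_ = -_ ; 0# = 0# ; 1# = 1#
    ; isRing = record
      { +-isAbelianGroup = record
        { isGroup = record
          { isMonoid = record
            { isSemigroup = record
              { isMagma = record
                { isEquivalence = record { refl = ≈-refl ; sym = ≈-sym ; trans = ≈-trans }
                ; ∙-cong = +-cong }
              ; assoc = +-assoc }
            ; identity = +-identityˡ , λ a → ≈-trans (+-comm a 0#) (+-identityˡ a) }
          ; inverse = +-inverseˡ , λ a → ≈-trans (+-comm a (- a)) (+-inverseˡ a)
          ; ⁻¹-cong = neg-cong }
        ; comm = +-comm }
      ; *-cong = *-cong
      ; *-assoc = *-assoc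
      ; *-identity = *-identityˡ , *-identityʳ
      ; distrib = distribˡ , distribʳ } }

  ----------------------------------------------------------------------
  -- W_fin is the group of transformations of Q induced by words in s₁,…,sₙ.

  act : Word → Lattice → Lattice
  act w μ = foldr (reflect ∘ finite) μ w

  infix 4 _∼_
  _∼_ : Word → Word → Set
  v ∼ w = ∀ μ → (∀ i → proj₁ (act v μ) i ≡ proj₁ (act w μ) i) × proj₂ (act v μ) ≡ proj₂ (act w μ)

  Reduced : Word → Set
  Reduced w = ∀ v → v ∼ w → length w ℕ.≤ length v

  -- W_fin listed without repetition, each element by one of its reduced words.
  record ReducedWords : Set where
    field
      words    : List Word
      reduced  : All Reduced words
      distinct : AllPairs (λ v w → ¬ v ∼ w) words
      complete : ∀ w → Any (w ∼_) words

  ℓs ℓd : Word → ℕ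
  ℓs []           = 0
  ℓs (swap _ ∷ w) = suc (ℓs w)
  ℓs (flip ∷ w)   = ℓs w
  ℓd []           = 0
  ℓd (swap _ ∷ w) = ℓd w
  ℓd (flip ∷ w)   = suc (ℓd w)

  χ : Character → FiniteNode → 𝕂×
  χ plus      (swap _) = t ½^ 1ℤ
  χ plusMinus (swap _) = t ½^ 1ℤ
  χ minusPlus (swap _) = -× (t ½^ -1ℤ)
  χ minus     (swap _) = -× (t ½^ -1ℤ)
  χ plus      flip     = tₙ ½^ 1ℤ
  χ minusPlus flip     = tₙ ½^ 1ℤ
  χ plusMinus flip     = -× (tₙ ½^ -1ℤ)
  χ minus     flip     = -× (tₙ ½^ -1ℤ)

  χ⟦_⟧ : Character → Word → 𝕂×
  χ⟦ Ξ ⟧ = foldr (λ i k → χ Ξ i *× k) 1×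

  s⟦_⟧ : Side → Word → H̃
  s⟦ S ⟧ = product (s S ∘ finite)

  open SemiringExp (Ring.semiring H̃-ring) using (_^_)

  -- The signs in e_Ξ.  Comparing coefficients of the longest element w₀, which
  -- is 1 in ε_Ξ and sgn Ξ w₀ in e_Ξ, shows that identities between the two carry
  -- the factor sgn Ξ w₀: it is (-1)ⁿ for Ξ = minus, plusMinus and 1 otherwise.
  -- For n = 1:  tₙ^{1/2} ε₋ = tₙ^{1/2} T₁ - tₙ = - κ_dr^X (1 - ξ_{s₁}).
  sgn : Character → Word → H̃
  sgn plus      w = 1#
  sgn minus     w = (- 1#) ^ (ℓs w ℕ.+ ℓd w)
  sgn plusMinus w = (- 1#) ^ ℓd w
  sgn minusPlus w = (- 1#) ^ ℓs w

  ∑ : List Word → (Word → H̃) → H̃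
  ∑ ws f = foldr (λ w h → f w + h) 0# ws

  module Symmetrizers (W : ReducedWords) where
    open ReducedWords W

    Longest : Word → Set
    Longest w₀ = w₀ ∈ words × All (λ w → length w ℕ.≤ length w₀) words

    -- ε_Ξ, for w₀ the word of the longest element
    ε : Word → Character → H̃
    ε w₀ Ξ = scalar (χ⟦ Ξ ⟧ w₀ ⁻¹) * ∑ words λ w → scalar ⌊ χ⟦ Ξ ⟧ w ⌋ * T⟦ w ⟧

    e : Side → Character → H̃
    e S Ξ = ∑ words λ w → sgn Ξ w * s⟦ S ⟧ w

{-# OPTIONS --safe #-}
module Submission where

-- Put τᵢ = t^{1/2} Tᵢ = (1 + sᵢ) kᵢ - 1, where t = t_{αᵢ} and kᵢ = t^{1/2} c_{αᵢ}.  A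
-- computation in rank two shows that the τᵢ satisfy the braid relations, so that τ_w is
-- defined for w in W_fin.  Then
--   ∑ τ_w = (∑ s_w) K,   K the product of the k over the positive roots,
-- by induction on the rank:  with U the left-hand side and U′ that of the parabolic
-- subgroup fixing ε₁, every element in the image of 1 + τᵢ is fixed by sᵢ, hence U is
-- fixed by W_fin.  So is U* = ∑ s_d ρ U′, where d runs over the shortest coset
-- representatives and ρ is the product of the k over the positive roots that involve ε₁.
-- Both are sums of elements x with x Z^{ε₁} = Z^p x for p in the orbit of ε₁.  The terms
-- with p = - ε₁ agree, so U - U* has no term with p = - ε₁, by invariance none for any
-- other p, and is therefore 0.
--
-- The other characters reduce to this case:  for those roots on which the character is
-- a sign, invert the parameters in k and conjugate sᵢ, up to sign, by the product of k
-- over the positive ones among them.  Since χ⁺(Tᵢ) / χ(Tᵢ) is 1 or minus the parameter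
-- of αᵢ, the scalars for w₀ turn k with inverted parameters into k at the opposite root.

open import Algebra.Bundles using (Monoid; Ring; CommutativeMonoid; CommutativeRing)
import Algebra.Properties.CommutativeMonoid.Sum as CommutativeMonoidSum
import Algebra.Properties.CommutativeSemigroup as CommutativeSemigroupProperties
import Algebra.Properties.Ring as RingProperties
import Algebra.Solver.Ring.NaturalCoefficients.Default as SemiringSolver
open import Data.Bool.Base using (true; false; if_then_else_)
open import Data.Empty using (⊥-elim)
open import Data.Fin.Base as Fin using (Fin; zero; suc; inject₁; fromℕ; toℕ)
open import Data.Fin.Permutation.Components using (transpose)
import Data.Fin.Properties as Fin
open import Data.Integer.Base as ℤ using (ℤ; +_; -[1+_]; 0ℤ; 1ℤ; -1ℤ)
import Data.Integer.Properties as ℤ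
open import Data.List.Base using (List; []; _∷_; _++_; map; foldr; length; cartesianProductWith; filter)
import Data.List.Properties as List
open import Data.List.Membership.Propositional using (_∈_)
open import Data.List.Membership.Propositional.Properties using (∈-filter⁺; ∈-map⁺; ∈-map⁻; ∈-cartesianProductWith⁺)
open import Data.List.Membership.Propositional.Properties.WithK using (unique∧set⇒bag)
open import Data.List.Relation.Binary.BagAndSetEquality using (∼bag⇒↭)
open import Data.List.Relation.Binary.Permutation.Propositional using (_↭_)
open import Data.List.Relation.Unary.All as All using (All; []; _∷_)
open import Data.List.Relation.Unary.All.Properties using (all-filter)
open import Data.List.Relation.Unary.AllPairs as AllPairs using ([]; _∷_)
import Data.List.Relation.Unary.AllPairs.Properties as AllPairs
open import Data.List.Relation.Unary.Any using (Any; here; there)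
open import Data.List.Relation.Unary.Unique.Propositional using (Unique)
import Data.List.Relation.Unary.Unique.Propositional.Properties as Unique
open import Data.Maybe.Base using (Maybe; just; nothing)
open import Data.Nat.Base as ℕ using (ℕ; zero; suc; z≤n; s≤s)
import Data.Nat.Properties as ℕ
open import Data.Product.Base using (_×_; _,_; proj₁; proj₂; map₂; ∃-syntax; Σ-syntax)
open import Data.Product.Properties using (≡-dec)
open import Data.Sign.Base as Sign using (Sign)
import Data.Sign.Properties as Sign
open import Data.Sum.Base using (_⊎_; inj₁; inj₂)
open import Data.Vec.Base as Vec using (Vec; []; _∷_; lookup; allFin)
open import Data.Vec.N-ary using (N-ary; _$ⁿ_)
open import Function.Base using (_∘_)
open import Function.Bundles using (mk⇔)
open import Level using (0ℓ)
open import Relation.Binary.Bundles using (Setoid)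
open import Relation.Binary.Definitions using (DecidableEquality)
open import Relation.Binary.PropositionalEquality as ≡ using (_≡_; _≢_; _≗_; cong; cong₂; subst; subst₂)
import Relation.Binary.Reasoning.Setoid as SetoidReasoning
open import Relation.Nullary.Decidable using (Dec; does; yes; no; map′; ¬?)
open import Relation.Nullary.Negation using (¬_)
open import Defs using (module Polynomial; module RationalFunctions; module Fraction; Regular; module LocalizedDAHA)

-- The relations of the algebra contain braid relations for the elements `s S i` but none for the
-- T's, and no basis theorem is at hand. Both facts shape the proof. The braid relations of the τᵢ
-- come from two identities between values of k, of types A₂ and B₂. Comparing coefficients of group
-- elements is replaced by comparing eigenvalues: the operator taking x to x Z^{ε₁} - Z^p x kills
-- the terms that belong to p and is multiplication by Z^r - Z^p, a unit, on those that belong to r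
-- ≠ p. This separates only the points of the orbit of ε₁, that is, the cosets of the stabiliser of
-- ε₁, and so the induction runs through these cosets. `ReducedWords` lists arbitrary reduced words.
-- Words are therefore compared by braid moves alone, without cancellation: such a comparison
-- survives evaluation at the T's, which are not involutions. The conjugation used for the other
-- characters changes neither the way the reflections act on functions nor the functions themselves,
-- so the conjugated reflections satisfy all the hypotheses of the first case.

Gen : ℕ → Set
Gen m = Fin (suc m)

Wd : ℕ → Set
Wd m = List (Gen m)

↑ : ∀ {m} → Wd m → Wd (suc m)
↑ = map suc

-- Pt m is the orbit of ε₁ under the group of rank m + 1:  first = ε₁,
-- last = -ε₁, and mid embeds the orbit of the parabolic subgroup that omits
-- the first generator.
data Pt : ℕ → Set where
  first last : ∀ {m} → Pt m
  mid        : ∀ {m} → Pt m → Pt (suc m)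

infixr 8 _·_
_·_ : ∀ {m} → Gen m → Pt m → Pt m
_·_ {zero}  zero    first         = last
_·_ {zero}  zero    last          = first
_·_ {suc m} zero    first         = mid first
_·_ {suc m} zero    last          = mid last
_·_ {suc m} zero    (mid first)   = first
_·_ {suc m} zero    (mid last)    = last
_·_ {suc m} zero    (mid (mid p)) = mid (mid p)
_·_ {suc m} (suc i) first         = first
_·_ {suc m} (suc i) last          = last
_·_ {suc m} (suc i) (mid p)       = mid (i · p)

·-involutive : ∀ {m} (i : Gen m) p → i · i · p ≡ p
·-involutive {zero}  zero    first         = ≡.refl
·-involutive {zero}  zero    last          = ≡.refl
·-involutive {suc m} zero    first         = ≡.refl
·-involutive {suc m} zero    last          = ≡.refl
·-involutive {suc m} zero    (mid first)   = ≡.refl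
·-involutive {suc m} zero    (mid last)    = ≡.refl
·-involutive {suc m} zero    (mid (mid p)) = ≡.refl
·-involutive {suc m} (suc i) first         = ≡.refl
·-involutive {suc m} (suc i) last          = ≡.refl
·-involutive {suc m} (suc i) (mid p)       = cong mid (·-involutive i p)

neg : ∀ {m} → Pt m → Pt m
neg first   = last
neg last    = first
neg (mid p) = mid (neg p)

·-neg : ∀ {m} (i : Gen m) p → i · neg p ≡ neg (i · p)
·-neg {zero}  zero    first         = ≡.refl
·-neg {zero}  zero    last          = ≡.refl
·-neg {suc m} zero    first         = ≡.refl
·-neg {suc m} zero    last          = ≡.refl
·-neg {suc m} zero    (mid first)   = ≡.refl
·-neg {suc m} zero    (mid last)    = ≡.refl
·-neg {suc m} zero    (mid (mid p)) = ≡.refl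
·-neg {suc m} (suc i) first         = ≡.refl
·-neg {suc m} (suc i) last          = ≡.refl
·-neg {suc m} (suc i) (mid p)       = cong mid (·-neg i p)

-- Braid equivalence of words and shortest coset representatives

infix 4 _⇝_
-- Each relation is given only for the first generator of a rank, and `shift` carries it up from the
-- parabolic subgroups; the double bond at the end of the diagram appears in rank two only. The
-- relation s² = 1 is left out, so lengths are preserved and the equivalence holds for any elements
-- with the braid relations.
data _⇝_ : ∀ {m} → Wd m → Wd m → Set where
  far    : ∀ {m} (k : Gen m) →
           (zero ∷ suc (suc k) ∷ []) ⇝ (suc (suc k) ∷ zero ∷ [])
  braid₃ : ∀ {m} → _⇝_ {suc (suc m)} (zero ∷ suc zero ∷ zero ∷ []) (suc zero ∷ zero ∷ suc zero ∷ [])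
  braid₄ : _⇝_ {1} (zero ∷ suc zero ∷ zero ∷ suc zero ∷ []) (suc zero ∷ zero ∷ suc zero ∷ zero ∷ [])
  shift  : ∀ {m} {v w : Wd m} → v ⇝ w → ↑ v ⇝ ↑ w
  ⇝-refl  : ∀ {m} {v : Wd m} → v ⇝ v
  ⇝-sym   : ∀ {m} {v w : Wd m} → v ⇝ w → w ⇝ v
  ⇝-trans : ∀ {m} {u v w : Wd m} → u ⇝ v → v ⇝ w → u ⇝ w
  _⊕_     : ∀ {m} {v v′ w w′ : Wd m} → v ⇝ v′ → w ⇝ w′ → v ++ w ⇝ v′ ++ w′

⇝-setoid : ℕ → Setoid 0ℓ 0ℓ
⇝-setoid m = record
  { Carrier = Wd m ; _≈_ = _⇝_
  ; isEquivalence = record { refl = ⇝-refl ; sym = ⇝-sym ; trans = ⇝-trans } }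

prepend : ∀ {m} (u : Wd m) {v w} → v ⇝ w → u ++ v ⇝ u ++ w
prepend u v⇝w = ⇝-refl {v = u} ⊕ v⇝w

append : ∀ {m} (u : Wd m) {v w} → v ⇝ w → v ++ u ⇝ w ++ u
append u v⇝w = v⇝w ⊕ ⇝-refl {v = u}

⇝-length : ∀ {m} {v w : Wd m} → v ⇝ w → length v ≡ length w
⇝-length (far k)   = ≡.refl
⇝-length braid₃    = ≡.refl
⇝-length braid₄    = ≡.refl
⇝-length (shift {v = v} {w} h) =
  ≡.trans (List.length-map suc v) (≡.trans (⇝-length h) (≡.sym (List.length-map suc w)))
⇝-length ⇝-refl    = ≡.refl
⇝-length (⇝-sym h) = ≡.sym (⇝-length h)
⇝-length (⇝-trans h k) = ≡.trans (⇝-length h) (⇝-length k)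
⇝-length (_⊕_ {v = v} {v′} h k) = ≡.trans (List.length-++ v)
  (≡.trans (cong₂ ℕ._+_ (⇝-length h) (⇝-length k)) (≡.sym (List.length-++ v′)))

far-word : ∀ {m} (v : Wd m) → zero ∷ ↑ (↑ v) ⇝ ↑ (↑ v) ++ zero ∷ []
far-word []      = ⇝-refl
far-word (k ∷ v) = ⇝-trans (append (↑ (↑ v)) (far k)) (prepend (suc (suc k) ∷ []) (far-word v))

-- p is moved to i · p by i:  coset p is the shortest word taking first to p.
coset : ∀ {m} → Pt m → Wd m
coset         first   = []
coset {zero}  last    = zero ∷ []
coset {suc m} (mid p) = ↑ (coset p) ++ zero ∷ []
coset {suc m} last    = zero ∷ ↑ (coset last) ++ zero ∷ []

data Kind : Set where
  short long : Kind

kind : ∀ {m} → Gen m → Kind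
kind {zero}  zero    = short
kind {suc m} zero    = long
kind {suc m} (suc i) = kind i

-- Deodhar's alternative for a generator times a shortest coset representative: the product is
-- another representative, longer or shorter by one letter, or the generator slides through and
-- comes out as a generator of the stabiliser of ε₁. In the first two cases the words agree
-- literally.
data Move : ∀ {m} → Gen m → Pt m → Set where
  up   : ∀ {m i} {p : Pt m} → coset (i · p) ≡ i ∷ coset p → Move i p
  down : ∀ {m i} {p : Pt m} → coset p ≡ i ∷ coset (i · p) → Move i p
  stay : ∀ {m i} {p : Pt (suc m)} (j : Gen m) → i · p ≡ p →
         i ∷ coset p ⇝ coset p ++ suc j ∷ [] → Move i p

move : ∀ {m} (i : Gen m) p → Move i p
move {zero}  zero first = up ≡.refl
move {zero}  zero last  = down ≡.refl
move {suc m} zero first = up ≡.refl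
move {suc m} zero last  = down ≡.refl
move {suc m} zero (mid first) = down ≡.refl
move {suc m} zero (mid last)  = up ≡.refl
-- The letters of `↑ (↑ (coset p))` commute with s₁, so s₁ reaches the final s₂ s₁, and s₁ s₂ s₁ =
-- s₂ s₁ s₂ expels s₂ on the right.
move {suc (suc m)} zero (mid (mid p)) = stay zero ≡.refl (begin
  zero ∷ ↑ (↑ (coset p) ++ zero ∷ []) ++ zero ∷ []
    ≡⟨ cong (zero ∷_) (lemma (coset p)) ⟩
  zero ∷ ↑ (↑ (coset p)) ++ suc zero ∷ zero ∷ []
    ≈⟨ append (suc zero ∷ zero ∷ []) (far-word (coset p)) ⟩
  (↑ (↑ (coset p)) ++ zero ∷ []) ++ suc zero ∷ zero ∷ []
    ≡⟨ List.++-assoc (↑ (↑ (coset p))) _ _ ⟩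
  ↑ (↑ (coset p)) ++ zero ∷ suc zero ∷ zero ∷ []
    ≈⟨ prepend (↑ (↑ (coset p))) braid₃ ⟩
  ↑ (↑ (coset p)) ++ suc zero ∷ zero ∷ suc zero ∷ []
    ≡⟨ List.++-assoc (↑ (↑ (coset p))) _ _ ⟨
  (↑ (↑ (coset p)) ++ suc zero ∷ zero ∷ []) ++ suc zero ∷ []
    ≡⟨ cong (_++ suc zero ∷ []) (lemma (coset p)) ⟨
  (↑ (↑ (coset p) ++ zero ∷ []) ++ zero ∷ []) ++ suc zero ∷ [] ∎)
  where
  open SetoidReasoning (⇝-setoid (suc (suc m)))
  lemma : ∀ (v : Wd m) → ↑ (↑ v ++ zero ∷ []) ++ zero ∷ [] ≡ ↑ (↑ v) ++ suc zero ∷ zero ∷ []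
  lemma v = ≡.trans (cong (_++ zero ∷ []) (List.map-++ suc (↑ v) (zero ∷ [])))
                    (List.++-assoc (↑ (↑ v)) _ _)
move {suc m} (suc i) first = stay i ≡.refl ⇝-refl
move {suc m} (suc i) (mid p) with move i p
... | up e   = up (cong (λ v → ↑ v ++ zero ∷ []) e)
... | down e = down (cong (λ v → ↑ v ++ zero ∷ []) e)
... | stay {m = m′} j ip≡p h = stay (suc j) (cong mid ip≡p) (begin
  suc i ∷ ↑ d ++ zero ∷ []                ≈⟨ append (zero ∷ []) (shift h) ⟩
  ↑ (d ++ suc j ∷ []) ++ zero ∷ []        ≡⟨ cong (_++ zero ∷ []) (List.map-++ suc d _) ⟩
  (↑ d ++ suc (suc j) ∷ []) ++ zero ∷ []  ≡⟨ List.++-assoc (↑ d) _ _ ⟩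
  ↑ d ++ suc (suc j) ∷ zero ∷ []          ≈⟨ prepend (↑ d) (⇝-sym (far j)) ⟩
  ↑ d ++ zero ∷ suc (suc j) ∷ []          ≡⟨ List.++-assoc (↑ d) _ _ ⟨
  (↑ d ++ zero ∷ []) ++ suc (suc j) ∷ []  ∎)
  where
  open SetoidReasoning (⇝-setoid (suc (suc m′)))
  d = coset p
move {suc zero} (suc zero) last = stay zero ≡.refl (⇝-sym braid₄)
-- The front s₂ s₁ s₂ turns into s₁ s₂ s₁; its last letter travels through the middle of the word to
-- the final s₂ s₁, where a second braid move releases s₂.
move {suc (suc m)} (suc zero) last = stay zero ≡.refl (begin
  suc zero ∷ zero ∷ ↑ (zero ∷ ↑ d ++ zero ∷ []) ++ zero ∷ []
    ≡⟨ cong (λ v → suc zero ∷ zero ∷ suc zero ∷ v) (lemma d) ⟩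
  suc zero ∷ zero ∷ suc zero ∷ ↑ (↑ d) ++ suc zero ∷ zero ∷ []
    ≈⟨ append (↑ (↑ d) ++ suc zero ∷ zero ∷ []) (⇝-sym braid₃) ⟩
  zero ∷ suc zero ∷ zero ∷ ↑ (↑ d) ++ suc zero ∷ zero ∷ []
    ≈⟨ prepend (zero ∷ suc zero ∷ []) (append (suc zero ∷ zero ∷ []) (far-word d)) ⟩
  zero ∷ suc zero ∷ (↑ (↑ d) ++ zero ∷ []) ++ suc zero ∷ zero ∷ []
    ≡⟨ cong (λ v → zero ∷ suc zero ∷ v) (List.++-assoc (↑ (↑ d)) _ _) ⟩
  zero ∷ suc zero ∷ ↑ (↑ d) ++ zero ∷ suc zero ∷ zero ∷ []
    ≈⟨ prepend (zero ∷ suc zero ∷ ↑ (↑ d)) braid₃ ⟩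
  zero ∷ suc zero ∷ ↑ (↑ d) ++ suc zero ∷ zero ∷ suc zero ∷ []
    ≡⟨ cong (λ v → zero ∷ suc zero ∷ v) (List.++-assoc (↑ (↑ d)) _ _) ⟨
  zero ∷ suc zero ∷ (↑ (↑ d) ++ suc zero ∷ zero ∷ []) ++ suc zero ∷ []
    ≡⟨ cong (λ v → zero ∷ suc zero ∷ v ++ suc zero ∷ []) (lemma d) ⟨
  zero ∷ suc zero ∷ (↑ (↑ d ++ zero ∷ []) ++ zero ∷ []) ++ suc zero ∷ [] ∎)
  where
  open SetoidReasoning (⇝-setoid (suc (suc m)))
  d = coset {m} last
  lemma : ∀ (v : Wd m) → ↑ (↑ v ++ zero ∷ []) ++ zero ∷ [] ≡ ↑ (↑ v) ++ suc zero ∷ zero ∷ []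
  lemma v = ≡.trans (cong (_++ zero ∷ []) (List.map-++ suc (↑ v) (zero ∷ [])))
                    (List.++-assoc (↑ (↑ v)) _ _)
move {suc (suc m)} (suc (suc i)) last with move (suc i) (last {suc m})
... | stay j _ h = stay (suc j) ≡.refl (begin
  suc (suc i) ∷ zero ∷ ↑ d ++ zero ∷ []          ≈⟨ append (↑ d ++ zero ∷ []) (⇝-sym (far i)) ⟩
  zero ∷ suc (suc i) ∷ ↑ d ++ zero ∷ []          ≈⟨ prepend (zero ∷ []) (append (zero ∷ []) (shift h)) ⟩
  zero ∷ ↑ (d ++ suc j ∷ []) ++ zero ∷ []        ≡⟨ cong (λ v → zero ∷ v ++ zero ∷ []) (List.map-++ suc d _) ⟩
  zero ∷ (↑ d ++ suc (suc j) ∷ []) ++ zero ∷ []  ≡⟨ cong (zero ∷_) (List.++-assoc (↑ d) _ _) ⟩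
  zero ∷ ↑ d ++ suc (suc j) ∷ zero ∷ []          ≈⟨ prepend (zero ∷ ↑ d) (⇝-sym (far j)) ⟩
  zero ∷ ↑ d ++ zero ∷ suc (suc j) ∷ []          ≡⟨ cong (zero ∷_) (List.++-assoc (↑ d) _ _) ⟨
  zero ∷ (↑ d ++ zero ∷ []) ++ suc (suc j) ∷ []  ∎)
  where
  open SetoidReasoning (⇝-setoid (suc (suc m)))
  d = coset {suc m} last
... | up ()
... | down ()

-- Normal forms and reduced words

infixr 6 _◂_
-- One coset representative for each step of the tower of parabolic subgroups. By `normalise` and
-- `word-injective` these chains correspond to the elements of the group.
data NF : ℕ → Set where
  base : Pt zero → NF zero
  _◂_  : ∀ {m} → Pt (suc m) → NF m → NF (suc m)

word : ∀ {m} → NF m → Wd m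
word (base p) = coset p
word (p ◂ x)  = coset p ++ ↑ (word x)

-- The exchange condition for normal forms: both cases are braid equivalences, so a generator either
-- extends the normal form or is already its first letter up to braid moves.
data Step {m} (i : Gen m) (x : NF m) : Set where
  up   : (y : NF m) → i ∷ word x ⇝ word y → Step i x
  down : (y : NF m) → word x ⇝ i ∷ word y → Step i x

≡⇒⇝ : ∀ {m} {v w : Wd m} → v ≡ w → v ⇝ w
≡⇒⇝ ≡.refl = ⇝-refl

step : ∀ {m} (i : Gen m) x → Step i x
step i (base p) with move i p
... | up e   = up (base (i · p)) (≡⇒⇝ (≡.sym e))
... | down e = down (base (i · p)) (≡⇒⇝ e)
step i (p ◂ x) with move i p
... | up e   = up (i · p ◂ x) (≡⇒⇝ (≡.sym (cong (_++ ↑ (word x)) e)))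
... | down e = down (i · p ◂ x) (≡⇒⇝ (cong (_++ ↑ (word x)) e))
... | stay j _ h with step j x
...   | up y k   = up (p ◂ y) (⇝-trans (append (↑ (word x)) h)
          (⇝-trans (≡⇒⇝ (List.++-assoc (coset p) _ _)) (prepend (coset p) (shift k))))
...   | down y k = down (p ◂ y) (⇝-trans (prepend (coset p) (shift k))
          (⇝-trans (≡⇒⇝ (≡.sym (List.++-assoc (coset p) _ _))) (append (↑ (word y)) (⇝-sym h))))

-- Equality in the group, tested on points (by the inverse transformations).
pull : ∀ {m} → Wd m → Pt m → Pt m
pull []      p = p
pull (i ∷ v) p = pull v (i · p)

push : ∀ {m} → Wd m → Pt m → Pt m
push v p = foldr _·_ p v

infix 4 _≐_
_≐_ : ∀ {m} → Wd m → Wd m → Set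
v ≐ w = ∀ p → pull v p ≡ pull w p

pull-++ : ∀ {m} (v w : Wd m) p → pull (v ++ w) p ≡ pull w (pull v p)
pull-++ []      w p = ≡.refl
pull-++ (i ∷ v) w p = pull-++ v w (i · p)

pull-↑-first : ∀ {m} (v : Wd m) → pull (↑ v) first ≡ first
pull-↑-first []      = ≡.refl
pull-↑-first (i ∷ v) = pull-↑-first v

pull-↑-last : ∀ {m} (v : Wd m) → pull (↑ v) last ≡ last
pull-↑-last []      = ≡.refl
pull-↑-last (i ∷ v) = pull-↑-last v

pull-↑-mid : ∀ {m} (v : Wd m) p → pull (↑ v) (mid p) ≡ mid (pull v p)
pull-↑-mid []      p = ≡.refl
pull-↑-mid (i ∷ v) p = pull-↑-mid v (i · p)

pull-push : ∀ {m} (v : Wd m) p → pull v (push v p) ≡ p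
pull-push []      p = ≡.refl
pull-push (i ∷ v) p = ≡.trans (cong (pull v) (·-involutive i _)) (pull-push v p)

push-pull : ∀ {m} (v : Wd m) p → push v (pull v p) ≡ p
push-pull []      p = ≡.refl
push-pull (i ∷ v) p = ≡.trans (cong (i ·_) (push-pull v (i · p))) (·-involutive i p)

pull-injective : ∀ {m} (v : Wd m) {p q} → pull v p ≡ pull v q → p ≡ q
pull-injective v {p} {q} h = ≡.trans (≡.sym (push-pull v p)) (≡.trans (cong (push v) h) (push-pull v q))

pull-coset : ∀ {m} (p : Pt m) → pull (coset p) p ≡ first
pull-coset         first   = ≡.refl
pull-coset {zero}  last    = ≡.refl
pull-coset {suc m} (mid p) = ≡.trans (pull-++ (↑ (coset p)) (zero ∷ []) (mid p))
  (cong (zero ·_) (≡.trans (pull-↑-mid (coset p) p) (cong mid (pull-coset p))))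
pull-coset {suc m} last    = ≡.trans (pull-++ (↑ (coset last)) (zero ∷ []) (mid last))
  (cong (zero ·_) (≡.trans (pull-↑-mid (coset last) last) (cong mid (pull-coset last))))

⇝⇒≐ : ∀ {m} {v w : Wd m} → v ⇝ w → v ≐ w
⇝⇒≐ (far k) first = ≡.refl
⇝⇒≐ (far k) last  = ≡.refl
⇝⇒≐ (far k) (mid first) = ≡.refl
⇝⇒≐ (far k) (mid last)  = ≡.refl
⇝⇒≐ (far k) (mid (mid p)) = ≡.refl
⇝⇒≐ braid₃ first = ≡.refl
⇝⇒≐ braid₃ last  = ≡.refl
⇝⇒≐ braid₃ (mid first) = ≡.refl
⇝⇒≐ braid₃ (mid last)  = ≡.refl
⇝⇒≐ braid₃ (mid (mid first)) = ≡.refl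
⇝⇒≐ braid₃ (mid (mid last))  = ≡.refl
⇝⇒≐ braid₃ (mid (mid (mid p))) = ≡.refl
⇝⇒≐ braid₄ first = ≡.refl
⇝⇒≐ braid₄ last  = ≡.refl
⇝⇒≐ braid₄ (mid first) = ≡.refl
⇝⇒≐ braid₄ (mid last)  = ≡.refl
⇝⇒≐ (shift {v = v} {w} h) first = ≡.trans (pull-↑-first v) (≡.sym (pull-↑-first w))
⇝⇒≐ (shift {v = v} {w} h) last  = ≡.trans (pull-↑-last v) (≡.sym (pull-↑-last w))
⇝⇒≐ (shift {v = v} {w} h) (mid p) =
  ≡.trans (pull-↑-mid v p) (≡.trans (cong mid (⇝⇒≐ h p)) (≡.sym (pull-↑-mid w p)))
⇝⇒≐ ⇝-refl p = ≡.refl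
⇝⇒≐ (⇝-sym h) p = ≡.sym (⇝⇒≐ h p)
⇝⇒≐ (⇝-trans h k) p = ≡.trans (⇝⇒≐ h p) (⇝⇒≐ k p)
⇝⇒≐ (_⊕_ {v = v} {v′} {w} {w′} h k) p = ≡.trans (pull-++ v w p)
  (≡.trans (cong (pull w) (⇝⇒≐ h p)) (≡.trans (⇝⇒≐ k _) (≡.sym (pull-++ v′ w′ p))))

-- The alternative in `length≤` is the heart of Matsumoto's theorem: a word that is not braid
-- equivalent to its normal form is longer than it, and hence is not reduced.
record Normalised {m} (v : Wd m) : Set where
  constructor normalised
  field
    nf     : NF m
    equal  : v ≐ word nf
    length≤ : length (word nf) ℕ.< length v ⊎ v ⇝ word nf

trivial : ∀ {m} → NF m
trivial {zero}  = base first
trivial {suc m} = first ◂ trivial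

word-trivial : ∀ m → word (trivial {m}) ≡ []
word-trivial zero    = ≡.refl
word-trivial (suc m) = cong ↑ (word-trivial m)

normalise : ∀ {m} (v : Wd m) → Normalised v
normalise {m} [] = normalised trivial (λ p → cong (λ v → pull v p) (≡.sym (word-trivial m)))
  (inj₂ (≡⇒⇝ (≡.sym (word-trivial m))))
normalise (i ∷ v) with normalise v
... | normalised x v≐x v→x with step i x
...   | up y ix⇝y = normalised y (λ p → ≡.trans (v≐x (i · p)) (⇝⇒≐ ix⇝y p)) (bound v→x)
  where
  bound : length (word x) ℕ.< length v ⊎ v ⇝ word x →
          length (word y) ℕ.< suc (length v) ⊎ i ∷ v ⇝ word y
  bound (inj₁ x<v) = inj₁ (subst (ℕ._< suc (length v)) (⇝-length ix⇝y) (s≤s x<v))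
  bound (inj₂ v⇝x) = inj₂ (⇝-trans (prepend (i ∷ []) v⇝x) ix⇝y)
...   | down y x⇝iy = normalised y
        (λ p → ≡.trans (v≐x (i · p)) (≡.trans (⇝⇒≐ x⇝iy (i · p)) (cong (pull (word y)) (·-involutive i p))))
        (inj₁ (ℕ.≤-trans (ℕ.≤-reflexive (≡.sym (⇝-length x⇝iy))) (ℕ.m≤n⇒m≤1+n (bound v→x))))
  where
  bound : length (word x) ℕ.< length v ⊎ v ⇝ word x → length (word x) ℕ.≤ length v
  bound (inj₁ x<v) = ℕ.<⇒≤ x<v
  bound (inj₂ v⇝x) = ℕ.≤-reflexive (≡.sym (⇝-length v⇝x))

mid-injective : ∀ {m} {p q : Pt m} → mid p ≡ mid q → p ≡ q
mid-injective ≡.refl = ≡.refl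

-- The image of ε₁ recovers the coset. Once the common representative is cancelled, the rest is
-- determined by its action on the points `mid r`.
word-injective : ∀ {m} (x y : NF m) → word x ≐ word y → x ≡ y
word-injective (base p) (base q) h = cong base (pull-injective (coset q)
  (≡.trans (≡.sym (h p)) (≡.trans (pull-coset p) (≡.sym (pull-coset q)))))
word-injective (p ◂ x) (q ◂ y) h = both p≡q (word-injective x y x≐y)
  where
  both : p ≡ q → x ≡ y → p ◂ x ≡ q ◂ y
  both ≡.refl ≡.refl = ≡.refl
  at-first : ∀ r z → pull (word (r ◂ z)) r ≡ first
  at-first r z = ≡.trans (pull-++ (coset r) (↑ (word z)) r)
    (≡.trans (cong (pull (↑ (word z))) (pull-coset r)) (pull-↑-first (word z)))
  p≡q : p ≡ q
  p≡q = pull-injective (word (q ◂ y))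
    (≡.trans (≡.sym (h p)) (≡.trans (at-first p x) (≡.sym (at-first q y))))
  x≐y : word x ≐ word y
  x≐y r = mid-injective (≡.trans (≡.sym (pull-↑-mid (word x) r)) (≡.trans (cancel p≡q) (pull-↑-mid (word y) r)))
    where
    r′ = push (coset p) (mid r)
    cancel : p ≡ q → pull (↑ (word x)) (mid r) ≡ pull (↑ (word y)) (mid r)
    cancel ≡.refl = ≡.trans (≡.sym (cong (pull (↑ (word x))) (pull-push (coset p) (mid r))))
      (≡.trans (≡.sym (pull-++ (coset p) (↑ (word x)) r′)) (≡.trans (h r′)
      (≡.trans (pull-++ (coset p) (↑ (word y)) r′) (cong (pull (↑ (word y))) (pull-push (coset p) (mid r))))))

top : ∀ {m} → NF m
top {zero}  = base last
top {suc m} = last ◂ top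

coset-length : ∀ {m} (p : Pt m) → length (coset p) ℕ.≤ length (coset (last {m}))
coset-length         first   = z≤n
coset-length {zero}  last    = ℕ.≤-refl
coset-length {suc m} (mid p) = ℕ.m≤n⇒m≤1+n (begin
  length (↑ (coset p) ++ zero ∷ [])       ≡⟨ List.length-++ (↑ (coset p)) ⟩
  length (↑ (coset p)) ℕ.+ 1              ≡⟨ cong (ℕ._+ 1) (List.length-map suc (coset p)) ⟩
  length (coset p) ℕ.+ 1                  ≤⟨ ℕ.+-monoˡ-≤ 1 (coset-length p) ⟩
  length (coset (last {m})) ℕ.+ 1         ≡⟨ cong (ℕ._+ 1) (List.length-map suc (coset (last {m}))) ⟨
  length (↑ (coset (last {m}))) ℕ.+ 1     ≡⟨ List.length-++ (↑ (coset (last {m}))) ⟨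
  length (↑ (coset (last {m})) ++ zero ∷ []) ∎)
  where open ℕ.≤-Reasoning
coset-length {suc m} last    = ℕ.≤-refl

coset-longest : ∀ {m} (p : Pt m) → length (coset (last {m})) ℕ.≤ length (coset p) → p ≡ last
coset-longest {zero}  first h = ⊥-elim (ℕ.<⇒≱ (s≤s z≤n) h)
coset-longest {suc m} first h = ⊥-elim (ℕ.<⇒≱ (s≤s z≤n) h)
coset-longest {suc m} (mid p) h = ⊥-elim (ℕ.<⇒≱ (s≤s (ℕ.≤-trans (ℕ.≤-reflexive (list-length p))
  (ℕ.≤-trans (ℕ.+-monoˡ-≤ 1 (coset-length p)) (ℕ.≤-reflexive (≡.sym (list-length last)))))) h)
  where
  list-length : ∀ q → length (↑ (coset {m} q) ++ zero ∷ []) ≡ length (coset q) ℕ.+ 1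
  list-length q = ≡.trans (List.length-++ (↑ (coset q))) (cong (ℕ._+ 1) (List.length-map suc (coset q)))
coset-longest {zero}  last h = ≡.refl
coset-longest {suc m} last h = ≡.refl

word-length-◂ : ∀ {m} p (x : NF m) → length (word (p ◂ x)) ≡ length (coset p) ℕ.+ length (word x)
word-length-◂ p x = ≡.trans (List.length-++ (coset p)) (cong (length (coset p) ℕ.+_) (List.length-map suc (word x)))

word-length : ∀ {m} (x : NF m) → length (word x) ℕ.≤ length (word (top {m}))
word-length (base p) = coset-length p
word-length {suc m} (p ◂ x) = subst₂ ℕ._≤_ (≡.sym (word-length-◂ p x)) (≡.sym (word-length-◂ last (top {m})))
  (ℕ.+-mono-≤ (coset-length p) (word-length x))

-- Lengths add up along the chain and each summand is bounded by that of `last`, so equality of the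
-- totals forces equality at every level.
word-longest : ∀ {m} (x : NF m) → length (word (top {m})) ℕ.≤ length (word x) → x ≡ top
word-longest (base p) h = cong base (coset-longest p h)
word-longest {suc m} (p ◂ x) h = cong₂ _◂_
  (coset-longest p (ℕ.+-cancelʳ-≤ (length (word (top {m}))) _ _ (ℕ.≤-trans h′ (ℕ.+-monoʳ-≤ _ (word-length x)))))
  (word-longest x (ℕ.+-cancelˡ-≤ (length (coset (last {suc m}))) _ _ (ℕ.≤-trans h′ (ℕ.+-monoˡ-≤ _ (coset-length p)))))
  where
  h′ = subst₂ ℕ._≤_ (word-length-◂ last (top {m})) (word-length-◂ p x) h

-- A solver for identities in noncommutative rings

module NoncommutativeSolver (R : Ring 0ℓ 0ℓ) where
  open Ring R
  open RingProperties R using (-‿distribˡ-*; -‿distribʳ-*; -‿+-comm; -‿involutive; -0#≈0#)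
  open SetoidReasoning setoid

  infixl 6 _:+_ _:-_
  infixl 7 _:*_
  infix  8 :-_
  infix  4 _:=_

  data Expr (n : ℕ) : Set where
    var       : Fin n → Expr n
    _:+_ _:*_ : Expr n → Expr n → Expr n
    :-_       : Expr n → Expr n
    :0 :1     : Expr n

  _:-_ : ∀ {n} → Expr n → Expr n → Expr n
  e :- f = e :+ :- f

  _:=_ : ∀ {n} → Expr n → Expr n → Expr n × Expr n
  _:=_ = _,_

  -- A sum of signed words in the variables.
  Term : ℕ → Set
  Term n = Sign × List (Fin n)

  _·ₜ_ : ∀ {n} → Term n → Term n → Term n
  (σ , v) ·ₜ (τ , w) = σ Sign.* τ , v ++ w

  opp : ∀ {n} → Term n → Term n
  opp (σ , v) = Sign.opposite σ , v

  expand : ∀ {n} → Expr n → List (Term n)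
  expand (var i)  = (Sign.+ , i ∷ []) ∷ []
  expand (e :+ f) = expand e ++ expand f
  expand (e :* f) = cartesianProductWith _·ₜ_ (expand e) (expand f)
  expand (:- e)   = map opp (expand e)
  expand :0       = []
  expand :1       = (Sign.+ , []) ∷ []

  _≟ₜ_ : ∀ {n} → DecidableEquality (Term n)
  _≟ₜ_ = ≡-dec Sign._≟_ (List.≡-dec Fin._≟_)

  remove : ∀ {n} → Term n → List (Term n) → Maybe (List (Term n))
  remove t []       = nothing
  remove t (u ∷ us) with t ≟ₜ u | remove t us
  ... | yes _ | _       = just us
  ... | no _  | just vs = just (u ∷ vs)
  ... | no _  | nothing = nothing

  -- Only terms of opposite sign are removed against each other and equal terms are never collected.
  -- This is enough to recognise a difference that is zero.
  cons : ∀ {n} → Term n → List (Term n) → List (Term n)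
  cons t us with remove (opp t) us
  ... | just vs = vs
  ... | nothing = t ∷ us

  cancel : ∀ {n} → List (Term n) → List (Term n)
  cancel = foldr cons []

  module _ {n} (ρ : Vec Carrier n) where
    ⟦_⟧ : Expr n → Carrier
    ⟦ var i ⟧  = lookup ρ i
    ⟦ e :+ f ⟧ = ⟦ e ⟧ + ⟦ f ⟧
    ⟦ e :* f ⟧ = ⟦ e ⟧ * ⟦ f ⟧
    ⟦ :- e ⟧   = - ⟦ e ⟧
    ⟦ :0 ⟧     = 0#
    ⟦ :1 ⟧     = 1#

    ⟦_⟧w : List (Fin n) → Carrier
    ⟦_⟧w = foldr (λ i x → lookup ρ i * x) 1#

    ⟦_⟧ₜ : Term n → Carrier
    ⟦ Sign.+ , w ⟧ₜ = ⟦ w ⟧w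
    ⟦ Sign.- , w ⟧ₜ = - ⟦ w ⟧w

    ⟦_⟧ₛ : List (Term n) → Carrier
    ⟦_⟧ₛ = foldr (λ t x → ⟦ t ⟧ₜ + x) 0#

    ⟦++⟧w : ∀ v w → ⟦ v ++ w ⟧w ≈ ⟦ v ⟧w * ⟦ w ⟧w
    ⟦++⟧w []      w = sym (*-identityˡ _)
    ⟦++⟧w (i ∷ v) w = trans (*-congˡ (⟦++⟧w v w)) (sym (*-assoc _ _ _))

    ⟦·⟧ₜ : ∀ t u → ⟦ t ·ₜ u ⟧ₜ ≈ ⟦ t ⟧ₜ * ⟦ u ⟧ₜ
    ⟦·⟧ₜ (Sign.+ , v) (Sign.+ , w) = ⟦++⟧w v w
    ⟦·⟧ₜ (Sign.+ , v) (Sign.- , w) = trans (-‿cong (⟦++⟧w v w)) (-‿distribʳ-* _ _)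
    ⟦·⟧ₜ (Sign.- , v) (Sign.+ , w) = trans (-‿cong (⟦++⟧w v w)) (-‿distribˡ-* _ _)
    ⟦·⟧ₜ (Sign.- , v) (Sign.- , w) = trans (⟦++⟧w v w) (trans (sym (-‿involutive _))
      (trans (-‿cong (-‿distribˡ-* _ _)) (-‿distribʳ-* _ _)))

    ⟦opp⟧ₜ : ∀ t → ⟦ opp t ⟧ₜ ≈ - ⟦ t ⟧ₜ
    ⟦opp⟧ₜ (Sign.+ , v) = refl
    ⟦opp⟧ₜ (Sign.- , v) = sym (-‿involutive _)

    ⟦++⟧ₛ : ∀ ts us → ⟦ ts ++ us ⟧ₛ ≈ ⟦ ts ⟧ₛ + ⟦ us ⟧ₛ
    ⟦++⟧ₛ []       us = sym (+-identityˡ _)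
    ⟦++⟧ₛ (t ∷ ts) us = trans (+-congˡ (⟦++⟧ₛ ts us)) (sym (+-assoc _ _ _))

    ⟦map·⟧ₛ : ∀ t us → ⟦ map (t ·ₜ_) us ⟧ₛ ≈ ⟦ t ⟧ₜ * ⟦ us ⟧ₛ
    ⟦map·⟧ₛ t []       = sym (zeroʳ _)
    ⟦map·⟧ₛ t (u ∷ us) = trans (+-cong (⟦·⟧ₜ t u) (⟦map·⟧ₛ t us)) (sym (distribˡ _ _ _))

    ⟦×⟧ₛ : ∀ ts us → ⟦ cartesianProductWith _·ₜ_ ts us ⟧ₛ ≈ ⟦ ts ⟧ₛ * ⟦ us ⟧ₛ
    ⟦×⟧ₛ []       us = sym (zeroˡ _)
    ⟦×⟧ₛ (t ∷ ts) us = trans (⟦++⟧ₛ (map (t ·ₜ_) us) _)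
      (trans (+-cong (⟦map·⟧ₛ t us) (⟦×⟧ₛ ts us)) (sym (distribʳ _ _ _)))

    ⟦opp⟧ₛ : ∀ ts → ⟦ map opp ts ⟧ₛ ≈ - ⟦ ts ⟧ₛ
    ⟦opp⟧ₛ []       = sym -0#≈0#
    ⟦opp⟧ₛ (t ∷ ts) = trans (+-cong (⟦opp⟧ₜ t) (⟦opp⟧ₛ ts)) (-‿+-comm _ _)

    expand-sound : ∀ e → ⟦ expand e ⟧ₛ ≈ ⟦ e ⟧
    expand-sound (var i)  = trans (+-identityʳ _) (*-identityʳ _)
    expand-sound (e :+ f) = trans (⟦++⟧ₛ (expand e) _) (+-cong (expand-sound e) (expand-sound f))
    expand-sound (e :* f) = trans (⟦×⟧ₛ (expand e) _) (*-cong (expand-sound e) (expand-sound f))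
    expand-sound (:- e)   = trans (⟦opp⟧ₛ (expand e)) (-‿cong (expand-sound e))
    expand-sound :0       = refl
    expand-sound :1       = +-identityʳ _

    remove-sound : ∀ t us {vs} → remove t us ≡ just vs → ⟦ us ⟧ₛ ≈ ⟦ t ⟧ₜ + ⟦ vs ⟧ₛ
    remove-sound t (u ∷ us) eq with t ≟ₜ u | remove t us in r
    remove-sound t (u ∷ us) ≡.refl | yes ≡.refl | _       = refl
    remove-sound t (u ∷ us) ≡.refl | no _       | just vs = begin
      ⟦ u ⟧ₜ + ⟦ us ⟧ₛ               ≈⟨ +-congˡ (remove-sound t us r) ⟩
      ⟦ u ⟧ₜ + (⟦ t ⟧ₜ + ⟦ vs ⟧ₛ)    ≈⟨ +-assoc _ _ _ ⟨
      ⟦ u ⟧ₜ + ⟦ t ⟧ₜ + ⟦ vs ⟧ₛ      ≈⟨ +-congʳ (+-comm _ _) ⟩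
      ⟦ t ⟧ₜ + ⟦ u ⟧ₜ + ⟦ vs ⟧ₛ      ≈⟨ +-assoc _ _ _ ⟩
      ⟦ t ⟧ₜ + (⟦ u ⟧ₜ + ⟦ vs ⟧ₛ)    ∎

    cons-sound : ∀ t us → ⟦ t ⟧ₜ + ⟦ us ⟧ₛ ≈ ⟦ cons t us ⟧ₛ
    cons-sound t us with remove (opp t) us in r
    ... | nothing = refl
    ... | just vs = begin
      ⟦ t ⟧ₜ + ⟦ us ⟧ₛ                    ≈⟨ +-congˡ (remove-sound (opp t) us r) ⟩
      ⟦ t ⟧ₜ + (⟦ opp t ⟧ₜ + ⟦ vs ⟧ₛ)     ≈⟨ +-assoc _ _ _ ⟨
      ⟦ t ⟧ₜ + ⟦ opp t ⟧ₜ + ⟦ vs ⟧ₛ       ≈⟨ +-congʳ (trans (+-congˡ (⟦opp⟧ₜ t)) (-‿inverseʳ _)) ⟩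
      0# + ⟦ vs ⟧ₛ                        ≈⟨ +-identityˡ _ ⟩
      ⟦ vs ⟧ₛ                             ∎

    cancel-sound : ∀ ts → ⟦ ts ⟧ₛ ≈ ⟦ cancel ts ⟧ₛ
    cancel-sound []       = refl
    cancel-sound (t ∷ ts) = trans (+-congˡ (cancel-sound ts)) (cons-sound t (cancel ts))

  solve : ∀ {n} (ρ : Vec Carrier n) (f : N-ary n (Expr n) (Expr n × Expr n)) →
          let (e , e′) = f $ⁿ Vec.map var (allFin n) in
          cancel (expand (e :- e′)) ≡ [] → ⟦_⟧ ρ e ≈ ⟦_⟧ ρ e′
  solve {n} ρ f h = RingProperties.x∙y⁻¹≈ε⇒x≈y R _ _ (begin
    ⟦_⟧ ρ (e :- e′)                        ≈⟨ expand-sound ρ (e :- e′) ⟨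
    ⟦_⟧ₛ ρ (expand (e :- e′))              ≈⟨ cancel-sound ρ (expand (e :- e′)) ⟩
    ⟦_⟧ₛ ρ (cancel (expand (e :- e′)))     ≡⟨ cong (⟦_⟧ₛ ρ) h ⟩
    0#                                     ∎)
    where
    e e′ : Expr n
    e  = proj₁ (f $ⁿ Vec.map var (allFin n))
    e′ = proj₂ (f $ⁿ Vec.map var (allFin n))

-- Words evaluated at elements with the braid relations

module BraidMonoid (M : Monoid 0ℓ 0ℓ) where
  open Monoid M
  open SetoidReasoning setoid

  ⟦_⟧ : ∀ {m} → (Gen m → Carrier) → Wd m → Carrier
  ⟦ g ⟧ = foldr (λ i x → g i ∙ x) ε

  -- The indices are compared through `toℕ`, so that the record restricts along `suc`. Neighbours i
  -- and j = i + 1 are joined by a double bond exactly when j is the last generator m.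
  record Braided {m} (g : Gen m → Carrier) : Set where
    field
      commute : ∀ i j → suc (suc (toℕ i)) ℕ.≤ toℕ j → g i ∙ g j ≈ g j ∙ g i
      triple  : ∀ i j → toℕ j ≡ suc (toℕ i) → toℕ j ℕ.< m →
                g i ∙ (g j ∙ g i) ≈ g j ∙ (g i ∙ g j)
      quadruple : ∀ i j → toℕ j ≡ suc (toℕ i) → toℕ j ≡ m →
                g i ∙ (g j ∙ (g i ∙ g j)) ≈ g j ∙ (g i ∙ (g j ∙ g i))
  open Braided public

  tail : ∀ {m} {g : Gen (suc m) → Carrier} → Braided g → Braided (g ∘ suc)
  tail b = record
    { commute   = λ i j h → commute b (suc i) (suc j) (s≤s h)
    ; triple    = λ i j h k → triple b (suc i) (suc j) (cong suc h) (s≤s k)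
    ; quadruple = λ i j h k → quadruple b (suc i) (suc j) (cong suc h) (cong suc k) }

  braided-resp : ∀ {m} {g h : Gen m → Carrier} → (∀ i → g i ≈ h i) → Braided g → Braided h
  braided-resp {m} {g} {h} g≈h b = record
    { commute   = λ i j e → trans (sym (two i j)) (trans (commute b i j e) (two j i))
    ; triple    = λ i j e f → trans (sym (three i j i)) (trans (triple b i j e f) (three j i j))
    ; quadruple = λ i j e f → trans (sym (four i j i j)) (trans (quadruple b i j e f) (four j i j i)) }
    where
    two : ∀ i j → g i ∙ g j ≈ h i ∙ h j
    two i j = ∙-cong (g≈h i) (g≈h j)
    three : ∀ i j k → g i ∙ (g j ∙ g k) ≈ h i ∙ (h j ∙ h k)
    three i j k = ∙-cong (g≈h i) (two j k)
    four : ∀ i j k l → g i ∙ (g j ∙ (g k ∙ g l)) ≈ h i ∙ (h j ∙ (h k ∙ h l))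
    four i j k l = ∙-cong (g≈h i) (three j k l)

  kind-long : ∀ {m} (i : Gen m) → toℕ i ℕ.< m → kind i ≡ long
  kind-long {suc m} zero    _       = ≡.refl
  kind-long {suc m} (suc i) (s≤s h) = kind-long i h

  -- Generators joined by a simple bond are both long, so both sides of the relation of odd length
  -- are the same product. The relations of even length follow from commutation.
  kind-braided : ∀ {m} (v : Kind → Carrier) → (∀ a b → v a ∙ v b ≈ v b ∙ v a) → Braided {m} (v ∘ kind)
  kind-braided {m} v comm = record
    { commute   = λ i j _ → comm (kind i) (kind j)
    ; triple    = λ i j e j<m → reflexive (cong₂ (λ a b → v a ∙ (v b ∙ v a))
        (≡.trans (kind-long i (ℕ.≤-trans (ℕ.≤-reflexive (≡.sym e)) (ℕ.<⇒≤ j<m))) (≡.sym (kind-long j j<m)))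
        (≡.trans (kind-long j j<m) (≡.sym (kind-long i (ℕ.≤-trans (ℕ.≤-reflexive (≡.sym e)) (ℕ.<⇒≤ j<m))))))
    ; quadruple = λ i j _ _ → trans (sym (assoc _ _ _)) (trans (∙-cong (comm _ _) (comm _ _)) (assoc _ _ _)) }

  ⟦⟧-cong : ∀ {m} {g h : Gen m → Carrier} → (∀ i → g i ≈ h i) → ∀ v → ⟦ g ⟧ v ≈ ⟦ h ⟧ v
  ⟦⟧-cong g≈h []      = refl
  ⟦⟧-cong g≈h (i ∷ v) = ∙-cong (g≈h i) (⟦⟧-cong g≈h v)

  ⟦⟧-++ : ∀ {m} (g : Gen m → Carrier) v w → ⟦ g ⟧ (v ++ w) ≈ ⟦ g ⟧ v ∙ ⟦ g ⟧ w
  ⟦⟧-++ g []      w = sym (identityˡ _)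
  ⟦⟧-++ g (i ∷ v) w = trans (∙-congˡ (⟦⟧-++ g v w)) (sym (assoc _ _ _))

  ⟦⟧-↑ : ∀ {m} (g : Gen (suc m) → Carrier) v → ⟦ g ⟧ (↑ v) ≡ ⟦ g ∘ suc ⟧ v
  ⟦⟧-↑ g []      = ≡.refl
  ⟦⟧-↑ g (i ∷ v) = cong (g (suc i) ∙_) (⟦⟧-↑ g v)

  ⟦⟧-⇝ : ∀ {m} {g : Gen m → Carrier} {v w} → Braided g → v ⇝ w → ⟦ g ⟧ v ≈ ⟦ g ⟧ w
  ⟦⟧-⇝ {g = g} b (far k) = trans (sym (assoc _ _ _))
    (trans (∙-congʳ (commute b zero (suc (suc k)) (s≤s (s≤s z≤n)))) (assoc _ _ _))
  ⟦⟧-⇝ b braid₃ = trans (∙-congˡ (∙-congˡ (identityʳ _)))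
    (trans (triple b zero (suc zero) ≡.refl (s≤s (s≤s z≤n))) (∙-congˡ (∙-congˡ (sym (identityʳ _)))))
  ⟦⟧-⇝ b braid₄ = trans (∙-congˡ (∙-congˡ (∙-congˡ (identityʳ _))))
    (trans (quadruple b zero (suc zero) ≡.refl ≡.refl) (∙-congˡ (∙-congˡ (∙-congˡ (sym (identityʳ _))))))
  ⟦⟧-⇝ {g = g} b (shift {v = v} {w} h) = begin
    ⟦ g ⟧ (↑ v)      ≡⟨ ⟦⟧-↑ g v ⟩
    ⟦ g ∘ suc ⟧ v    ≈⟨ ⟦⟧-⇝ (tail b) h ⟩
    ⟦ g ∘ suc ⟧ w    ≡⟨ ⟦⟧-↑ g w ⟨
    ⟦ g ⟧ (↑ w)      ∎
  ⟦⟧-⇝ b ⇝-refl        = refl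
  ⟦⟧-⇝ b (⇝-sym h)     = sym (⟦⟧-⇝ b h)
  ⟦⟧-⇝ b (⇝-trans h k) = trans (⟦⟧-⇝ b h) (⟦⟧-⇝ b k)
  ⟦⟧-⇝ {g = g} b (_⊕_ {v = v} {v′} {w} {w′} h k) = trans (⟦⟧-++ g v w)
    (trans (∙-cong (⟦⟧-⇝ b h) (⟦⟧-⇝ b k)) (sym (⟦⟧-++ g v′ w′)))

-- Products of the elements E in rank two

-- E = (1 + s) a
module RankTwo (A : Ring 0ℓ 0ℓ) where
  open Ring A
  open NoncommutativeSolver A
  open SetoidReasoning setoid

  -- With `ā` the value at the opposite root, moving a across s turns E E into (1 + s) (a + ā) a,
  -- and a + ā is central. For τ = E - 1 this is the quadratic Hecke relation with eigenvalues θ and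
  -- -1.
  square : ∀ {s a ā θ} → s * s ≈ 1# → a * s ≈ s * ā → a + ā ≈ 1# + θ → (∀ x → θ * x ≈ x * θ) →
           let E = (1# + s) * a in E * E ≈ E + θ * E
  square {s} {a} {ā} {θ} ss as quad θ-central = begin
    (1# + s) * a * ((1# + s) * a)
      ≈⟨ solve (s ∷ a ∷ []) (λ s a → (:1 :+ s) :* a :* ((:1 :+ s) :* a) :=
           (:1 :+ s) :* a :* a :+ (:1 :+ s) :* (a :* s) :* a) ≡.refl ⟩
    (1# + s) * a * a + (1# + s) * (a * s) * a
      ≈⟨ +-congˡ (*-congʳ (*-congˡ as)) ⟩
    (1# + s) * a * a + (1# + s) * (s * ā) * a
      ≈⟨ solve (s ∷ a ∷ ā ∷ []) (λ s a ā → (:1 :+ s) :* a :* a :+ (:1 :+ s) :* (s :* ā) :* a :=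
           (:1 :+ s) :* a :* a :+ (s :+ s :* s) :* (ā :* a)) ≡.refl ⟩
    (1# + s) * a * a + (s + s * s) * (ā * a)
      ≈⟨ +-congˡ (*-congʳ (+-congˡ ss)) ⟩
    (1# + s) * a * a + (s + 1#) * (ā * a)
      ≈⟨ solve (s ∷ a ∷ ā ∷ []) (λ s a ā → (:1 :+ s) :* a :* a :+ (s :+ :1) :* (ā :* a) :=
           (:1 :+ s) :* (a :+ ā) :* a) ≡.refl ⟩
    (1# + s) * (a + ā) * a
      ≈⟨ *-congʳ (*-congˡ quad) ⟩
    (1# + s) * (1# + θ) * a
      ≈⟨ solve (s ∷ a ∷ θ ∷ []) (λ s a θ → (:1 :+ s) :* (:1 :+ θ) :* a :=
           (:1 :+ s) :* a :+ (θ :+ s :* θ) :* a) ≡.refl ⟩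
    (1# + s) * a + (θ + s * θ) * a
      ≈⟨ +-congˡ (*-congʳ (+-congˡ (θ-central s))) ⟨
    (1# + s) * a + (θ + θ * s) * a
      ≈⟨ solve (s ∷ a ∷ θ ∷ []) (λ s a θ → (:1 :+ s) :* a :+ (θ :+ θ :* s) :* a :=
           (:1 :+ s) :* a :+ θ :* ((:1 :+ s) :* a)) ≡.refl ⟩
    (1# + s) * a + θ * ((1# + s) * a) ∎

  -- Here a, b, g, ā are the values of k at the roots α, β, α + β, -α of a system of type A₂. The
  -- factor (1 + s)(1 + s′ + s′ s) is the sum of all six group elements with a common coefficient κ,
  -- hence symmetric in s and s′ by the braid relation. The term θ E is the correction in the A₂
  -- identity.
  triple-product : ∀ {s s′ a b g ā θ κ} → s * s ≈ 1# → a * s ≈ s * ā → g * s ≈ s * b → b * s ≈ s * g →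
    a * s′ ≈ s′ * g → (∀ x → θ * x ≈ x * θ) →
    a * b * a + ā * g * a ≈ b * g * a + θ * a → g * b * a ≈ κ → b * g * a ≈ κ →
    let E = (1# + s) * a ; E′ = (1# + s′) * b in
    E * (E′ * E) ≈ θ * E + (1# + s) * (1# + s′ + s′ * s) * κ
  triple-product {s} {s′} {a} {b} {g} {ā} {θ} {κ} ss as gs bs as′ θ-central id gba bga = begin
    (1# + s) * a * ((1# + s′) * b * ((1# + s) * a))
      ≈⟨ solve (s ∷ s′ ∷ a ∷ b ∷ []) (λ s s′ a b →
           (:1 :+ s) :* a :* ((:1 :+ s′) :* b :* ((:1 :+ s) :* a)) :=
           (:1 :+ s) :* (a :* b :* a :+ (a :* s′) :* b :* a :+ (a :* (b :* s) :* a :+ (a :* s′) :* (b :* s) :* a))) ≡.refl ⟩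
    (1# + s) * (a * b * a + (a * s′) * b * a + (a * (b * s) * a + (a * s′) * (b * s) * a))
      ≈⟨ *-congˡ (+-cong (+-congˡ (*-congʳ (*-congʳ as′)))
           (+-cong (*-congʳ (*-congˡ bs)) (*-congʳ (*-cong as′ bs)))) ⟩
    (1# + s) * (a * b * a + (s′ * g) * b * a + (a * (s * g) * a + (s′ * g) * (s * g) * a))
      ≈⟨ solve (s ∷ s′ ∷ a ∷ b ∷ g ∷ []) (λ s s′ a b g →
           (:1 :+ s) :* (a :* b :* a :+ (s′ :* g) :* b :* a :+ (a :* (s :* g) :* a :+ (s′ :* g) :* (s :* g) :* a)) :=
           (:1 :+ s) :* (a :* b :* a :+ s′ :* (g :* b :* a) :+ ((a :* s) :* g :* a :+ s′ :* (g :* s) :* g :* a))) ≡.refl ⟩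
    (1# + s) * (a * b * a + s′ * (g * b * a) + ((a * s) * g * a + s′ * (g * s) * g * a))
      ≈⟨ *-congˡ (+-cong (+-congˡ (*-congˡ gba)) (+-cong (*-congʳ (*-congʳ as)) (*-congʳ (*-congʳ (*-congˡ gs))))) ⟩
    (1# + s) * (a * b * a + s′ * κ + ((s * ā) * g * a + s′ * (s * b) * g * a))
      ≈⟨ solve (s ∷ s′ ∷ a ∷ b ∷ g ∷ ā ∷ κ ∷ []) (λ s s′ a b g ā κ →
           (:1 :+ s) :* (a :* b :* a :+ s′ :* κ :+ ((s :* ā) :* g :* a :+ s′ :* (s :* b) :* g :* a)) :=
           (:1 :+ s) :* (a :* b :* a) :+ (s :+ s :* s) :* (ā :* g :* a) :+ (:1 :+ s) :* (s′ :* κ :+ s′ :* s :* (b :* g :* a))) ≡.refl ⟩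
    (1# + s) * (a * b * a) + (s + s * s) * (ā * g * a) + (1# + s) * (s′ * κ + s′ * s * (b * g * a))
      ≈⟨ +-cong (+-congˡ (*-congʳ (+-congˡ ss))) (*-congˡ (+-congˡ (*-congˡ bga))) ⟩
    (1# + s) * (a * b * a) + (s + 1#) * (ā * g * a) + (1# + s) * (s′ * κ + s′ * s * κ)
      ≈⟨ solve (s ∷ s′ ∷ a ∷ b ∷ g ∷ ā ∷ κ ∷ []) (λ s s′ a b g ā κ →
           (:1 :+ s) :* (a :* b :* a) :+ (s :+ :1) :* (ā :* g :* a) :+ (:1 :+ s) :* (s′ :* κ :+ s′ :* s :* κ) :=
           (:1 :+ s) :* (a :* b :* a :+ ā :* g :* a) :+ (:1 :+ s) :* (s′ :* κ :+ s′ :* s :* κ)) ≡.refl ⟩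
    (1# + s) * (a * b * a + ā * g * a) + (1# + s) * (s′ * κ + s′ * s * κ)
      ≈⟨ +-congʳ (*-congˡ (trans id (+-congʳ bga))) ⟩
    (1# + s) * (κ + θ * a) + (1# + s) * (s′ * κ + s′ * s * κ)
      ≈⟨ solve (s ∷ s′ ∷ a ∷ θ ∷ κ ∷ []) (λ s s′ a θ κ →
           (:1 :+ s) :* (κ :+ θ :* a) :+ (:1 :+ s) :* (s′ :* κ :+ s′ :* s :* κ) :=
           (θ :+ s :* θ) :* a :+ (:1 :+ s) :* (:1 :+ s′ :+ s′ :* s) :* κ) ≡.refl ⟩
    (θ + s * θ) * a + (1# + s) * (1# + s′ + s′ * s) * κ
      ≈⟨ +-congʳ (*-congʳ (+-congˡ (θ-central s))) ⟨
    (θ + θ * s) * a + (1# + s) * (1# + s′ + s′ * s) * κ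
      ≈⟨ solve (s ∷ s′ ∷ a ∷ θ ∷ κ ∷ []) (λ s s′ a θ κ →
           (θ :+ θ :* s) :* a :+ (:1 :+ s) :* (:1 :+ s′ :+ s′ :* s) :* κ :=
           θ :* ((:1 :+ s) :* a) :+ (:1 :+ s) :* (:1 :+ s′ :+ s′ :* s) :* κ) ≡.refl ⟩
    θ * ((1# + s) * a) + (1# + s) * (1# + s′ + s′ * s) * κ ∎

  -- The terms θ E from E E and from E E′ E cancel in the product of the E - 1. What remains apart
  -- from G is symmetric in E and E′.
  triple-braid : ∀ {E E′ θ G G′} → E * E ≈ E + θ * E → E′ * E′ ≈ E′ + θ * E′ →
    E * (E′ * E) ≈ θ * E + G → E′ * (E * E′) ≈ θ * E′ + G′ → G ≈ G′ →
    (E - 1#) * ((E′ - 1#) * (E - 1#)) ≈ (E′ - 1#) * ((E - 1#) * (E′ - 1#))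
  triple-braid {E} {E′} {θ} {G} {G′} EE EE′ EEE EEE′ G≈G′ = trans (left EE EEE) (trans
      (trans (solve (E ∷ E′ ∷ G ∷ []) (λ E E′ G →
        G :+ E :- E :* E′ :- E′ :* E :+ E′ :- :1 := G :+ E′ :- E′ :* E :- E :* E′ :+ E :- :1) ≡.refl)
        (+-congʳ (+-congʳ (+-congʳ (+-congʳ (+-congʳ G≈G′))))))
      (sym (left EE′ EEE′)))
    where
    left : ∀ {E E′ G} → E * E ≈ E + θ * E → E * (E′ * E) ≈ θ * E + G →
           (E - 1#) * ((E′ - 1#) * (E - 1#)) ≈ G + E - E * E′ - E′ * E + E′ - 1#
    left {E} {E′} {G} EE EEE = begin
      (E - 1#) * ((E′ - 1#) * (E - 1#))
        ≈⟨ solve (E ∷ E′ ∷ []) (λ E E′ → (E :- :1) :* ((E′ :- :1) :* (E :- :1)) :=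
             E :* (E′ :* E) :- E :* E :+ (E :+ E :- E :* E′ :- E′ :* E :+ E′ :- :1)) ≡.refl ⟩
      E * (E′ * E) - E * E + (E + E - E * E′ - E′ * E + E′ - 1#)
        ≈⟨ +-congʳ (+-cong EEE (-‿cong EE)) ⟩
      θ * E + G - (E + θ * E) + (E + E - E * E′ - E′ * E + E′ - 1#)
        ≈⟨ solve (E ∷ E′ ∷ θ ∷ G ∷ []) (λ E E′ θ G →
             θ :* E :+ G :- (E :+ θ :* E) :+ (E :+ E :- E :* E′ :- E′ :* E :+ E′ :- :1) :=
             G :+ E :- E :* E′ :- E′ :* E :+ E′ :- :1) ≡.refl ⟩
      G + E - E * E′ - E′ * E + E′ - 1# ∎

  -- The analogue in type B₂, with a, a′ the values at α and s′ α, and b, b′ those at β and s β;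
  -- bars mark opposite roots. Either simple root may be the long one, so the lemma serves both
  -- sides of the braid relation. The eight group elements again get a common coefficient.
  quadruple-product : ∀ {s s′ a b a′ b′ ā b̄ Θ κ} → s * s ≈ 1# → s′ * s′ ≈ 1# →
    a * s ≈ s * ā → b * s ≈ s * b′ → a′ * s ≈ s * a′ →
    a * s′ ≈ s′ * a′ → a′ * s′ ≈ s′ * a → b′ * s′ ≈ s′ * b′ → b̄ * s′ ≈ s′ * b →
    (∀ x → Θ * x ≈ x * Θ) →
    a * b * a + ā * b′ * a + a * b̄ * a′ ≈ a′ * b′ * a + Θ * a →
    a′ * b′ * a * b ≈ κ → a * b′ * a′ * b ≈ κ →
    let E = (1# + s) * a ; E′ = (1# + s′) * b in
    E * (E′ * (E * E′)) ≈ Θ * (E * E′) + (1# + s) * (1# + s′ + s′ * s + s′ * s * s′) * κ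
  quadruple-product {s} {s′} {a} {b} {a′} {b′} {ā} {b̄} {Θ} {κ}
    ss s′s′ as bs a′s as′ a′s′ b′s′ b̄s′ Θ-central id κ₁ κ₂ = begin
    (1# + s) * a * ((1# + s′) * b * ((1# + s) * a * ((1# + s′) * b)))
      ≈⟨ solve (s ∷ s′ ∷ a ∷ b ∷ []) (λ s s′ a b →
           (:1 :+ s) :* a :* ((:1 :+ s′) :* b :* ((:1 :+ s) :* a :* ((:1 :+ s′) :* b))) :=
           (:1 :+ s) :* (a :* b :* a :+ (a :* s′) :* b :* a :+ (a :* (b :* s) :* a :+ (a :* s′) :* (b :* s) :* a)) :* ((:1 :+ s′) :* b)) ≡.refl ⟩
    (1# + s) * (a * b * a + (a * s′) * b * a + (a * (b * s) * a + (a * s′) * (b * s) * a)) * ((1# + s′) * b)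
      ≈⟨ *-congʳ (*-congˡ (+-cong (+-congˡ (*-congʳ (*-congʳ as′)))
           (+-cong (*-congʳ (*-congˡ bs)) (*-congʳ (*-cong as′ bs))))) ⟩
    (1# + s) * (a * b * a + (s′ * a′) * b * a + (a * (s * b′) * a + (s′ * a′) * (s * b′) * a)) * ((1# + s′) * b)
      ≈⟨ solve (s ∷ s′ ∷ a ∷ b ∷ a′ ∷ b′ ∷ []) (λ s s′ a b a′ b′ →
           (:1 :+ s) :* (a :* b :* a :+ (s′ :* a′) :* b :* a :+ (a :* (s :* b′) :* a :+ (s′ :* a′) :* (s :* b′) :* a)) :* ((:1 :+ s′) :* b) :=
           (:1 :+ s) :* (a :* b :* a :+ s′ :* a′ :* b :* a :+ ((a :* s) :* b′ :* a :+ s′ :* (a′ :* s) :* b′ :* a)) :* ((:1 :+ s′) :* b)) ≡.refl ⟩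
    (1# + s) * (a * b * a + s′ * a′ * b * a + ((a * s) * b′ * a + s′ * (a′ * s) * b′ * a)) * ((1# + s′) * b)
      ≈⟨ *-congʳ (*-congˡ (+-congˡ (+-cong (*-congʳ (*-congʳ as)) (*-congʳ (*-congʳ (*-congˡ a′s)))))) ⟩
    (1# + s) * (a * b * a + s′ * a′ * b * a + ((s * ā) * b′ * a + s′ * (s * a′) * b′ * a)) * ((1# + s′) * b)
      ≈⟨ solve (s ∷ s′ ∷ a ∷ b ∷ a′ ∷ b′ ∷ ā ∷ []) (λ s s′ a b a′ b′ ā →
           (:1 :+ s) :* (a :* b :* a :+ s′ :* a′ :* b :* a :+ ((s :* ā) :* b′ :* a :+ s′ :* (s :* a′) :* b′ :* a)) :* ((:1 :+ s′) :* b) :=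
           ((:1 :+ s) :* (a :* b :* a :+ s′ :* a′ :* b :* a) :+ (s :+ s :* s) :* (ā :* b′ :* a)) :* ((:1 :+ s′) :* b)
           :+ (:1 :+ s) :* (s′ :* s) :* (a′ :* b′ :* a :* b :+ a′ :* b′ :* (a :* s′) :* b)) ≡.refl ⟩
    ((1# + s) * (a * b * a + s′ * a′ * b * a) + (s + s * s) * (ā * b′ * a)) * ((1# + s′) * b)
    + (1# + s) * (s′ * s) * (a′ * b′ * a * b + a′ * b′ * (a * s′) * b)
      ≈⟨ +-cong (*-congʳ (+-congˡ (*-congʳ (+-congˡ ss)))) (*-congˡ (+-cong κ₁ move-s′)) ⟩
    ((1# + s) * (a * b * a + s′ * a′ * b * a) + (s + 1#) * (ā * b′ * a)) * ((1# + s′) * b)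
    + (1# + s) * (s′ * s) * (κ + s′ * κ)
      ≈⟨ solve (s ∷ s′ ∷ a ∷ b ∷ a′ ∷ b′ ∷ ā ∷ κ ∷ []) (λ s s′ a b a′ b′ ā κ →
           ((:1 :+ s) :* (a :* b :* a :+ s′ :* a′ :* b :* a) :+ (s :+ :1) :* (ā :* b′ :* a)) :* ((:1 :+ s′) :* b)
           :+ (:1 :+ s) :* (s′ :* s) :* (κ :+ s′ :* κ) :=
           (:1 :+ s) :* ((a :* b :* a :+ ā :* b′ :* a) :* (:1 :+ s′) :* b :+ (s′ :* a′) :* b :* (a :+ a :* s′) :* b)
           :+ (:1 :+ s) :* (s′ :* s) :* (κ :+ s′ :* κ)) ≡.refl ⟩
    (1# + s) * ((a * b * a + ā * b′ * a) * (1# + s′) * b + (s′ * a′) * b * (a + a * s′) * b)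
    + (1# + s) * (s′ * s) * (κ + s′ * κ)
      -- Moving the left s′ across its term makes 1 + s′ a right factor there too, so that the three
      -- cubic terms of `id` stand in front of one common factor.
      ≈⟨ +-congʳ (*-congˡ (+-congˡ (*-congʳ flip))) ⟩
    (1# + s) * ((a * b * a + ā * b′ * a) * (1# + s′) * b + a * b̄ * a′ * (s′ + 1#) * b)
    + (1# + s) * (s′ * s) * (κ + s′ * κ)
      ≈⟨ +-congʳ (*-congˡ (solve (s′ ∷ a * b * a + ā * b′ * a ∷ a * b̄ * a′ ∷ b ∷ []) (λ s′ P Q b →
           P :* (:1 :+ s′) :* b :+ Q :* (s′ :+ :1) :* b := (P :+ Q) :* ((:1 :+ s′) :* b)) ≡.refl)) ⟩
    (1# + s) * ((a * b * a + ā * b′ * a + a * b̄ * a′) * ((1# + s′) * b))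
    + (1# + s) * (s′ * s) * (κ + s′ * κ)
      ≈⟨ +-congʳ (*-congˡ (*-congʳ id)) ⟩
    (1# + s) * ((a′ * b′ * a + Θ * a) * ((1# + s′) * b)) + (1# + s) * (s′ * s) * (κ + s′ * κ)
      ≈⟨ solve (s ∷ s′ ∷ a ∷ b ∷ a′ ∷ b′ ∷ Θ ∷ κ ∷ []) (λ s s′ a b a′ b′ Θ κ →
           (:1 :+ s) :* ((a′ :* b′ :* a :+ Θ :* a) :* ((:1 :+ s′) :* b)) :+ (:1 :+ s) :* (s′ :* s) :* (κ :+ s′ :* κ) :=
           (Θ :+ s :* Θ) :* a :* ((:1 :+ s′) :* b) :+ (:1 :+ s) :* (a′ :* b′ :* a :* b :+ a′ :* b′ :* (a :* s′) :* b)
           :+ (:1 :+ s) :* (s′ :* s) :* (κ :+ s′ :* κ)) ≡.refl ⟩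
    (Θ + s * Θ) * a * ((1# + s′) * b) + (1# + s) * (a′ * b′ * a * b + a′ * b′ * (a * s′) * b)
    + (1# + s) * (s′ * s) * (κ + s′ * κ)
      ≈⟨ +-congʳ (+-cong (*-congʳ (*-congʳ (+-congˡ (sym (Θ-central s))))) (*-congˡ (+-cong κ₁ move-s′))) ⟩
    (Θ + Θ * s) * a * ((1# + s′) * b) + (1# + s) * (κ + s′ * κ)
    + (1# + s) * (s′ * s) * (κ + s′ * κ)
      ≈⟨ solve (s ∷ s′ ∷ a ∷ b ∷ Θ ∷ κ ∷ []) (λ s s′ a b Θ κ →
           (Θ :+ Θ :* s) :* a :* ((:1 :+ s′) :* b) :+ (:1 :+ s) :* (κ :+ s′ :* κ)
           :+ (:1 :+ s) :* (s′ :* s) :* (κ :+ s′ :* κ) :=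
           Θ :* ((:1 :+ s) :* a :* ((:1 :+ s′) :* b)) :+ (:1 :+ s) :* (:1 :+ s′ :+ s′ :* s :+ s′ :* s :* s′) :* κ) ≡.refl ⟩
    Θ * ((1# + s) * a * ((1# + s′) * b)) + (1# + s) * (1# + s′ + s′ * s + s′ * s * s′) * κ ∎
    where
    move-s′ : a′ * b′ * (a * s′) * b ≈ s′ * κ
    move-s′ = begin
      a′ * b′ * (a * s′) * b      ≈⟨ *-congʳ (*-congˡ as′) ⟩
      a′ * b′ * (s′ * a′) * b     ≈⟨ solve (a′ ∷ b′ ∷ s′ ∷ b ∷ []) (λ a′ b′ s′ b →
                                       a′ :* b′ :* (s′ :* a′) :* b := a′ :* (b′ :* s′) :* a′ :* b) ≡.refl ⟩
      a′ * (b′ * s′) * a′ * b     ≈⟨ *-congʳ (*-congʳ (*-congˡ b′s′)) ⟩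
      a′ * (s′ * b′) * a′ * b     ≈⟨ solve (a′ ∷ b′ ∷ s′ ∷ b ∷ []) (λ a′ b′ s′ b →
                                       a′ :* (s′ :* b′) :* a′ :* b := (a′ :* s′) :* b′ :* a′ :* b) ≡.refl ⟩
      (a′ * s′) * b′ * a′ * b     ≈⟨ *-congʳ (*-congʳ (*-congʳ a′s′)) ⟩
      (s′ * a) * b′ * a′ * b      ≈⟨ solve (a′ ∷ b′ ∷ s′ ∷ b ∷ a ∷ []) (λ a′ b′ s′ b a →
                                       (s′ :* a) :* b′ :* a′ :* b := s′ :* (a :* b′ :* a′ :* b)) ≡.refl ⟩
      s′ * (a * b′ * a′ * b)      ≈⟨ *-congˡ κ₂ ⟩
      s′ * κ                      ∎
    flip : (s′ * a′) * b * (a + a * s′) ≈ a * b̄ * a′ * (s′ + 1#)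
    flip = begin
      (s′ * a′) * b * (a + a * s′)          ≈⟨ *-congʳ (*-congʳ as′) ⟨
      (a * s′) * b * (a + a * s′)           ≈⟨ solve (s′ ∷ a ∷ b ∷ []) (λ s′ a b →
                                                 (a :* s′) :* b :* (a :+ a :* s′) := a :* (s′ :* b) :* a :* (:1 :+ s′)) ≡.refl ⟩
      a * (s′ * b) * a * (1# + s′)          ≈⟨ *-congʳ (*-congʳ (*-congˡ b̄s′)) ⟨
      a * (b̄ * s′) * a * (1# + s′)          ≈⟨ solve (s′ ∷ a ∷ b̄ ∷ []) (λ s′ a b̄ →
                                                 a :* (b̄ :* s′) :* a :* (:1 :+ s′) := a :* b̄ :* (s′ :* a) :* (:1 :+ s′)) ≡.refl ⟩
      a * b̄ * (s′ * a) * (1# + s′)          ≈⟨ *-congʳ (*-congˡ a′s′) ⟨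
      a * b̄ * (a′ * s′) * (1# + s′)         ≈⟨ solve (s′ ∷ a ∷ b̄ ∷ a′ ∷ []) (λ s′ a b̄ a′ →
                                                 a :* b̄ :* (a′ :* s′) :* (:1 :+ s′) := a :* b̄ :* a′ :* (s′ :+ s′ :* s′)) ≡.refl ⟩
      a * b̄ * a′ * (s′ + s′ * s′)           ≈⟨ *-congˡ (+-congˡ s′s′) ⟩
      a * b̄ * a′ * (s′ + 1#)                ∎

  -- Apart from G the expanded product is symmetric under exchanging E, θ with E′, θ′, once
  -- centrality has cancelled θ′ E E′ against E θ′ E′.
  quadruple-braid : ∀ {E E′ θ θ′ G G′} → (∀ x → θ * x ≈ x * θ) → (∀ x → θ′ * x ≈ x * θ′) →
    E * E ≈ E + θ * E → E′ * E′ ≈ E′ + θ′ * E′ →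
    E * (E′ * (E * E′)) ≈ (θ + θ′) * (E * E′) + G → E′ * (E * (E′ * E)) ≈ (θ′ + θ) * (E′ * E) + G′ → G ≈ G′ →
    let τ = E - 1# ; τ′ = E′ - 1# in τ * (τ′ * (τ * τ′)) ≈ τ′ * (τ * (τ′ * τ))
  quadruple-braid {E} {E′} {θ} {θ′} {G} {G′} θ-central θ′-central EE EE′ EEEE EEEE′ G≈G′ =
    trans (left θ-central θ′-central EE EE′ EEEE) (trans
      (trans (solve (E ∷ E′ ∷ G ∷ θ ∷ θ′ ∷ []) (λ E E′ G θ θ′ →
        G :- E :* (E′ :* E) :- E′ :* (E :* E′) :+ (E :* E′ :+ E′ :* E :+ θ :* E :+ θ′ :* E′ :- E :- E′ :+ :1) :=
        G :- E′ :* (E :* E′) :- E :* (E′ :* E) :+ (E′ :* E :+ E :* E′ :+ θ′ :* E′ :+ θ :* E :- E′ :- E :+ :1)) ≡.refl)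
        (+-congʳ (+-congʳ (+-congʳ G≈G′))))
      (sym (left θ′-central θ-central EE′ EE EEEE′)))
    where
    left : ∀ {E E′ θ θ′ G} → (∀ x → θ * x ≈ x * θ) → (∀ x → θ′ * x ≈ x * θ′) →
      E * E ≈ E + θ * E → E′ * E′ ≈ E′ + θ′ * E′ →
      E * (E′ * (E * E′)) ≈ (θ + θ′) * (E * E′) + G →
      (E - 1#) * ((E′ - 1#) * ((E - 1#) * (E′ - 1#))) ≈
      G - E * (E′ * E) - E′ * (E * E′) + (E * E′ + E′ * E + θ * E + θ′ * E′ - E - E′ + 1#)
    left {E} {E′} {θ} {θ′} {G} θ-central θ′-central EE EE′ EEEE = begin
      (E - 1#) * ((E′ - 1#) * ((E - 1#) * (E′ - 1#)))
        ≈⟨ solve (E ∷ E′ ∷ []) (λ E E′ → (E :- :1) :* ((E′ :- :1) :* ((E :- :1) :* (E′ :- :1))) :=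
             E :* (E′ :* (E :* E′)) :- E :* E :* E′ :- E :* (E′ :* E′) :+ E :* E :+ E′ :* E′
             :+ (:- (E :* (E′ :* E)) :- E′ :* (E :* E′) :+ E :* E′ :+ E :* E′ :+ E :* E′ :+ E′ :* E
                 :- E :- E :- E′ :- E′ :+ :1)) ≡.refl ⟩
      E * (E′ * (E * E′)) - E * E * E′ - E * (E′ * E′) + E * E + E′ * E′ + rest
        ≈⟨ +-congʳ (+-cong (+-cong (+-cong (+-cong EEEE (-‿cong (*-congʳ EE))) (-‿cong (*-congˡ EE′))) EE) EE′) ⟩
      (θ + θ′) * (E * E′) + G - (E + θ * E) * E′ - E * (E′ + θ′ * E′) + (E + θ * E) + (E′ + θ′ * E′) + rest
        ≈⟨ solve (E ∷ E′ ∷ θ ∷ θ′ ∷ G ∷ []) (λ E E′ θ θ′ G →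
             (θ :+ θ′) :* (E :* E′) :+ G :- (E :+ θ :* E) :* E′ :- E :* (E′ :+ θ′ :* E′) :+ (E :+ θ :* E) :+ (E′ :+ θ′ :* E′)
             :+ (:- (E :* (E′ :* E)) :- E′ :* (E :* E′) :+ E :* E′ :+ E :* E′ :+ E :* E′ :+ E′ :* E
                 :- E :- E :- E′ :- E′ :+ :1) :=
             (θ′ :* E) :* E′ :- (E :* θ′) :* E′ :+ (G :- E :* (E′ :* E) :- E′ :* (E :* E′)
             :+ (E :* E′ :+ E′ :* E :+ θ :* E :+ θ′ :* E′ :- E :- E′ :+ :1))) ≡.refl ⟩
      (θ′ * E) * E′ - (E * θ′) * E′ + _
        ≈⟨ +-congʳ (trans (+-congˡ (-‿cong (*-congʳ (sym (θ′-central E))))) (-‿inverseʳ _)) ⟩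
      0# + _
        ≈⟨ +-identityˡ _ ⟩
      _ ∎
      where
      rest = - (E * (E′ * E)) - E′ * (E * E′) + E * E′ + E * E′ + E * E′ + E′ * E - E - E - E′ - E′ + 1#

-- The orbit of ε₁, sums over it, and roots

_≟ₚ_ : ∀ {m} → DecidableEquality (Pt m)
first ≟ₚ first = yes ≡.refl
first ≟ₚ last  = no λ ()
first ≟ₚ mid q = no λ ()
last  ≟ₚ first = no λ ()
last  ≟ₚ last  = yes ≡.refl
last  ≟ₚ mid q = no λ ()
mid p ≟ₚ first = no λ ()
mid p ≟ₚ last  = no λ ()
mid p ≟ₚ mid q = map′ (cong mid) mid-injective (p ≟ₚ q)

allPt : ∀ m → List (Pt m)
allPt zero    = first ∷ last ∷ []
allPt (suc m) = first ∷ last ∷ map mid (allPt m)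

∈-allPt : ∀ {m} (p : Pt m) → p ∈ allPt m
∈-allPt {zero}  first   = here ≡.refl
∈-allPt {zero}  last    = there (here ≡.refl)
∈-allPt {suc m} first   = here ≡.refl
∈-allPt {suc m} last    = there (here ≡.refl)
∈-allPt {suc m} (mid p) = there (there (∈-map⁺ mid (∈-allPt p)))

axis : ∀ {m} → Pt m → Gen m
axis first   = zero
axis last    = zero
axis (mid p) = suc (axis p)

axis-neg : ∀ {m} (p : Pt m) → axis (neg p) ≡ axis p
axis-neg first   = ≡.refl
axis-neg last    = ≡.refl
axis-neg (mid p) = cong suc (axis-neg p)

Apart : ∀ {m} → Pt m → Pt m → Set
Apart p q = axis p ≢ axis q

apart-mid : ∀ {m} {p q : Pt m} → Apart p q → Apart (mid p) (mid q)
apart-mid p≢q e = p≢q (Fin.suc-injective e)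

-- The first generator leads from `last` to `mid last`, the parabolic subgroup from there to all
-- points `mid p`, and the first generator back from `mid first` to `first`.
transitive : ∀ {m} (Q : Pt m → Set) → (∀ i p → Q p → Q (i · p)) → Q last → ∀ p → Q p
transitive {zero}  Q step-Q q last    = q
transitive {zero}  Q step-Q q first   = step-Q zero last q
transitive {suc m} Q step-Q q last    = q
transitive {suc m} Q step-Q q (mid p) =
  transitive (Q ∘ mid) (λ i p → step-Q (suc i) (mid p)) (step-Q zero last q) p
transitive {suc m} Q step-Q q first   =
  step-Q zero (mid first) (transitive (Q ∘ mid) (λ i p → step-Q (suc i) (mid p)) (step-Q zero last q) first)

-- Over a commutative monoid, so that the same lemmas serve sums of group elements and products of
-- functions over roots.
module PointSums (M : CommutativeMonoid 0ℓ 0ℓ) where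
  open CommutativeMonoid M
  open CommutativeSemigroupProperties commutativeSemigroup using (interchange)
  open SetoidReasoning setoid

  ∑ : ∀ {m} → (Pt m → Carrier) → Carrier
  ∑ {zero}  f = f first ∙ f last
  ∑ {suc m} f = (f first ∙ f last) ∙ ∑ (f ∘ mid)

  -- Sums over the positive roots that involve ε₁, and over all positive roots.
  ∑ε₁ ∑roots : ∀ {m} → (Pt m → Pt m → Carrier) → (Pt m → Carrier) → Carrier
  ∑ε₁ {zero}  ℓ h = h first
  ∑ε₁ {suc m} ℓ h = ∑ (λ q → ℓ first (mid q)) ∙ h first
  ∑roots {zero}  ℓ h = ∑ε₁ ℓ h
  ∑roots {suc m} ℓ h = ∑ε₁ ℓ h ∙ ∑roots (λ p q → ℓ (mid p) (mid q)) (h ∘ mid)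

  ∑-cong : ∀ {m} {f g : Pt m → Carrier} → (∀ p → f p ≈ g p) → ∑ f ≈ ∑ g
  ∑-cong {zero}  f≈g = ∙-cong (f≈g first) (f≈g last)
  ∑-cong {suc m} f≈g = ∙-cong (∙-cong (f≈g first) (f≈g last)) (∑-cong (f≈g ∘ mid))

  ∑-∙ : ∀ {m} (f g : Pt m → Carrier) → ∑ (λ p → f p ∙ g p) ≈ ∑ f ∙ ∑ g
  ∑-∙ {zero}  f g = interchange _ _ _ _
  ∑-∙ {suc m} f g = trans (∙-cong (interchange _ _ _ _) (∑-∙ (f ∘ mid) (g ∘ mid))) (interchange _ _ _ _)

  ∑-· : ∀ {m} i (f : Pt m → Carrier) → ∑ (λ p → f (i · p)) ≈ ∑ f
  ∑-· {zero}        zero    f = comm _ _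
  ∑-· {suc zero}    zero    f = comm _ _
  ∑-· {suc (suc m)} zero    f = trans (sym (assoc _ _ _)) (trans (∙-congʳ (comm _ _)) (assoc _ _ _))
  ∑-· {suc m}       (suc i) f = ∙-congˡ (∑-· i (f ∘ mid))

  ∑-closed : ∀ {m} (P : Carrier → Set) → (∀ {x y} → P x → P y → P (x ∙ y)) →
             (f : Pt m → Carrier) → (∀ p → P (f p)) → P (∑ f)
  ∑-closed {zero}  P _⊹_ f Pf = Pf first ⊹ Pf last
  ∑-closed {suc m} P _⊹_ f Pf = (Pf first ⊹ Pf last) ⊹ ∑-closed P _⊹_ (f ∘ mid) (Pf ∘ mid)

  -- A generator acts as an involution, so the points fall into orbits of size one or two. The
  -- hypothesis is a disjunction because `Move` decides for each point which size occurs.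
  ∑-orbits : ∀ {m} i (P : Carrier → Set) → (∀ {x y} → x ≈ y → P x → P y) → (∀ {x y} → P x → P y → P (x ∙ y)) →
             (f : Pt m → Carrier) → (∀ p → (i · p ≡ p × P (f p)) ⊎ (i · p ≢ p × P (f p ∙ f (i · p)))) → P (∑ f)
  ∑-orbits i P resp _⊹_ f orbit = go i f (λ p ip≡p → fixed p ip≡p (orbit p)) (λ p ip≢p → moved p ip≢p (orbit p))
    where
    fixed : ∀ p → i · p ≡ p → (i · p ≡ p × P (f p)) ⊎ (i · p ≢ p × P (f p ∙ f (i · p))) → P (f p)
    fixed p _    (inj₁ (_ , Pf))   = Pf
    fixed p ip≡p (inj₂ (ip≢p , _)) = ⊥-elim (ip≢p ip≡p)
    moved : ∀ p → i · p ≢ p → (i · p ≡ p × P (f p)) ⊎ (i · p ≢ p × P (f p ∙ f (i · p))) → P (f p ∙ f (i · p))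
    moved p ip≢p (inj₁ (ip≡p , _)) = ⊥-elim (ip≢p ip≡p)
    moved p _    (inj₂ (_ , Pf))   = Pf
    go : ∀ {m} i (f : Pt m → Carrier) → (∀ p → i · p ≡ p → P (f p)) →
         (∀ p → i · p ≢ p → P (f p ∙ f (i · p))) → P (∑ f)
    go {zero} zero f _ pairs = pairs first λ ()
    go {suc zero} zero f _ pairs = resp (interchange _ _ _ _) (pairs first (λ ()) ⊹ pairs last λ ())
    go {suc (suc m)} zero f points pairs = resp (trans (∙-congʳ (interchange _ _ _ _)) (assoc _ _ _))
      ((pairs first (λ ()) ⊹ pairs last (λ ())) ⊹
        ∑-closed P _⊹_ (λ p → f (mid (mid p))) (λ p → points (mid (mid p)) ≡.refl))
    go {suc m} (suc i) f points pairs = (points first ≡.refl ⊹ points last ≡.refl) ⊹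
      go i (f ∘ mid) (λ p ip≡p → points (mid p) (cong mid ip≡p))
        (λ p ip≢p → pairs (mid p) (ip≢p ∘ mid-injective))

  ∑ₙ : ∀ {m} → (NF m → Carrier) → Carrier
  ∑ₙ {zero}  f = ∑ λ p → f (base p)
  ∑ₙ {suc m} f = ∑ λ p → ∑ₙ λ x → f (p ◂ x)

  ∑ₙ-cong : ∀ {m} {f g : NF m → Carrier} → (∀ x → f x ≈ g x) → ∑ₙ f ≈ ∑ₙ g
  ∑ₙ-cong {zero}  f≈g = ∑-cong λ p → f≈g (base p)
  ∑ₙ-cong {suc m} f≈g = ∑-cong λ p → ∑ₙ-cong λ x → f≈g (p ◂ x)

  ∑ₙ-closed : ∀ {m} (P : Carrier → Set) → (∀ {x y} → P x → P y → P (x ∙ y)) →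
              (f : NF m → Carrier) → (∀ x → P (f x)) → P (∑ₙ f)
  ∑ₙ-closed {zero}  P _⊹_ f Pf = ∑-closed P _⊹_ _ λ p → Pf (base p)
  ∑ₙ-closed {suc m} P _⊹_ f Pf = ∑-closed P _⊹_ _ λ p → ∑ₙ-closed P _⊹_ _ λ x → Pf (p ◂ x)

-- For ℓ p q and h p attached to the roots p + q and p, simple selects the values
-- at the simple roots.
simple : {C : Set} → ∀ {m} → (Pt m → Pt m → C) → (Pt m → C) → Gen m → C
simple {m = zero}  ℓ h zero    = h first
simple {m = suc m} ℓ h zero    = ℓ first (mid last)
simple {m = suc m} ℓ h (suc i) = simple (λ p q → ℓ (mid p) (mid q)) (h ∘ mid) i

-- The simple root i is p, or p + q.
data SimpleRoot {m} (i : Gen m) : Set₁ where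
  short-root : ∀ p → kind i ≡ short → i · p ≡ neg p →
               (∀ {C : Set} (ℓ : Pt m → Pt m → C) h → simple ℓ h i ≡ h p) → SimpleRoot i
  long-root  : ∀ p q → kind i ≡ long → Apart p q → i · p ≡ neg q → i · q ≡ neg p →
               (∀ {C : Set} (ℓ : Pt m → Pt m → C) h → simple ℓ h i ≡ ℓ p q) → SimpleRoot i

simpleRoot : ∀ {m} (i : Gen m) → SimpleRoot i
simpleRoot {zero}  zero    = short-root first ≡.refl ≡.refl (λ _ _ → ≡.refl)
simpleRoot {suc m} zero    = long-root first (mid last) ≡.refl (λ ()) ≡.refl ≡.refl (λ _ _ → ≡.refl)
simpleRoot {suc m} (suc i) with simpleRoot i
... | short-root p k e f       = short-root (mid p) k (cong mid e) (λ _ _ → f _ _)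
... | long-root p q k a e e′ f = long-root (mid p) (mid q) k (apart-mid a) (cong mid e) (cong mid e′) (λ _ _ → f _ _)

-- Reflection systems and the symmetrizer of the trivial character

record FunctionMap (F : CommutativeRing 0ℓ 0ℓ) (A : Ring 0ℓ 0ℓ) : Set where
  private
    module F = CommutativeRing F
    module A = Ring A
  field
    φ      : F.Carrier → A.Carrier
    φ-cong : ∀ {f g} → f F.≈ g → φ f A.≈ φ g
    φ-+    : ∀ f g → φ (f F.+ g) A.≈ φ f A.+ φ g
    φ-*    : ∀ f g → φ (f F.* g) A.≈ φ f A.* φ g
    φ-1    : φ F.1# A.≈ A.1#

module Hecke (A : Ring 0ℓ 0ℓ) (F : CommutativeRing 0ℓ 0ℓ) (Φ : FunctionMap F A) where

  open Ring A hiding (zero)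
  private module F = CommutativeRing F
  open FunctionMap Φ
  open RingProperties A using (-‿distribˡ-*; -‿distribʳ-*; -‿+-comm; -0#≈0#; x∙y⁻¹≈ε⇒x≈y; x≈y⇒x∙y⁻¹≈ε)
  open NoncommutativeSolver A using (solve; _:+_; _:-_; _:*_; :-_; :0; :1; _:=_)
  open SetoidReasoning setoid
  open PointSums +-commutativeMonoid
  open PointSums F.*-commutativeMonoid public using () renaming (∑ to ∏; ∑-cong to ∏-cong; ∑-· to ∏-·; ∑-∙ to ∏-*; ∑ε₁ to ∏ε₁; ∑roots to ∏roots)
  open BraidMonoid *-monoid

  φ-comm : ∀ f g → φ f * φ g ≈ φ g * φ f
  φ-comm f g = trans (sym (φ-* f g)) (trans (φ-cong (F.*-comm f g)) (φ-* g f))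

  record Tr (s : Carrier) (f g : F.Carrier) : Set where
    constructor tr
    field transport : s * φ f ≈ φ g * s
  open Tr public

  Tr-* : ∀ {s f g f′ g′} → Tr s f g → Tr s f′ g′ → Tr s (f F.* f′) (g F.* g′)
  Tr-* {s} {f} {g} {f′} {g′} (tr h) (tr k) = tr (begin
    s * φ (f F.* f′)     ≈⟨ *-congˡ (φ-* f f′) ⟩
    s * (φ f * φ f′)     ≈⟨ *-assoc _ _ _ ⟨
    s * φ f * φ f′       ≈⟨ *-congʳ h ⟩
    φ g * s * φ f′       ≈⟨ *-assoc _ _ _ ⟩
    φ g * (s * φ f′)     ≈⟨ *-congˡ k ⟩
    φ g * (φ g′ * s)     ≈⟨ *-assoc _ _ _ ⟨
    φ g * φ g′ * s       ≈⟨ *-congʳ (φ-* g g′) ⟨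
    φ (g F.* g′) * s     ∎)

  Tr-1 : ∀ {s} → Tr s F.1# F.1#
  Tr-1 = tr (trans (*-congˡ φ-1) (trans (*-identityʳ _) (trans (sym (*-identityˡ _)) (*-congʳ (sym φ-1)))))

  Tr-resp : ∀ {s f g f′ g′} → f F.≈ f′ → g F.≈ g′ → Tr s f g → Tr s f′ g′
  Tr-resp f≈f′ g≈g′ (tr h) = tr (trans (*-congˡ (φ-cong (F.sym f≈f′))) (trans h (*-congʳ (φ-cong g≈g′))))

  Tr-back : ∀ {s f g} → s * s ≈ 1# → Tr s f g → φ f * s ≈ s * φ g
  Tr-back {s} {f} {g} ss (tr h) = begin
    φ f * s              ≈⟨ *-identityˡ _ ⟨
    1# * (φ f * s)       ≈⟨ *-congʳ ss ⟨
    s * s * (φ f * s)    ≈⟨ solve (s ∷ φ f ∷ []) (λ s f → s :* s :* (f :* s) := s :* (s :* f) :* s) ≡.refl ⟩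
    s * (s * φ f) * s    ≈⟨ *-congʳ (*-congˡ h) ⟩
    s * (φ g * s) * s    ≈⟨ solve (s ∷ φ g ∷ []) (λ s g → s :* (g :* s) :* s := s :* g :* (s :* s)) ≡.refl ⟩
    s * φ g * (s * s)    ≈⟨ *-congˡ ss ⟩
    s * φ g * 1#         ≈⟨ *-identityʳ _ ⟩
    s * φ g              ∎

  Tr-∏ : ∀ {m s} {f g : Pt m → F.Carrier} → (∀ p → Tr s (f p) (g p)) → Tr s (∏ f) (∏ g)
  Tr-∏ {zero}  h = Tr-* (h first) (h last)
  Tr-∏ {suc m} h = Tr-* (Tr-* (h first) (h last)) (Tr-∏ (h ∘ mid))

  -- What the argument needs of one side of the algebra. The short roots are the points p and the
  -- long roots the sums p + q of points on different axes; `h` and `ℓ` are the values of k there,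
  -- and `z p` is Z^p. A value `ℓ p q` on a common axis belongs to no root, whence the hypotheses
  -- `Apart`. These requirements pass to the subgroup fixing ε₁ and to twisted reflections.
  record System (m : ℕ) : Set where
    field
      s            : Gen m → Carrier
      s-involutive : ∀ i → s i * s i ≈ 1#
      s-braided    : Braided s
      z            : Pt m → F.Carrier
      z-transport  : ∀ i p → Tr (s i) (z p) (z (i · p))
      z-separates  : ∀ {p q} → p ≢ q → ∃[ u ] u F.* (z p F.- z q) F.≈ F.1#
      ℓ            : Pt m → Pt m → F.Carrier
      h            : Pt m → F.Carrier
      ℓ-transport  : ∀ i p q → Tr (s i) (ℓ p q) (ℓ (i · p) (i · q))
      h-transport  : ∀ i p → Tr (s i) (h p) (h (i · p))
      ℓ-sym        : ∀ p q → ℓ p q F.≈ ℓ q p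
      θℓ θh        : F.Carrier
      θℓ-central   : ∀ x → φ θℓ * x ≈ x * φ θℓ
      θh-central   : ∀ x → φ θh * x ≈ x * φ θh
      ℓ-quadratic  : ∀ {p q} → Apart p q → ℓ p q F.+ ℓ (neg p) (neg q) F.≈ F.1# F.+ θℓ
      h-quadratic  : ∀ p → h p F.+ h (neg p) F.≈ F.1# F.+ θh
      A₂-identity  : ∀ {p q r} → Apart p q → Apart q r → Apart p r →
        ℓ p (neg q) F.* ℓ q (neg r) F.+ ℓ (neg p) q F.* ℓ p (neg r) F.≈
        ℓ q (neg r) F.* ℓ p (neg r) F.+ θℓ
      B₂-identity  : ∀ {p q} → Apart p q →
        ℓ p (neg q) F.* h q F.+ ℓ (neg p) q F.* h p F.+ h (neg q) F.* ℓ p q F.≈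
        ℓ p q F.* h p F.+ (θℓ F.+ θh)
  open System

  restrict : ∀ {m} → System (suc m) → System m
  restrict S = record
    { s            = s S ∘ suc
    ; s-involutive = s-involutive S ∘ suc
    ; s-braided    = tail (s-braided S)
    ; z            = z S ∘ mid
    ; z-transport  = λ i p → z-transport S (suc i) (mid p)
    ; z-separates  = λ p≢q → z-separates S (p≢q ∘ mid-injective)
    ; ℓ            = λ p q → ℓ S (mid p) (mid q)
    ; h            = h S ∘ mid
    ; ℓ-transport  = λ i p q → ℓ-transport S (suc i) (mid p) (mid q)
    ; h-transport  = λ i p → h-transport S (suc i) (mid p)
    ; ℓ-sym        = λ p q → ℓ-sym S (mid p) (mid q)
    ; θℓ           = θℓ S
    ; θh           = θh S
    ; θℓ-central   = θℓ-central S
    ; θh-central   = θh-central S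
    ; ℓ-quadratic  = ℓ-quadratic S ∘ apart-mid
    ; h-quadratic  = h-quadratic S ∘ mid
    ; A₂-identity  = λ pq qr pr → A₂-identity S (apart-mid pq) (apart-mid qr) (apart-mid pr)
    ; B₂-identity  = B₂-identity S ∘ apart-mid
    }

  k : ∀ {m} → System m → Gen m → F.Carrier
  k S = simple (ℓ S) (h S)

  E τ : ∀ {m} → System m → Gen m → Carrier
  E S i = (1# + s S i) * φ (k S i)
  τ S i = E S i - 1#

  -- Braid relations

  zero-fixes-k : ∀ {m} (S : System (suc (suc m))) i → Tr (s S zero) (k S (suc (suc i))) (k S (suc (suc i)))
  zero-fixes-k S = go (λ p → mid (mid p)) (restrict (restrict S)) (λ p → h-transport S zero (mid (mid p)))
    (λ p q → ℓ-transport S zero (mid (mid p)) (mid (mid q)))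
    where
    go : ∀ {m M} {x : Carrier} (f : Pt m → Pt M) (S′ : System m) → (∀ p → Tr x (h S′ p) (h S′ p)) →
         (∀ p q → Tr x (ℓ S′ p q) (ℓ S′ p q)) → ∀ i → Tr x (k S′ i) (k S′ i)
    go {zero}  f S′ h-tr ℓ-tr zero    = h-tr first
    go {suc m} f S′ h-tr ℓ-tr zero    = ℓ-tr first (mid last)
    go {suc m} f S′ h-tr ℓ-tr (suc i) = go (f ∘ mid) (restrict S′) (h-tr ∘ mid) (λ p q → ℓ-tr (mid p) (mid q)) i

  commuting-E : ∀ {s s′ f f′} → s * s′ ≈ s′ * s → Tr s f′ f′ → Tr s′ f f → s * s ≈ 1# → s′ * s′ ≈ 1# →
    let E = (1# + s) * φ f ; E′ = (1# + s′) * φ f′ in E * E′ ≈ E′ * E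
  commuting-E {s} {s′} {f} {f′} ss′ t t′ ss s′s′ = begin
    (1# + s) * φ f * ((1# + s′) * φ f′)
      ≈⟨ solve (s ∷ s′ ∷ φ f ∷ φ f′ ∷ []) (λ s s′ f f′ → (:1 :+ s) :* f :* ((:1 :+ s′) :* f′) :=
           (:1 :+ s) :* (f :+ f :* s′) :* f′) ≡.refl ⟩
    (1# + s) * (φ f + φ f * s′) * φ f′
      ≈⟨ *-congʳ (*-congˡ (+-congˡ (Tr-back s′s′ t′))) ⟩
    (1# + s) * (φ f + s′ * φ f) * φ f′
      ≈⟨ solve (s ∷ s′ ∷ φ f ∷ φ f′ ∷ []) (λ s s′ f f′ → (:1 :+ s) :* (f :+ s′ :* f) :* f′ :=
           (:1 :+ s :+ (s′ :+ s :* s′)) :* (f :* f′)) ≡.refl ⟩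
    (1# + s + (s′ + s * s′)) * (φ f * φ f′)
      ≈⟨ *-cong (+-congˡ (+-congˡ ss′)) (φ-comm f f′) ⟩
    (1# + s + (s′ + s′ * s)) * (φ f′ * φ f)
      ≈⟨ solve (s ∷ s′ ∷ φ f ∷ φ f′ ∷ []) (λ s s′ f f′ → (:1 :+ s :+ (s′ :+ s′ :* s)) :* (f′ :* f) :=
           (:1 :+ s′) :* (f′ :+ s :* f′) :* f) ≡.refl ⟩
    (1# + s′) * (φ f′ + s * φ f′) * φ f
      ≈⟨ *-congʳ (*-congˡ (+-congˡ (Tr-back ss t))) ⟨
    (1# + s′) * (φ f′ + φ f′ * s) * φ f
      ≈⟨ solve (s ∷ s′ ∷ φ f ∷ φ f′ ∷ []) (λ s s′ f f′ → (:1 :+ s′) :* (f′ :+ f′ :* s) :* f :=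
           (:1 :+ s′) :* f′ :* ((:1 :+ s) :* f)) ≡.refl ⟩
    (1# + s′) * φ f′ * ((1# + s) * φ f) ∎

  subtract-1-commute : ∀ {x y} → x * y ≈ y * x → (x - 1#) * (y - 1#) ≈ (y - 1#) * (x - 1#)
  subtract-1-commute {x} {y} h = begin
    (x - 1#) * (y - 1#)    ≈⟨ solve (x ∷ y ∷ []) (λ x y → (x :- :1) :* (y :- :1) := x :* y :- x :- y :+ :1) ≡.refl ⟩
    x * y - x - y + 1#     ≈⟨ +-congʳ (+-congʳ (+-congʳ h)) ⟩
    y * x - x - y + 1#     ≈⟨ solve (x ∷ y ∷ []) (λ x y → y :* x :- x :- y :+ :1 := (y :- :1) :* (x :- :1)) ≡.refl ⟩
    (y - 1#) * (x - 1#)    ∎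

  braided-cons : ∀ {m} {g : Gen (suc m) → Carrier} →
    (∀ j → 2 ℕ.≤ toℕ j → g zero * g j ≈ g j * g zero) →
    (∀ j → toℕ j ≡ 1 → 1 ℕ.< suc m → g zero * (g j * g zero) ≈ g j * (g zero * g j)) →
    (∀ j → toℕ j ≡ 1 → 1 ≡ suc m → g zero * (g j * (g zero * g j)) ≈ g j * (g zero * (g j * g zero))) →
    Braided (g ∘ suc) → Braided g
  braided-cons {m} {g} far₀ triple₀ quadruple₀ b = record { commute = c ; triple = t ; quadruple = q }
    where
    c : ∀ i j → suc (suc (toℕ i)) ℕ.≤ toℕ j → g i * g j ≈ g j * g i
    c zero    j       h       = far₀ j h
    c (suc i) (suc j) (s≤s h) = commute b i j h
    t : ∀ i j → toℕ j ≡ suc (toℕ i) → toℕ j ℕ.< suc m → g i * (g j * g i) ≈ g j * (g i * g j)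
    t zero    j       e h       = triple₀ j e (subst (ℕ._< suc m) e h)
    t (suc i) (suc j) e (s≤s h) = triple b i j (ℕ.suc-injective e) h
    q : ∀ i j → toℕ j ≡ suc (toℕ i) → toℕ j ≡ suc m → g i * (g j * (g i * g j)) ≈ g j * (g i * (g j * g i))
    q zero    j       e h = quadruple₀ j e (≡.trans (≡.sym e) h)
    q (suc i) (suc j) e h = quadruple b i j (ℕ.suc-injective e) (ℕ.suc-injective h)

  open RankTwo A
  open SemiringSolver F.commutativeSemiring using (con) renaming (_:+_ to _⊞_; _:*_ to _⊠_; _:=_ to _⊜_; solve to solveF)

  φ-product₃ : ∀ f g h → φ (f F.* g F.* h) ≈ φ f * φ g * φ h
  φ-product₃ f g h = trans (φ-* _ _) (*-congʳ (φ-* f g))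

  φ-quadratic : ∀ {f g θ} → f F.+ g F.≈ F.1# F.+ θ → φ f + φ g ≈ 1# + φ θ
  φ-quadratic {f} {g} {θ} e = trans (sym (φ-+ f g)) (trans (φ-cong e) (trans (φ-+ _ _) (+-congʳ φ-1)))

  φ-A₂ : ∀ {a b g ā θ} → a F.* b F.+ ā F.* g F.≈ b F.* g F.+ θ →
         φ a * φ b * φ a + φ ā * φ g * φ a ≈ φ b * φ g * φ a + φ θ * φ a
  φ-A₂ {a} {b} {g} {ā} {θ} e = begin
    φ a * φ b * φ a + φ ā * φ g * φ a          ≈⟨ +-cong (φ-product₃ a b a) (φ-product₃ ā g a) ⟨
    φ (a F.* b F.* a) + φ (ā F.* g F.* a)      ≈⟨ φ-+ _ _ ⟨
    φ (a F.* b F.* a F.+ ā F.* g F.* a)        ≈⟨ φ-cong (F.trans (F.sym (F.distribʳ a _ _)) (F.trans (F.*-congʳ e) (F.distribʳ a _ _))) ⟩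
    φ (b F.* g F.* a F.+ θ F.* a)              ≈⟨ φ-+ _ _ ⟩
    φ (b F.* g F.* a) + φ (θ F.* a)            ≈⟨ +-cong (φ-product₃ b g a) (φ-* θ a) ⟩
    φ b * φ g * φ a + φ θ * φ a                ∎

  φ-B₂ : ∀ {a b a′ b′ ā b̄ θ} → a F.* b F.+ ā F.* b′ F.+ b̄ F.* a′ F.≈ a′ F.* b′ F.+ θ →
         φ a * φ b * φ a + φ ā * φ b′ * φ a + φ a * φ b̄ * φ a′ ≈ φ a′ * φ b′ * φ a + φ θ * φ a
  φ-B₂ {a} {b} {a′} {b′} {ā} {b̄} {θ} e = begin
    φ a * φ b * φ a + φ ā * φ b′ * φ a + φ a * φ b̄ * φ a′
      ≈⟨ +-cong (+-cong (φ-product₃ a b a) (φ-product₃ ā b′ a)) (φ-product₃ a b̄ a′) ⟨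
    φ (a F.* b F.* a) + φ (ā F.* b′ F.* a) + φ (a F.* b̄ F.* a′)
      ≈⟨ trans (φ-+ _ _) (+-congʳ (φ-+ _ _)) ⟨
    φ (a F.* b F.* a F.+ ā F.* b′ F.* a F.+ a F.* b̄ F.* a′)
      ≈⟨ φ-cong (solveF 6 (λ a b a′ b′ ā b̄ → a ⊠ b ⊠ a ⊞ ā ⊠ b′ ⊠ a ⊞ a ⊠ b̄ ⊠ a′ ⊜
           (a ⊠ b ⊞ ā ⊠ b′ ⊞ b̄ ⊠ a′) ⊠ a) F.refl a b a′ b′ ā b̄) ⟩
    φ ((a F.* b F.+ ā F.* b′ F.+ b̄ F.* a′) F.* a)
      ≈⟨ φ-cong (F.trans (F.*-congʳ e) (F.distribʳ a _ _)) ⟩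
    φ (a′ F.* b′ F.* a F.+ θ F.* a)
      ≈⟨ trans (φ-+ _ _) (+-cong (φ-product₃ a′ b′ a) (φ-* θ a)) ⟩
    φ a′ * φ b′ * φ a + φ θ * φ a ∎

  E-square : ∀ {m} (S : System m) {i f f̄ θ} → Tr (s S i) f f̄ → f F.+ f̄ F.≈ F.1# F.+ θ →
             (∀ x → φ θ * x ≈ x * φ θ) →
             let E = (1# + s S i) * φ f in E * E ≈ E + φ θ * E
  E-square S {i} t e θ-central = square (s-involutive S i) (Tr-back (s-involutive S i) t) (φ-quadratic e) θ-central

  braid-sums₃ : ∀ {s s′ κ} → s * (s′ * s) ≈ s′ * (s * s′) →
    (1# + s) * (1# + s′ + s′ * s) * κ ≈ (1# + s′) * (1# + s + s * s′) * κ
  braid-sums₃ {s} {s′} {κ} h = *-congʳ (begin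
    (1# + s) * (1# + s′ + s′ * s)
      ≈⟨ solve (s ∷ s′ ∷ []) (λ s s′ → (:1 :+ s) :* (:1 :+ s′ :+ s′ :* s) :=
           :1 :+ s :+ s′ :+ s :* s′ :+ s′ :* s :+ s :* (s′ :* s)) ≡.refl ⟩
    1# + s + s′ + s * s′ + s′ * s + s * (s′ * s)
      ≈⟨ +-congˡ h ⟩
    1# + s + s′ + s * s′ + s′ * s + s′ * (s * s′)
      ≈⟨ solve (s ∷ s′ ∷ []) (λ s s′ → :1 :+ s :+ s′ :+ s :* s′ :+ s′ :* s :+ s′ :* (s :* s′) :=
           (:1 :+ s′) :* (:1 :+ s :+ s :* s′)) ≡.refl ⟩
    (1# + s′) * (1# + s + s * s′) ∎)

  braid-sums₄ : ∀ {s s′ κ} → s * (s′ * (s * s′)) ≈ s′ * (s * (s′ * s)) →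
    (1# + s) * (1# + s′ + s′ * s + s′ * s * s′) * κ ≈ (1# + s′) * (1# + s + s * s′ + s * s′ * s) * κ
  braid-sums₄ {s} {s′} {κ} h = *-congʳ (begin
    (1# + s) * (1# + s′ + s′ * s + s′ * s * s′)
      ≈⟨ solve (s ∷ s′ ∷ []) (λ s s′ → (:1 :+ s) :* (:1 :+ s′ :+ s′ :* s :+ s′ :* s :* s′) :=
           :1 :+ s :+ s′ :+ s :* s′ :+ s′ :* s :+ s :* s′ :* s :+ s′ :* s :* s′ :+ s :* (s′ :* (s :* s′))) ≡.refl ⟩
    1# + s + s′ + s * s′ + s′ * s + s * s′ * s + s′ * s * s′ + s * (s′ * (s * s′))
      ≈⟨ +-congˡ h ⟩
    1# + s + s′ + s * s′ + s′ * s + s * s′ * s + s′ * s * s′ + s′ * (s * (s′ * s))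
      ≈⟨ solve (s ∷ s′ ∷ []) (λ s s′ →
           :1 :+ s :+ s′ :+ s :* s′ :+ s′ :* s :+ s :* s′ :* s :+ s′ :* s :* s′ :+ s′ :* (s :* (s′ :* s)) :=
           (:1 :+ s′) :* (:1 :+ s :+ s :* s′ :+ s :* s′ :* s)) ≡.refl ⟩
    (1# + s′) * (1# + s + s * s′ + s * s′ * s) ∎)

  φ-product₄ : ∀ f g h l → φ (f F.* g F.* h F.* l) ≈ φ f * φ g * φ h * φ l
  φ-product₄ f g h l = trans (φ-* _ _) (*-congʳ (φ-product₃ f g h))

  τ-triple : ∀ {m} (S : System (suc (suc m))) →
    τ S zero * (τ S (suc zero) * τ S zero) ≈ τ S (suc zero) * (τ S zero * τ S (suc zero))
  τ-triple S = triple-braid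
    (E-square S a→ā (F.trans (F.+-congˡ (ℓ-sym S _ _)) (ℓ-quadratic S λ ())) (θℓ-central S))
    (E-square S b→b̄ (F.trans (F.+-congˡ (ℓ-sym S _ _)) (ℓ-quadratic S λ ())) (θℓ-central S))
    (triple-product (s-involutive S zero) (back zero a→ā) (back zero g→b) (back zero b→g) (back (suc zero) a→g)
      (θℓ-central S) (φ-A₂ (F.trans (F.+-congˡ (F.*-congʳ (ℓ-sym S _ _))) (A₂-identity S (λ ()) (λ ()) λ ())))
      (sym (φ-product₃ g b a)) (trans (sym (φ-product₃ b g a))
        (φ-cong (solveF 3 (λ a b g → b ⊠ g ⊠ a ⊜ g ⊠ b ⊠ a) F.refl a b g))))
    (triple-product (s-involutive S (suc zero)) (back (suc zero) b→b̄) (back (suc zero) g→a) (back (suc zero) a→g)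
      (back zero b→g) (θℓ-central S)
      (φ-A₂ (F.trans
        (F.+-cong (F.*-cong (ℓ-sym S _ _) (ℓ-sym S _ _)) (F.*-congˡ (ℓ-sym S _ _)))
        -- The simple roots in exchanged order: for p, q, r = -ε₃, -ε₂, -ε₁ the differences p - q
        -- and q - r are ε₂ - ε₃ and ε₁ - ε₂.
        (F.trans (A₂-identity S {mid (mid last)} {mid last} {last} (λ ()) (λ ()) λ ())
          (F.+-congʳ (F.*-cong (ℓ-sym S _ _) (ℓ-sym S _ _))))))
      (trans (sym (φ-product₃ g a b)) (φ-cong (solveF 3 (λ a b g → g ⊠ a ⊠ b ⊜ g ⊠ b ⊠ a) F.refl a b g)))
      (trans (sym (φ-product₃ a g b)) (φ-cong (solveF 3 (λ a b g → a ⊠ g ⊠ b ⊜ g ⊠ b ⊠ a) F.refl a b g))))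
    (braid-sums₃ (triple (s-braided S) zero (suc zero) ≡.refl (s≤s (s≤s z≤n))))
    where
    a = ℓ S first (mid last)
    b = ℓ S (mid first) (mid (mid last))
    g = ℓ S first (mid (mid last))
    back : ∀ i {f f′} → Tr (s S i) f f′ → φ f * s S i ≈ s S i * φ f′
    back i = Tr-back (s-involutive S i)
    a→ā = ℓ-transport S zero first (mid last)
    b→g = ℓ-transport S zero (mid first) (mid (mid last))
    g→b = ℓ-transport S zero first (mid (mid last))
    a→g = ℓ-transport S (suc zero) first (mid last)
    g→a = ℓ-transport S (suc zero) first (mid (mid last))
    b→b̄ = ℓ-transport S (suc zero) (mid first) (mid (mid last))

  τ-quadruple : (S : System 1) → τ S zero * (τ S (suc zero) * (τ S zero * τ S (suc zero))) ≈
                τ S (suc zero) * (τ S zero * (τ S (suc zero) * τ S zero))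
  τ-quadruple S = quadruple-braid (θℓ-central S) (θh-central S)
    (E-square S a→ā (ℓ-quadratic S λ ()) (θℓ-central S))
    (E-square S b→b̄ (h-quadratic S (mid first)) (θh-central S))
    (trans (quadruple-product (s-involutive S zero) (s-involutive S (suc zero)) (back zero a→ā) (back zero b→b′)
      (back zero a′→a′) (back (suc zero) a→a′) (back (suc zero) a′→a) (back (suc zero) b′→b′) (back (suc zero) b̄→b)
      (Θ-central (θℓ-central S) (θh-central S)) (φ-B₂ (B₂-identity S λ ()))
      (sym (φ-product₄ a′ b′ a b)) (trans (sym (φ-product₄ a b′ a′ b))
        (φ-cong (solveF 4 (λ a b a′ b′ → a ⊠ b′ ⊠ a′ ⊠ b ⊜ a′ ⊠ b′ ⊠ a ⊠ b) F.refl a b a′ b′))))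
      (+-congʳ (*-congʳ (φ-+ _ _))))
    (trans (quadruple-product (s-involutive S (suc zero)) (s-involutive S zero) (back (suc zero) b→b̄) (back (suc zero) a→a′)
      (back (suc zero) b′→b′) (back zero b→b′) (back zero b′→b) (back zero a′→a′) (back zero ā→a)
      (Θ-central (θh-central S) (θℓ-central S))
      (φ-B₂ (F.trans (solveF 6 (λ a b a′ b′ ā b̄ → b ⊠ a ⊞ b̄ ⊠ a′ ⊞ ā ⊠ b′ ⊜ a ⊠ b ⊞ ā ⊠ b′ ⊞ b̄ ⊠ a′)
          F.refl a b a′ b′ ā b̄)
        (F.trans (B₂-identity S λ ()) (F.+-cong (F.*-comm _ _) (F.+-comm _ _)))))
      (trans (sym (φ-product₄ b′ a′ b a))
        (φ-cong (solveF 4 (λ a b a′ b′ → b′ ⊠ a′ ⊠ b ⊠ a ⊜ a′ ⊠ b′ ⊠ a ⊠ b) F.refl a b a′ b′)))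
      (trans (sym (φ-product₄ b a′ b′ a))
        (φ-cong (solveF 4 (λ a b a′ b′ → b ⊠ a′ ⊠ b′ ⊠ a ⊜ a′ ⊠ b′ ⊠ a ⊠ b) F.refl a b a′ b′))))
      (+-congʳ (*-congʳ (φ-+ _ _))))
    (braid-sums₄ (quadruple (s-braided S) zero (suc zero) ≡.refl ≡.refl))
    where
    a = ℓ S first (mid last)
    b = h S (mid first)
    a′ = ℓ S first (mid first)
    b′ = h S first
    ā = ℓ S last (mid first)
    b̄ = h S (mid last)
    back : ∀ i {f f′} → Tr (s S i) f f′ → φ f * s S i ≈ s S i * φ f′
    back i = Tr-back (s-involutive S i)
    Θ-central : ∀ {θ θ′} → (∀ x → φ θ * x ≈ x * φ θ) → (∀ x → φ θ′ * x ≈ x * φ θ′) →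
                ∀ x → φ (θ F.+ θ′) * x ≈ x * φ (θ F.+ θ′)
    Θ-central {θ} {θ′} c c′ x = begin
      φ (θ F.+ θ′) * x         ≈⟨ *-congʳ (φ-+ θ θ′) ⟩
      (φ θ + φ θ′) * x         ≈⟨ distribʳ x _ _ ⟩
      φ θ * x + φ θ′ * x       ≈⟨ +-cong (c x) (c′ x) ⟩
      x * φ θ + x * φ θ′       ≈⟨ distribˡ x _ _ ⟨
      x * (φ θ + φ θ′)         ≈⟨ *-congˡ (φ-+ θ θ′) ⟨
      x * φ (θ F.+ θ′)         ∎
    a→ā : Tr (s S zero) a ā
    a→ā = Tr-resp F.refl (ℓ-sym S _ _) (ℓ-transport S zero first (mid last))
    ā→a : Tr (s S zero) ā a
    ā→a = Tr-resp F.refl (ℓ-sym S _ _) (ℓ-transport S zero last (mid first))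
    a′→a′ : Tr (s S zero) a′ a′
    a′→a′ = Tr-resp F.refl (ℓ-sym S _ _) (ℓ-transport S zero first (mid first))
    b→b′ = h-transport S zero (mid first)
    b′→b = h-transport S zero first
    a→a′ = ℓ-transport S (suc zero) first (mid last)
    a′→a = ℓ-transport S (suc zero) first (mid first)
    b→b̄  = h-transport S (suc zero) (mid first)
    b̄→b  = h-transport S (suc zero) (mid last)
    b′→b′ = h-transport S (suc zero) first

  τ-braided : ∀ {m} (S : System m) → Braided (τ S)
  τ-braided {zero} S = record
    { commute = λ { zero zero () } ; triple = λ { zero zero () } ; quadruple = λ { zero zero () } }
  τ-braided {suc m} S = braided-cons (far₀ S) (triple₀ S) (quadruple₀ S) (τ-braided (restrict S))
    where
    far₀ : ∀ {m} (S : System (suc m)) j → 2 ℕ.≤ toℕ j → τ S zero * τ S j ≈ τ S j * τ S zero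
    far₀ S (suc zero) (s≤s ())
    far₀ {suc m} S (suc (suc j)) _ = subtract-1-commute (commuting-E
      (commute (s-braided S) zero (suc (suc j)) (s≤s (s≤s z≤n)))
      (zero-fixes-k S j) (ℓ-transport S (suc (suc j)) first (mid last)) (s-involutive S zero) (s-involutive S (suc (suc j))))
    triple₀ : ∀ {m} (S : System (suc m)) j → toℕ j ≡ 1 → 1 ℕ.< suc m →
              τ S zero * (τ S j * τ S zero) ≈ τ S j * (τ S zero * τ S j)
    triple₀ {zero}  S j          _ (s≤s ())
    triple₀ {suc m} S (suc zero) _ _ = τ-triple S
    quadruple₀ : ∀ {m} (S : System (suc m)) j → toℕ j ≡ 1 → 1 ≡ suc m →
                 τ S zero * (τ S j * (τ S zero * τ S j)) ≈ τ S j * (τ S zero * (τ S j * τ S zero))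
    quadruple₀ {zero} S (suc zero) _ _ = τ-quadruple S

  ∑-*ˡ : ∀ {m} y (f : Pt m → Carrier) → ∑ (λ p → y * f p) ≈ y * ∑ f
  ∑-*ˡ {zero}  y f = sym (distribˡ y _ _)
  ∑-*ˡ {suc m} y f = trans (+-cong (sym (distribˡ y _ _)) (∑-*ˡ y (f ∘ mid))) (sym (distribˡ y _ _))

  ∑-*ʳ : ∀ {m} y (f : Pt m → Carrier) → ∑ (λ p → f p * y) ≈ ∑ f * y
  ∑-*ʳ {zero}  y f = sym (distribʳ y _ _)
  ∑-*ʳ {suc m} y f = trans (+-cong (sym (distribʳ y _ _)) (∑-*ʳ y (f ∘ mid))) (sym (distribʳ y _ _))

  ∑ₙ-*ˡ : ∀ {m} y (f : NF m → Carrier) → ∑ₙ (λ x → y * f x) ≈ y * ∑ₙ f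
  ∑ₙ-*ˡ {zero}  y f = ∑-*ˡ y (λ p → f (base p))
  ∑ₙ-*ˡ {suc m} y f = trans
    (∑-cong {suc m} {λ p → ∑ₙ λ x → y * f (p ◂ x)} {λ p → y * ∑ₙ λ x → f (p ◂ x)} λ p → ∑ₙ-*ˡ y (λ x → f (p ◂ x)))
    (∑-*ˡ {suc m} y λ p → ∑ₙ λ x → f (p ◂ x))

  ∑ₙ-*ʳ : ∀ {m} y (f : NF m → Carrier) → ∑ₙ (λ x → f x * y) ≈ ∑ₙ f * y
  ∑ₙ-*ʳ {zero}  y f = ∑-*ʳ y (λ p → f (base p))
  ∑ₙ-*ʳ {suc m} y f = trans
    (∑-cong {suc m} {λ p → ∑ₙ λ x → f (p ◂ x) * y} {λ p → (∑ₙ λ x → f (p ◂ x)) * y} λ p → ∑ₙ-*ʳ y (λ x → f (p ◂ x)))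
    (∑-*ʳ {suc m} y λ p → ∑ₙ λ x → f (p ◂ x))

  ∑words : ∀ {m} → (Gen m → Carrier) → Carrier
  ∑words g = ∑ₙ λ x → ⟦ g ⟧ (word x)

  ∑words-suc : ∀ {m} (g : Gen (suc m) → Carrier) → ∑words g ≈ ∑ λ p → ⟦ g ⟧ (coset p) * ∑words (g ∘ suc)
  ∑words-suc {m} g = ∑-cong {suc m} {λ p → ∑ₙ λ x → ⟦ g ⟧ (word (p ◂ x))} λ p → trans
    (∑ₙ-cong {m} λ x → trans (⟦⟧-++ g (coset p) (↑ (word x))) (*-congˡ (reflexive (⟦⟧-↑ g (word x)))))
    (∑ₙ-*ˡ {m} (⟦ g ⟧ (coset p)) λ x → ⟦ g ∘ suc ⟧ (word x))

  -- Left invariance of the sum of the τ_w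

  Multiple : Carrier → Carrier → Set
  Multiple e x = ∃[ y ] x ≈ e * y

  coset-length-up : ∀ {m} (i : Gen m) p → coset (i · p) ≡ i ∷ coset p → i · p ≢ p
  coset-length-up i p e ip≡p =
    ℕ.1+n≢n (≡.trans (≡.sym (cong length e)) (cong (length ∘ coset) ip≡p))

  coset-length-down : ∀ {m} (i : Gen m) p → coset p ≡ i ∷ coset (i · p) → i · p ≢ p
  coset-length-down i p e ip≡p =
    ℕ.1+n≢n (≡.trans (≡.sym (cong length e)) (≡.sym (cong (length ∘ coset) ip≡p)))

  E≈1+τ : ∀ {m} (S : System m) i x → x + τ S i * x ≈ E S i * x
  E≈1+τ S i x = solve (E S i ∷ x ∷ []) (λ e x → x :+ (e :- :1) :* x := e :* x) ≡.refl

  -- The summands of two cosets exchanged by i combine to (1 + τᵢ) u = Eᵢ u. A coset fixed by i lets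
  -- the generator pass to the right as some `suc j`, and there the sum over the subgroup is, by
  -- induction, already a multiple of 1 + τⱼ.
  E-multiple : ∀ {m} (S : System m) i → Multiple (E S i) (∑words (τ S))
  E-multiple {zero} S zero = 1# , (begin
    1# + τ S zero * 1#   ≈⟨ E≈1+τ S zero 1# ⟩
    E S zero * 1#        ∎)
  E-multiple {suc m} S i = proj₁ multiple , trans (∑words-suc (τ S)) (proj₂ multiple)
    where
    u : Pt (suc m) → Carrier
    u p = ⟦ τ S ⟧ (coset p) * ∑words (τ (restrict S))
    _⊹_ : ∀ {x y} → Multiple (E S i) x → Multiple (E S i) y → Multiple (E S i) (x + y)
    (x , hx) ⊹ (y , hy) = x + y , trans (+-cong hx hy) (sym (distribˡ _ _ _))
    orbit : ∀ p → Move i p → (i · p ≡ p × Multiple (E S i) (u p)) ⊎ (i · p ≢ p × Multiple (E S i) (u p + u (i · p)))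
    orbit p (up e) = inj₂ (coset-length-up i p e , u p , (begin
      u p + u (i · p)            ≡⟨ cong (λ v → u p + ⟦ τ S ⟧ v * ∑words (τ (restrict S))) e ⟩
      u p + τ S i * _ * _        ≈⟨ +-congˡ (*-assoc _ _ _) ⟩
      u p + τ S i * u p          ≈⟨ E≈1+τ S i (u p) ⟩
      E S i * u p                ∎))
    orbit p (down e) = inj₂ (coset-length-down i p e , u (i · p) , (begin
      u p + u (i · p)                    ≡⟨ cong (λ v → ⟦ τ S ⟧ v * ∑words (τ (restrict S)) + u (i · p)) e ⟩
      τ S i * _ * _ + u (i · p)          ≈⟨ +-congʳ (*-assoc _ _ _) ⟩
      τ S i * u (i · p) + u (i · p)      ≈⟨ +-comm _ _ ⟩
      u (i · p) + τ S i * u (i · p)      ≈⟨ E≈1+τ S i (u (i · p)) ⟩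
      E S i * u (i · p)                  ∎))
    orbit p (stay j ip≡p h) = inj₁ (ip≡p , d * y , (begin
      d * ∑words (τ (restrict S))        ≈⟨ *-congˡ (proj₂ (E-multiple (restrict S) j)) ⟩
      d * (E S (suc j) * y)              ≈⟨ *-congˡ (E≈1+τ S (suc j) y) ⟨
      d * (y + τ S (suc j) * y)          ≈⟨ solve (d ∷ y ∷ τ S (suc j) ∷ []) (λ d y t →
                                              d :* (y :+ t :* y) := d :* y :+ d :* (t :* :1) :* y) ≡.refl ⟩
      d * y + d * (τ S (suc j) * 1#) * y ≈⟨ +-congˡ (*-congʳ (trans (sym (⟦⟧-++ (τ S) (coset p) (suc j ∷ [])))
                                              (sym (⟦⟧-⇝ (τ-braided S) h)))) ⟩
      d * y + τ S i * d * y              ≈⟨ +-congˡ (*-assoc _ _ _) ⟩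
      d * y + τ S i * (d * y)            ≈⟨ E≈1+τ S i (d * y) ⟩
      E S i * (d * y)                    ∎))
      where
      d = ⟦ τ S ⟧ (coset p)
      y = proj₁ (E-multiple (restrict S) j)
    multiple : Multiple (E S i) (∑ u)
    multiple = ∑-orbits i (Multiple (E S i)) (λ x≈y (z , h) → z , trans (sym x≈y) h) _⊹_ u (λ p → orbit p (move i p))

  s-invariant : ∀ {m} (S : System m) i → s S i * ∑words (τ S) ≈ ∑words (τ S)
  s-invariant S i = begin
    s S i * ∑words (τ S)                      ≈⟨ *-congˡ (proj₂ (E-multiple S i)) ⟩
    s S i * ((1# + s S i) * φ (k S i) * y)    ≈⟨ solve (s S i ∷ φ (k S i) ∷ y ∷ []) (λ s k y →
                                                   s :* ((:1 :+ s) :* k :* y) := (s :+ s :* s) :* k :* y) ≡.refl ⟩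
    (s S i + s S i * s S i) * φ (k S i) * y   ≈⟨ *-congʳ (*-congʳ (+-congˡ (s-involutive S i))) ⟩
    (s S i + 1#) * φ (k S i) * y              ≈⟨ *-congʳ (*-congʳ (+-comm _ _)) ⟩
    (1# + s S i) * φ (k S i) * y              ≈⟨ proj₂ (E-multiple S i) ⟨
    ∑words (τ S)                              ∎
    where y = proj₁ (E-multiple S i)

  -- Weights

  -- For ζ = φ (z first) a product w of reflections has weight Z^(w ε₁), which depends on its coset
  -- only. Left multiplication by functions does not change weights.
  record Weight (ζ : Carrier) (f : F.Carrier) (x : Carrier) : Set where
    constructor weight
    field eigen : x * ζ ≈ φ f * x
  open Weight

  -- A decomposition into weight elements is kept as data, so that the points occurring as weights
  -- can be followed through multiplication by s and τ.
  data Span {m} (ζ : Carrier) (z : Pt m → F.Carrier) (P : Pt m → Set) : Carrier → Set where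
    pure : ∀ {p x} → P p → Weight ζ (z p) x → Span ζ z P x
    _⊹_  : ∀ {x y} → Span ζ z P x → Span ζ z P y → Span ζ z P (x + y)
    resp : ∀ {x y} → x ≈ y → Span ζ z P x → Span ζ z P y

  weight-resp : ∀ {ζ f x y} → x ≈ y → Weight ζ f x → Weight ζ f y
  weight-resp x≈y (weight h) = weight (trans (*-congʳ (sym x≈y)) (trans h (*-congˡ x≈y)))

  weight-+ : ∀ {ζ f x y} → Weight ζ f x → Weight ζ f y → Weight ζ f (x + y)
  weight-+ (weight h) (weight k) = weight (trans (distribʳ _ _ _) (trans (+-cong h k) (sym (distribˡ _ _ _))))

  weight-φ : ∀ {ζ f x} g → Weight ζ f x → Weight ζ f (φ g * x)
  weight-φ {ζ} {f} {x} g (weight h) = weight (begin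
    φ g * x * ζ       ≈⟨ *-assoc _ _ _ ⟩
    φ g * (x * ζ)     ≈⟨ *-congˡ h ⟩
    φ g * (φ f * x)   ≈⟨ *-assoc _ _ _ ⟨
    φ g * φ f * x     ≈⟨ *-congʳ (φ-comm g f) ⟩
    φ f * φ g * x     ≈⟨ *-assoc _ _ _ ⟩
    φ f * (φ g * x)   ∎)

  weight-s : ∀ {ζ f g x s} → Tr s f g → Weight ζ f x → Weight ζ g (s * x)
  weight-s {ζ} {f} {g} {x} {s} (tr t) (weight h) = weight (begin
    s * x * ζ         ≈⟨ *-assoc _ _ _ ⟩
    s * (x * ζ)       ≈⟨ *-congˡ h ⟩
    s * (φ f * x)     ≈⟨ *-assoc _ _ _ ⟨
    s * φ f * x       ≈⟨ *-congʳ t ⟩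
    φ g * s * x       ≈⟨ *-assoc _ _ _ ⟩
    φ g * (s * x)     ∎)

  -1F : F.Carrier
  -1F = F.- F.1#

  φ-0 : φ F.0# ≈ 0#
  φ-0 = RingProperties.x+x≈x⇒x≈0 A (φ F.0#) (trans (sym (φ-+ _ _)) (φ-cong (F.+-identityˡ _)))

  φ-neg : ∀ f → φ (F.- f) ≈ - φ f
  φ-neg f = RingProperties.+-inverseˡ-unique A (φ (F.- f)) (φ f) (trans (sym (φ-+ _ _)) (trans (φ-cong (F.-‿inverseˡ f)) φ-0))

  weight-neg : ∀ {ζ f x} → Weight ζ f x → Weight ζ f (- x)
  weight-neg {x = x} w = weight-resp (begin
    φ -1F * x     ≈⟨ *-congʳ (trans (φ-neg F.1#) (-‿cong φ-1)) ⟩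
    - 1# * x      ≈⟨ solve (x ∷ []) (λ x → :- :1 :* x := :- x) ≡.refl ⟩
    - x           ∎) (weight-φ -1F w)

  τ-expand : ∀ {m} (S : System m) i x → τ S i * x ≈ φ (k S i F.- F.1#) * x + s S i * (φ (k S i) * x)
  τ-expand S i x = begin
    ((1# + s S i) * φ (k S i) - 1#) * x
      ≈⟨ solve (s S i ∷ φ (k S i) ∷ x ∷ []) (λ s k x → ((:1 :+ s) :* k :- :1) :* x := (k :- :1) :* x :+ s :* (k :* x)) ≡.refl ⟩
    (φ (k S i) - 1#) * x + s S i * (φ (k S i) * x)
      ≈⟨ +-congʳ (*-congʳ (trans (φ-+ _ _) (+-congˡ (trans (φ-neg F.1#) (-‿cong φ-1))))) ⟨
    φ (k S i F.- F.1#) * x + s S i * (φ (k S i) * x) ∎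

  span-φ : ∀ {m ζ z} {P : Pt m → Set} {x} f → Span ζ z P x → Span ζ z P (φ f * x)
  span-φ f (pure Pp w)  = pure Pp (weight-φ f w)
  span-φ f (σ ⊹ σ′)     = resp (sym (distribˡ _ _ _)) (span-φ f σ ⊹ span-φ f σ′)
  span-φ f (resp x≈y σ) = resp (*-congˡ x≈y) (span-φ f σ)

  span-s : ∀ {m} (S : System m) {ζ} {P Q : Pt m → Set} {x} i → (∀ p → P p → Q (i · p)) →
           Span ζ (z S) P x → Span ζ (z S) Q (s S i * x)
  span-s S i P⇒Q (pure {p} Pp w) = pure (P⇒Q p Pp) (weight-s (z-transport S i p) w)
  span-s S i P⇒Q (σ ⊹ σ′)        = resp (sym (distribˡ _ _ _)) (span-s S i P⇒Q σ ⊹ span-s S i P⇒Q σ′)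
  span-s S i P⇒Q (resp x≈y σ)    = resp (*-congˡ x≈y) (span-s S i P⇒Q σ)

  span-map : ∀ {m m′ ζ} {z : Pt m → F.Carrier} {z′ : Pt m′ → F.Carrier} {P Q x} (f : Pt m′ → Pt m) →
             (∀ p → z′ p ≡ z (f p)) → (∀ p → P p → Q (f p)) → Span ζ z′ P x → Span ζ z Q x
  span-map {ζ = ζ} f z′≡z P⇒Q (pure {p} {x} Pp w) = pure (P⇒Q p Pp) (subst (λ g → Weight ζ g x) (z′≡z p) w)
  span-map f z′≡z P⇒Q (σ ⊹ σ′)     = span-map f z′≡z P⇒Q σ ⊹ span-map f z′≡z P⇒Q σ′
  span-map f z′≡z P⇒Q (resp x≈y σ) = resp x≈y (span-map f z′≡z P⇒Q σ)

  span-⊆ : ∀ {m ζ} {z : Pt m → F.Carrier} {P Q x} → (∀ p → P p → Q p) → Span ζ z P x → Span ζ z Q x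
  span-⊆ = span-map (λ p → p) (λ p → ≡.refl)

  span-τ : ∀ {m} (S : System m) {ζ} {P Q : Pt m → Set} {x} i → (∀ p → P p → Q p) → (∀ p → P p → Q (i · p)) →
           Span ζ (z S) P x → Span ζ (z S) Q (τ S i * x)
  span-τ S i P⊆Q P⇒Q σ = resp (sym (τ-expand S i _))
    (span-⊆ P⊆Q (span-φ _ σ) ⊹ span-s S i P⇒Q (span-φ _ σ))

  weight-τ : ∀ {m} (S : System m) {ζ f x} i → Tr (s S i) f f → Weight ζ f x → Weight ζ f (τ S i * x)
  weight-τ S i t w = weight-resp (sym (τ-expand S i _)) (weight-+ (weight-φ _ w) (weight-s t (weight-φ _ w)))

  weight-τ↑ : ∀ {m} (S : System (suc m)) {ζ f x} → (∀ i → Tr (s S (suc i)) f f) → ∀ v →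
              Weight ζ f x → Weight ζ f (⟦ τ S ⟧ (↑ v) * x)
  weight-τ↑ S t []      w = weight-resp (sym (*-identityˡ _)) w
  weight-τ↑ S t (i ∷ v) w = weight-resp (sym (*-assoc _ _ _)) (weight-τ S (suc i) (t i) (weight-τ↑ S t v w))

  span-τ↑ : ∀ {m} (S : System (suc m)) {ζ} {P : Pt (suc m) → Set} {x} → (∀ i p → P p → P (suc i · p)) → ∀ v →
            Span ζ (z S) P x → Span ζ (z S) P (⟦ τ S ⟧ (↑ v) * x)
  span-τ↑ S stable []      σ = resp (sym (*-identityˡ _)) σ
  span-τ↑ S stable (i ∷ v) σ = resp (sym (*-assoc _ _ _)) (span-τ S (suc i) (λ _ Pp → Pp) (stable i) (span-τ↑ S stable v σ))

  weight-coset : ∀ {m} (S : System m) {ζ x} p → Weight ζ (z S first) x → Weight ζ (z S p) (⟦ s S ⟧ (coset p) * x)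
  weight-coset S {ζ} {x} p w = subst (λ q → Weight ζ (z S q) (⟦ s S ⟧ (coset p) * x)) pushes (go (coset p))
    where
    go : ∀ v → Weight ζ (z S (push v first)) (⟦ s S ⟧ v * x)
    go []      = weight-resp (sym (*-identityˡ _)) w
    go (i ∷ v) = weight-resp (sym (*-assoc _ _ _)) (weight-s (z-transport S i _) (go v))
    pushes : push (coset p) first ≡ p
    pushes = ≡.trans (cong (push (coset p)) (≡.sym (pull-coset p))) (push-pull (coset p) p)

  -- The operator that tests for weight z p: on an element of weight f it is left multiplication by
  -- f - z p, as `D-weight` shows.
  D : ∀ {m} → Carrier → (Pt m → F.Carrier) → Pt m → Carrier → Carrier
  D ζ z p x = x * ζ - φ (z p) * x

  Ds : ∀ {m} → Carrier → (Pt m → F.Carrier) → List (Pt m) → Carrier → Carrier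
  Ds ζ z ps x = foldr (D ζ z) x ps

  module _ {m} (ζ : Carrier) (z : Pt m → F.Carrier) where
    D-cong : ∀ p {x y} → x ≈ y → D ζ z p x ≈ D ζ z p y
    D-cong p x≈y = +-cong (*-congʳ x≈y) (-‿cong (*-congˡ x≈y))

    Ds-cong : ∀ ps {x y} → x ≈ y → Ds ζ z ps x ≈ Ds ζ z ps y
    Ds-cong []       x≈y = x≈y
    Ds-cong (p ∷ ps) x≈y = D-cong p (Ds-cong ps x≈y)

    D-comm : ∀ p q x → D ζ z p (D ζ z q x) ≈ D ζ z q (D ζ z p x)
    D-comm p q x = begin
      D ζ z p (D ζ z q x)
        ≈⟨ solve (ζ ∷ φ (z p) ∷ φ (z q) ∷ x ∷ []) (λ ζ a b x →
             (x :* ζ :- b :* x) :* ζ :- a :* (x :* ζ :- b :* x) := x :* ζ :* ζ :- b :* x :* ζ :- a :* x :* ζ :+ a :* b :* x) ≡.refl ⟩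
      x * ζ * ζ - φ (z q) * x * ζ - φ (z p) * x * ζ + φ (z p) * φ (z q) * x
        ≈⟨ +-congˡ (*-congʳ (φ-comm (z p) (z q))) ⟩
      x * ζ * ζ - φ (z q) * x * ζ - φ (z p) * x * ζ + φ (z q) * φ (z p) * x
        ≈⟨ solve (ζ ∷ φ (z p) ∷ φ (z q) ∷ x ∷ []) (λ ζ a b x →
             x :* ζ :* ζ :- b :* x :* ζ :- a :* x :* ζ :+ b :* a :* x := (x :* ζ :- a :* x) :* ζ :- b :* (x :* ζ :- a :* x)) ≡.refl ⟩
      D ζ z q (D ζ z p x) ∎

    D-Ds-comm : ∀ p qs x → D ζ z p (Ds ζ z qs x) ≈ Ds ζ z qs (D ζ z p x)
    D-Ds-comm p []       x = refl
    D-Ds-comm p (q ∷ qs) x = trans (D-comm p q _) (D-cong q (D-Ds-comm p qs x))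

    Ds-comm : ∀ ps qs x → Ds ζ z ps (Ds ζ z qs x) ≈ Ds ζ z qs (Ds ζ z ps x)
    Ds-comm []       qs x = refl
    Ds-comm (p ∷ ps) qs x = trans (D-cong p (Ds-comm ps qs x)) (D-Ds-comm p qs _)

    D-0 : ∀ p → D ζ z p 0# ≈ 0#
    D-0 p = solve (ζ ∷ φ (z p) ∷ []) (λ ζ a → :0 :* ζ :- a :* :0 := :0) ≡.refl

    Ds-0 : ∀ ps → Ds ζ z ps 0# ≈ 0#
    Ds-0 []       = refl
    Ds-0 (p ∷ ps) = trans (D-cong p (Ds-0 ps)) (D-0 p)

    D-+ : ∀ p x y → D ζ z p (x + y) ≈ D ζ z p x + D ζ z p y
    D-+ p x y = solve (ζ ∷ φ (z p) ∷ x ∷ y ∷ []) (λ ζ a x y →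
      (x :+ y) :* ζ :- a :* (x :+ y) := x :* ζ :- a :* x :+ (y :* ζ :- a :* y)) ≡.refl

    Ds-+ : ∀ ps x y → Ds ζ z ps (x + y) ≈ Ds ζ z ps x + Ds ζ z ps y
    Ds-+ []       x y = refl
    Ds-+ (p ∷ ps) x y = trans (D-cong p (Ds-+ ps x y)) (D-+ p _ _)

    D-weight : ∀ {f x} p → Weight ζ f x → D ζ z p x ≈ φ (f F.- z p) * x
    D-weight {f} {x} p (weight h) = begin
      x * ζ - φ (z p) * x          ≈⟨ +-congʳ h ⟩
      φ f * x - φ (z p) * x        ≈⟨ solve (φ f ∷ φ (z p) ∷ x ∷ []) (λ f a x → f :* x :- a :* x := (f :- a) :* x) ≡.refl ⟩
      (φ f - φ (z p)) * x          ≈⟨ *-congʳ (trans (φ-+ _ _) (+-congˡ (φ-neg _))) ⟨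
      φ (f F.- z p) * x            ∎

    Ds-weight : ∀ {f x} ps → Weight ζ f x → Weight ζ f (Ds ζ z ps x)
    Ds-weight []       w = w
    Ds-weight (p ∷ ps) w = weight-resp (sym (D-weight p (Ds-weight ps w))) (weight-φ _ (Ds-weight ps w))

    kill-weight : ∀ {p x} ps → p ∈ ps → Weight ζ (z p) x → Ds ζ z ps x ≈ 0#
    kill-weight (p ∷ ps) (here ≡.refl) w = trans (D-weight p (Ds-weight ps w))
      (trans (*-congʳ (trans (φ-cong (F.-‿inverseʳ _)) φ-0)) (zeroˡ _))
    kill-weight (p ∷ ps) (there p∈ps) w = trans (D-cong p (kill-weight ps p∈ps w)) (D-0 p)

    kill : ∀ {P x} ps → (∀ p → P p → p ∈ ps) → Span ζ z P x → Ds ζ z ps x ≈ 0#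
    kill ps P⊆ps (pure {p} Pp w) = kill-weight ps (P⊆ps p Pp) w
    kill ps P⊆ps (σ ⊹ σ′)        = trans (Ds-+ ps _ _) (trans (+-cong (kill ps P⊆ps σ) (kill ps P⊆ps σ′)) (+-identityˡ 0#))
    kill ps P⊆ps (resp x≈y σ)    = trans (Ds-cong ps (sym x≈y)) (kill ps P⊆ps σ)

    module _ (separates : ∀ {p q} → p ≢ q → ∃[ u ] u F.* (z p F.- z q) F.≈ F.1#) where
      -- Each operator in the list multiplies an element of weight z p by some z p - z q, which has
      -- an inverse by `separates`.
      faithful : ∀ {p x} ps → All (_≢ p) ps → Weight ζ (z p) x → Ds ζ z ps x ≈ 0# → x ≈ 0#
      faithful []       []           w h = h
      faithful {p} {x} (q ∷ ps) (q≢p ∷ ≢p) w h = faithful ps ≢p w (begin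
        y                                  ≈⟨ *-identityˡ _ ⟨
        1# * y                             ≈⟨ *-congʳ (trans (φ-cong (proj₂ u)) φ-1) ⟨
        φ (proj₁ u F.* (z p F.- z q)) * y  ≈⟨ *-congʳ (φ-* _ _) ⟩
        φ (proj₁ u) * φ (z p F.- z q) * y  ≈⟨ *-assoc _ _ _ ⟩
        φ (proj₁ u) * (φ (z p F.- z q) * y) ≈⟨ *-congˡ (D-weight q (Ds-weight ps w)) ⟨
        φ (proj₁ u) * D ζ z q y            ≈⟨ trans (*-congˡ h) (zeroʳ _) ⟩
        0#                                 ∎)
        where
        u = separates (q≢p ∘ ≡.sym)
        y = Ds ζ z ps x

      -- The annihilators of the weights in a list are peeled off one at a time.
      vanish : ∀ x → (∀ p → Span ζ z (_≢ p) x) → x ≈ 0#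
      vanish x spans = peel (allPt m) (kill {P = _≢ last} (allPt m) (λ p _ → ∈-allPt p) (spans last))
        where
        peel : ∀ ps → Ds ζ z ps x ≈ 0# → x ≈ 0#
        peel []       h = h
        peel (p ∷ ps) h = peel ps (faithful others (all-filter (λ q → ¬? (q ≟ₚ p)) (allPt m)) w
          (trans (Ds-comm others ps x) (trans (Ds-cong ps
            (kill others (λ q q≢p → ∈-filter⁺ (λ q → ¬? (q ≟ₚ p)) (∈-allPt q) q≢p) (spans p))) (Ds-0 ps))))
          where
          others = filter (λ q → ¬? (q ≟ₚ p)) (allPt m)
          w : Weight ζ (z p) (Ds ζ z ps x)
          w = weight (x∙y⁻¹≈ε⇒x≈y _ _ h)

  -- Multiplication by sᵢ turns a decomposition that avoids p into one that avoids i · p, and fixes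
  -- x. Starting from `last`, every point is avoided by some decomposition of x.
  invariant-vanishes : ∀ {m} (S : System m) ζ x → (∀ i → s S i * x ≈ x) → Span ζ (z S) (_≢ last) x → x ≈ 0#
  invariant-vanishes S ζ x inv σ = vanish ζ (z S) (z-separates S) x
    (transitive (λ p → Span ζ (z S) (_≢ p) x)
      (λ i p σ → resp (inv i) (span-s S i (λ q q≢p iq≡ip → q≢p (·-injective i iq≡ip)) σ)) σ)
    where
    ·-injective : ∀ {m} (i : Gen m) {p q} → i · p ≡ i · q → p ≡ q
    ·-injective i {p} {q} e = ≡.trans (≡.sym (·-involutive i p)) (≡.trans (cong (i ·_) e) (·-involutive i q))

  -- Leading coefficients

  ρ K : ∀ {m} → System m → F.Carrier
  ρ S = ∏ε₁ (ℓ S) (h S)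
  K S = ∏roots (ℓ S) (h S)

  ρ-invariant : ∀ {m} (S : System (suc m)) i → Tr (s S (suc i)) (ρ S) (ρ S)
  ρ-invariant S i = Tr-* (Tr-resp F.refl (∏-· i (λ q → ℓ S first (mid q)))
    (Tr-∏ λ q → ℓ-transport S (suc i) first (mid q))) (h-transport S (suc i) first)

  -- ρ without the factors ℓ first (mid first) and ℓ first (mid last)
  ρ° : ∀ {m} → System (suc m) → F.Carrier
  ρ° {zero}  S = h S first
  ρ° {suc m} S = ∏ (λ q → ℓ S first (mid (mid q))) F.* h S first

  ρ°-transport : ∀ {m} (S : System (suc m)) → Tr (s S zero) (ρ (restrict S)) (ρ° S)
  ρ°-transport {zero}  S = h-transport S zero (mid first)
  ρ°-transport {suc m} S = Tr-* (Tr-∏ λ q → ℓ-transport S zero (mid first) (mid (mid q))) (h-transport S zero (mid first))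

  ρ°-ρ : ∀ {m} (S : System (suc m)) → ℓ S (mid first) first F.* ρ° S F.* ℓ S first (mid last) F.≈ ρ S
  ρ°-ρ {zero} S = F.trans (F.*-congʳ (F.*-congʳ (ℓ-sym S _ _)))
    (solveF 3 (λ a b c → a ⊠ c ⊠ b ⊜ a ⊠ b ⊠ c) F.refl _ _ _)
  ρ°-ρ {suc m} S = F.trans (F.*-congʳ (F.*-congʳ (ℓ-sym S _ _)))
    (solveF 4 (λ a b c d → a ⊠ (c ⊠ d) ⊠ b ⊜ a ⊠ b ⊠ c ⊠ d) F.refl _ _ _ _)

  back-word : ∀ {m} (S : System m) v p q →
              φ (ℓ S p q) * ⟦ s S ⟧ v ≈ ⟦ s S ⟧ v * φ (ℓ S (pull v p) (pull v q))
  back-word S []      p q = trans (*-identityʳ _) (sym (*-identityˡ _))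
  back-word S (i ∷ v) p q = begin
    φ (ℓ S p q) * (s S i * ⟦ s S ⟧ v)              ≈⟨ *-assoc _ _ _ ⟨
    φ (ℓ S p q) * s S i * ⟦ s S ⟧ v                ≈⟨ *-congʳ (Tr-back (s-involutive S i) (ℓ-transport S i p q)) ⟩
    s S i * φ (ℓ S (i · p) (i · q)) * ⟦ s S ⟧ v    ≈⟨ *-assoc _ _ _ ⟩
    s S i * (φ (ℓ S (i · p) (i · q)) * ⟦ s S ⟧ v)  ≈⟨ *-congˡ (back-word S v (i · p) (i · q)) ⟩
    s S i * (⟦ s S ⟧ v * _)                        ≈⟨ *-assoc _ _ _ ⟨
    s S i * ⟦ s S ⟧ v * _                          ∎

  ⟦⟧-coset-last : ∀ {m} (g : Gen (suc m) → Carrier) y →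
    ⟦ g ⟧ (coset (last {suc m})) * y ≈ g zero * (⟦ g ∘ suc ⟧ (coset (last {m})) * (g zero * y))
  ⟦⟧-coset-last {m} g y = begin
    g zero * ⟦ g ⟧ (↑ (coset last) ++ zero ∷ []) * y
      ≈⟨ *-congʳ (*-congˡ (trans (⟦⟧-++ g (↑ (coset last)) (zero ∷ [])) (*-congʳ (reflexive (⟦⟧-↑ g (coset (last {m}))))))) ⟩
    g zero * (⟦ g ∘ suc ⟧ (coset last) * (g zero * 1#)) * y
      ≈⟨ solve (g zero ∷ ⟦ g ∘ suc ⟧ (coset (last {m})) ∷ y ∷ []) (λ a b y →
           a :* (b :* (a :* :1)) :* y := a :* (b :* (a :* y))) ≡.refl ⟩
    g zero * (⟦ g ∘ suc ⟧ (coset last) * (g zero * y)) ∎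

  -- The word of `last` is s₁ d s₁, with d the word of `last` one rank below. On the way from ε₁ to
  -- -ε₁ every letter has to move the point, so only the term that takes the reflecting part of each
  -- τ has weight -ε₁. The values of k picked up on the way, moved to the right, are the factors of
  -- ρ.
  leading : ∀ {m} (S : System m) ζ y → Weight ζ (z S first) y →
    ∃[ r ] Span ζ (z S) (_≢ last) r × ⟦ τ S ⟧ (coset last) * y ≈ ⟦ s S ⟧ (coset last) * (φ (ρ S) * y) + r
  leading {zero} S ζ y w = φ (h S first F.- F.1#) * y , pure {p = first} (λ ()) (weight-φ _ w) , (begin
    τ S zero * 1# * y                                        ≈⟨ *-congʳ (*-identityʳ _) ⟩
    τ S zero * y                                             ≈⟨ τ-expand S zero y ⟩
    φ (h S first F.- F.1#) * y + s S zero * (φ (h S first) * y)  ≈⟨ +-comm _ _ ⟩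
    s S zero * (φ (h S first) * y) + φ (h S first F.- F.1#) * y  ≈⟨ +-congʳ (*-congʳ (*-identityʳ _)) ⟨
    s S zero * 1# * (φ (h S first) * y) + φ (h S first F.- F.1#) * y ∎)
  leading {suc m} S ζ y w = r , span , (begin
    ⟦ τ S ⟧ (coset (last {suc m})) * y
      ≈⟨ ⟦⟧-coset-last (τ S) y ⟩
    τ₀ * (τw * (τ₀ * y))
      ≈⟨ *-congˡ (trans (*-congˡ (τ-expand S zero y)) (trans (distribˡ _ _ _) (+-congˡ (proj₂ (proj₂ ih))))) ⟩
    τ₀ * (r₁ + (M + r′))
      ≈⟨ solve (τ₀ ∷ r₁ ∷ M ∷ r′ ∷ []) (λ t r M r′ → t :* (r :+ (M :+ r′)) := t :* M :+ t :* (r :+ r′)) ≡.refl ⟩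
    τ₀ * M + τ₀ * (r₁ + r′)
      ≈⟨ +-congʳ (τ-expand S zero M) ⟩
    φ c * M + s₀ * (φ k₀ * M) + τ₀ * (r₁ + r′)
      ≈⟨ solve (φ c * M ∷ s₀ * (φ k₀ * M) ∷ τ₀ * (r₁ + r′) ∷ []) (λ a b c → a :+ b :+ c := b :+ (c :+ a)) ≡.refl ⟩
    s₀ * (φ k₀ * M) + r
      ≈⟨ +-congʳ (trans (*-congˡ main) (sym (⟦⟧-coset-last (s S) (φ (ρ S) * y)))) ⟩
    ⟦ s S ⟧ (coset (last {suc m})) * (φ (ρ S) * y) + r ∎)
    where
    s₀ = s S zero
    τ₀ = τ S zero
    k₀ = ℓ S first (mid last)
    c  = k₀ F.- F.1#
    τw = ⟦ τ S ∘ suc ⟧ (coset (last {m}))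
    sw = ⟦ s S ∘ suc ⟧ (coset (last {m}))
    ρ′ = ρ (restrict S)
    y₂ = s₀ * (φ k₀ * y)
    w₂ : Weight ζ (z S (mid first)) y₂
    w₂ = weight-s (z-transport S zero first) (weight-φ k₀ w)
    ih = leading (restrict S) ζ y₂ w₂
    r′ = proj₁ ih
    r₁ = τw * (φ c * y)
    M  = sw * (φ ρ′ * y₂)
    r  = τ₀ * (r₁ + r′) + φ c * M
    -- The point `mid last` has to be excluded too, since the outer s₁ takes it to `last`.
    Inner : Pt (suc m) → Set
    Inner p = p ≢ last × p ≢ mid last
    inner-stable : ∀ p → Inner p → zero · p ≢ last
    inner-stable p (_ , p≢) e = p≢ (≡.trans (≡.sym (·-involutive zero p)) (cong (zero ·_) e))
    w₁ : Weight ζ (z S first) r₁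
    w₁ = weight-resp (*-congʳ (reflexive (⟦⟧-↑ (τ S) (coset (last {m})))))
      (weight-τ↑ S (λ i → z-transport S (suc i) first) (coset (last {m})) (weight-φ c w))
    span′ : Span ζ (z S) Inner r′
    span′ = span-map mid (λ _ → ≡.refl) (λ q q≢last → (λ ()) , q≢last ∘ mid-injective) (proj₁ (proj₂ ih))
    span : Span ζ (z S) (_≢ last) r
    span = span-τ S zero (λ _ → proj₁) inner-stable (pure {p = first} ((λ ()) , λ ()) w₁ ⊹ span′)
         ⊹ pure {p = mid last} (λ ()) (weight-φ c (weight-coset (restrict S) last (weight-φ ρ′ w₂)))
    -- Across the inner word the outer value k(ε₁ - ε₂) becomes k(ε₁ + ε₂); s₁ turns the ρ of the
    -- smaller rank into `ρ° S`; the inner k(ε₁ - ε₂) is the factor of ρ still missing.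
    main : φ k₀ * M ≈ sw * (s₀ * (φ (ρ S) * y))
    main = begin
      φ k₀ * (sw * (φ ρ′ * (s₀ * (φ k₀ * y))))
        ≈⟨ *-congˡ (*-congʳ (reflexive (⟦⟧-↑ (s S) (coset (last {m}))))) ⟨
      φ k₀ * (⟦ s S ⟧ v * (φ ρ′ * (s₀ * (φ k₀ * y))))
        ≈⟨ *-assoc _ _ _ ⟨
      φ k₀ * ⟦ s S ⟧ v * (φ ρ′ * (s₀ * (φ k₀ * y)))
        ≈⟨ *-congʳ (back-word S v first (mid last)) ⟩
      ⟦ s S ⟧ v * φ (ℓ S (pull v first) (pull v (mid last))) * (φ ρ′ * (s₀ * (φ k₀ * y)))
        ≡⟨ cong₂ (λ p q → ⟦ s S ⟧ v * φ (ℓ S p q) * (φ ρ′ * (s₀ * (φ k₀ * y)))) (pull-↑-first (coset (last {m})))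
             (≡.trans (pull-↑-mid (coset (last {m})) last) (cong mid (pull-coset last))) ⟩
      ⟦ s S ⟧ v * φ (ℓ S first (mid first)) * (φ ρ′ * (s₀ * (φ k₀ * y)))
        ≈⟨ solve (⟦ s S ⟧ v ∷ φ (ℓ S first (mid first)) ∷ φ ρ′ ∷ s₀ ∷ φ k₀ * y ∷ []) (λ v l r s x →
             v :* l :* (r :* (s :* x)) := v :* (l :* r :* s :* x)) ≡.refl ⟩
      ⟦ s S ⟧ v * (φ (ℓ S first (mid first)) * φ ρ′ * s₀ * (φ k₀ * y))
        ≈⟨ *-congˡ (*-congʳ (trans (*-congʳ (sym (φ-* _ _)))
             (Tr-back (s-involutive S zero) (Tr-* (ℓ-transport S zero first (mid first)) (ρ°-transport S))))) ⟩
      ⟦ s S ⟧ v * (s₀ * φ (ℓ S (mid first) first F.* ρ° S) * (φ k₀ * y))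
        ≈⟨ *-congˡ (trans (*-assoc _ _ _) (*-congˡ (trans (sym (*-assoc _ _ _))
             (*-congʳ (trans (sym (φ-* _ _)) (φ-cong (ρ°-ρ S))))))) ⟩
      ⟦ s S ⟧ v * (s₀ * (φ (ρ S) * y))
        ≈⟨ *-congʳ (reflexive (⟦⟧-↑ (s S) (coset (last {m})))) ⟩
      sw * (s₀ * (φ (ρ S) * y)) ∎
      where v = ↑ (coset (last {m}))

  ∑-sub : ∀ {m} (f g : Pt m → Carrier) → ∑ f - ∑ g ≈ ∑ (λ p → f p - g p)
  ∑-sub f g = sym (trans (∑-∙ f (λ p → - g p)) (+-congˡ (neg-∑ g)))
    where
    neg-∑ : ∀ {m} (g : Pt m → Carrier) → ∑ (λ p → - g p) ≈ - ∑ g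
    neg-∑ {zero}  g = -‿+-comm _ _
    neg-∑ {suc m} g = trans (+-cong (-‿+-comm _ _) (neg-∑ (g ∘ mid))) (-‿+-comm _ _)

  symmetrizer : ∀ {m} (S : System m) → ∑words (τ S) ≈ ∑words (s S) * φ (K S)
  symmetrizer {zero} S = begin
    1# + τ S zero * 1#                    ≈⟨ E≈1+τ S zero 1# ⟩
    (1# + s S zero) * φ (h S first) * 1#  ≈⟨ solve (s S zero ∷ φ (h S first) ∷ []) (λ s f →
                                               (:1 :+ s) :* f :* :1 := (:1 :+ s :* :1) :* f) ≡.refl ⟩
    (1# + s S zero * 1#) * φ (h S first)  ∎
  symmetrizer {suc m} S = begin
    ∑words (τ S)
      ≈⟨ ∑words-suc (τ S) ⟩
    ∑ u
      ≈⟨ x∙y⁻¹≈ε⇒x≈y _ _ (invariant-vanishes S ζ (∑ u - ∑ u*) invariant span) ⟩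
    ∑ u*
      ≈⟨ ∑-cong {suc m} {u*} {λ p → ⟦ s S ⟧ (coset p) * ∑words (s S ∘ suc) * φ (K S)} collect ⟩
    ∑ (λ p → ⟦ s S ⟧ (coset p) * ∑words (s S ∘ suc) * φ (K S))
      ≈⟨ ∑-*ʳ {suc m} (φ (K S)) (λ p → ⟦ s S ⟧ (coset p) * ∑words (s S ∘ suc)) ⟩
    ∑ (λ p → ⟦ s S ⟧ (coset p) * ∑words (s S ∘ suc)) * φ (K S)
      ≈⟨ *-congʳ (∑words-suc (s S)) ⟨
    ∑words (s S) * φ (K S) ∎
    where
    ζ = φ (z S first)
    S′ = restrict S
    U′ = ∑words (τ S′)
    u u* : Pt (suc m) → Carrier
    u  p = ⟦ τ S ⟧ (coset p) * U′
    u* p = ⟦ s S ⟧ (coset p) * (φ (ρ S) * U′)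

    weight-1 : Weight ζ (z S first) 1#
    weight-1 = weight (trans (*-identityˡ _) (sym (*-identityʳ _)))

    weight-U′ : Weight ζ (z S first) U′
    weight-U′ = ∑ₙ-closed {m} (Weight ζ (z S first)) weight-+ _ λ x → weight-resp
      (trans (*-identityʳ _) (reflexive (⟦⟧-↑ (τ S) (word x))))
      (weight-τ↑ S (λ i → z-transport S (suc i) first) (word x) weight-1)

    weight-ρU′ = weight-φ (ρ S) weight-U′

    difference : ∀ p → Span ζ (z S) (_≢ last) (u p - u* p)
    difference first = pure {p = first} (λ ()) (weight-+ (weight-resp (sym (*-identityˡ _)) weight-U′)
      (weight-neg (weight-resp (sym (*-identityˡ _)) weight-ρU′)))
    difference (mid p) = resp (+-congʳ (sym (begin
        ⟦ τ S ⟧ (↑ (coset p) ++ zero ∷ []) * U′         ≈⟨ *-congʳ (⟦⟧-++ (τ S) (↑ (coset p)) (zero ∷ [])) ⟩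
        ⟦ τ S ⟧ (↑ (coset p)) * (τ S zero * 1#) * U′    ≈⟨ *-assoc _ _ _ ⟩
        ⟦ τ S ⟧ (↑ (coset p)) * (τ S zero * 1# * U′)    ≈⟨ *-congˡ (*-congʳ (*-identityʳ _)) ⟩
        ⟦ τ S ⟧ (↑ (coset p)) * (τ S zero * U′)         ∎)))
      (span-τ↑ S (λ i q q≢last iq≡last → q≢last (≡.trans (≡.sym (·-involutive (suc i) q)) (cong (suc i ·_) iq≡last)))
        (coset p) (span-τ S {P = _≡ first} zero (λ { _ ≡.refl () }) (λ { _ ≡.refl () }) (pure {p = first} ≡.refl weight-U′))
       ⊹ pure {p = mid p} (λ ()) (weight-neg (weight-coset S (mid p) weight-ρU′)))
    difference last = let (r , span , e) = leading S ζ U′ weight-U′ in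
      resp (sym (trans (+-congʳ (trans e (+-comm _ _))) (trans (+-assoc _ _ _)
        (trans (+-congˡ (-‿inverseʳ _)) (+-identityʳ r))))) span

    span : Span ζ (z S) (_≢ last) (∑ u - ∑ u*)
    span = resp (sym (∑-sub {suc m} u u*)) (∑-closed {suc m} (Span ζ (z S) (_≢ last)) _⊹_ (λ p → u p - u* p) difference)

    -- In the case `stay` the generator that leaves the representative on the right is absorbed,
    -- because ρ and U′ are both invariant under the subgroup.
    s-u* : ∀ i p → Move i p → s S i * u* p ≈ u* (i · p)
    s-u* i p (up e) = trans (sym (*-assoc _ _ _)) (reflexive (cong (λ v → ⟦ s S ⟧ v * (φ (ρ S) * U′)) (≡.sym e)))
    s-u* i p (down e) = begin
      s S i * (⟦ s S ⟧ (coset p) * _)                ≡⟨ cong (λ v → s S i * (⟦ s S ⟧ v * (φ (ρ S) * U′))) e ⟩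
      s S i * (s S i * ⟦ s S ⟧ (coset (i · p)) * _)  ≈⟨ solve (s S i ∷ ⟦ s S ⟧ (coset (i · p)) ∷ φ (ρ S) * U′ ∷ []) (λ s d x →
                                                         s :* (s :* d :* x) := s :* s :* (d :* x)) ≡.refl ⟩
      s S i * s S i * u* (i · p)                     ≈⟨ trans (*-congʳ (s-involutive S i)) (*-identityˡ _) ⟩
      u* (i · p)                                     ∎
    s-u* i p (stay j ip≡p h) = begin
      s S i * (d * (φ (ρ S) * U′))              ≈⟨ *-assoc _ _ _ ⟨
      s S i * d * (φ (ρ S) * U′)                ≈⟨ *-congʳ (trans (⟦⟧-⇝ (s-braided S) h)
                                                     (trans (⟦⟧-++ (s S) (coset p) (suc j ∷ [])) (*-congˡ (*-identityʳ _)))) ⟩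
      d * s S (suc j) * (φ (ρ S) * U′)          ≈⟨ solve (d ∷ s S (suc j) ∷ φ (ρ S) ∷ U′ ∷ []) (λ d s r x →
                                                     d :* s :* (r :* x) := d :* (s :* r :* x)) ≡.refl ⟩
      d * (s S (suc j) * φ (ρ S) * U′)          ≈⟨ *-congˡ (trans (*-congʳ (transport (ρ-invariant S j))) (*-assoc _ _ _)) ⟩
      d * (φ (ρ S) * (s S (suc j) * U′))        ≈⟨ *-congˡ (*-congˡ (s-invariant S′ j)) ⟩
      d * (φ (ρ S) * U′)                        ≡⟨ cong u* (≡.sym ip≡p) ⟩
      u* (i · p)                                ∎
      where d = ⟦ s S ⟧ (coset p)

    invariant : ∀ i → s S i * (∑ u - ∑ u*) ≈ ∑ u - ∑ u*
    invariant i = begin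
      s S i * (∑ u - ∑ u*)
        ≈⟨ solve (s S i ∷ ∑ u ∷ ∑ u* ∷ []) (λ s x y → s :* (x :- y) := s :* x :- s :* y) ≡.refl ⟩
      s S i * ∑ u - s S i * ∑ u*
        ≈⟨ +-cong (trans (*-congˡ (sym (∑words-suc (τ S)))) (trans (s-invariant S i) (∑words-suc (τ S)))) (-‿cong (begin
             s S i * ∑ u*                    ≈⟨ ∑-*ˡ {suc m} (s S i) u* ⟨
             ∑ (λ p → s S i * u* p)          ≈⟨ ∑-cong {suc m} {λ p → s S i * u* p} {λ p → u* (i · p)} (λ p → s-u* i p (move i p)) ⟩
             ∑ (λ p → u* (i · p))            ≈⟨ ∑-· i u* ⟩
             ∑ u*                            ∎)) ⟩
      ∑ u - ∑ u* ∎

    s↑-ρ : ∀ v → ⟦ s S ∘ suc ⟧ v * φ (ρ S) ≈ φ (ρ S) * ⟦ s S ∘ suc ⟧ v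
    s↑-ρ []      = trans (*-identityˡ _) (sym (*-identityʳ _))
    s↑-ρ (i ∷ v) = trans (*-assoc _ _ _) (trans (*-congˡ (s↑-ρ v)) (trans (sym (*-assoc _ _ _))
      (trans (*-congʳ (transport (ρ-invariant S i))) (*-assoc _ _ _))))

    collect : ∀ p → u* p ≈ ⟦ s S ⟧ (coset p) * ∑words (s S ∘ suc) * φ (K S)
    collect p = begin
      d * (φ (ρ S) * U′)
        ≈⟨ *-congˡ (*-congˡ (symmetrizer S′)) ⟩
      d * (φ (ρ S) * (e′ * φ (K S′)))
        ≈⟨ *-congˡ (*-assoc _ _ _) ⟨
      d * (φ (ρ S) * e′ * φ (K S′))
        ≈⟨ *-congˡ (*-congʳ (trans (sym (∑ₙ-*ˡ {m} (φ (ρ S)) λ x → ⟦ s S ∘ suc ⟧ (word x)))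
             (trans (∑ₙ-cong {m} λ x → sym (s↑-ρ (word x))) (∑ₙ-*ʳ {m} (φ (ρ S)) λ x → ⟦ s S ∘ suc ⟧ (word x))))) ⟩
      d * (e′ * φ (ρ S) * φ (K S′))
        ≈⟨ solve (d ∷ e′ ∷ φ (ρ S) ∷ φ (K S′) ∷ []) (λ d e r k → d :* (e :* r :* k) := d :* e :* (r :* k)) ≡.refl ⟩
      d * e′ * (φ (ρ S) * φ (K S′))
        ≈⟨ *-congˡ (φ-* _ _) ⟨
      d * e′ * φ (K S) ∎
      where
      d = ⟦ s S ⟧ (coset p)
      e′ = ∑words (s S ∘ suc)

  -- Twisting by a sign character and a function

  Tr-∏roots : ∀ {m x} {ℓ ℓ′ : Pt m → Pt m → F.Carrier} {h h′ : Pt m → F.Carrier} →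
    (∀ p q → Tr x (ℓ p q) (ℓ′ p q)) → (∀ p → Tr x (h p) (h′ p)) → Tr x (∏roots ℓ h) (∏roots ℓ′ h′)
  Tr-∏roots {zero}  ℓ-tr h-tr = h-tr first
  Tr-∏roots {suc m} ℓ-tr h-tr = Tr-* (Tr-* (Tr-∏ λ q → ℓ-tr first (mid q)) (h-tr first))
    (Tr-∏roots (λ p q → ℓ-tr (mid p) (mid q)) (h-tr ∘ mid))

  Tr-sub : ∀ {x f g f′ g′} → Tr x f g → Tr x f′ g′ → Tr x (f F.- f′) (g F.- g′)
  Tr-sub {x} {f} {g} {f′} {g′} (tr t) (tr t′) = tr (begin
    x * φ (f F.- f′)           ≈⟨ *-congˡ (trans (φ-+ _ _) (+-congˡ (φ-neg f′))) ⟩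
    x * (φ f - φ f′)           ≈⟨ solve (x ∷ φ f ∷ φ f′ ∷ []) (λ x f f′ → x :* (f :- f′) := x :* f :- x :* f′) ≡.refl ⟩
    x * φ f - x * φ f′         ≈⟨ +-cong t (-‿cong t′) ⟩
    φ g * x - φ g′ * x         ≈⟨ solve (x ∷ φ g ∷ φ g′ ∷ []) (λ x g g′ → g :* x :- g′ :* x := (g :- g′) :* x) ≡.refl ⟩
    (φ g - φ g′) * x           ≈⟨ *-congʳ (trans (φ-+ _ _) (+-congˡ (φ-neg g′))) ⟨
    φ (g F.- g′) * x           ∎)

  Tr-inverse : ∀ {x f g f′ g′} → f F.* f′ F.≈ F.1# → g F.* g′ F.≈ F.1# → Tr x f g → Tr x f′ g′
  Tr-inverse {x} {f} {g} {f′} {g′} ff′ gg′ (tr t) = tr (begin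
    x * φ f′                   ≈⟨ *-identityˡ _ ⟨
    1# * (x * φ f′)            ≈⟨ *-congʳ (trans (sym φ-1) (trans (φ-cong (F.trans (F.sym gg′) (F.*-comm g g′))) (φ-* g′ g))) ⟩
    φ g′ * φ g * (x * φ f′)    ≈⟨ solve (x ∷ φ g′ ∷ φ g ∷ φ f′ ∷ []) (λ x g′ g f′ → g′ :* g :* (x :* f′) := g′ :* (g :* x) :* f′) ≡.refl ⟩
    φ g′ * (φ g * x) * φ f′    ≈⟨ *-congʳ (*-congˡ (sym t)) ⟩
    φ g′ * (x * φ f) * φ f′    ≈⟨ solve (x ∷ φ g′ ∷ φ f ∷ φ f′ ∷ []) (λ x g′ f f′ → g′ :* (x :* f) :* f′ := g′ :* x :* (f :* f′)) ≡.refl ⟩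
    φ g′ * x * (φ f * φ f′)    ≈⟨ trans (*-congˡ (trans (sym (φ-* f f′)) (trans (φ-cong ff′) φ-1))) (*-identityʳ _) ⟩
    φ g′ * x                   ∎)

  ∏roots-cong : ∀ {m} {ℓ ℓ′ : Pt m → Pt m → F.Carrier} {h h′ : Pt m → F.Carrier} →
    (∀ p q → ℓ p q F.≈ ℓ′ p q) → (∀ p → h p F.≈ h′ p) → ∏roots ℓ h F.≈ ∏roots ℓ′ h′
  ∏roots-cong {zero}  ℓ≈ h≈ = h≈ first
  ∏roots-cong {suc m} ℓ≈ h≈ = F.*-cong (F.*-cong (∏-cong λ q → ℓ≈ first (mid q)) (h≈ first))
    (∏roots-cong (λ p q → ℓ≈ (mid p) (mid q)) (λ p → h≈ (mid p)))

  ∏roots-* : ∀ {m} (ℓ ℓ′ : Pt m → Pt m → F.Carrier) (h h′ : Pt m → F.Carrier) →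
    ∏roots (λ p q → ℓ p q F.* ℓ′ p q) (λ p → h p F.* h′ p) F.≈ ∏roots ℓ h F.* ∏roots ℓ′ h′
  ∏roots-* {zero}  ℓ ℓ′ h h′ = F.refl
  ∏roots-* {suc m} ℓ ℓ′ h h′ = F.trans
    (F.*-cong (F.*-congʳ (∏-* (λ q → ℓ first (mid q)) (λ q → ℓ′ first (mid q)))) (∏roots-* {m} _ _ _ _))
    (solveF 6 (λ a b c d e f → (a ⊠ b) ⊠ (c ⊠ d) ⊠ (e ⊠ f) ⊜ a ⊠ c ⊠ e ⊠ (b ⊠ d ⊠ f)) F.refl _ _ _ _ _ _)

  ∏roots-1 : ∀ {m} → ∏roots {m} (λ _ _ → F.1#) (λ _ → F.1#) F.≈ F.1#
  ∏roots-1 {zero}  = F.refl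
  ∏roots-1 {suc m} = F.trans (F.*-cong (F.trans (F.*-congʳ (∏-1 {m})) (F.*-identityˡ _)) (∏roots-1 {m})) (F.*-identityˡ _)
    where
    ∏-1 : ∀ {m} → ∏ {m} (λ _ → F.1#) F.≈ F.1#
    ∏-1 {zero}  = F.*-identityˡ _
    ∏-1 {suc m} = F.trans (F.*-cong (F.*-identityˡ _) (∏-1 {m})) (F.*-identityˡ _)

  ∏roots-cong-apart : ∀ {m} {ℓ ℓ′ : Pt m → Pt m → F.Carrier} {h h′ : Pt m → F.Carrier} →
    (∀ {p q} → Apart p q → ℓ p q F.≈ ℓ′ p q) → (∀ p → h p F.≈ h′ p) → ∏roots ℓ h F.≈ ∏roots ℓ′ h′
  ∏roots-cong-apart {zero}  ℓ≈ h≈ = h≈ first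
  ∏roots-cong-apart {suc m} ℓ≈ h≈ = F.*-cong (F.*-cong (∏-cong λ q → ℓ≈ {first} {mid q} λ ()) (h≈ first))
    (∏roots-cong-apart (ℓ≈ ∘ apart-mid) (λ p → h≈ (mid p)))

  module FM = BraidMonoid F.*-monoid

  -- Along the longest word the letters of each kind are as many as the positive roots.
  ∏-top : ∀ {m} (c : Kind → F.Carrier) → FM.⟦ c ∘ kind ⟧ (word (top {m})) F.≈ ∏roots {m} (λ _ _ → c long) (λ _ → c short)
  ∏-top {m} c = ∏-word {m}
    where
    ∏-coset : ∀ {m} → FM.⟦ c ∘ kind ⟧ (coset (last {m})) F.≈ ∏ε₁ {m} (λ _ _ → c long) (λ _ → c short)
    ∏-coset-suc : ∀ {m} → FM.⟦ c ∘ kind ⟧ (coset (last {suc m})) F.≈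
      c long F.* (FM.⟦ c ∘ kind ⟧ (coset (last {m})) F.* (c long F.* F.1#))
    ∏-coset-suc {m} = F.*-congˡ (F.trans (FM.⟦⟧-++ (c ∘ kind) (↑ (coset (last {m}))) (zero ∷ []))
      (F.*-congʳ (F.reflexive (FM.⟦⟧-↑ (c ∘ kind) (coset (last {m}))))))
    ∏-coset {zero}        = F.*-identityʳ _
    ∏-coset {suc zero}    = F.trans (∏-coset-suc {zero}) (F.trans (F.*-congˡ (F.*-congʳ (∏-coset {zero})))
      (solveF 2 (λ a b → a ⊠ (b ⊠ (a ⊠ con 1)) ⊜ a ⊠ a ⊠ b) F.refl (c long) (c short)))
    ∏-coset {suc (suc m)} = F.trans (∏-coset-suc {suc m}) (F.trans (F.*-congˡ (F.*-congʳ (∏-coset {suc m})))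
      (solveF 3 (λ a b d → a ⊠ (b ⊠ d ⊠ (a ⊠ con 1)) ⊜ a ⊠ a ⊠ b ⊠ d) F.refl (c long) (∏ {m} λ _ → c long) (c short)))
    ∏-word : ∀ {m} → FM.⟦ c ∘ kind ⟧ (word (top {m})) F.≈ ∏roots {m} (λ _ _ → c long) (λ _ → c short)
    ∏-word {zero}  = ∏-coset {zero}
    ∏-word {suc m} = F.trans (FM.⟦⟧-++ (c ∘ kind) (coset (last {suc m})) (↑ (word (top {m}))))
      (F.*-cong (∏-coset {suc m}) (F.trans (F.reflexive (FM.⟦⟧-↑ (c ∘ kind) (word (top {m})))) (∏-word {m})))

  record Equivariant {m} (s : Gen m → Carrier) (ℓ : Pt m → Pt m → F.Carrier) (h : Pt m → F.Carrier) : Set where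
    field
      ℓ-equivariant : ∀ i p q → Tr (s i) (ℓ p q) (ℓ (i · p) (i · q))
      h-equivariant : ∀ i p → Tr (s i) (h p) (h (i · p))
      ℓ-symmetric   : ∀ p q → ℓ p q F.≈ ℓ q p
  open Equivariant

  equivariant-tail : ∀ {m} {s : Gen (suc m) → Carrier} {ℓ h} → Equivariant s ℓ h →
    Equivariant (s ∘ suc) (λ p q → ℓ (mid p) (mid q)) (h ∘ mid)
  equivariant-tail e = record
    { ℓ-equivariant = λ i p q → ℓ-equivariant e (suc i) (mid p) (mid q)
    ; h-equivariant = λ i p → h-equivariant e (suc i) (mid p)
    ; ℓ-symmetric = λ p q → ℓ-symmetric e (mid p) (mid q) }

  -- sᵢ permutes the positive roots other than αᵢ.
  simple-divides : ∀ {m} {s : Gen m → Carrier} {ℓ h} → Equivariant s ℓ h → ∀ i →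
    ∃[ r ] ∏roots ℓ h F.≈ simple ℓ h i F.* r × Tr (s i) r r
  simple-divides {zero} e zero = F.1# , F.sym (F.*-identityʳ _) , Tr-1
  simple-divides {suc zero} {s} {ℓ} {h} e zero =
    ℓ first (mid first) F.* (h first F.* h (mid first)) ,
    solveF 4 (λ a b c d → a ⊠ b ⊠ c ⊠ d ⊜ b ⊠ (a ⊠ (c ⊠ d))) F.refl _ _ _ _ ,
    Tr-* (Tr-resp F.refl (ℓ-symmetric e _ _) (ℓ-equivariant e zero first (mid first)))
      (Tr-resp F.refl (F.*-comm _ _) (Tr-* (h-equivariant e zero first) (h-equivariant e zero (mid first))))
  simple-divides {suc (suc m)} {s} {ℓ} {h} e zero =
    ℓ first (mid first) F.* ((P F.* P′) F.* (h first F.* h (mid first))) F.* K″ ,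
    solveF 7 (λ a b p c p′ d k → a ⊠ b ⊠ p ⊠ c ⊠ (p′ ⊠ d ⊠ k) ⊜ b ⊠ (a ⊠ ((p ⊠ p′) ⊠ (c ⊠ d)) ⊠ k)) F.refl _ _ _ _ _ _ _ ,
    Tr-* (Tr-* (Tr-resp F.refl (ℓ-symmetric e _ _) (ℓ-equivariant e zero first (mid first)))
      (Tr-* (Tr-resp F.refl (F.*-comm _ _) (Tr-* (Tr-∏ λ q → ℓ-equivariant e zero first (mid (mid q)))
                                                  (Tr-∏ λ q → ℓ-equivariant e zero (mid first) (mid (mid q)))))
        (Tr-resp F.refl (F.*-comm _ _) (Tr-* (h-equivariant e zero first) (h-equivariant e zero (mid first))))))
      (Tr-∏roots (λ p q → ℓ-equivariant e zero (mid (mid p)) (mid (mid q))) (λ p → h-equivariant e zero (mid (mid p))))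
    where
    P P′ K″ : F.Carrier
    P  = ∏ λ q → ℓ first (mid (mid q))
    P′ = ∏ λ q → ℓ (mid first) (mid (mid q))
    K″ = ∏roots (λ p q → ℓ (mid (mid p)) (mid (mid q))) (λ p → h (mid (mid p)))
  simple-divides {suc m} {s} {ℓ} {h} e (suc i) with simple-divides (equivariant-tail e) i
  ... | r , K≈ , t = ∏ε₁ ℓ h F.* r ,
    F.trans (F.*-congˡ K≈) (solveF 3 (λ a b c → a ⊠ (b ⊠ c) ⊜ b ⊠ (a ⊠ c)) F.refl _ _ _) ,
    Tr-* (Tr-* (Tr-resp F.refl (∏-· i (λ q → ℓ first (mid q))) (Tr-∏ λ q → ℓ-equivariant e (suc i) first (mid q)))
      (h-equivariant e (suc i) first)) t

  -- N is the inverse of the product KL. Since KL is a function and the σᵢ are central, the twisted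
  -- reflections move functions exactly as the old ones do; ℓ and h stay the same, and `symmetrizer`
  -- applies to `twisted`.
  module Twist {m} (S : System m) (σ : Gen m → Carrier)
    (σ-central : ∀ i x → σ i * x ≈ x * σ i) (σ-square : ∀ i → σ i * σ i ≈ 1#) (σ-braided : Braided σ)
    (ℓL : Pt m → Pt m → F.Carrier) (hL : Pt m → F.Carrier) (equivariant : Equivariant (s S) ℓL hL)
    (N : F.Carrier) (N-inverse : ∏roots ℓL hL F.* N F.≈ F.1#) where

    KL : F.Carrier
    KL = ∏roots ℓL hL

    σs s̃ : Gen m → Carrier
    σs i = σ i * s S i
    s̃ i  = φ KL * σs i * φ N

    N-KL : φ N * φ KL ≈ 1#
    N-KL = trans (sym (φ-* _ _)) (trans (φ-cong (F.trans (F.*-comm _ _) N-inverse)) φ-1)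

    KL-N : φ KL * φ N ≈ 1#
    KL-N = trans (sym (φ-* _ _)) (trans (φ-cong N-inverse) φ-1)

    conjugate : Carrier → Carrier
    conjugate x = φ KL * x * φ N

    conjugate-* : ∀ x y → conjugate x * conjugate y ≈ conjugate (x * y)
    conjugate-* x y = begin
      φ KL * x * φ N * (φ KL * y * φ N)    ≈⟨ solve (φ KL ∷ x ∷ φ N ∷ y ∷ []) (λ k x n y →
                                                k :* x :* n :* (k :* y :* n) := k :* x :* (n :* k) :* (y :* n)) ≡.refl ⟩
      φ KL * x * (φ N * φ KL) * (y * φ N)  ≈⟨ *-congʳ (trans (*-congˡ N-KL) (*-identityʳ _)) ⟩
      φ KL * x * (y * φ N)                 ≈⟨ solve (φ KL ∷ x ∷ φ N ∷ y ∷ []) (λ k x n y →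
                                                k :* x :* (y :* n) := k :* (x :* y) :* n) ≡.refl ⟩
      φ KL * (x * y) * φ N                 ∎

    conjugate-cong : ∀ {x y} → x ≈ y → conjugate x ≈ conjugate y
    conjugate-cong x≈y = *-congʳ (*-congˡ x≈y)

    conjugate-1 : conjugate 1# ≈ 1#
    conjugate-1 = trans (*-congʳ (*-identityʳ _)) KL-N

    conjugate-braided : ∀ {g : Gen m → Carrier} → Braided g → Braided (conjugate ∘ g)
    conjugate-braided {g} b = record
      { commute = λ i j h → trans (conjugate-* _ _) (trans (conjugate-cong (commute b i j h)) (sym (conjugate-* _ _)))
      ; triple = λ i j h k → trans (three _ _ _) (trans (conjugate-cong (triple b i j h k)) (sym (three _ _ _)))
      ; quadruple = λ i j h k → trans (four _ _ _ _) (trans (conjugate-cong (quadruple b i j h k)) (sym (four _ _ _ _))) }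
      where
      three : ∀ x y z → conjugate x * (conjugate y * conjugate z) ≈ conjugate (x * (y * z))
      three x y z = trans (*-congˡ (conjugate-* y z)) (conjugate-* _ _)
      four : ∀ x y z t → conjugate x * (conjugate y * (conjugate z * conjugate t)) ≈ conjugate (x * (y * (z * t)))
      four x y z t = trans (*-congˡ (three y z t)) (conjugate-* _ _)

    σs-braided : Braided σs
    σs-braided = record
      { commute = λ i j h → trans (two i j) (trans (*-cong (commute σ-braided i j h) (commute (s-braided S) i j h)) (sym (two j i)))
      ; triple = λ i j h k → trans (three i j i) (trans (*-cong (triple σ-braided i j h k) (triple (s-braided S) i j h k)) (sym (three j i j)))
      ; quadruple = λ i j h k → trans (four i j i j)
          (trans (*-cong (quadruple σ-braided i j h k) (quadruple (s-braided S) i j h k)) (sym (four j i j i))) }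
      where
      Central : Carrier → Set
      Central c = ∀ x → c * x ≈ x * c
      central-* : ∀ {c d} → Central c → Central d → Central (c * d)
      central-* {c} {d} C D x = trans (*-assoc _ _ _) (trans (*-congˡ (D x)) (trans (sym (*-assoc _ _ _))
        (trans (*-congʳ (C x)) (*-assoc _ _ _))))
      merge : ∀ i {c} y → Central c → σs i * (c * y) ≈ σ i * c * (s S i * y)
      merge i {c} y C = begin
        σ i * s S i * (c * y)      ≈⟨ solve (σ i ∷ s S i ∷ c ∷ y ∷ []) (λ a s c y →
                                        a :* s :* (c :* y) := a :* (s :* c) :* y) ≡.refl ⟩
        σ i * (s S i * c) * y      ≈⟨ *-congʳ (*-congˡ (C _)) ⟨
        σ i * (c * s S i) * y      ≈⟨ solve (σ i ∷ s S i ∷ c ∷ y ∷ []) (λ a s c y →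
                                        a :* (c :* s) :* y := a :* c :* (s :* y)) ≡.refl ⟩
        σ i * c * (s S i * y)      ∎
      two : ∀ i j → σs i * σs j ≈ (σ i * σ j) * (s S i * s S j)
      two i j = merge i (s S j) (σ-central j)
      three : ∀ i j k → σs i * (σs j * σs k) ≈ (σ i * (σ j * σ k)) * (s S i * (s S j * s S k))
      three i j k = trans (*-congˡ (two j k)) (merge i _ (central-* (σ-central j) (σ-central k)))
      four : ∀ i j k l → σs i * (σs j * (σs k * σs l)) ≈ (σ i * (σ j * (σ k * σ l))) * (s S i * (s S j * (s S k * s S l)))
      four i j k l = trans (*-congˡ (three j k l))
        (merge i _ (central-* (σ-central j) (central-* (σ-central k) (σ-central l))))

    Tr-s̃ : ∀ {i f g} → Tr (s S i) f g → Tr (s̃ i) f g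
    Tr-s̃ {i} {f} {g} (tr t) = tr (begin
      φ KL * (σ i * s S i) * φ N * φ f    ≈⟨ *-assoc _ _ _ ⟩
      φ KL * (σ i * s S i) * (φ N * φ f)  ≈⟨ *-congˡ (φ-comm N f) ⟩
      φ KL * (σ i * s S i) * (φ f * φ N)  ≈⟨ solve (φ KL ∷ σ i ∷ s S i ∷ φ f ∷ φ N ∷ []) (λ k a s f n →
                                               k :* (a :* s) :* (f :* n) := k :* a :* (s :* f) :* n) ≡.refl ⟩
      φ KL * σ i * (s S i * φ f) * φ N    ≈⟨ *-congʳ (*-congˡ t) ⟩
      φ KL * σ i * (φ g * s S i) * φ N    ≈⟨ solve (φ KL ∷ σ i ∷ s S i ∷ φ g ∷ φ N ∷ []) (λ k a s g n →
                                               k :* a :* (g :* s) :* n := k :* (a :* g) :* s :* n) ≡.refl ⟩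
      φ KL * (σ i * φ g) * s S i * φ N    ≈⟨ *-congʳ (*-congʳ (*-congˡ (σ-central i (φ g)))) ⟩
      φ KL * (φ g * σ i) * s S i * φ N    ≈⟨ solve (φ KL ∷ σ i ∷ s S i ∷ φ g ∷ φ N ∷ []) (λ k a s g n →
                                               k :* (g :* a) :* s :* n := k :* g :* (a :* s) :* n) ≡.refl ⟩
      φ KL * φ g * (σ i * s S i) * φ N    ≈⟨ *-congʳ (*-congʳ (φ-comm KL g)) ⟩
      φ g * φ KL * (σ i * s S i) * φ N    ≈⟨ solve (φ KL ∷ σs i ∷ φ g ∷ φ N ∷ []) (λ k a g n →
                                               g :* k :* a :* n := g :* (k :* a :* n)) ≡.refl ⟩
      φ g * (φ KL * (σ i * s S i) * φ N)  ∎)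

    twisted : System m
    twisted = record
      { s = s̃
      ; s-involutive = λ i → trans (conjugate-* _ _) (trans (conjugate-cong (begin
          σ i * s S i * (σ i * s S i)   ≈⟨ solve (σ i ∷ s S i ∷ []) (λ a s → a :* s :* (a :* s) := a :* (s :* a) :* s) ≡.refl ⟩
          σ i * (s S i * σ i) * s S i   ≈⟨ *-congʳ (*-congˡ (σ-central i _)) ⟨
          σ i * (σ i * s S i) * s S i   ≈⟨ solve (σ i ∷ s S i ∷ []) (λ a s → a :* (a :* s) :* s := a :* a :* (s :* s)) ≡.refl ⟩
          σ i * σ i * (s S i * s S i)   ≈⟨ *-cong (σ-square i) (s-involutive S i) ⟩
          1# * 1#                       ≈⟨ *-identityˡ _ ⟩
          1#                            ∎)) conjugate-1)
      ; s-braided = conjugate-braided σs-braided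
      ; z = z S
      ; z-transport = λ i p → Tr-s̃ (z-transport S i p)
      ; z-separates = z-separates S
      ; ℓ = ℓ S
      ; h = h S
      ; ℓ-transport = λ i p q → Tr-s̃ (ℓ-transport S i p q)
      ; h-transport = λ i p → Tr-s̃ (h-transport S i p)
      ; ℓ-sym = ℓ-sym S
      ; θℓ = θℓ S
      ; θh = θh S
      ; θℓ-central = θℓ-central S
      ; θh-central = θh-central S
      ; ℓ-quadratic = ℓ-quadratic S
      ; h-quadratic = h-quadratic S
      ; A₂-identity = A₂-identity S
      ; B₂-identity = B₂-identity S
      }

    -- KL = l R with R fixed by sᵢ. Hence R passes through the reflection and meets N l, where R N l
    -- = 1. All that remains of the conjugation is the factor l on the left.
    E-twisted : ∀ i r → k S i F.≈ simple ℓL hL i F.* r →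
                E twisted i ≈ φ (simple ℓL hL i) * (1# + σs i) * φ r
    E-twisted i r k≈ = begin
      (1# + φ KL * σs i * φ N) * φ (k S i)
        ≈⟨ trans (distribʳ _ _ _) (+-congʳ (*-identityˡ _)) ⟩
      φ (k S i) + φ KL * σs i * φ N * φ (k S i)
        ≈⟨ +-cong (trans (φ-cong k≈) (φ-* _ _)) (*-cong (*-congʳ (*-congʳ (trans (φ-cong K≈) (φ-* _ _)))) (trans (φ-cong k≈) (φ-* _ _))) ⟩
      φ l * φ r + φ l * φ R * σs i * φ N * (φ l * φ r)
        ≈⟨ solve (φ l ∷ φ r ∷ φ R ∷ σ i ∷ s S i ∷ φ N ∷ []) (λ l r R a s n →
             l :* r :+ l :* R :* (a :* s) :* n :* (l :* r) := l :* r :+ l :* (R :* a) :* s :* (n :* l) :* r) ≡.refl ⟩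
      φ l * φ r + φ l * (φ R * σ i) * s S i * (φ N * φ l) * φ r
        ≈⟨ +-congˡ (*-congʳ (*-cong (*-congʳ (*-congˡ (sym (σ-central i (φ R))))) (sym (φ-* N l)))) ⟩
      φ l * φ r + φ l * (σ i * φ R) * s S i * φ (N F.* l) * φ r
        ≈⟨ solve (φ l ∷ φ r ∷ φ R ∷ σ i ∷ s S i ∷ φ (N F.* l) ∷ []) (λ l r R a s n →
             l :* r :+ l :* (a :* R) :* s :* n :* r := l :* r :+ l :* a :* (R :* s) :* n :* r) ≡.refl ⟩
      φ l * φ r + φ l * σ i * (φ R * s S i) * φ (N F.* l) * φ r
        ≈⟨ +-congˡ (*-congʳ (*-congʳ (*-congˡ (sym (transport R-fixed))))) ⟩
      φ l * φ r + φ l * σ i * (s S i * φ R) * φ (N F.* l) * φ r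
        ≈⟨ solve (φ l ∷ φ r ∷ φ R ∷ σ i ∷ s S i ∷ φ (N F.* l) ∷ []) (λ l r R a s n →
             l :* r :+ l :* a :* (s :* R) :* n :* r := l :* r :+ l :* (a :* s) :* (R :* n) :* r) ≡.refl ⟩
      φ l * φ r + φ l * σs i * (φ R * φ (N F.* l)) * φ r
        ≈⟨ +-congˡ (*-congʳ (*-congˡ (trans (sym (φ-* _ _)) (trans (φ-cong R-inverse) φ-1)))) ⟩
      φ l * φ r + φ l * σs i * 1# * φ r
        ≈⟨ solve (φ l ∷ φ r ∷ σs i ∷ []) (λ l r a → l :* r :+ l :* a :* :1 :* r := l :* (:1 :+ a) :* r) ≡.refl ⟩
      φ l * (1# + σs i) * φ r ∎
      where
      l = simple ℓL hL i
      divides = simple-divides equivariant i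
      R = proj₁ divides
      K≈ = proj₁ (proj₂ divides)
      R-fixed = proj₂ (proj₂ divides)
      R-inverse : R F.* (N F.* l) F.≈ F.1#
      R-inverse = F.trans (solveF 3 (λ R n l → R ⊠ (n ⊠ l) ⊜ l ⊠ R ⊠ n) F.refl R N l)
        (F.trans (F.*-congʳ (F.sym K≈)) N-inverse)

    ⟦s̃⟧ : ∀ v → ⟦ s̃ ⟧ v ≈ conjugate (⟦ σs ⟧ v)
    ⟦s̃⟧ []      = sym conjugate-1
    ⟦s̃⟧ (i ∷ v) = trans (*-congˡ (⟦s̃⟧ v)) (conjugate-* _ _)

    twisted-braided : ∀ (g : Gen m → Carrier) (r : Gen m → F.Carrier) →
      (∀ i → k S i F.≈ simple ℓL hL i F.* r i) →
      (∀ i → g i + 1# ≈ φ (simple ℓL hL i) * (1# + σs i) * φ (r i)) → Braided g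
    twisted-braided g r k≈ g≈ = braided-resp (λ i → sym (begin
        g i                 ≈⟨ solve (g i ∷ []) (λ g → g := g :+ :1 :- :1) ≡.refl ⟩
        g i + 1# - 1#       ≈⟨ +-congʳ (trans (g≈ i) (sym (E-twisted i (r i) (k≈ i)))) ⟩
        E twisted i - 1#    ∎)) (τ-braided twisted)

    -- The conjugations telescope along each word, and the final N cancels against the factor KL of
    -- K.
    twisted-symmetrizer : ∀ (g : Gen m → Carrier) (r : Gen m → F.Carrier) KR →
      (∀ i → k S i F.≈ simple ℓL hL i F.* r i) → K S F.≈ KL F.* KR →
      (∀ i → g i + 1# ≈ φ (simple ℓL hL i) * (1# + σs i) * φ (r i)) →
      ∑words g ≈ φ KL * ∑words σs * φ KR
    twisted-symmetrizer g r KR k≈ K≈ g≈ = begin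
      ∑words g
        ≈⟨ ∑ₙ-cong {m} (λ x → ⟦⟧-cong g≈τ (word x)) ⟩
      ∑words (τ twisted)
        ≈⟨ symmetrizer twisted ⟩
      ∑words s̃ * φ (K S)
        ≈⟨ *-cong (trans (∑ₙ-cong {m} λ x → ⟦s̃⟧ (word x))
             (trans (∑ₙ-*ʳ {m} (φ N) λ x → φ KL * ⟦ σs ⟧ (word x)) (*-congʳ (∑ₙ-*ˡ {m} (φ KL) λ x → ⟦ σs ⟧ (word x)))))
             (trans (φ-cong K≈) (φ-* _ _)) ⟩
      φ KL * ∑words σs * φ N * (φ KL * φ KR)
        ≈⟨ solve (φ KL ∷ ∑words σs ∷ φ N ∷ φ KR ∷ []) (λ k e n r → k :* e :* n :* (k :* r) := k :* e :* (n :* k) :* r) ≡.refl ⟩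
      φ KL * ∑words σs * (φ N * φ KL) * φ KR
        ≈⟨ *-congʳ (trans (*-congˡ N-KL) (*-identityʳ _)) ⟩
      φ KL * ∑words σs * φ KR ∎
      where
      g≈τ : ∀ i → g i ≈ τ twisted i
      g≈τ i = begin
        g i                 ≈⟨ solve (g i ∷ []) (λ g → g := g :+ :1 :- :1) ≡.refl ⟩
        g i + 1# - 1#       ≈⟨ +-congʳ (trans (g≈ i) (sym (E-twisted i (r i) (k≈ i)))) ⟩
        E twisted i - 1#    ∎

-- Laurent monomials as rational functions

module _ (R : CommutativeRing 0ℓ 0ℓ) where
  open CommutativeRing R hiding (zero)
  open Polynomial R

  term-cong : ∀ k {a b} → a ≈ b → term k a ≈ₚ term k b
  term-cong zero    a≈b = coeffs λ { zero → a≈b ; (suc _) → refl }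
  term-cong (suc k) a≈b = coeffs λ { zero → refl ; (suc l) → at (term-cong k a≈b) l }

  term-* : ∀ k l a b → (term k a *ₚ term l b) ≈ₚ term (k ℕ.+ l) (a * b)
  term-* zero l a b = coeffs λ i → trans (*ₚ-const a (term l b) i) (scaled l i)
    where
    scaled : ∀ l i → a * coeff (term l b) i ≈ coeff (term l (a * b)) i
    scaled zero    zero    = refl
    scaled zero    (suc i) = zeroʳ a
    scaled (suc l) zero    = zeroʳ a
    scaled (suc l) (suc i) = scaled l i
  term-* (suc k) l a b = coeffs λ i → trans (coeff-+ (map (0# *_) (term l b)) _ i)
    (trans (+-congʳ (trans (coeff-scale 0# (term l b) i) (zeroˡ _))) (trans (+-identityˡ _) (shifted i)))
    where
    shifted : ∀ i → coeff (0# ∷ (term k a *ₚ term l b)) i ≈ coeff (0# ∷ term (k ℕ.+ l) (a * b)) i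
    shifted zero    = refl
    shifted (suc i) = at (term-* k l a b) i

module LaurentMonomials (R : CommutativeRing 0ℓ 0ℓ) where
  private module R = CommutativeRing R
  open RationalFunctions R

  module P n = CommutativeRing (PolyRing n)
  module Q n = CommutativeRing (RatFun n)

  monomial-cong : ∀ n {c d e f} → c R.≈ d → e ≗ f → P._≈_ n (monomial n c e) (monomial n d f)
  monomial-cong zero    c≈d e≗f = c≈d
  monomial-cong (suc n) {c} {d} {e} {f} c≈d e≗f = P.trans (suc n)
    (term-cong (PolyRing n) (e zero) (monomial-cong n c≈d (e≗f ∘ suc)))
    (P.reflexive (suc n) (cong (λ k → Polynomial.term (PolyRing n) k (monomial n d (f ∘ suc))) (e≗f zero)))

  monomial-* : ∀ n c d e f →
    P._≈_ n (P._*_ n (monomial n c e) (monomial n d f)) (monomial n (c R.* d) (λ i → e i ℕ.+ f i))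
  monomial-* zero    c d e f = R.refl
  monomial-* (suc n) c d e f = P.trans (suc n) (term-* (PolyRing n) (e zero) (f zero) _ _)
    (term-cong (PolyRing n) (e zero ℕ.+ f zero) (monomial-* n c d (e ∘ suc) (f ∘ suc)))

  monomial-1 : ∀ n → P._≈_ n (monomial n R.1# λ _ → 0) (P.1# n)
  monomial-1 zero    = R.refl
  monomial-1 (suc n) = term-cong (PolyRing n) 0 (monomial-1 n)

  laurent-cong : ∀ n {c d a b} → c R.≈ d → a ≗ b → Q._≈_ n (laurent n c a) (laurent n d b)
  laurent-cong n c≈d a≗b = Fraction.crossMultiplied (P.*-cong n
    (monomial-cong n c≈d (λ i → cong _⁺ (a≗b i)))
    (P.sym n (monomial-cong n R.refl (λ i → cong _⁻ (a≗b i)))))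

  split : ∀ k → + (k ⁺) ≡ k ℤ.+ + (k ⁻)
  split (+ k)    = ≡.sym (ℤ.+-identityʳ (+ k))
  split -[1+ k ] = ≡.sym (ℤ.n⊖n≡0 (suc k))

  -- These are the cross-multiplied exponents of the fractions x^k x^l and x^(k + l), which may
  -- differ by a common factor. In ℤ the equality follows from k⁺ = k + k⁻.
  ⁺-⁻ : ∀ k l → (k ⁺ ℕ.+ l ⁺) ℕ.+ (k ℤ.+ l) ⁻ ≡ (k ℤ.+ l) ⁺ ℕ.+ (k ⁻ ℕ.+ l ⁻)
  ⁺-⁻ k l = ℤ.+-injective (begin
    + (k ⁺) ℤ.+ + (l ⁺) ℤ.+ + d            ≡⟨ cong₂ (λ x y → x ℤ.+ y ℤ.+ + d) (split k) (split l) ⟩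
    k ℤ.+ + (k ⁻) ℤ.+ (l ℤ.+ + (l ⁻)) ℤ.+ + d  ≡⟨ solve 5 (λ k k⁻ l l⁻ d →
         k :+ k⁻ :+ (l :+ l⁻) :+ d := k :+ l :+ d :+ (k⁻ :+ l⁻)) ≡.refl k (+ (k ⁻)) l (+ (l ⁻)) (+ d) ⟩
    k ℤ.+ l ℤ.+ + d ℤ.+ (+ (k ⁻) ℤ.+ + (l ⁻))  ≡⟨ cong (ℤ._+ (+ (k ⁻) ℤ.+ + (l ⁻))) (split (k ℤ.+ l)) ⟨
    + ((k ℤ.+ l) ⁺) ℤ.+ (+ (k ⁻) ℤ.+ + (l ⁻))  ∎)
    where
    open ≡.≡-Reasoning
    open SemiringSolver ℤ.+-*-commutativeSemiring
    d = (k ℤ.+ l) ⁻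

  laurent-* : ∀ n c d a b →
    Q._≈_ n (Q._*_ n (laurent n c a) (laurent n d b)) (laurent n (c R.* d) (λ i → a i ℤ.+ b i))
  laurent-* n c d a b = Fraction.crossMultiplied (begin
    M c a⁺ * M d b⁺ * M R.1# ab⁻           ≈⟨ *-congʳ (monomial-* n c d a⁺ b⁺) ⟩
    M (c R.* d) _ * M R.1# ab⁻             ≈⟨ monomial-* n (c R.* d) R.1# _ ab⁻ ⟩
    M (c R.* d R.* R.1#) _                 ≈⟨ monomial-cong n (R.*-congˡ (R.sym (R.*-identityʳ R.1#))) (λ i → ⁺-⁻ (a i) (b i)) ⟩
    M (c R.* d R.* (R.1# R.* R.1#)) _      ≈⟨ monomial-* n (c R.* d) (R.1# R.* R.1#) ab⁺ _ ⟨
    M (c R.* d) ab⁺ * M (R.1# R.* R.1#) _  ≈⟨ *-congˡ (monomial-* n R.1# R.1# a⁻ b⁻) ⟨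
    M (c R.* d) ab⁺ * (M R.1# a⁻ * M R.1# b⁻) ∎)
    where
    open P n using (_*_; *-congʳ; *-congˡ)
    open import Relation.Binary.Reasoning.Setoid (P.setoid n)
    M = monomial n
    a⁺ a⁻ b⁺ b⁻ ab⁺ ab⁻ : Fin n → ℕ
    a⁺ i = a i ⁺
    a⁻ i = a i ⁻
    b⁺ i = b i ⁺
    b⁻ i = b i ⁻
    ab⁺ i = (a i ℤ.+ b i) ⁺
    ab⁻ i = (a i ℤ.+ b i) ⁻

  laurent-constant : ∀ n c {a} → a ≗ (λ _ → 0ℤ) → Q._≈_ n (laurent n c a) (constant n c)
  laurent-constant n c {a} a≗0 = Fraction.crossMultiplied (P.*-cong n
    (monomial-cong n R.refl (λ i → cong _⁺ (a≗0 i)))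
    (P.sym n (P.trans n (monomial-cong n R.refl (λ i → cong _⁻ (a≗0 i))) (monomial-1 n))))

  constant-cong : ∀ n {c d} → c R.≈ d → Q._≈_ n (constant n c) (constant n d)
  constant-cong n c≈d = Fraction.crossMultiplied (P.*-congʳ n (monomial-cong n c≈d λ _ → ≡.refl))

  constant-* : ∀ n c d → Q._≈_ n (Q._*_ n (constant n c) (constant n d)) (constant n (c R.* d))
  constant-* n c d = Fraction.crossMultiplied (P.*-cong n (monomial-* n c d _ _) (P.sym n (P.*-identityˡ n _)))

  constant-1 : ∀ n → Q._≈_ n (constant n R.1#) (Q.1# n)
  constant-1 n = Fraction.crossMultiplied (P.*-congʳ n (monomial-1 n))

  laurent-scale : ∀ n c d a → Q._≈_ n (Q._*_ n (constant n c) (laurent n d a)) (laurent n (c R.* d) a)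
  laurent-scale n c d a = Fraction.crossMultiplied (P.*-cong n (monomial-* n c d (λ _ → 0) (λ i → a i ⁺))
    (P.sym n (P.*-identityˡ n _)))

  monomial-neg : ∀ n c e → P._≈_ n (monomial n (R.- c) e) (P.-_ n (monomial n c e))
  monomial-neg zero    c e = R.refl
  monomial-neg (suc n) c e = P.trans (suc n) (term-cong (PolyRing n) (e zero) (monomial-neg n c (e ∘ suc)))
    (term-neg (e zero) (monomial n c (e ∘ suc)))
    where
    term-neg : ∀ k a → Polynomial._≈ₚ_ (PolyRing n) (Polynomial.term (PolyRing n) k (P.-_ n a))
                         (Polynomial.-ₚ_ (PolyRing n) (Polynomial.term (PolyRing n) k a))
    term-neg zero    a = P.refl (suc n)
    term-neg (suc k) a = Polynomial.coeffs λ
      { zero → P.sym n (RingProperties.-0#≈0# (CommutativeRing.ring (PolyRing n)))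
      ; (suc l) → Polynomial.at (term-neg k a) l }

  constant-neg : ∀ n c → Q._≈_ n (constant n (R.- c)) (Q.-_ n (constant n c))
  constant-neg n c = Fraction.crossMultiplied (P.*-congʳ n (monomial-neg n c (λ _ → 0)))

  zero? : ∀ {k} (a : Fin k → ℤ) → (∃[ i ] a i ≢ 0ℤ) ⊎ (∀ i → a i ≡ 0ℤ)
  zero? a with Fin.all? (λ i → a i ℤ.≟ 0ℤ)
  ... | yes a≡0 = inj₂ a≡0
  ... | no a≢0  = inj₁ (Fin.¬∀⟶∃¬ _ _ (λ i → a i ℤ.≟ 0ℤ) a≢0)

  Unit : Set
  Unit = Σ[ c ∈ R.Carrier ] Regular R c

  module _ (n : ℕ) where
    private
      module Qn = CommutativeRing (RatFun n)
      one-minus-nonzero : ∀ (c : Unit) a → (∃[ i ] a i ≢ 0ℤ) → Fraction.Nonzero (PolyRing n) (Qn.1# Qn.- laurent n (proj₁ c) a)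
      one-minus-nonzero c a a≢0 = 1-laurent-nonzero n a a≢0 (proj₂ c)

    monomialFun : (Fin n → ℤ) → Qn.Carrier
    monomialFun = laurent n R.1#

    -- The default 1 at a = 0, where 1 - c may vanish, makes both functions total. Values at roots
    -- can then be written down for all pairs of points, also for p and -p, whose sum is zero.
    lin lin⁻¹ : Unit → (Fin n → ℤ) → Qn.Carrier
    lin c a with zero? a
    ... | inj₁ _ = Qn.1# Qn.- laurent n (proj₁ c) a
    ... | inj₂ _ = Qn.1#
    lin⁻¹ c a with zero? a
    ... | inj₁ a≢0 = Fraction.inverse (PolyRing n) (Qn.1# Qn.- laurent n (proj₁ c) a) (one-minus-nonzero c a a≢0)
    ... | inj₂ _   = Qn.1#

    lin-inverse : ∀ c a → lin c a Qn.* lin⁻¹ c a Qn.≈ Qn.1#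
    lin-inverse c a with zero? a
    ... | inj₁ a≢0 = Fraction.inverseʳ (PolyRing n) (Qn.1# Qn.- laurent n (proj₁ c) a) (one-minus-nonzero c a a≢0)
    ... | inj₂ _   = Qn.*-identityˡ Qn.1#

    laurent-split : ∀ c a → laurent n c a Qn.≈ constant n c Qn.* monomialFun a
    laurent-split c a = Qn.sym {constant n c Qn.* monomialFun a} {laurent n c a}
      (Qn.trans {constant n c Qn.* monomialFun a} {laurent n (c R.* R.1#) a} {laurent n c a}
      (laurent-scale n c R.1# a) (laurent-cong n {c R.* R.1#} {c} {a} {a} (R.*-identityʳ c) λ _ → ≡.refl))

    lin-nonzero : ∀ c a → ¬ (∀ i → a i ≡ 0ℤ) → lin c a Qn.≈ Qn.1# Qn.- constant n (proj₁ c) Qn.* monomialFun a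
    lin-nonzero c a a≢0 with zero? a
    ... | inj₁ _   = Qn.+-congˡ {Qn.1#} {Qn.- laurent n (proj₁ c) a} {Qn.- (constant n (proj₁ c) Qn.* monomialFun a)}
                       (Qn.-‿cong {laurent n (proj₁ c) a} {constant n (proj₁ c) Qn.* monomialFun a} (laurent-split (proj₁ c) a))
    ... | inj₂ a≡0 = ⊥-elim (a≢0 a≡0)

    lin-cong : ∀ c {a b} → a ≗ b → lin c a Qn.≈ lin c b
    lin-cong c {a} {b} a≗b with zero? a | zero? b
    ... | inj₁ _         | inj₁ _         = Qn.+-congˡ {Qn.1#} {Qn.- laurent n (proj₁ c) a} {Qn.- laurent n (proj₁ c) b}
                                              (Qn.-‿cong {laurent n (proj₁ c) a} {laurent n (proj₁ c) b} (laurent-cong n R.refl a≗b))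
    ... | inj₁ (i , a≢0) | inj₂ b≡0       = ⊥-elim (a≢0 (≡.trans (a≗b i) (b≡0 i)))
    ... | inj₂ a≡0       | inj₁ (i , b≢0) = ⊥-elim (b≢0 (≡.trans (≡.sym (a≗b i)) (a≡0 i)))
    ... | inj₂ _         | inj₂ _         = Qn.refl {Qn.1#}

    monomialFun-cong : ∀ {a b} → a ≗ b → monomialFun a Qn.≈ monomialFun b
    monomialFun-cong = laurent-cong n R.refl

    monomialFun-* : ∀ a b → monomialFun a Qn.* monomialFun b Qn.≈ monomialFun (λ i → a i ℤ.+ b i)
    monomialFun-* a b = Qn.trans {monomialFun a Qn.* monomialFun b} {laurent n (R.1# R.* R.1#) (λ i → a i ℤ.+ b i)} {monomialFun (λ i → a i ℤ.+ b i)}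
      (laurent-* n R.1# R.1# a b) (laurent-cong n {R.1# R.* R.1#} {R.1#} (R.*-identityˡ R.1#) (λ _ → ≡.refl))

    monomialFun-0 : ∀ {a} → (∀ i → a i ≡ 0ℤ) → monomialFun a Qn.≈ Qn.1#
    monomialFun-0 {a} a≡0 = Qn.trans {monomialFun a} {constant n R.1#} {Qn.1#} (laurent-constant n R.1# a≡0) (constant-1 n)

    module Transport (A : Ring 0ℓ 0ℓ) (Φ : FunctionMap (RatFun n) A)
      (central : ∀ c x → Ring._≈_ A (Ring._*_ A (FunctionMap.φ Φ (constant n c)) x) (Ring._*_ A x (FunctionMap.φ Φ (constant n c)))) where
      open Hecke A (RatFun n) Φ using (Tr; tr; Tr-*; Tr-1; Tr-sub; Tr-resp)

      laurent-transport : ∀ {x} c {a b} → Tr x (monomialFun a) (monomialFun b) → Tr x (laurent n c a) (laurent n c b)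
      laurent-transport {x} c {a} {b} t = Tr-resp
        (Qn.sym {laurent n c a} {constant n c Qn.* monomialFun a} (laurent-split c a))
        (Qn.sym {laurent n c b} {constant n c Qn.* monomialFun b} (laurent-split c b))
        (Tr-* {x} {constant n c} {constant n c} {monomialFun a} {monomialFun b} (tr (Ring.sym A (central c x))) t)

      lin-transport : ∀ {x} c {a b} → ((∀ i → a i ≡ 0ℤ) → ∀ i → b i ≡ 0ℤ) → ((∀ i → b i ≡ 0ℤ) → ∀ i → a i ≡ 0ℤ) →
        Tr x (monomialFun a) (monomialFun b) → Tr x (lin c a) (lin c b)
      lin-transport c {a} {b} a⇒b b⇒a t with zero? a | zero? b
      ... | inj₁ _         | inj₁ _         = Tr-sub Tr-1 (laurent-transport (proj₁ c) t)
      ... | inj₁ (i , a≢0) | inj₂ b≡0       = ⊥-elim (a≢0 (b⇒a b≡0 i))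
      ... | inj₂ a≡0       | inj₁ (i , b≢0) = ⊥-elim (b≢0 (a⇒b a≡0 i))
      ... | inj₂ _         | inj₂ _         = Tr-1

-- Lattice coordinates and the orbit of ε₁

-- ev a p is the coefficient of a along p, so that ev a (neg p) = - ev a p.
ev : ∀ {m} → (Gen m → ℤ) → Pt m → ℤ
ev a first   = a zero
ev a last    = ℤ.- a zero
ev a (mid p) = ev (a ∘ suc) p

pos : ∀ {m} → Gen m → Pt m
pos zero            = first
pos {suc m} (suc i) = mid (pos i)

ev-pos : ∀ {m} (a : Gen m → ℤ) i → ev a (pos i) ≡ a i
ev-pos         a zero    = ≡.refl
ev-pos {suc m} a (suc i) = ev-pos (a ∘ suc) i

ev-neg : ∀ {m} (a : Gen m → ℤ) p → ev a (neg p) ≡ ℤ.- ev a p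
ev-neg a first   = ≡.refl
ev-neg a last    = ≡.sym (ℤ.neg-involutive (a zero))
ev-neg a (mid p) = ev-neg (a ∘ suc) p

ev-cong : ∀ {m} {a b : Gen m → ℤ} → a ≗ b → ∀ p → ev a p ≡ ev b p
ev-cong a≗b first   = a≗b zero
ev-cong a≗b last    = cong ℤ.-_ (a≗b zero)
ev-cong a≗b (mid p) = ev-cong (a≗b ∘ suc) p

ev-0 : ∀ {m} p → ev {m} (λ _ → 0ℤ) p ≡ 0ℤ
ev-0 first   = ≡.refl
ev-0 last    = ≡.refl
ev-0 (mid p) = ev-0 p

ev-+ : ∀ {m} (a b : Gen m → ℤ) p → ev (λ i → a i ℤ.+ b i) p ≡ ev a p ℤ.+ ev b p
ev-+ a b first   = ≡.refl
ev-+ a b last    = ℤ.neg-distrib-+ (a zero) (b zero)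
ev-+ a b (mid p) = ev-+ (a ∘ suc) (b ∘ suc) p

ev-odd : ∀ {m} (f : Pt m → ℤ) → (∀ p → f (neg p) ≡ ℤ.- f p) → ∀ p → ev (f ∘ pos) p ≡ f p
ev-odd f odd first   = ≡.refl
ev-odd f odd last    = ≡.sym (odd first)
ev-odd f odd (mid p) = ev-odd (f ∘ mid) (odd ∘ mid) p

infixr 8 _▹_
-- The action of sᵢ on the lattice: as sᵢ is an isometric involution, the coefficient along εⱼ is
-- the old one along sᵢ εⱼ.
_▹_ : ∀ {m} → Gen m → (Gen m → ℤ) → Gen m → ℤ
(i ▹ a) j = ev a (i · pos j)

ev-▹ : ∀ {m} i (a : Gen m → ℤ) p → ev (i ▹ a) p ≡ ev a (i · p)
ev-▹ i a = ev-odd (λ p → ev a (i · p)) (λ p → ≡.trans (cong (ev a) (·-neg i p)) (ev-neg a (i · p)))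

vec : ∀ {m} → Pt m → Gen m → ℤ
vec first   zero    = 1ℤ
vec first   (suc i) = 0ℤ
vec last    zero    = -1ℤ
vec last    (suc i) = 0ℤ
vec (mid p) zero    = 0ℤ
vec (mid p) (suc i) = vec p i

vec-neg : ∀ {m} (p : Pt m) i → vec (neg p) i ≡ ℤ.- vec p i
vec-neg first   zero    = ≡.refl
vec-neg first   (suc i) = ≡.refl
vec-neg last    zero    = ≡.refl
vec-neg last    (suc i) = ≡.refl
vec-neg (mid p) zero    = ≡.refl
vec-neg (mid p) (suc i) = vec-neg p i

▹-vec : ∀ {m} i (p : Pt m) → i ▹ vec p ≗ vec (i · p)
▹-vec {zero}  zero    first zero = ≡.refl
▹-vec {zero}  zero    last  zero = ≡.refl
▹-vec {suc m} zero    first zero = ≡.refl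
▹-vec {suc m} zero    first (suc zero) = ≡.refl
▹-vec {suc (suc m)} zero first (suc (suc j)) = ev-0 (pos j)
▹-vec {suc m} zero    last  zero = ≡.refl
▹-vec {suc m} zero    last  (suc zero) = ≡.refl
▹-vec {suc (suc m)} zero last (suc (suc j)) = ev-0 (pos j)
▹-vec {suc m} zero    (mid first) zero = ≡.refl
▹-vec {suc m} zero    (mid first) (suc zero) = ≡.refl
▹-vec {suc (suc m)} zero (mid first) (suc (suc j)) = ev-0 (pos j)
▹-vec {suc m} zero    (mid last) zero = ≡.refl
▹-vec {suc m} zero    (mid last) (suc zero) = ≡.refl
▹-vec {suc (suc m)} zero (mid last) (suc (suc j)) = ev-0 (pos j)
▹-vec {suc (suc m)} zero (mid (mid p)) zero = ≡.refl
▹-vec {suc (suc m)} zero (mid (mid p)) (suc zero) = ≡.refl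
▹-vec {suc (suc m)} zero (mid (mid p)) (suc (suc j)) = ev-pos (vec p) j
▹-vec {suc m} (suc i) first zero = ≡.refl
▹-vec {suc m} (suc i) first (suc j) = ev-0 (i · pos j)
▹-vec {suc m} (suc i) last zero = ≡.refl
▹-vec {suc m} (suc i) last (suc j) = ev-0 (i · pos j)
▹-vec {suc m} (suc i) (mid p) zero = ≡.refl
▹-vec {suc m} (suc i) (mid p) (suc j) = ▹-vec i p j

ev-vec-refl : ∀ {m} (p : Pt m) → ev (vec p) p ≡ 1ℤ
ev-vec-refl first   = ≡.refl
ev-vec-refl last    = ≡.refl
ev-vec-refl (mid p) = ev-vec-refl p

-- Along the orbit the coefficients of p are 0, 1 and -1, with 1 at p only. Points can thus be told
-- apart by lattice vectors, which compares the two notions of equality in the group.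
ev-vec-1 : ∀ {m} (p q : Pt m) → ev (vec p) q ≡ 1ℤ → p ≡ q
ev-vec-1 first   first   h = ≡.refl
ev-vec-1 first   (mid q) h with ≡.trans (≡.sym (ev-0 q)) h
... | ()
ev-vec-1 last    last    h = ≡.refl
ev-vec-1 last    (mid q) h with ≡.trans (≡.sym (ev-0 q)) h
... | ()
ev-vec-1 (mid p) (mid q) h = cong mid (ev-vec-1 p q h)

vec-injective : ∀ {m} (p q : Pt m) → vec p ≗ vec q → p ≡ q
vec-injective p q h = ev-vec-1 p q (≡.trans (ev-cong h q) (ev-vec-refl q))

-- Nodes of the diagram and generators

module Nodes (𝕜 : CommutativeRing 0ℓ 0ℓ) where
  module L m = LocalizedDAHA 𝕜 m
  open LocalizedDAHA using (swap; flip; finite)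

  shiftNode : ∀ {m} → L.FiniteNode m → L.FiniteNode (suc m)
  shiftNode (swap j) = swap (suc j)
  shiftNode flip     = flip

  toNode : ∀ {m} → Gen m → L.FiniteNode m
  toNode {zero}  zero    = flip
  toNode {suc m} zero    = swap zero
  toNode {suc m} (suc i) = shiftNode (toNode i)

  fromNode : ∀ {m} → L.FiniteNode m → Gen m
  fromNode (swap j)   = inject₁ j
  fromNode {m} flip   = fromℕ m

  to-from : ∀ {m} (x : L.FiniteNode m) → toNode (fromNode x) ≡ x
  to-from {suc m} (swap zero)    = ≡.refl
  to-from {suc m} (swap (suc j)) = cong shiftNode (to-from (swap j))
  to-from {zero}  flip           = ≡.refl
  to-from {suc m} flip           = cong shiftNode (to-from {m} flip)

  from-to : ∀ {m} (i : Gen m) → fromNode (toNode i) ≡ i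
  from-to {zero}  zero    = ≡.refl
  from-to {suc m} zero    = ≡.refl
  from-to {suc m} (suc i) = ≡.trans (shifted (toNode i)) (cong suc (from-to i))
    where
    shifted : ∀ {m} (x : L.FiniteNode m) → fromNode (shiftNode x) ≡ suc (fromNode x)
    shifted (swap j) = ≡.refl
    shifted flip     = ≡.refl

  transpose-suc : ∀ {n} (i j k : Fin n) → transpose (suc i) (suc j) (suc k) ≡ suc (transpose i j k)
  transpose-suc i j k with does (k Fin.≟ i)
  ... | true = ≡.refl
  ... | false with does (k Fin.≟ j)
  ...   | true  = ≡.refl
  ...   | false = ≡.refl

  reflect-shift-zero : ∀ {m} (x : L.FiniteNode m) a k →
    proj₁ (L.reflect (suc m) (finite (shiftNode x)) (a , k)) zero ≡ a zero
  reflect-shift-zero (swap j) a k = ≡.refl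
  reflect-shift-zero flip     a k = ≡.refl

  reflect-shift-suc : ∀ {m} (x : L.FiniteNode m) a k j →
    proj₁ (L.reflect (suc m) (finite (shiftNode x)) (a , k)) (suc j) ≡
    proj₁ (L.reflect m (finite x) (a ∘ suc , k)) j
  reflect-shift-suc (swap i) a k j = cong a (transpose-suc (inject₁ i) (suc i) j)
  reflect-shift-suc flip     a k j = ≡.refl

  reflect-toNode : ∀ {m} i a k → proj₁ (L.reflect m (finite (toNode i)) (a , k)) ≗ i ▹ a
  reflect-toNode {zero}  zero a k zero = ≡.refl
  reflect-toNode {suc m} zero a k zero = ≡.refl
  reflect-toNode {suc m} zero a k (suc zero) = ≡.refl
  reflect-toNode {suc (suc m)} zero a k (suc (suc j)) = ≡.sym (ev-pos (λ i → a (suc (suc i))) j)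
  reflect-toNode {suc m} (suc i) a k zero = reflect-shift-zero (toNode i) a k
  reflect-toNode {suc m} (suc i) a k (suc j) =
    ≡.trans (reflect-shift-suc (toNode i) a k j) (reflect-toNode i (a ∘ suc) k j)

  reflect-finite-δ : ∀ {m} (x : L.FiniteNode m) μ → proj₂ (L.reflect m (finite x) μ) ≡ proj₂ μ
  reflect-finite-δ (swap j) μ = ≡.refl
  reflect-finite-δ flip     μ = ≡.refl

  toℕ-swap : ∀ {m} (i : Gen m) {j} → toNode i ≡ swap j → toℕ j ≡ toℕ i
  toℕ-swap i e = ≡.trans (≡.sym (Fin.toℕ-inject₁ _)) (cong toℕ (≡.trans (≡.sym (cong fromNode e)) (from-to i)))

  -- Coefficients are contravariant: a word applied to a vector amounts to the inverse word applied
  -- to the point, which is what `pull` computes.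
  ev-act : ∀ {m} (v : L.Word m) a k p → ev (proj₁ (L.act m v (a , k))) p ≡ ev a (pull (map fromNode v) p)
  ev-act     []      a k p = ≡.refl
  ev-act {m} (x ∷ v) a k p = begin
    ev (proj₁ (L.reflect m (finite x) μ)) p                      ≡⟨ cong (λ y → ev (proj₁ (L.reflect m (finite y) μ)) p) (to-from x) ⟨
    ev (proj₁ (L.reflect m (finite (toNode (fromNode x))) μ)) p  ≡⟨ ev-cong (reflect-toNode (fromNode x) (proj₁ μ) (proj₂ μ)) p ⟩
    ev (fromNode x ▹ proj₁ μ) p                                  ≡⟨ ev-▹ (fromNode x) (proj₁ μ) p ⟩
    ev (proj₁ μ) (fromNode x · p)                                ≡⟨ ev-act v a k (fromNode x · p) ⟩
    ev a (pull (map fromNode v) (fromNode x · p))                ∎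
    where
    open ≡.≡-Reasoning
    μ = L.act m v (a , k)

  act-δ : ∀ {m} (v : L.Word m) μ → proj₂ (L.act m v μ) ≡ proj₂ μ
  act-δ     []      μ = ≡.refl
  act-δ {m} (x ∷ v) μ = ≡.trans (reflect-finite-δ x (L.act m v μ)) (act-δ v μ)

  ≐⇒∼ : ∀ {m} (v w : L.Word m) → map fromNode v ≐ map fromNode w → L._∼_ m v w
  ≐⇒∼ {m} v w h μ@(a , k) = (λ i → begin
      proj₁ (L.act m v μ) i               ≡⟨ ev-pos _ i ⟨
      ev (proj₁ (L.act m v μ)) (pos i)    ≡⟨ ev-act v a k (pos i) ⟩
      ev a (pull (map fromNode v) (pos i)) ≡⟨ cong (ev a) (h (pos i)) ⟩
      ev a (pull (map fromNode w) (pos i)) ≡⟨ ev-act w a k (pos i) ⟨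
      ev (proj₁ (L.act m w μ)) (pos i)    ≡⟨ ev-pos _ i ⟩
      proj₁ (L.act m w μ) i               ∎) ,
    ≡.trans (act-δ v μ) (≡.sym (act-δ w μ))
    where open ≡.≡-Reasoning

  ∼⇒≐ : ∀ {m} (v w : L.Word m) → L._∼_ m v w → map fromNode v ≐ map fromNode w
  ∼⇒≐ {m} v w h p = ev-vec-1 r (pull (map fromNode w) p) (begin
    ev (vec r) (pull (map fromNode w) p)       ≡⟨ ev-act w (vec r) 0ℤ p ⟨
    ev (proj₁ (L.act m w (vec r , 0ℤ))) p      ≡⟨ ev-cong (proj₁ (h (vec r , 0ℤ))) p ⟨
    ev (proj₁ (L.act m v (vec r , 0ℤ))) p      ≡⟨ ev-act v (vec r) 0ℤ p ⟩
    ev (vec r) r                               ≡⟨ ev-vec-refl r ⟩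
    1ℤ                                         ∎)
    where
    open ≡.≡-Reasoning
    r = pull (map fromNode v) p

  vec-pos : ∀ {m} (i : Gen m) → vec (pos i) ≗ L.single m i 1ℤ
  vec-pos         zero    zero    = ≡.refl
  vec-pos         zero    (suc j) = ≡.refl
  vec-pos {suc m} (suc i) zero    = ≡.refl
  vec-pos {suc m} (suc i) (suc j) = vec-pos i j

  data NodeRoot {m} (i : Gen m) : Set₁ where
    short-node : ∀ p → toNode i ≡ flip → kind i ≡ short → vec p ≗ L.single m (fromℕ m) 1ℤ →
                 (∀ {C : Set} (ℓ : Pt m → Pt m → C) h → simple ℓ h i ≡ h p) → NodeRoot i
    long-node  : ∀ j p r → toNode i ≡ swap j → kind i ≡ long → Apart p r →
                 (λ k → vec p k ℤ.+ vec r k) ≗ (λ k → L.single m (inject₁ j) 1ℤ k ℤ.- L.single m (suc j) 1ℤ k) →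
                 (∀ {C : Set} (ℓ : Pt m → Pt m → C) h → simple ℓ h i ≡ ℓ p r) → NodeRoot i

  nodeRoot : ∀ {m} (i : Gen m) → NodeRoot i
  nodeRoot {zero}  zero = short-node first ≡.refl ≡.refl (λ { zero → ≡.refl }) (λ _ _ → ≡.refl)
  nodeRoot {suc m} zero = long-node zero first (mid last) ≡.refl ≡.refl (λ ()) e (λ _ _ → ≡.refl)
    where
    e : (λ k → vec first k ℤ.+ vec (mid last) k) ≗ (λ k → L.single (suc m) zero 1ℤ k ℤ.- L.single (suc m) (suc zero) 1ℤ k)
    e zero          = ≡.refl
    e (suc zero)    = ≡.refl
    e (suc (suc k)) = ≡.refl
  nodeRoot {suc m} (suc i) with nodeRoot i
  ... | short-node p e κ v f = short-node (mid p) (cong shiftNode e) κ (λ { zero → ≡.refl ; (suc k) → v k }) (λ _ _ → f _ _)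
  ... | long-node j p r e κ a v f = long-node (suc j) (mid p) (mid r) (cong shiftNode e) κ (apart-mid a)
          (λ { zero → ≡.refl ; (suc k) → v k }) (λ _ _ → f _ _)

-- A commutative solver and the rank-two identities of rational functions

module CommutativeSolver (R : CommutativeRing 0ℓ 0ℓ) where
  open CommutativeRing R hiding (zero)
  open SetoidReasoning setoid
  open NoncommutativeSolver ring hiding (solve) public

  insert : ∀ {n} → Fin n → List (Fin n) → List (Fin n)
  insert i []       = i ∷ []
  insert i (j ∷ js) with i Fin.≤? j
  ... | yes _ = i ∷ j ∷ js
  ... | no _  = j ∷ insert i js

  sort : ∀ {n} → List (Fin n) → List (Fin n)
  sort = foldr insert []

  module _ {n} (ρ : Vec Carrier n) where
    insert-sound : ∀ i js → ⟦_⟧w ρ (insert i js) ≈ lookup ρ i * ⟦_⟧w ρ js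
    insert-sound i []       = refl
    insert-sound i (j ∷ js) with i Fin.≤? j
    ... | yes _ = refl
    ... | no _  = begin
      lookup ρ j * ⟦_⟧w ρ (insert i js)        ≈⟨ *-congˡ (insert-sound i js) ⟩
      lookup ρ j * (lookup ρ i * ⟦_⟧w ρ js)    ≈⟨ *-assoc _ _ _ ⟨
      lookup ρ j * lookup ρ i * ⟦_⟧w ρ js      ≈⟨ *-congʳ (*-comm _ _) ⟩
      lookup ρ i * lookup ρ j * ⟦_⟧w ρ js      ≈⟨ *-assoc _ _ _ ⟩
      lookup ρ i * (lookup ρ j * ⟦_⟧w ρ js)    ∎

    sort-sound : ∀ js → ⟦_⟧w ρ (sort js) ≈ ⟦_⟧w ρ js
    sort-sound []       = refl
    sort-sound (j ∷ js) = trans (insert-sound j (sort js)) (*-congˡ (sort-sound js))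

    sorts-sound : ∀ ts → ⟦_⟧ₛ ρ (map (map₂ sort) ts) ≈ ⟦_⟧ₛ ρ ts
    sorts-sound []                  = refl
    sorts-sound ((Sign.+ , w) ∷ ts) = +-cong (sort-sound w) (sorts-sound ts)
    sorts-sound ((Sign.- , w) ∷ ts) = +-cong (-‿cong (sort-sound w)) (sorts-sound ts)

  solve : ∀ {n} (ρ : Vec Carrier n) (f : N-ary n (Expr n) (Expr n × Expr n)) →
          let (e , e′) = f $ⁿ Vec.map var (allFin n) in
          cancel (map (map₂ sort) (expand (e :- e′))) ≡ [] → ⟦_⟧ ρ e ≈ ⟦_⟧ ρ e′
  solve {n} ρ f h = RingProperties.x∙y⁻¹≈ε⇒x≈y ring _ _ (begin
    ⟦_⟧ ρ (e :- e′)                                          ≈⟨ expand-sound ρ (e :- e′) ⟨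
    ⟦_⟧ₛ ρ (expand (e :- e′))                                ≈⟨ sorts-sound ρ (expand (e :- e′)) ⟨
    ⟦_⟧ₛ ρ (map (map₂ sort) (expand (e :- e′)))              ≈⟨ cancel-sound ρ (map (map₂ sort) (expand (e :- e′))) ⟩
    ⟦_⟧ₛ ρ (cancel (map (map₂ sort) (expand (e :- e′))))     ≡⟨ cong (⟦_⟧ₛ ρ) h ⟩
    0#                                                       ∎)
    where
    e e′ : Expr n
    e  = proj₁ (f $ⁿ Vec.map var (allFin n))
    e′ = proj₂ (f $ⁿ Vec.map var (allFin n))

-- E stands for 1/(1 - x), and similarly for the other capital letters.
-- Identities are proved by exhibiting the difference of both sides as a linear
-- combination of differences known to vanish.
module Identities (R : CommutativeRing 0ℓ 0ℓ) where
  open CommutativeRing R hiding (zero)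
  open RingProperties ring using (x≈y⇒x∙y⁻¹≈ε)
  open CommutativeSolver R public using (solve; _:+_; _:-_; _:*_; :-_; :0; :1; _:=_)
  open SetoidReasoning setoid

  infixl 4 _⊹_
  _⊹_ : ∀ {x y} → x ≈ 0# → y ≈ 0# → x + y ≈ 0#
  p ⊹ q = trans (+-cong p q) (+-identityˡ 0#)

  infix 5 _⊛_
  _⊛_ : ∀ c {x y} → x ≈ y → c * (x - y) ≈ 0#
  c ⊛ p = trans (*-congˡ (x≈y⇒x∙y⁻¹≈ε p)) (zeroʳ c)

  modulo : ∀ {x y z} → x ≈ y + z → z ≈ 0# → x ≈ y
  modulo p q = trans p (trans (+-congˡ q) (+-identityʳ _))

  -- In terms of e = x/(1 - x) the values at long roots are affine, and θ enters through 1 - θ only.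
  -- The rank-two identities thereby come down to partial fractions free of parameters.
  long-expand : ∀ θ x E → E * (1# - x) ≈ 1# → (1# - θ * x) * E ≈ 1# + (1# - θ) * (x * E)
  long-expand θ x E hE = modulo
    (solve (θ ∷ x ∷ E ∷ []) (λ θ x E → (:1 :- θ :* x) :* E :=
      :1 :+ (:1 :- θ) :* (x :* E) :+ :1 :* (E :* (:1 :- x) :- :1)) ≡.refl)
    (1# ⊛ hE)

  short-expand : ∀ A B y R → R * (1# - y * y) ≈ 1# →
    (1# - A * y) * (1# - B * y) * R ≈ 1# - (A + B) * (y * R) + (1# + A * B) * (y * y * R)
  short-expand A B y R hR = modulo
    (solve (A ∷ B ∷ y ∷ R ∷ []) (λ A B y R → (:1 :- A :* y) :* (:1 :- B :* y) :* R :=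
      :1 :- (A :+ B) :* (y :* R) :+ (:1 :+ A :* B) :* (y :* y :* R) :+ :1 :* (R :* (:1 :- y :* y) :- :1)) ≡.refl)
    (1# ⊛ hR)

  reflect-e : ∀ {x x̄ E Ē} → x * x̄ ≈ 1# → E * (1# - x) ≈ 1# → Ē * (1# - x̄) ≈ 1# → x * E + x̄ * Ē + 1# ≈ 0#
  reflect-e {x} {x̄} {E} {Ē} hx hE hĒ = modulo
    (solve (x ∷ x̄ ∷ E ∷ Ē ∷ []) (λ x x̄ E Ē → x :* E :+ x̄ :* Ē :+ :1 := :0 :+
      (:- (x :* E :+ x̄ :* Ē :+ :1) :* (E :* (:1 :- x) :- :1) :+ E :* x :* (E :* (:1 :- x) :- :1)
        :+ :- E :* (Ē :* (:1 :- x̄) :- :1) :+ :- (E :* Ē) :* (x :* x̄ :- :1))) ≡.refl)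
    ((- (x * E + x̄ * Ē + 1#)) ⊛ hE ⊹ E * x ⊛ hE ⊹ (- E) ⊛ hĒ ⊹ (- (E * Ē)) ⊛ hx)

  reflect-s : ∀ {y ȳ R R̄} → y * ȳ ≈ 1# → R * (1# - y * y) ≈ 1# → R̄ * (1# - ȳ * ȳ) ≈ 1# → y * R + ȳ * R̄ ≈ 0#
  reflect-s {y} {ȳ} {R} {R̄} hy hR hR̄ = modulo
    (solve (y ∷ ȳ ∷ R ∷ R̄ ∷ []) (λ y ȳ R R̄ → y :* R :+ ȳ :* R̄ := :0 :+
      (:- (y :* R :+ ȳ :* R̄) :* (R :* (:1 :- y :* y) :- :1) :+ R :* y :* (R :* (:1 :- y :* y) :- :1)
        :+ :- (R :* y) :* (R̄ :* (:1 :- ȳ :* ȳ) :- :1) :+ :- (R :* R̄ :* (ȳ :+ y)) :* (y :* ȳ :- :1)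
        )) ≡.refl)
    ((- (y * R + ȳ * R̄)) ⊛ hR ⊹ R * y ⊛ hR ⊹ (- (R * y)) ⊛ hR̄ ⊹ (- (R * R̄ * (ȳ + y))) ⊛ hy)

  -- e = x E, f = y F and g = x y G
  product-e : ∀ {x y E F G} → E * (1# - x) ≈ 1# → F * (1# - y) ≈ 1# → G * (1# - x * y) ≈ 1# →
    x * E * (y * F) ≈ x * y * G * (1# + x * E + y * F)
  product-e {x} {y} {E} {F} {G} hE hF hG = modulo
    (solve (x ∷ y ∷ E ∷ F ∷ G ∷ []) (λ x y E F G → x :* E :* (y :* F) := x :* y :* G :* (:1 :+ x :* E :+ y :* F) :+
      (:- (x :* y :* E :* F) :* (G :* (:1 :- x :* y) :- :1) :+ x :* y :* G :* (x :* E :+ :1) :* (F :* (:1 :- y) :- :1)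
        :+ x :* y :* G :* F :* (E :* (:1 :- x) :- :1))) ≡.refl)
    ((- (x * y * E * F)) ⊛ hG ⊹ x * y * G * (x * E + 1#) ⊛ hF ⊹ x * y * G * F ⊛ hE)

  -- a = 1 + λ e, where λ = 1 - θ
  A₂ : ∀ {θ e ē f g} → e + ē + 1# ≈ 0# → e * f ≈ g * (1# + e + f) →
    let a = λ e → 1# + (1# - θ) * e in a e * a f + a ē * a g ≈ a f * a g + θ
  A₂ {θ} {e} {ē} {f} {g} hē hef = modulo
    (solve (θ ∷ e ∷ ē ∷ f ∷ g ∷ []) (λ θ e ē f g → let a = λ e → :1 :+ (:1 :- θ) :* e in
      a e :* a f :+ a ē :* a g := a f :* a g :+ θ :+
      ((:1 :- θ) :* (:1 :- θ) :* (e :* f :- g :* (:1 :+ e :+ f)) :+ (:1 :- θ) :* a g :* (e :+ ē :+ :1 :- :0))) ≡.refl)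
    ((1# - θ) * (1# - θ) ⊛ hef ⊹ (1# - θ) * (1# + (1# - θ) * g) ⊛ hē)

  long-quadratic : ∀ {θ e ē} → e + ē + 1# ≈ 0# → (1# + (1# - θ) * e) + (1# + (1# - θ) * ē) ≈ 1# + θ
  long-quadratic {θ} {e} {ē} hē = modulo
    (solve (θ ∷ e ∷ ē ∷ []) (λ θ e ē → (:1 :+ (:1 :- θ) :* e) :+ (:1 :+ (:1 :- θ) :* ē) := :1 :+ θ :+
      (:1 :- θ) :* (e :+ ē :+ :1 :- :0)) ≡.refl) ((1# - θ) ⊛ hē)

  short-quadratic : ∀ {A B s s̄ r r̄} → s + s̄ ≈ 0# → r + r̄ + 1# ≈ 0# →
    let b = λ s r → 1# - (A + B) * s + (1# + A * B) * r in b s r + b s̄ r̄ ≈ 1# + - (A * B)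
  short-quadratic {A} {B} {s} {s̄} {r} {r̄} hs hr = modulo
    (solve (A ∷ B ∷ s ∷ s̄ ∷ r ∷ r̄ ∷ []) (λ A B s s̄ r r̄ → let b = λ s r → :1 :- (A :+ B) :* s :+ (:1 :+ A :* B) :* r in
      b s r :+ b s̄ r̄ := :1 :+ :- (A :* B) :+ (:- (A :+ B) :* (s :+ s̄ :- :0) :+ (:1 :+ A :* B) :* (r :+ r̄ :+ :1 :- :0))) ≡.refl)
    ((- (A + B)) ⊛ hs ⊹ (1# + A * B) ⊛ hr)

  -- E = 1/(1 - x), E′ = 1/(1 - x y²), R = 1/(1 - y²), R′ = 1/(1 - x² y²)
  module _ {x y E E′ R R′} (hE : E * (1# - x) ≈ 1#) (hE′ : E′ * (1# - x * (y * y)) ≈ 1#)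
    (hR : R * (1# - y * y) ≈ 1#) (hR′ : R′ * (1# - x * y * (x * y)) ≈ 1#) where

    -- K₁, K₂ and K₃ are the decompositions 1 - x² y² = (1 - x y²) + x y² (1 - x), 1 - x y² = (1 -
    -- y²) + y² (1 - x) and 1 - x y² = x (1 - y²) + (1 - x), divided by the denominators.
    K₁ : R′ * (E + x * (y * y) * E′) ≈ E * E′
    K₁ = modulo (solve (x ∷ y ∷ E ∷ E′ ∷ R′ ∷ []) (λ x y E E′ R′ → R′ :* (E :+ x :* (y :* y) :* E′) := E :* E′ :+
        (E :* E′ :* (R′ :* (:1 :- x :* y :* (x :* y)) :- :1) :+ :- (R′ :* E) :* (E′ :* (:1 :- x :* (y :* y)) :- :1)
          :+ :- (R′ :* x :* (y :* y) :* E′) :* (E :* (:1 :- x) :- :1))) ≡.refl)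
      (E * E′ ⊛ hR′ ⊹ (- (R′ * E)) ⊛ hE′ ⊹ (- (R′ * x * (y * y) * E′)) ⊛ hE)

    K₂ : E * R ≈ E * E′ + y * y * R * E′
    K₂ = modulo (solve (x ∷ y ∷ E ∷ E′ ∷ R ∷ []) (λ x y E E′ R → E :* R := E :* E′ :+ y :* y :* R :* E′ :+
        (:- (E :* R) :* (E′ :* (:1 :- x :* (y :* y)) :- :1) :+ E :* E′ :* (R :* (:1 :- y :* y) :- :1)
          :+ y :* y :* R :* E′ :* (E :* (:1 :- x) :- :1))) ≡.refl)
      ((- (E * R)) ⊛ hE′ ⊹ E * E′ ⊛ hR ⊹ y * y * R * E′ ⊛ hE)

    K₃ : E * R ≈ x * E * E′ + E′ * R
    K₃ = modulo (solve (x ∷ y ∷ E ∷ E′ ∷ R ∷ []) (λ x y E E′ R → E :* R := x :* E :* E′ :+ E′ :* R :+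
        (:- (E :* R) :* (E′ :* (:1 :- x :* (y :* y)) :- :1) :+ x :* E :* E′ :* (R :* (:1 :- y :* y) :- :1)
          :+ E′ :* R :* (E :* (:1 :- x) :- :1))) ≡.refl)
      ((- (E * R)) ⊛ hE′ ⊹ x * E * E′ ⊛ hR ⊹ E′ * R ⊛ hE)

    private
      e e′ s s′ r r′ : Carrier
      e  = x * E
      e′ = x * (y * y) * E′
      s  = y * R
      s′ = x * y * R′
      r  = y * y * R
      r′ = x * y * (x * y) * R′

    B₂-s : e * s ≈ s′ * (1# + e + e′) + s * e′
    B₂-s = modulo (solve (x ∷ y ∷ E ∷ E′ ∷ R ∷ R′ ∷ []) (λ x y E E′ R R′ →
        x :* E :* (y :* R) := x :* y :* R′ :* (:1 :+ x :* E :+ x :* (y :* y) :* E′) :+ y :* R :* (x :* (y :* y) :* E′) :+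
        (x :* y :* (E :* R :- (E :* E′ :+ y :* y :* R :* E′)) :+ :- (x :* y) :* (R′ :* (E :+ x :* (y :* y) :* E′) :- E :* E′)
          :+ x :* y :* R′ :* (E :* (:1 :- x) :- :1))) ≡.refl)
      (x * y ⊛ K₂ ⊹ (- (x * y)) ⊛ K₁ ⊹ x * y * R′ ⊛ hE)

    B₂-r : e * r ≈ r′ * (1# + e + e′) + e′ * (1# + r)
    B₂-r = modulo (solve (x ∷ y ∷ E ∷ E′ ∷ R ∷ R′ ∷ []) (λ x y E E′ R R′ →
        x :* E :* (y :* y :* R) := x :* y :* (x :* y) :* R′ :* (:1 :+ x :* E :+ x :* (y :* y) :* E′)
          :+ x :* (y :* y) :* E′ :* (:1 :+ y :* y :* R) :+
        (x :* (y :* y) :* (E :* R :- (x :* E :* E′ :+ E′ :* R))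
          :+ :- (x :* y :* (x :* y)) :* (R′ :* (E :+ x :* (y :* y) :* E′) :- E :* E′)
          :+ x :* y :* (x :* y) :* R′ :* (E :* (:1 :- x) :- :1) :+ x :* (y :* y) :* E′ :* (R :* (:1 :- y :* y) :- :1))) ≡.refl)
      (x * (y * y) ⊛ K₃ ⊹ (- (x * y * (x * y))) ⊛ K₁ ⊹ x * y * (x * y) * R′ ⊛ hE ⊹ x * (y * y) * E′ ⊛ hR)

    -- After the opposite values have been eliminated, the coefficients of (1 - θ)(A + B) and (1 -
    -- θ)(1 + A B) remain; these are `B₂-s` and `B₂-r`.
    B₂ : ∀ {θ A B ē s̄ r̄} → e + ē + 1# ≈ 0# → s + s̄ ≈ 0# → r + r̄ + 1# ≈ 0# →
      let a = λ e → 1# + (1# - θ) * e ; b = λ s r → 1# - (A + B) * s + (1# + A * B) * r in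
      a e * b s r + a ē * b s′ r′ + b s̄ r̄ * a e′ ≈ a e′ * b s′ r′ + (θ + - (A * B))
    B₂ {θ} {A} {B} {ē} {s̄} {r̄} hē hs̄ hr̄ = modulo
      (solve (θ ∷ A ∷ B ∷ e ∷ e′ ∷ ē ∷ s ∷ s′ ∷ s̄ ∷ r ∷ r′ ∷ r̄ ∷ []) (λ θ A B e e′ ē s s′ s̄ r r′ r̄ →
        let a = λ e → :1 :+ (:1 :- θ) :* e
            b = λ s r → :1 :- (A :+ B) :* s :+ (:1 :+ A :* B) :* r in
        a e :* b s r :+ a ē :* b s′ r′ :+ b s̄ r̄ :* a e′ := a e′ :* b s′ r′ :+ (θ :+ :- (A :* B)) :+
        ((:1 :- θ) :* b s′ r′ :* (e :+ ē :+ :1 :- :0) :+ :- (A :+ B) :* a e′ :* (s :+ s̄ :- :0)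
          :+ (:1 :+ A :* B) :* a e′ :* (r :+ r̄ :+ :1 :- :0)
          :+ :- ((:1 :- θ) :* (A :+ B)) :* (e :* s :- (s′ :* (:1 :+ e :+ e′) :+ s :* e′))
          :+ (:1 :- θ) :* (:1 :+ A :* B) :* (e :* r :- (r′ :* (:1 :+ e :+ e′) :+ e′ :* (:1 :+ r))))) ≡.refl)
      ((1# - θ) * (1# - (A + B) * s′ + (1# + A * B) * r′) ⊛ hē ⊹ (- (A + B)) * (1# + (1# - θ) * e′) ⊛ hs̄
        ⊹ (1# + A * B) * (1# + (1# - θ) * e′) ⊛ hr̄ ⊹ (- ((1# - θ) * (A + B))) ⊛ B₂-s ⊹ (1# - θ) * (1# + A * B) ⊛ B₂-r)

  cross-inverse : ∀ {a b c d} → a * c ≈ 1# → b * d ≈ 1# → a * b * (c * d) ≈ 1#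
  cross-inverse {a} {b} {c} {d} h k = modulo (solve (a ∷ b ∷ c ∷ d ∷ []) (λ a b c d →
    a :* b :* (c :* d) := :1 :+ (b :* d :* (a :* c :- :1) :+ :1 :* (b :* d :- :1))) ≡.refl) (b * d ⊛ h ⊹ 1# ⊛ k)

  neg-inverse : ∀ {x y} → x * y ≈ 1# → - x * - y ≈ 1#
  neg-inverse {x} {y} h = trans (solve (x ∷ y ∷ []) (λ x y → :- x :* :- y := x :* y) ≡.refl) h

  neg-product : ∀ {a b c A B} → A ≈ a * b → B ≈ - (a * c) → b * c ≈ 1# → a * a ≈ - (A * B)
  neg-product {a} {b} {c} {A} {B} hA hB h = modulo (solve (a ∷ b ∷ c ∷ A ∷ B ∷ []) (λ a b c A B →
    a :* a := :- (A :* B) :+ (B :* (A :- a :* b) :+ a :* b :* (B :- :- (a :* c)) :+ :- (a :* a) :* (b :* c :- :1))) ≡.refl)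
    (B ⊛ hA ⊹ a * b ⊛ hB ⊹ (- (a * a)) ⊛ h)

-- Enumeration of the finite group by reduced words

allPt-unique : ∀ m → Unique (allPt m)
allPt-unique zero    = ((λ ()) ∷ []) ∷ [] ∷ []
allPt-unique (suc m) = ((λ ()) ∷ All.tabulate (mids first λ _ ())) ∷ All.tabulate (mids last λ _ ()) ∷ Unique.map⁺ mid-injective (allPt-unique m)
  where
  mids : ∀ (p : Pt (suc m)) → (∀ q → p ≢ mid q) → ∀ {q} → q ∈ map mid (allPt m) → p ≢ q
  mids p p≢mid q∈ p≡q with ∈-map⁻ mid q∈
  ... | r , _ , q≡mid = p≢mid r (≡.trans p≡q q≡mid)

allNF : ∀ m → List (NF m)
allNF zero    = map base (allPt zero)
allNF (suc m) = cartesianProductWith _◂_ (allPt (suc m)) (allNF m)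

∈-allNF : ∀ {m} (x : NF m) → x ∈ allNF m
∈-allNF (base p) = ∈-map⁺ base (∈-allPt p)
∈-allNF (p ◂ x)  = ∈-cartesianProductWith⁺ _◂_ (∈-allPt p) (∈-allNF x)

allNF-unique : ∀ m → Unique (allNF m)
allNF-unique zero    = Unique.map⁺ {f = base} (λ { ≡.refl → ≡.refl }) (allPt-unique zero)
allNF-unique (suc m) = Unique.cartesianProductWith⁺ _◂_ (λ { ≡.refl → ≡.refl , ≡.refl }) (allPt-unique (suc m)) (allNF-unique m)

module ListSums (M : CommutativeMonoid 0ℓ 0ℓ) where
  open import Data.List.Relation.Binary.Permutation.Propositional using (refl; prep; swap; trans)
  open CommutativeMonoid M renaming (refl to ≈-refl; trans to ≈-trans)
  open PointSums M
  open SetoidReasoning setoid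

  sum : {X : Set} → List X → (X → Carrier) → Carrier
  sum xs f = foldr (λ x h → f x ∙ h) ε xs

  sum-++ : {X : Set} (xs ys : List X) (f : X → Carrier) → sum (xs ++ ys) f ≈ sum xs f ∙ sum ys f
  sum-++ []       ys f = sym (identityˡ _)
  sum-++ (x ∷ xs) ys f = ≈-trans (∙-congˡ (sum-++ xs ys f)) (sym (assoc _ _ _))

  sum-map : {X Z : Set} (g : X → Z) (xs : List X) (f : Z → Carrier) → sum (map g xs) f ≡ sum xs (f ∘ g)
  sum-map g []       f = ≡.refl
  sum-map g (x ∷ xs) f = cong (f (g x) ∙_) (sum-map g xs f)

  sum-All : {X : Set} {xs : List X} {f g : X → Carrier} → All (λ x → f x ≈ g x) xs → sum xs f ≈ sum xs g
  sum-All []         = ≈-refl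
  sum-All (e ∷ es)   = ∙-cong e (sum-All es)

  sum-↭ : {X : Set} {xs ys : List X} (f : X → Carrier) → xs ↭ ys → sum xs f ≈ sum ys f
  sum-↭ f refl         = ≈-refl
  sum-↭ f (prep x p)   = ∙-congˡ (sum-↭ f p)
  sum-↭ f (swap x y p) = ≈-trans (sym (assoc _ _ _)) (≈-trans (∙-cong (comm _ _) (sum-↭ f p)) (assoc _ _ _))
  sum-↭ f (trans p q)  = ≈-trans (sum-↭ f p) (sum-↭ f q)

  sum-allPt : ∀ {m} (f : Pt m → Carrier) → sum (allPt m) f ≈ ∑ f
  sum-allPt {zero}  f = ∙-congˡ (identityʳ _)
  sum-allPt {suc m} f = ≈-trans (sym (assoc _ _ _))
    (∙-congˡ (≈-trans (reflexive (sum-map mid (allPt m) f)) (sum-allPt (f ∘ mid))))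

  sum-product : {X Z W : Set} (_⊗_ : X → Z → W) (xs : List X) (zs : List Z) (f : W → Carrier) →
    sum (cartesianProductWith _⊗_ xs zs) f ≈ sum xs (λ x → sum zs (λ z → f (x ⊗ z)))
  sum-product _⊗_ []       zs f = ≈-refl
  sum-product _⊗_ (x ∷ xs) zs f = ≈-trans (sum-++ (map (x ⊗_) zs) _ f)
    (∙-cong (reflexive (sum-map (x ⊗_) zs f)) (sum-product _⊗_ xs zs f))

  sum-allNF : ∀ {m} (f : NF m → Carrier) → sum (allNF m) f ≈ ∑ₙ f
  sum-allNF {zero}  f = ≈-trans (reflexive (sum-map base (allPt zero) f)) (sum-allPt (f ∘ base))
  sum-allNF {suc m} f = ≈-trans (sum-product _◂_ (allPt (suc m)) (allNF m) f)
    (≈-trans (sum-allPt {suc m} λ p → sum (allNF m) λ x → f (p ◂ x))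
      (∑-cong {suc m} λ p → sum-allNF {m} λ x → f (p ◂ x)))

module Enumeration (𝕜 : CommutativeRing 0ℓ 0ℓ) (m : ℕ) where
  open LocalizedDAHA 𝕜 m using (Word; _∼_; Reduced; module ReducedWords; ReducedWords)
  open Nodes 𝕜

  gens : Word → Wd m
  gens = map fromNode

  nodes : Wd m → Word
  nodes = map toNode

  gens-nodes : ∀ v → gens (nodes v) ≡ v
  gens-nodes []      = ≡.refl
  gens-nodes (i ∷ v) = cong₂ _∷_ (from-to i) (gens-nodes v)

  nfw : Word → NF m
  nfw v = Normalised.nf (normalise (gens v))

  gens≐nfw : ∀ v → gens v ≐ word (nfw v)
  gens≐nfw v = Normalised.equal (normalise (gens v))

  nfw∼ : ∀ v w → nfw v ≡ nfw w → v ∼ w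
  nfw∼ v w e = ≐⇒∼ v w λ p → ≡.trans (gens≐nfw v p)
    (≡.trans (cong (λ x → pull (word x) p) e) (≡.sym (gens≐nfw w p)))

  nodes∼ : ∀ v → nodes (word (nfw v)) ∼ v
  nodes∼ v = ≐⇒∼ (nodes (word (nfw v))) v λ p →
    ≡.trans (cong (λ w → pull w p) (gens-nodes (word (nfw v)))) (≡.sym (gens≐nfw v p))

  -- The normal form represents the same element, so it cannot be shorter than a reduced word; this
  -- leaves the second alternative of `Normalised`.
  reduced⇒⇝ : ∀ v → Reduced v → gens v ⇝ word (nfw v)
  reduced⇒⇝ v v-reduced with Normalised.length≤ (normalise (gens v))
  ... | inj₂ v⇝nf = v⇝nf
  ... | inj₁ nf<v = ⊥-elim (ℕ.<⇒≱ nf<v (begin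
    length (gens v)                   ≡⟨ List.length-map fromNode v ⟩
    length v                          ≤⟨ v-reduced (nodes (word (nfw v))) (nodes∼ v) ⟩
    length (nodes (word (nfw v)))     ≡⟨ List.length-map toNode (word (nfw v)) ⟩
    length (word (nfw v))             ∎))
    where open ℕ.≤-Reasoning

  module _ (W : ReducedWords) where
    open ReducedWords W

    nfw-onto : ∀ x → x ∈ map nfw words
    nfw-onto x = find words (complete (nodes (word x)))
      where
      find : ∀ ws → Any (nodes (word x) ∼_) ws → x ∈ map nfw ws
      find (w ∷ ws) (here x∼w) = here (word-injective x (nfw w) λ p →
        ≡.trans (≡.sym (cong (λ v → pull v p) (gens-nodes (word x))))
          (≡.trans (∼⇒≐ (nodes (word x)) w x∼w p) (gens≐nfw w p)))
      find (w ∷ ws) (there h) = there (find ws h)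

    -- By `distinct` and `complete` the normal forms of the listed words contain every normal form
    -- once. So does `allNF`, and two such lists are permutations of each other.
    words↭allNF : map nfw words ↭ allNF m
    words↭allNF = ∼bag⇒↭ (unique∧set⇒bag
      (AllPairs.map⁺ (AllPairs.map (λ {v} {w} v≁w e → v≁w (nfw∼ v w e)) distinct))
      (allNF-unique m) (λ {x} → mk⇔ (λ _ → ∈-allNF x) (λ _ → nfw-onto x)))

    module _ (M : CommutativeMonoid 0ℓ 0ℓ) where
      open CommutativeMonoid M renaming (refl to ≈-refl; trans to ≈-trans)
      open PointSums M
      open ListSums M

      sum-words : (f : Word → Carrier) (g : NF m → Carrier) →
                  (∀ w → gens w ⇝ word (nfw w) → f w ≈ g (nfw w)) → sum words f ≈ ∑ₙ g
      sum-words f g f≈g = ≈-trans (sum-All (All.map (λ {w} r → f≈g w (reduced⇒⇝ w r)) reduced))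
        (≈-trans (reflexive (≡.sym (sum-map nfw words g))) (≈-trans (sum-↭ g words↭allNF) (sum-allNF g)))

    -- Some listed word has the normal form `top`, and w₀ is at least as long. By `word-longest` no
    -- other normal form reaches this length.
    longest⇒⇝ : ∀ w₀ → w₀ ∈ words → All (λ w → length w ℕ.≤ length w₀) words → gens w₀ ⇝ word (top {m})
    longest⇒⇝ w₀ w₀∈ longest = subst (λ x → gens w₀ ⇝ word x) (word-longest (nfw w₀) (begin
        length (word (top {m}))           ≡⟨ cong (λ x → length (word x)) top≡ ⟩
        length (word (nfw v))             ≡⟨ ⇝-length (reduced⇒⇝ v (All.lookup reduced v∈)) ⟨
        length (gens v)                   ≡⟨ List.length-map fromNode v ⟩
        length v                          ≤⟨ All.lookup longest v∈ ⟩
        length w₀                         ≡⟨ List.length-map fromNode w₀ ⟨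
        length (gens w₀)                  ≡⟨ ⇝-length w₀⇝ ⟩
        length (word (nfw w₀))            ∎)) w₀⇝
      where
      open ℕ.≤-Reasoning
      w₀⇝ = reduced⇒⇝ w₀ (All.lookup reduced w₀∈)
      v∈∃ = ∈-map⁻ nfw (nfw-onto top)
      v    = proj₁ v∈∃
      v∈   = proj₁ (proj₂ v∈∃)
      top≡ = proj₂ (proj₂ v∈∃)

-- Functions at the roots, parameters and characters

p≢neg : ∀ {m} (p : Pt m) → p ≢ neg p
p≢neg first   ()
p≢neg last    ()
p≢neg (mid p) e = p≢neg p (mid-injective e)

turn : ∀ {m} → Sign → Pt m → Pt m
turn Sign.+ p = p
turn Sign.- p = neg p

neg-involutive : ∀ {m} (p : Pt m) → neg (neg p) ≡ p
neg-involutive first   = ≡.refl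
neg-involutive last    = ≡.refl
neg-involutive (mid p) = cong mid (neg-involutive p)

turn-neg : ∀ {m} σ (p : Pt m) → turn σ (neg p) ≡ neg (turn σ p)
turn-neg Sign.+ p = ≡.refl
turn-neg Sign.- p = ≡.refl

turn-· : ∀ {m} σ i (p : Pt m) → i · turn σ p ≡ turn σ (i · p)
turn-· Sign.+ i p = ≡.refl
turn-· Sign.- i p = ·-neg i p

turn-injective : ∀ {m} σ {p r : Pt m} → turn σ p ≡ turn σ r → p ≡ r
turn-injective Sign.+ e = e
turn-injective Sign.- e = ≡.trans (≡.sym (neg-involutive _)) (≡.trans (cong neg e) (neg-involutive _))

pick : {X : Set} → Sign → X → X → X
pick Sign.+ x y = x
pick Sign.- x y = y

module Signs (A : Ring 0ℓ 0ℓ) where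
  open Ring A
  open RingProperties A using (-‿distribˡ-*; -‿distribʳ-*; -‿involutive)

  ±1 : Sign → Carrier
  ±1 Sign.+ = 1#
  ±1 Sign.- = - 1#

  ±1-central : ∀ σ x → ±1 σ * x ≈ x * ±1 σ
  ±1-central Sign.+ x = trans (*-identityˡ x) (sym (*-identityʳ x))
  ±1-central Sign.- x = trans (sym (-‿distribˡ-* _ _)) (trans (-‿cong (±1-central Sign.+ x)) (-‿distribʳ-* _ _))

  ±1-square : ∀ σ → ±1 σ * ±1 σ ≈ 1#
  ±1-square Sign.+ = *-identityˡ 1#
  ±1-square Sign.- = trans (sym (-‿distribˡ-* _ _)) (trans (-‿cong (*-identityˡ _)) (-‿involutive 1#))

module Characters (A : Ring 0ℓ 0ℓ) (F : CommutativeRing 0ℓ 0ℓ) (Φ : FunctionMap F A) where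
  open Ring A hiding (zero)
  private module F = CommutativeRing F
  open FunctionMap Φ
  open Hecke A F Φ using (Tr; tr; transport; Tr-*; Tr-1; Tr-resp; Tr-inverse; System; Equivariant; φ-neg; ∏roots; ∏roots-cong; ∏roots-*; ∏roots-1; ∏roots-cong-apart; ∏-top; ∑words; module Twist; module FM)
  open BraidMonoid *-monoid using (Braided; kind-braided)
  open RingProperties A using (-‿distribˡ-*; -‿distribʳ-*; -‿involutive)
  open Signs A
  open Identities F

  infixl 6 _⊞_
  _⊞_ : ∀ {m} → (Gen m → ℤ) → (Gen m → ℤ) → Gen m → ℤ
  (a ⊞ b) i = a i ℤ.+ b i

  -- Z a = Z^a and lin c a = 1 - c Z^a, except that lin c 0 = 1.
  record Torus (m : ℕ) : Set₁ where
    field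
      s            : Gen m → Carrier
      s-involutive : ∀ i → s i * s i ≈ 1#
      s-braided    : Braided s
      Scalar       : Set
      ⟪_⟫          : Scalar → F.Carrier
      ⟪⟫-central   : ∀ c x → φ ⟪ c ⟫ * x ≈ x * φ ⟪ c ⟫
      1ˢ           : Scalar
      ⟪1⟫          : ⟪ 1ˢ ⟫ F.≈ F.1#
      Z            : (Gen m → ℤ) → F.Carrier
      Z-cong       : ∀ {a b} → a ≗ b → Z a F.≈ Z b
      Z-*          : ∀ a b → Z a F.* Z b F.≈ Z (a ⊞ b)
      Z-0          : ∀ {a} → (∀ i → a i ≡ 0ℤ) → Z a F.≈ F.1#
      Z-transport  : ∀ i a → Tr (s i) (Z a) (Z (i ▹ a))
      lin lin⁻¹    : Scalar → (Gen m → ℤ) → F.Carrier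
      lin-inverse  : ∀ c a → lin c a F.* lin⁻¹ c a F.≈ F.1#
      lin-cong     : ∀ c {a b} → a ≗ b → lin c a F.≈ lin c b
      lin-nonzero  : ∀ c a → ¬ (∀ i → a i ≡ 0ℤ) → lin c a F.≈ F.1# F.- ⟪ c ⟫ F.* Z a
      lin-transport : ∀ i c a → Tr (s i) (lin c a) (lin c (i ▹ a))

  module Functions {m} (𝕋 : Torus m) (σ : Sign) where
    open Torus 𝕋

    inverse-unique : ∀ {f f′ g g′} → f F.≈ g → f F.* f′ F.≈ F.1# → g F.* g′ F.≈ F.1# → f′ F.≈ g′
    inverse-unique {f} {f′} {g} {g′} f≈g ff′ gg′ = begin
      f′                  ≈⟨ F.*-identityʳ f′ ⟨
      f′ F.* F.1#         ≈⟨ F.*-congˡ gg′ ⟨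
      f′ F.* (g F.* g′)   ≈⟨ F.*-assoc _ _ _ ⟨
      f′ F.* g F.* g′     ≈⟨ F.*-congʳ (F.trans (F.*-comm f′ g) (F.trans (F.*-congʳ (F.sym f≈g)) ff′)) ⟩
      F.1# F.* g′         ≈⟨ F.*-identityˡ g′ ⟩
      g′                  ∎
      where open SetoidReasoning F.setoid

    lin⁻¹-cong : ∀ c {a b} → a ≗ b → lin⁻¹ c a F.≈ lin⁻¹ c b
    lin⁻¹-cong c a≗b = inverse-unique (lin-cong c a≗b) (lin-inverse c _) (lin-inverse c _)

    lin⁻¹-transport : ∀ i c a → Tr (s i) (lin⁻¹ c a) (lin⁻¹ c (i ▹ a))
    lin⁻¹-transport i c a = Tr-inverse (lin-inverse c a) (lin-inverse c (i ▹ a)) (lin-transport i c a)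

    Z-inverse : ∀ a b → (∀ i → a i ℤ.+ b i ≡ 0ℤ) → Z a F.* Z b F.≈ F.1#
    Z-inverse a b h = F.trans (Z-* a b) (Z-0 h)

    -- The exponent that belongs to p. The sign σ accounts for the two sides: c involves X^(-α) on
    -- side X, but Y^α on side Y.
    w : Pt m → Gen m → ℤ
    w p = vec (turn σ p)

    w-· : ∀ i p → i ▹ w p ≗ w (i · p)
    w-· i p j = ≡.trans (▹-vec i (turn σ p) j) (cong (λ r → vec r j) (turn-· σ i p))

    w-neg : ∀ p i → w (neg p) i ≡ ℤ.- w p i
    w-neg p i = ≡.trans (cong (λ r → vec r i) (turn-neg σ p)) (vec-neg (turn σ p) i)

    w-cancel : ∀ p i → w p i ℤ.+ w (neg p) i ≡ 0ℤ
    w-cancel p i = ≡.trans (cong (ℤ._+_ (w p i)) (w-neg p i)) (ℤ.+-inverseʳ (w p i))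

    w-injective : ∀ {p r} → w p ≗ w r → p ≡ r
    w-injective e = turn-injective σ (vec-injective _ _ e)

    ⊞-nonzero : ∀ {p r} → p ≢ neg r → ¬ (∀ i → (w p ⊞ w r) i ≡ 0ℤ)
    ⊞-nonzero {p} {r} p≢ h = p≢ (w-injective λ i → begin
      w p i                             ≡⟨ ℤ.+-identityʳ _ ⟨
      w p i ℤ.+ 0ℤ                      ≡⟨ cong (ℤ._+_ (w p i)) (w-cancel r i) ⟨
      w p i ℤ.+ (w r i ℤ.+ w (neg r) i) ≡⟨ ℤ.+-assoc (w p i) (w r i) (w (neg r) i) ⟨
      w p i ℤ.+ w r i ℤ.+ w (neg r) i   ≡⟨ cong (ℤ._+ w (neg r) i) (h i) ⟩
      0ℤ ℤ.+ w (neg r) i                ≡⟨ ℤ.+-identityˡ _ ⟩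
      w (neg r) i                       ∎)
      where open ≡.≡-Reasoning

    ⊞-▹ : ∀ i p r → i ▹ (w p ⊞ w r) ≗ w (i · p) ⊞ w (i · r)
    ⊞-▹ i p r j = ≡.trans (ev-+ (w p) (w r) (i · pos j)) (cong₂ ℤ._+_ (w-· i p j) (w-· i r j))

    unit : ∀ p r → p ≢ neg r → lin⁻¹ 1ˢ (w p ⊞ w r) F.* (F.1# F.- Z (w p ⊞ w r)) F.≈ F.1#
    unit p r p≢ = F.trans (F.*-comm _ _) (F.trans (F.*-congʳ (F.sym (F.trans (lin-nonzero 1ˢ _ (⊞-nonzero p≢))
      (F.+-congˡ (F.-‿cong (F.trans (F.*-congʳ ⟪1⟫) (F.*-identityˡ _))))))) (lin-inverse 1ˢ _))

    ζ : Pt m → F.Carrier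
    ζ p = Z (w p)

    ζ-separates : ∀ {p r} → p ≢ r → ∃[ u ] u F.* (ζ p F.- ζ r) F.≈ F.1#
    -- The witness comes from Z^p - Z^r = Z^p (1 - Z^(r - p)), where the exponent r - p is nonzero.
    ζ-separates {p} {r} p≢r = ζ (neg p) F.* lin⁻¹ 1ˢ d , modulo
      (solve (ζ (neg p) ∷ lin⁻¹ 1ˢ d ∷ ζ p ∷ ζ r ∷ Z d ∷ [])
        (λ p̄ E p r d → p̄ :* E :* (p :- r) := :1 :+ (E :* (p :* p̄ :- :1) :+ :- E :* (r :* p̄ :- d) :+ :1 :* (E :* (:1 :- d) :- :1))) ≡.refl)
      (lin⁻¹ 1ˢ d ⊛ Z-inverse _ _ (w-cancel p) ⊹ (F.- lin⁻¹ 1ˢ d) ⊛ Z-* _ _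
        ⊹ F.1# ⊛ unit r (neg p) (λ r≡ → p≢r (≡.trans (≡.sym (neg-involutive p)) (≡.sym r≡))))
      where d = w r ⊞ w (neg p)

    -- The values are (1 - θ x)/(1 - x) at long roots and (1 - α y)(1 - β y)/(1 - y²) at short ones.
    -- Adding the value at the opposite root gives 1 + θ and 1 - α β, so - α β plays for short roots
    -- the part of θ.
    module Parameters (θ α β : Scalar) where
      λℓ μ ν : F.Carrier
      λℓ = F.1# F.- ⟪ θ ⟫
      μ  = ⟪ α ⟫ F.+ ⟪ β ⟫
      ν  = F.1# F.+ ⟪ α ⟫ F.* ⟪ β ⟫

      ℓ : Pt m → Pt m → F.Carrier
      ℓ p r = lin θ (w p ⊞ w r) F.* lin⁻¹ 1ˢ (w p ⊞ w r)

      h : Pt m → F.Carrier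
      h p = lin α (w p) F.* lin β (w p) F.* lin⁻¹ 1ˢ (w p ⊞ w p)

      E : Pt m → Pt m → F.Carrier
      E p r = lin⁻¹ 1ˢ (w p ⊞ w r)

      x e : Pt m → Pt m → F.Carrier
      x p r = Z (w p ⊞ w r)
      e p r = x p r F.* E p r

      σₕ ρₕ : Pt m → F.Carrier
      σₕ p = ζ p F.* E p p
      ρₕ p = ζ p F.* ζ p F.* E p p

      ℓ-expand : ∀ {p r} → p ≢ neg r → ℓ p r F.≈ F.1# F.+ λℓ F.* e p r
      ℓ-expand {p} {r} p≢ = F.trans (F.*-congʳ (lin-nonzero θ _ (⊞-nonzero p≢))) (long-expand ⟪ θ ⟫ (x p r) (E p r) (unit p r p≢))

      unit² : ∀ p → E p p F.* (F.1# F.- ζ p F.* ζ p) F.≈ F.1#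
      unit² p = F.trans (F.*-congˡ (F.+-congˡ (F.-‿cong (Z-* _ _)))) (unit p p (p≢neg p))

      h-definition : ∀ p → h p F.≈ (F.1# F.- ⟪ α ⟫ F.* ζ p) F.* (F.1# F.- ⟪ β ⟫ F.* ζ p) F.* E p p
      h-definition p = F.*-congʳ (F.*-cong (lin-nonzero α _ w≢0) (lin-nonzero β _ w≢0))
        where
        w≢0 : ¬ (∀ i → w p i ≡ 0ℤ)
        w≢0 w≡0 = ⊞-nonzero (p≢neg p) (λ i → cong₂ ℤ._+_ (w≡0 i) (w≡0 i))

      h-expand : ∀ p → h p F.≈ F.1# F.- μ F.* σₕ p F.+ ν F.* ρₕ p
      h-expand p = F.trans (h-definition p) (short-expand ⟪ α ⟫ ⟪ β ⟫ (ζ p) (E p p) (unit² p))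

      apart-≢ : ∀ {p r : Pt m} → Apart p r → p ≢ neg r
      apart-≢ {p} {r} p#r p≡ = p#r (≡.trans (cong axis p≡) (axis-neg r))

      apart-negˡ : ∀ {p r : Pt m} → Apart p r → Apart (neg p) r
      apart-negˡ {p} p#r e = p#r (≡.trans (≡.sym (axis-neg p)) e)

      apart-negʳ : ∀ {p r : Pt m} → Apart p r → Apart p (neg r)
      apart-negʳ {r = r} p#r e = p#r (≡.trans e (axis-neg r))

      interchange : ∀ a b c d → a ℤ.+ b ℤ.+ (c ℤ.+ d) ≡ a ℤ.+ c ℤ.+ (b ℤ.+ d)
      interchange = CommutativeSemigroupProperties.interchange ℤ.+-commutativeSemigroup

      x-inverse : ∀ p r p̄ r̄ → (∀ i → w p i ℤ.+ w p̄ i ≡ 0ℤ) → (∀ i → w r i ℤ.+ w r̄ i ≡ 0ℤ) → x p r F.* x p̄ r̄ F.≈ F.1#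
      x-inverse p r p̄ r̄ hp hr = Z-inverse _ _ λ i → ≡.trans (interchange (w p i) (w r i) (w p̄ i) (w r̄ i)) (cong₂ ℤ._+_ (hp i) (hr i))

      w-cancel′ : ∀ p i → w (neg p) i ℤ.+ w p i ≡ 0ℤ
      w-cancel′ p i = ≡.trans (ℤ.+-comm (w (neg p) i) (w p i)) (w-cancel p i)

      e-neg : ∀ {p r} → Apart p r → e p r F.+ e (neg p) (neg r) F.+ F.1# F.≈ F.0#
      e-neg {p} {r} p#r = reflect-e (x-inverse p r _ _ (w-cancel p) (w-cancel r)) (unit p r (apart-≢ p#r))
        (unit (neg p) (neg r) (apart-≢ (apart-negˡ {p} (apart-negʳ {p} p#r))))

      e-neg′ : ∀ {p r} → Apart p r → e p (neg r) F.+ e (neg p) r F.+ F.1# F.≈ F.0#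
      e-neg′ {p} {r} p#r = reflect-e (x-inverse p (neg r) _ _ (w-cancel p) (w-cancel′ r))
        (unit p (neg r) (apart-≢ (apart-negʳ {p} p#r))) (unit (neg p) r (apart-≢ (apart-negˡ {p} p#r)))

      σₕ-neg : ∀ p → σₕ p F.+ σₕ (neg p) F.≈ F.0#
      σₕ-neg p = reflect-s (Z-inverse _ _ (w-cancel p)) (unit² p) (unit² (neg p))

      ρₕ-neg : ∀ p → ρₕ p F.+ ρₕ (neg p) F.+ F.1# F.≈ F.0#
      ρₕ-neg p = reflect-e (modulo (solve (ζ p ∷ ζ (neg p) ∷ []) (λ y ȳ → y :* y :* (ȳ :* ȳ) := :1 :+
          (y :* ȳ :+ :1) :* (y :* ȳ :- :1)) ≡.refl) ((ζ p F.* ζ (neg p) F.+ F.1#) ⊛ Z-inverse _ _ (w-cancel p)))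
        (unit² p) (unit² (neg p))

      ℓ-quadratic : ∀ {p r} → Apart p r → ℓ p r F.+ ℓ (neg p) (neg r) F.≈ F.1# F.+ ⟪ θ ⟫
      ℓ-quadratic {p} {r} p#r = F.trans (F.+-cong (ℓ-expand (apart-≢ p#r)) (ℓ-expand (apart-≢ (apart-negˡ {p} (apart-negʳ {p} p#r)))))
        (long-quadratic (e-neg p#r))

      h-quadratic : ∀ p → h p F.+ h (neg p) F.≈ F.1# F.+ F.- (⟪ α ⟫ F.* ⟪ β ⟫)
      h-quadratic p = F.trans (F.+-cong (h-expand p) (h-expand (neg p))) (short-quadratic (σₕ-neg p) (ρₕ-neg p))

      x-split : ∀ p r u → x p (neg u) F.≈ x p (neg r) F.* x r (neg u)
      x-split p r u = F.sym (F.trans (Z-* _ _) (Z-cong λ i → begin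
        w p i ℤ.+ w (neg r) i ℤ.+ (w r i ℤ.+ w (neg u) i)   ≡⟨ ℤ.+-assoc (w p i) _ _ ⟩
        w p i ℤ.+ (w (neg r) i ℤ.+ (w r i ℤ.+ w (neg u) i)) ≡⟨ cong (ℤ._+_ (w p i)) (ℤ.+-assoc (w (neg r) i) (w r i) _) ⟨
        w p i ℤ.+ (w (neg r) i ℤ.+ w r i ℤ.+ w (neg u) i)   ≡⟨ cong (λ k → w p i ℤ.+ (k ℤ.+ w (neg u) i)) (w-cancel′ r i) ⟩
        w p i ℤ.+ (0ℤ ℤ.+ w (neg u) i)                      ≡⟨ cong (ℤ._+_ (w p i)) (ℤ.+-identityˡ _) ⟩
        w p i ℤ.+ w (neg u) i                               ∎))
        where open ≡.≡-Reasoning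

      A₂-identity : ∀ {p r u} → Apart p r → Apart r u → Apart p u →
        ℓ p (neg r) F.* ℓ r (neg u) F.+ ℓ (neg p) r F.* ℓ p (neg u) F.≈ ℓ r (neg u) F.* ℓ p (neg u) F.+ ⟪ θ ⟫
      A₂-identity {p} {r} {u} p#r r#u p#u = begin
        ℓ p (neg r) F.* ℓ r (neg u) F.+ ℓ (neg p) r F.* ℓ p (neg u)
          ≈⟨ F.+-cong (F.*-cong (ℓ-expand p≢r) (ℓ-expand r≢u)) (F.*-cong (ℓ-expand (apart-≢ (apart-negˡ {p} p#r))) (ℓ-expand p≢u)) ⟩
        (F.1# F.+ λℓ F.* e p (neg r)) F.* (F.1# F.+ λℓ F.* e r (neg u)) F.+ (F.1# F.+ λℓ F.* e (neg p) r) F.* (F.1# F.+ λℓ F.* e p (neg u))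
          ≈⟨ A₂ (e-neg′ p#r) (F.trans (product-e (unit p (neg r) p≢r) (unit r (neg u) r≢u)
               (F.trans (F.*-congˡ (F.+-congˡ (F.-‿cong (F.sym (x-split p r u))))) (unit p (neg u) p≢u)))
               (F.*-congʳ (F.*-congʳ (F.sym (x-split p r u))))) ⟩
        (F.1# F.+ λℓ F.* e r (neg u)) F.* (F.1# F.+ λℓ F.* e p (neg u)) F.+ ⟪ θ ⟫
          ≈⟨ F.+-congʳ (F.*-cong (ℓ-expand r≢u) (ℓ-expand p≢u)) ⟨
        ℓ r (neg u) F.* ℓ p (neg u) F.+ ⟪ θ ⟫ ∎
        where
        open SetoidReasoning F.setoid
        p≢r = apart-≢ (apart-negʳ {p} p#r)
        r≢u = apart-≢ (apart-negʳ {r} r#u)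
        p≢u = apart-≢ (apart-negʳ {p} p#u)

      B₂-identity : ∀ {p r} → Apart p r →
        ℓ p (neg r) F.* h r F.+ ℓ (neg p) r F.* h p F.+ h (neg r) F.* ℓ p r F.≈
        ℓ p r F.* h p F.+ (⟪ θ ⟫ F.+ F.- (⟪ α ⟫ F.* ⟪ β ⟫))
      B₂-identity {p} {r} p#r = begin
        ℓ p (neg r) F.* h r F.+ ℓ (neg p) r F.* h p F.+ h (neg r) F.* ℓ p r
          ≈⟨ F.+-cong (F.+-cong (F.*-cong (ℓ-expand p≢r) (h-expand r)) (F.*-cong (ℓ-expand (apart-≢ (apart-negˡ {p} p#r))) hp))
               (F.*-cong (h-expand (neg r)) ℓpr) ⟩
        a (e p (neg r)) F.* b (σₕ r) (ρₕ r) F.+ a (e (neg p) r) F.* b s′ r′ F.+ b (σₕ (neg r)) (ρₕ (neg r)) F.* a e′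
          ≈⟨ B₂ (unit p (neg r) p≢r) hE′ (unit² r) hR′ (e-neg′ p#r) (σₕ-neg r) (ρₕ-neg r) ⟩
        a e′ F.* b s′ r′ F.+ (⟪ θ ⟫ F.+ F.- (⟪ α ⟫ F.* ⟪ β ⟫))
          ≈⟨ F.+-congʳ (F.*-cong ℓpr hp) ⟨
        ℓ p r F.* h p F.+ (⟪ θ ⟫ F.+ F.- (⟪ α ⟫ F.* ⟪ β ⟫)) ∎
        where
        open SetoidReasoning F.setoid
        p≢r = apart-≢ (apart-negʳ {p} p#r)
        a = λ e → F.1# F.+ λℓ F.* e
        b = λ s r → F.1# F.- μ F.* s F.+ ν F.* r
        X = x p (neg r)
        y = ζ r
        e′ = X F.* (y F.* y) F.* E p r
        s′ = X F.* y F.* E p p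
        r′ = X F.* y F.* (X F.* y) F.* E p p
        ζp : ζ p F.≈ X F.* y
        ζp = F.sym (F.trans (Z-* _ _) (Z-cong λ i → ≡.trans (ℤ.+-assoc (w p i) _ _)
          (≡.trans (cong (ℤ._+_ (w p i)) (w-cancel′ r i)) (ℤ.+-identityʳ _))))
        xpr : x p r F.≈ X F.* (y F.* y)
        xpr = F.trans (F.sym (Z-* (w p) (w r))) (F.trans (F.*-congʳ ζp) (F.*-assoc _ _ _))
        hE′ : E p r F.* (F.1# F.- X F.* (y F.* y)) F.≈ F.1#
        hE′ = F.trans (F.*-congˡ (F.+-congˡ (F.-‿cong (F.sym xpr)))) (unit p r (apart-≢ p#r))
        hR′ : E p p F.* (F.1# F.- X F.* y F.* (X F.* y)) F.≈ F.1#
        hR′ = F.trans (F.*-congˡ (F.+-congˡ (F.-‿cong (F.sym (F.*-cong ζp ζp))))) (unit² p)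
        ℓpr : ℓ p r F.≈ a e′
        ℓpr = F.trans (ℓ-expand (apart-≢ p#r)) (F.+-congˡ (F.*-congˡ (F.*-congʳ xpr)))
        hp : h p F.≈ b s′ r′
        hp = F.trans (h-expand p) (F.+-cong (F.+-congˡ (F.-‿cong (F.*-congˡ (F.*-congʳ ζp))))
          (F.*-congˡ (F.*-congʳ (F.*-cong ζp ζp))))

      ℓ-equivariant : ∀ i p r → Tr (s i) (ℓ p r) (ℓ (i · p) (i · r))
      ℓ-equivariant i p r = Tr-resp F.refl (F.*-cong (lin-cong θ (⊞-▹ i p r)) (lin⁻¹-cong 1ˢ (⊞-▹ i p r)))
        (Tr-* (lin-transport i θ _) (lin⁻¹-transport i 1ˢ _))

      h-equivariant : ∀ i p → Tr (s i) (h p) (h (i · p))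
      h-equivariant i p = Tr-resp F.refl (F.*-cong (F.*-cong (lin-cong α (w-· i p)) (lin-cong β (w-· i p))) (lin⁻¹-cong 1ˢ (⊞-▹ i p p)))
        (Tr-* (Tr-* (lin-transport i α _) (lin-transport i β _)) (lin⁻¹-transport i 1ˢ _))

      ℓ-symmetric : ∀ p r → ℓ p r F.≈ ℓ r p
      ℓ-symmetric p r = F.*-cong (lin-cong θ λ i → ℤ.+-comm (w p i) (w r i)) (lin⁻¹-cong 1ˢ λ i → ℤ.+-comm (w p i) (w r i))

      equivariant : Equivariant s ℓ h
      equivariant = record { ℓ-equivariant = ℓ-equivariant ; h-equivariant = h-equivariant ; ℓ-symmetric = ℓ-symmetric }

      long-factor : ∀ p r {y c G} → p ≢ neg r → y F.≈ x p r → c F.≈ ⟪ θ ⟫ → (F.1# F.- y) F.* G F.≈ F.1# →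
        (F.1# F.- c F.* y) F.* G F.≈ ℓ p r
      long-factor p r {y} {c} {G} p≢ hy hc hG = F.*-cong
        (F.trans (F.+-congˡ (F.-‿cong (F.*-cong hc hy))) (F.sym (lin-nonzero θ _ (⊞-nonzero p≢))))
        (inverse-unique (F.+-congˡ (F.-‿cong hy)) hG (F.trans (F.*-comm _ _) (unit p r p≢)))

      -- At a long root the parameters t and u coincide, so o = t^{1/2} u^(-1/2) is 1 and the second
      -- factor of the numerator cancels against 1 - y² = (1 - y)(1 + y).
      long-quotient : ∀ p r {y y² c o G} → p ≢ neg r → y F.≈ x p r → y² F.≈ y F.* y → c F.≈ ⟪ θ ⟫ → o F.≈ F.1# →
        (F.1# F.- y²) F.* G F.≈ F.1# → (F.1# F.- c F.* y) F.* (F.1# F.+ o F.* y) F.* G F.≈ ℓ p r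
      long-quotient p r {y} {y²} {c} {o} {G} p≢ hy hy² hc ho hG = F.trans (F.*-assoc _ _ _) (long-factor p r p≢ hy hc
        (modulo (solve (y ∷ y² ∷ o ∷ G ∷ []) (λ y y² o G → (:1 :- y) :* ((:1 :+ o :* y) :* G) := :1 :+
          ((:1 :- y) :* y :* G :* (o :- :1) :+ G :* (y² :- y :* y) :+ :1 :* ((:1 :- y²) :* G :- :1))) ≡.refl)
          ((F.1# F.- y) F.* y F.* G ⊛ ho ⊹ G ⊛ hy² ⊹ F.1# ⊛ hG)))

      short-quotient : ∀ p {y y² a b G} → y F.≈ ζ p → y² F.≈ y F.* y → a F.≈ ⟪ α ⟫ → F.- b F.≈ ⟪ β ⟫ →
        (F.1# F.- y²) F.* G F.≈ F.1# → (F.1# F.- a F.* y) F.* (F.1# F.+ b F.* y) F.* G F.≈ h p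
      short-quotient p {y} {y²} {a} {b} {G} hy hy² ha hb hG = F.trans (F.*-cong (F.*-cong
          (F.+-congˡ (F.-‿cong (F.*-cong ha hy)))
          (F.trans (solve (b ∷ y ∷ []) (λ b y → :1 :+ b :* y := :1 :- :- b :* y) ≡.refl) (F.+-congˡ (F.-‿cong (F.*-cong hb hy)))))
          (inverse-unique (F.+-congˡ (F.-‿cong (F.trans hy² (F.*-cong hy hy)))) hG (F.trans (F.*-comm _ _) (unit² p))))
        (F.sym (h-definition p))

      ℓ⁻¹ : Pt m → Pt m → F.Carrier
      ℓ⁻¹ p r = lin⁻¹ θ (w p ⊞ w r) F.* lin 1ˢ (w p ⊞ w r)

      h⁻¹ : Pt m → F.Carrier
      h⁻¹ p = lin⁻¹ α (w p) F.* lin⁻¹ β (w p) F.* lin 1ˢ (w p ⊞ w p)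

      *-inverses : ∀ {f f′ g g′} → f F.* f′ F.≈ F.1# → g F.* g′ F.≈ F.1# → f F.* g F.* (f′ F.* g′) F.≈ F.1#
      *-inverses {f} {f′} {g} {g′} hf hg = modulo (solve (f ∷ f′ ∷ g ∷ g′ ∷ []) (λ f f′ g g′ →
        f :* g :* (f′ :* g′) := :1 :+ (g :* g′ :* (f :* f′ :- :1) :+ :1 :* (g :* g′ :- :1))) ≡.refl)
        (g F.* g′ ⊛ hf ⊹ F.1# ⊛ hg)

      ℓ-inverse : ∀ p r → ℓ p r F.* ℓ⁻¹ p r F.≈ F.1#
      ℓ-inverse p r = *-inverses (lin-inverse θ _) (F.trans (F.*-comm _ _) (lin-inverse 1ˢ _))

      h-inverse : ∀ p → h p F.* h⁻¹ p F.≈ F.1#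
      h-inverse p = *-inverses (*-inverses (lin-inverse α _) (lin-inverse β _)) (F.trans (F.*-comm _ _) (lin-inverse 1ˢ _))

      system : System m
      system = record
        { s = s
        ; s-involutive = s-involutive
        ; s-braided = s-braided
        ; z = ζ
        ; z-transport = λ i p → Tr-resp F.refl (Z-cong (w-· i p)) (Z-transport i (w p))
        ; z-separates = ζ-separates
        ; ℓ = ℓ
        ; h = h
        ; ℓ-transport = ℓ-equivariant
        ; h-transport = h-equivariant
        ; ℓ-sym = ℓ-symmetric
        ; θℓ = ⟪ θ ⟫
        ; θh = F.- (⟪ α ⟫ F.* ⟪ β ⟫)
        ; θℓ-central = ⟪⟫-central θ
        ; θh-central = λ y → begin
            φ (F.- (⟪ α ⟫ F.* ⟪ β ⟫)) * y       ≈⟨ *-congʳ (trans (φ-neg _) (-‿cong (φ-* _ _))) ⟩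
            - (φ ⟪ α ⟫ * φ ⟪ β ⟫) * y           ≈⟨ -‿distribˡ-* _ _ ⟨
            - (φ ⟪ α ⟫ * φ ⟪ β ⟫ * y)           ≈⟨ -‿cong (trans (*-assoc _ _ _) (trans (*-congˡ (⟪⟫-central β y)) (trans (sym (*-assoc _ _ _))
                                                     (trans (*-congʳ (⟪⟫-central α y)) (*-assoc _ _ _))))) ⟩
            - (y * (φ ⟪ α ⟫ * φ ⟪ β ⟫))         ≈⟨ -‿distribʳ-* _ _ ⟩
            y * - (φ ⟪ α ⟫ * φ ⟪ β ⟫)           ≈⟨ *-congˡ (trans (φ-neg _) (-‿cong (φ-* _ _))) ⟨
            y * φ (F.- (⟪ α ⟫ F.* ⟪ β ⟫))       ∎
        ; ℓ-quadratic = ℓ-quadratic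
        ; h-quadratic = h-quadratic
        ; A₂-identity = A₂-identity
        ; B₂-identity = B₂-identity
        }
        where open SetoidReasoning setoid

    -- The parameters and their inverses; α β = - t for the t of the short roots.
    module Mixed (θ θ′ α α′ β β′ : Scalar) (θθ′ : ⟪ θ ⟫ F.* ⟪ θ′ ⟫ F.≈ F.1#)
      (αα′ : ⟪ α ⟫ F.* ⟪ α′ ⟫ F.≈ F.1#) (ββ′ : ⟪ β ⟫ F.* ⟪ β′ ⟫ F.≈ F.1#) where
      module P  = Parameters θ α β
      module P′ = Parameters θ′ α′ β′

      Θ Θ′ : Kind → F.Carrier
      Θ long   = ⟪ θ ⟫
      Θ short  = F.- (⟪ α ⟫ F.* ⟪ β ⟫)
      Θ′ long  = ⟪ θ′ ⟫
      Θ′ short = F.- (⟪ α′ ⟫ F.* ⟪ β′ ⟫)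

      ΘΘ′ : ∀ κ → Θ κ F.* Θ′ κ F.≈ F.1#
      ΘΘ′ long  = θθ′
      ΘΘ′ short = modulo (solve (⟪ α ⟫ ∷ ⟪ α′ ⟫ ∷ ⟪ β ⟫ ∷ ⟪ β′ ⟫ ∷ []) (λ a a′ b b′ →
        :- (a :* b) :* :- (a′ :* b′) := :1 :+ (b :* b′ :* (a :* a′ :- :1) :+ :1 :* (b :* b′ :- :1))) ≡.refl)
        (⟪ β ⟫ F.* ⟪ β′ ⟫ ⊛ αα′ ⊹ F.1# ⊛ ββ′)

      -- Multiply numerator and denominator of (1 - x/θ)/(1 - x) by -1/x: up to the factor 1/θ,
      -- inverting the parameter means passing to the opposite root. For short roots, in `h-link`,
      -- the multiplier is -1/y².
      ℓ-link : ∀ {p r} → Apart p r → P′.ℓ p r F.≈ ⟪ θ′ ⟫ F.* P.ℓ (neg p) (neg r)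
      ℓ-link {p} {r} p#r = F.trans (F.*-congʳ (lin-nonzero θ′ _ (⊞-nonzero (P.apart-≢ p#r)))) (F.trans
        (modulo (solve (⟪ θ ⟫ ∷ ⟪ θ′ ⟫ ∷ P.x p r ∷ P.x p̄ r̄ ∷ P.E p r ∷ P.E p̄ r̄ ∷ []) (λ θ θ′ x x̄ E Ē →
            (:1 :- θ′ :* x) :* E := θ′ :* ((:1 :- θ :* x̄) :* Ē) :+
            ((:1 :- θ′) :* (x :* E :+ x̄ :* Ē :+ :1 :- :0) :+ :- θ′ :* (Ē :* (:1 :- x̄) :- :1)
              :+ x̄ :* Ē :* (θ :* θ′ :- :1) :+ :1 :* (E :* (:1 :- x) :- :1))) ≡.refl)
          (F.1# F.- ⟪ θ′ ⟫ ⊛ P.e-neg p#r ⊹ (F.- ⟪ θ′ ⟫) ⊛ unit p̄ r̄ p̄≢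
            ⊹ P.x p̄ r̄ F.* P.E p̄ r̄ ⊛ θθ′ ⊹ F.1# ⊛ unit p r (P.apart-≢ p#r)))
        (F.*-congˡ (F.*-congʳ (F.sym (lin-nonzero θ _ (⊞-nonzero p̄≢))))))
        where
        p̄ = neg p
        r̄ = neg r
        p̄≢ = P.apart-≢ (P.apart-negˡ {p} (P.apart-negʳ {p} p#r))

      h-link : ∀ p → P′.h p F.≈ Θ′ short F.* P.h (neg p)
      h-link p = F.trans (P′.h-definition p) (F.trans
        (modulo (solve (⟪ α ⟫ ∷ ⟪ α′ ⟫ ∷ ⟪ β ⟫ ∷ ⟪ β′ ⟫ ∷ ζ p ∷ ζ p̄ ∷ P.E p p ∷ P.E p̄ p̄ ∷ []) (λ a a′ b b′ y ȳ R R̄ →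
            (:1 :- a′ :* y) :* (:1 :- b′ :* y) :* R := :- (a′ :* b′) :* ((:1 :- a :* ȳ) :* (:1 :- b :* ȳ) :* R̄) :+
            (:1 :* (R :* (:1 :- y :* y) :- :1) :+ (:1 :+ a′ :* b′) :* (y :* y :* R :+ ȳ :* ȳ :* R̄ :+ :1 :- :0)
              :+ :- (a′ :+ b′) :* (y :* R :+ ȳ :* R̄ :- :0) :+ a′ :* b′ :* (R̄ :* (:1 :- ȳ :* ȳ) :- :1)
              :+ (ȳ :* ȳ :* R̄ :- b′ :* ȳ :* R̄) :* (a :* a′ :- :1) :+ (a :* a′ :* ȳ :* ȳ :* R̄ :- a′ :* ȳ :* R̄) :* (b :* b′ :- :1)))
          ≡.refl)
          (F.1# ⊛ P.unit² p ⊹ F.1# F.+ ⟪ α′ ⟫ F.* ⟪ β′ ⟫ ⊛ P.ρₕ-neg p ⊹ (F.- (⟪ α′ ⟫ F.+ ⟪ β′ ⟫)) ⊛ P.σₕ-neg p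
            ⊹ ⟪ α′ ⟫ F.* ⟪ β′ ⟫ ⊛ P.unit² p̄ ⊹ (ζ p̄ F.* ζ p̄ F.* P.E p̄ p̄ F.- ⟪ β′ ⟫ F.* ζ p̄ F.* P.E p̄ p̄) ⊛ αα′
            ⊹ (⟪ α ⟫ F.* ⟪ α′ ⟫ F.* ζ p̄ F.* ζ p̄ F.* P.E p̄ p̄ F.- ⟪ α′ ⟫ F.* ζ p̄ F.* P.E p̄ p̄) ⊛ ββ′))
        (F.*-congˡ (F.sym (P.h-definition p̄))))
        where p̄ = neg p

      k k′ : Gen m → F.Carrier
      k i  = simple P.ℓ P.h i
      k′ i = simple P′.ℓ P′.h i

      -- Θ κ is the parameter t of the roots of kind κ.
      k-reflection : ∀ i → ∃[ k̄ ] Tr (s i) (k i) k̄ × k i F.+ k̄ F.≈ F.1# F.+ Θ (kind i) × k′ i F.≈ Θ′ (kind i) F.* k̄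
      k-reflection i with simpleRoot i
      ... | short-root p κ ip f rewrite κ | f P.ℓ P.h | f P′.ℓ P′.h = P.h (neg p) ,
        subst (λ r → Tr (s i) (P.h p) (P.h r)) ip (P.h-equivariant i p) , P.h-quadratic p , h-link p
      ... | long-root p r κ p#r ip ir f rewrite κ | f P.ℓ P.h | f P′.ℓ P′.h = P.ℓ (neg p) (neg r) ,
        Tr-resp F.refl (F.trans (F.reflexive (cong₂ P.ℓ ip ir)) (P.ℓ-symmetric _ _)) (P.ℓ-equivariant i p r) ,
        P.ℓ-quadratic p#r , ℓ-link p#r

      -- ε κ = - selects the sign character on the roots of kind κ.
      module Character (ε : Kind → Sign) where
        module Q = Parameters (pick (ε long) θ θ′) (pick (ε short) α α′) (pick (ε short) β β′)

        -- Values at roots on which the character is a sign will stand to the left of the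
        -- symmetrizer, the others to its right. Products of these functions split accordingly.
        ℓL ℓR ℓL⁻¹ : Pt m → Pt m → F.Carrier
        ℓL p r   = pick (ε long) F.1# (P′.ℓ p r)
        ℓR p r   = pick (ε long) (P.ℓ p r) F.1#
        ℓL⁻¹ p r = pick (ε long) F.1# (P′.ℓ⁻¹ p r)

        hL hR hL⁻¹ : Pt m → F.Carrier
        hL p   = pick (ε short) F.1# (P′.h p)
        hR p   = pick (ε short) (P.h p) F.1#
        hL⁻¹ p = pick (ε short) F.1# (P′.h⁻¹ p)

        ℓ-factor : ∀ p r → Q.ℓ p r F.≈ ℓL p r F.* ℓR p r
        ℓ-factor p r with ε long
        ... | Sign.+ = F.sym (F.*-identityˡ _)
        ... | Sign.- = F.sym (F.*-identityʳ _)

        h-factor : ∀ p → Q.h p F.≈ hL p F.* hR p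
        h-factor p with ε short
        ... | Sign.+ = F.sym (F.*-identityˡ _)
        ... | Sign.- = F.sym (F.*-identityʳ _)

        equivariantL : Equivariant s ℓL hL
        equivariantL = record { ℓ-equivariant = ℓ-eq ; h-equivariant = h-eq ; ℓ-symmetric = ℓ-sym }
          where
          ℓ-eq : ∀ i p r → Tr (s i) (ℓL p r) (ℓL (i · p) (i · r))
          ℓ-eq i p r with ε long
          ... | Sign.+ = Tr-1
          ... | Sign.- = P′.ℓ-equivariant i p r
          h-eq : ∀ i p → Tr (s i) (hL p) (hL (i · p))
          h-eq i p with ε short
          ... | Sign.+ = Tr-1
          ... | Sign.- = P′.h-equivariant i p
          ℓ-sym : ∀ p r → ℓL p r F.≈ ℓL r p
          ℓ-sym p r with ε long
          ... | Sign.+ = F.refl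
          ... | Sign.- = P′.ℓ-symmetric p r

        L-inverse : ∏roots ℓL hL F.* ∏roots ℓL⁻¹ hL⁻¹ F.≈ F.1#
        L-inverse = F.trans (F.sym (∏roots-* ℓL ℓL⁻¹ hL hL⁻¹)) (F.trans (∏roots-cong ℓ-inv h-inv) (∏roots-1 {m}))
          where
          ℓ-inv : ∀ p r → ℓL p r F.* ℓL⁻¹ p r F.≈ F.1#
          ℓ-inv p r with ε long
          ... | Sign.+ = F.*-identityˡ _
          ... | Sign.- = P′.ℓ-inverse p r
          h-inv : ∀ p → hL p F.* hL⁻¹ p F.≈ F.1#
          h-inv p with ε short
          ... | Sign.+ = F.*-identityˡ _
          ... | Sign.- = P′.h-inverse p

        sgn : Gen m → Carrier
        sgn i = ±1 (ε (kind i))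

        open Twist Q.system sgn (λ i → ±1-central (ε (kind i))) (λ i → ±1-square (ε (kind i)))
          (kind-braided (±1 ∘ ε) (λ κ κ′ → ±1-central (ε κ) (±1 (ε κ′)))) ℓL hL equivariantL (∏roots ℓL⁻¹ hL⁻¹) L-inverse
          using (twisted-symmetrizer; twisted-braided; σs; σs-braided) public

        -- τ κ is the square root of Θ κ.
        module Generators (T : Gen m → Carrier) (τ τ⁻¹ : Kind → F.Carrier)
          (τ-central : ∀ κ x → φ (τ κ) * x ≈ x * φ (τ κ)) (τ⁻¹-central : ∀ κ x → φ (τ⁻¹ κ) * x ≈ x * φ (τ⁻¹ κ))
          (ττ⁻¹ : ∀ κ → τ κ F.* τ⁻¹ κ F.≈ F.1#) (τ⁻¹τ⁻¹ : ∀ κ → τ⁻¹ κ F.* τ⁻¹ κ F.≈ Θ′ κ)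
          (T-c : ∀ i → T i + φ (τ⁻¹ (kind i)) ≈ (1# + s i) * φ (τ⁻¹ (kind i) F.* k i)) where

          χ : Kind → F.Carrier
          χ κ = pick (ε κ) (τ κ) (F.- τ⁻¹ κ)

          g : Gen m → Carrier
          g i = φ (χ (kind i)) * T i

          kL kR : Gen m → F.Carrier
          kL i = pick (ε (kind i)) F.1# (k′ i)
          kR i = pick (ε (kind i)) (k i) F.1#

          kL-simple : ∀ i → simple ℓL hL i ≡ kL i
          kL-simple i with simpleRoot i
          ... | short-root p κ _ f rewrite κ | f ℓL hL | f P′.ℓ P′.h = ≡.refl
          ... | long-root p r κ _ _ _ f rewrite κ | f ℓL hL | f P′.ℓ P′.h = ≡.refl

          kQ-factor : ∀ i → simple Q.ℓ Q.h i F.≈ simple ℓL hL i F.* kR i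
          kQ-factor i with simpleRoot i
          ... | short-root p κ _ f rewrite κ | f Q.ℓ Q.h | f ℓL hL | f P.ℓ P.h = h-factor p
          ... | long-root p r κ _ _ _ f rewrite κ | f Q.ℓ Q.h | f ℓL hL | f P.ℓ P.h = ℓ-factor p r

          T-symmetric : ∀ i → φ (τ (kind i)) * T i + 1# ≈ (1# + s i) * φ (k i)
          T-symmetric i = begin
            φ t * T i + 1#                              ≈⟨ +-congˡ (trans (sym φ-1) (trans (φ-cong (F.sym (ττ⁻¹ (kind i)))) (φ-* t t⁻¹))) ⟩
            φ t * T i + φ t * φ t⁻¹                     ≈⟨ distribˡ _ _ _ ⟨
            φ t * (T i + φ t⁻¹)                         ≈⟨ *-congˡ (T-c i) ⟩
            φ t * ((1# + s i) * φ (t⁻¹ F.* k i))        ≈⟨ *-assoc _ _ _ ⟨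
            φ t * (1# + s i) * φ (t⁻¹ F.* k i)          ≈⟨ *-congʳ (τ-central (kind i) _) ⟩
            (1# + s i) * φ t * φ (t⁻¹ F.* k i)          ≈⟨ trans (*-assoc _ _ _) (*-congˡ (trans (sym (φ-* _ _)) (φ-cong
                                                             (F.trans (F.sym (F.*-assoc _ _ _)) (F.trans (F.*-congʳ (ττ⁻¹ (kind i))) (F.*-identityˡ _)))))) ⟩
            (1# + s i) * φ (k i)                        ∎
            where
            open SetoidReasoning setoid
            t = τ (kind i)
            t⁻¹ = τ⁻¹ (kind i)

          -- From k + k̄ = 1 + Θ and k′ = Θ′ k̄ the constant 1 equals k′ + Θ′ k - Θ′. Together with
          -- T the last term completes the defining relation of T, whose value (1 + s) Θ′ k cancels
          -- Θ′ k and leaves s Θ′ k = k′ s.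
          T-antisymmetric : ∀ i → φ (F.- τ⁻¹ (kind i)) * T i + 1# ≈ φ (k′ i) * (1# + - 1# * s i)
          T-antisymmetric i = begin
            φ (F.- t⁻¹) * T i + 1#
              ≈⟨ +-cong (*-congʳ (φ-neg t⁻¹)) (trans (sym φ-1) (φ-cong one)) ⟩
            - φ t⁻¹ * T i + φ (k′ i F.+ Θ′k F.- t⁻¹ F.* t⁻¹)
              ≈⟨ +-congˡ (trans (φ-+ _ _) (+-cong (φ-+ _ _) (trans (φ-neg _) (-‿cong (φ-* _ _))))) ⟩
            - φ t⁻¹ * T i + (φ (k′ i) + φ Θ′k - φ t⁻¹ * φ t⁻¹)
              ≈⟨ solveA (φ t⁻¹ ∷ T i ∷ φ (k′ i) ∷ φ Θ′k ∷ []) (λ t T k′ K →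
                   (⊖ t) ⊗ T ⊕ (k′ ⊕ K ⊕ ⊖ (t ⊗ t)) ⊜ k′ ⊕ K ⊕ ⊖ (t ⊗ (T ⊕ t))) ≡.refl ⟩
            φ (k′ i) + φ Θ′k - φ t⁻¹ * (T i + φ t⁻¹)
              ≈⟨ +-congˡ (-‿cong (trans (*-congˡ (T-c i)) (trans (sym (*-assoc _ _ _)) (trans (*-congʳ (τ⁻¹-central (kind i) _))
                   (trans (*-assoc _ _ _) (*-congˡ (trans (sym (φ-* _ _)) (φ-cong (F.trans (F.sym (F.*-assoc _ _ _)) (F.*-congʳ (τ⁻¹τ⁻¹ (kind i))))))))))))  ⟩
            φ (k′ i) + φ Θ′k - (1# + s i) * φ Θ′k
              ≈⟨ solveA (φ (k′ i) ∷ φ Θ′k ∷ s i ∷ []) (λ k′ K s → k′ ⊕ K ⊕ ⊖ ((I ⊕ s) ⊗ K) ⊜ k′ ⊕ ⊖ (s ⊗ K)) ≡.refl ⟩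
            φ (k′ i) - s i * φ Θ′k
              ≈⟨ +-congˡ (-‿cong s-Θ′k) ⟩
            φ (k′ i) - φ (k′ i) * s i
              ≈⟨ solveA (φ (k′ i) ∷ s i ∷ []) (λ k s → k ⊕ ⊖ (k ⊗ s) ⊜ k ⊗ (I ⊕ (⊖ I) ⊗ s)) ≡.refl ⟩
            φ (k′ i) * (1# + - 1# * s i) ∎
            where
            open SetoidReasoning setoid
            open NoncommutativeSolver A using () renaming (solve to solveA; _:+_ to _⊕_; _:*_ to _⊗_; :-_ to ⊖_; :1 to I; _:=_ to _⊜_)
            t⁻¹ = τ⁻¹ (kind i)
            Θ′k = Θ′ (kind i) F.* k i
            reflection = k-reflection i
            k̄ = proj₁ reflection
            k̄-tr = proj₁ (proj₂ reflection)
            quadratic = proj₁ (proj₂ (proj₂ reflection))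
            link = proj₂ (proj₂ (proj₂ reflection))
            one : F.1# F.≈ k′ i F.+ Θ′k F.- t⁻¹ F.* t⁻¹
            one = modulo (solve (k i ∷ k̄ ∷ Θ (kind i) ∷ Θ′ (kind i) ∷ k′ i ∷ t⁻¹ ∷ []) (λ k k̄ Θ Θ′ k′ t →
                :1 := k′ :+ Θ′ :* k :- t :* t :+
                (:- Θ′ :* (k :+ k̄ :- (:1 :+ Θ)) :+ :- :1 :* (k′ :- Θ′ :* k̄) :+ :1 :* (t :* t :- Θ′) :+ :- :1 :* (Θ :* Θ′ :- :1))) ≡.refl)
              ((F.- Θ′ (kind i)) ⊛ quadratic ⊹ (F.- F.1#) ⊛ link ⊹ F.1# ⊛ τ⁻¹τ⁻¹ (kind i) ⊹ (F.- F.1#) ⊛ ΘΘ′ (kind i))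
            Θ′-central : ∀ x → φ (Θ′ (kind i)) * x ≈ x * φ (Θ′ (kind i))
            Θ′-central x = begin
              φ (Θ′ (kind i)) * x      ≈⟨ *-congʳ (trans (φ-cong (F.sym (τ⁻¹τ⁻¹ (kind i)))) (φ-* _ _)) ⟩
              φ t⁻¹ * φ t⁻¹ * x        ≈⟨ trans (*-assoc _ _ _) (trans (*-congˡ (τ⁻¹-central (kind i) x)) (trans (sym (*-assoc _ _ _))
                                            (trans (*-congʳ (τ⁻¹-central (kind i) x)) (*-assoc _ _ _)))) ⟩
              x * (φ t⁻¹ * φ t⁻¹)      ≈⟨ *-congˡ (trans (φ-cong (F.sym (τ⁻¹τ⁻¹ (kind i)))) (φ-* _ _)) ⟨
              x * φ (Θ′ (kind i))      ∎
            s-Θ′k : s i * φ Θ′k ≈ φ (k′ i) * s i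
            s-Θ′k = transport (Tr-resp F.refl (F.sym link) (Tr-* (tr (sym (Θ′-central (s i)))) k̄-tr))

          g-factor : ∀ i → g i + 1# ≈ φ (simple ℓL hL i) * (1# + σs i) * φ (kR i)
          g-factor i rewrite kL-simple i with ε (kind i)
          ... | Sign.+ = trans (T-symmetric i) (*-congʳ (trans (+-congˡ (sym (*-identityˡ (s i))))
                  (trans (sym (*-identityˡ _)) (*-congʳ (sym φ-1)))))
          ... | Sign.- = trans (T-antisymmetric i) (trans (sym (*-identityʳ _)) (*-congˡ (sym φ-1)))

          symmetrizer-factorization : ∑words g ≈ φ (∏roots ℓL hL) * ∑words σs * φ (∏roots ℓR hR)
          symmetrizer-factorization = twisted-symmetrizer g kR (∏roots ℓR hR) kQ-factor
            (F.trans (∏roots-cong ℓ-factor h-factor) (∏roots-* ℓL ℓR hL hR)) g-factor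

          g-braided : Braided g
          g-braided = twisted-braided g kR kQ-factor g-factor

          κℓ : Pt m → Pt m → F.Carrier
          κℓ p r = pick (ε long) F.1# (P.ℓ (neg p) (neg r))

          κh : Pt m → F.Carrier
          κh p = pick (ε short) F.1# (P.h (neg p))

          weight : Kind → F.Carrier
          weight κ = pick (ε κ) F.1# (Θ κ)

          -- By `∏-top` the weight of the longest word supplies one factor Θ for each positive root
          -- with a sign, which is what the links need to replace an inverted parameter by the
          -- opposite root.
          weighted-L : FM.⟦ weight ∘ kind ⟧ (word (top {m})) F.* ∏roots ℓL hL F.≈ ∏roots κℓ κh
          weighted-L = F.trans (F.*-congʳ (∏-top {m} weight)) (F.trans (F.sym (∏roots-* {m} (λ _ _ → weight long) ℓL (λ _ → weight short) hL))
            (∏roots-cong-apart ℓ-case h-case))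
            where
            cancel : ∀ κ {f f̄} → f F.≈ Θ′ κ F.* f̄ → Θ κ F.* f F.≈ f̄
            cancel κ {f} {f̄} e = F.trans (F.*-congˡ e) (F.trans (F.sym (F.*-assoc _ _ _)) (F.trans (F.*-congʳ (ΘΘ′ κ)) (F.*-identityˡ f̄)))
            ℓ-case : ∀ {p r} → Apart p r → weight long F.* ℓL p r F.≈ κℓ p r
            ℓ-case p#r with ε long
            ... | Sign.+ = F.*-identityˡ _
            ... | Sign.- = cancel long (ℓ-link p#r)
            h-case : ∀ p → weight short F.* hL p F.≈ κh p
            h-case p with ε short
            ... | Sign.+ = F.*-identityˡ _
            ... | Sign.- = cancel short (h-link p)

          weighted-factorization : φ (FM.⟦ weight ∘ kind ⟧ (word (top {m}))) * ∑words g ≈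
            φ (∏roots κℓ κh) * ∑words σs * φ (∏roots ℓR hR)
          weighted-factorization = begin
            φ wt * ∑words g                                                   ≈⟨ *-congˡ symmetrizer-factorization ⟩
            φ wt * (φ (∏roots ℓL hL) * ∑words σs * φ (∏roots ℓR hR))          ≈⟨ trans (sym (*-assoc _ _ _)) (*-congʳ (sym (*-assoc _ _ _))) ⟩
            φ wt * φ (∏roots ℓL hL) * ∑words σs * φ (∏roots ℓR hR)            ≈⟨ *-congʳ (*-congʳ (trans (sym (φ-* _ _)) (φ-cong weighted-L))) ⟩
            φ (∏roots κℓ κh) * ∑words σs * φ (∏roots ℓR hR)                  ∎
            where
            open SetoidReasoning setoid
            wt = FM.⟦ weight ∘ kind ⟧ (word (top {m}))

-- Products over roots by indices; signs and scalars of the longest element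

module FinSums (M : CommutativeMonoid 0ℓ 0ℓ) where
  open CommutativeMonoid M
  open PointSums M
  open CommutativeMonoidSum M using (sum; sum-cong-≋; sum-replicate-zero)

  ∑-pos : ∀ {m} (f : Pt m → Carrier) → ∑ f ≈ sum {suc m} λ j → f (neg (pos j)) ∙ f (pos j)
  ∑-pos {zero}  f = trans (comm _ _) (sym (identityʳ _))
  ∑-pos {suc m} f = ∙-cong (comm _ _) (∑-pos (f ∘ mid))

  ∑-ε : ∀ {m} → ∑ {m} (λ _ → ε) ≈ ε
  ∑-ε {zero}  = identityˡ ε
  ∑-ε {suc m} = trans (∙-cong (identityˡ ε) (∑-ε {m})) (identityˡ ε)

  ∑roots-short : ∀ {m} (h : Pt m → Carrier) → ∑roots (λ _ _ → ε) h ≈ sum {suc m} (h ∘ pos)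
  ∑roots-short {zero}  h = sym (identityʳ _)
  ∑roots-short {suc m} h = ∙-cong (trans (∙-congʳ (∑-ε {m})) (identityˡ _)) (∑roots-short (h ∘ mid))

  ∑roots-long : ∀ {m} (ℓ : Pt m → Pt m → Carrier) → ∑roots ℓ (λ _ → ε) ≈
    sum {suc m} λ i → sum {suc m} λ j → if does (i Fin.<? j) then ℓ (pos i) (neg (pos j)) ∙ ℓ (pos i) (pos j) else ε
  ∑roots-long {zero}  ℓ = sym (trans (identityʳ _) (identityʳ _))
  ∑roots-long {suc m} ℓ = ∙-cong
    (trans (identityʳ _) (trans (∑-pos (λ q → ℓ first (mid q))) (sym (identityˡ _))))
    (trans (∑roots-long (λ p q → ℓ (mid p) (mid q))) (sum-cong-≋ {suc m} λ i → sym (identityˡ (sum {suc m} λ j →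
      if does (i Fin.<? j) then ℓ (mid (pos i)) (mid (neg (pos j))) ∙ ℓ (mid (pos i)) (mid (pos j)) else ε))))

module SignedProducts (A : Ring 0ℓ 0ℓ) (F : CommutativeRing 0ℓ 0ℓ) (Φ : FunctionMap F A) where
  open Ring A hiding (zero)
  private module F = CommutativeRing F
  open FunctionMap Φ
  open Hecke A F Φ using (φ-neg; ∏roots; ∏roots-cong; ∏roots-*; ∏roots-1; ∏-top; module FM)
  open PointSums F.*-commutativeMonoid using () renaming (∑ to ∏; ∑ε₁ to ∏ε₁)
  open BraidMonoid *-monoid using (⟦_⟧; ⟦⟧-cong; ⟦⟧-⇝)
  open Signs A
  open RingProperties F.ring using (-‿distribˡ-*; -‿distribʳ-*; -‿involutive)
  open CommutativeSemigroupProperties F.*-commutativeSemigroup using (interchange)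

  φ-⟦⟧ : ∀ {m} (f : Gen m → F.Carrier) w → φ (FM.⟦ f ⟧ w) ≈ ⟦ φ ∘ f ⟧ w
  φ-⟦⟧ f []      = φ-1
  φ-⟦⟧ f (i ∷ w) = trans (φ-* (f i) (FM.⟦ f ⟧ w)) (*-congˡ (φ-⟦⟧ f w))

  ⟦⟧-* : ∀ {m} (f g : Gen m → F.Carrier) w → FM.⟦ (λ i → f i F.* g i) ⟧ w F.≈ FM.⟦ f ⟧ w F.* FM.⟦ g ⟧ w
  ⟦⟧-* f g []      = F.sym (F.*-identityˡ F.1#)
  ⟦⟧-* f g (i ∷ w) = F.trans (F.*-congˡ (⟦⟧-* f g w)) (interchange (f i) (g i) _ _)

  ⟦⟧-central-* : ∀ {m} (c t : Gen m → Carrier) → (∀ i x → c i * x ≈ x * c i) → ∀ w → ⟦ (λ i → c i * t i) ⟧ w ≈ ⟦ c ⟧ w * ⟦ t ⟧ w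
  ⟦⟧-central-* c t central []      = sym (*-identityˡ 1#)
  ⟦⟧-central-* c t central (i ∷ w) = begin
    c i * t i * ⟦ (λ i → c i * t i) ⟧ w     ≈⟨ *-congˡ (⟦⟧-central-* c t central w) ⟩
    c i * t i * (⟦ c ⟧ w * ⟦ t ⟧ w)         ≈⟨ trans (*-assoc _ _ _) (*-congˡ (sym (*-assoc _ _ _))) ⟩
    c i * (t i * ⟦ c ⟧ w * ⟦ t ⟧ w)         ≈⟨ *-congˡ (*-congʳ (⟦c⟧-central w (t i))) ⟨
    c i * (⟦ c ⟧ w * t i * ⟦ t ⟧ w)         ≈⟨ trans (*-congˡ (*-assoc _ _ _)) (sym (*-assoc _ _ _)) ⟩
    c i * ⟦ c ⟧ w * (t i * ⟦ t ⟧ w)         ∎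
    where
    open SetoidReasoning setoid
    ⟦c⟧-central : ∀ w x → ⟦ c ⟧ w * x ≈ x * ⟦ c ⟧ w
    ⟦c⟧-central []      x = trans (*-identityˡ x) (sym (*-identityʳ x))
    ⟦c⟧-central (i ∷ w) x = trans (*-assoc _ _ _) (trans (*-congˡ (⟦c⟧-central w x))
      (trans (sym (*-assoc _ _ _)) (trans (*-congʳ (central i x)) (*-assoc _ _ _))))

  -1-square : (F.- F.1#) F.* (F.- F.1#) F.≈ F.1#
  -1-square = F.trans (F.sym (-‿distribˡ-* _ _)) (F.trans (F.-‿cong (F.*-identityˡ _)) (-‿involutive F.1#))

  module _ (ε : Kind → Sign) where

    sign : Kind → F.Carrier
    sign κ = pick (ε κ) F.1# (F.- F.1#)

    φ-sign : ∀ κ → φ (sign κ) ≈ ±1 (ε κ)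
    φ-sign κ with ε κ
    ... | Sign.+ = φ-1
    ... | Sign.- = trans (φ-neg F.1#) (-‿cong φ-1)

    signs : ∀ {m} (w : Wd m) → φ (FM.⟦ sign ∘ kind ⟧ w) ≈ ⟦ ±1 ∘ ε ∘ kind ⟧ w
    signs w = trans (φ-⟦⟧ (sign ∘ kind) w) (⟦⟧-cong (λ i → φ-sign (kind i)) w)

    -- Long roots come in pairs εᵢ ± εⱼ, so that only the short roots contribute to the sign of the longest element.
    signs-top : ∀ {m} → ε short ≡ Sign.+ → {w : Wd m} → w ⇝ word (top {m}) → ⟦ ±1 ∘ ε ∘ kind ⟧ w ≈ 1#
    signs-top {m} short+ {w} w⇝ = begin
      ⟦ ±1 ∘ ε ∘ kind ⟧ w                              ≈⟨ signs w ⟨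
      φ (FM.⟦ sign ∘ kind ⟧ w)                         ≈⟨ φ-cong (FM.⟦⟧-⇝ (FM.kind-braided sign λ a b → F.*-comm (sign a) (sign b)) w⇝) ⟩
      φ (FM.⟦ sign ∘ kind ⟧ (word (top {m})))          ≈⟨ φ-cong (F.trans (∏-top {m} sign) (even {m})) ⟩
      φ F.1#                                           ≈⟨ φ-1 ⟩
      1#                                               ∎
      where
      open SetoidReasoning setoid
      square : sign long F.* sign long F.≈ F.1#
      square with ε long
      ... | Sign.+ = F.*-identityˡ F.1#
      ... | Sign.- = -1-square
      short-1 : sign short ≡ F.1#
      short-1 rewrite short+ = ≡.refl
      points : ∀ {m} → ∏ {m} (λ _ → sign long) F.≈ F.1#
      points {zero}  = square
      points {suc m} = F.trans (F.*-cong square (points {m})) (F.*-identityˡ F.1#)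
      even : ∀ {m} → ∏roots {m} (λ _ _ → sign long) (λ _ → sign short) F.≈ F.1#
      even {zero}  = F.reflexive short-1
      even {suc m} = F.trans (F.*-cong (F.trans (F.*-cong (points {m}) (F.reflexive short-1)) (F.*-identityˡ F.1#)) (even {m})) (F.*-identityˡ F.1#)

    module _ (τ τ⁻¹ Θ : Kind → F.Carrier) (ττ⁻¹ : ∀ κ → τ κ F.* τ⁻¹ κ F.≈ F.1#) (ττ : ∀ κ → τ κ F.* τ κ F.≈ Θ κ) where

      χ weight : Kind → F.Carrier
      χ κ      = pick (ε κ) (τ κ) (F.- τ⁻¹ κ)
      weight κ = pick (ε κ) F.1# (Θ κ)

      τ-split : ∀ κ → τ κ F.≈ sign κ F.* weight κ F.* χ κ
      τ-split κ with ε κ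
      ... | Sign.+ = F.sym (F.trans (F.*-congʳ (F.*-identityˡ F.1#)) (F.*-identityˡ (τ κ)))
      ... | Sign.- = F.sym (begin
        (F.- F.1#) F.* Θ κ F.* (F.- τ⁻¹ κ)      ≈⟨ F.*-congʳ (F.sym (-‿distribˡ-* _ _)) ⟩
        (F.- (F.1# F.* Θ κ)) F.* (F.- τ⁻¹ κ)    ≈⟨ F.trans (F.sym (-‿distribˡ-* _ _)) (F.-‿cong (F.sym (-‿distribʳ-* _ _))) ⟩
        F.- (F.- (F.1# F.* Θ κ F.* τ⁻¹ κ))      ≈⟨ -‿involutive _ ⟩
        F.1# F.* Θ κ F.* τ⁻¹ κ                  ≈⟨ F.*-congʳ (F.trans (F.*-identityˡ _) (F.sym (ττ κ))) ⟩
        τ κ F.* τ κ F.* τ⁻¹ κ                   ≈⟨ F.trans (F.*-assoc _ _ _) (F.*-congˡ (ττ⁻¹ κ)) ⟩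
        τ κ F.* F.1#                            ≈⟨ F.*-identityʳ _ ⟩
        τ κ                                     ∎)
        where open SetoidReasoning F.setoid

      -- Signs and weights are kept apart: the signs stay on w itself, where they form the sign of
      -- the character, while the weights move to the word of `top`, where they can be counted by
      -- roots.
      longest-scalar : ∀ {m} {w : Wd m} {x} → w ⇝ word (top {m}) → φ (FM.⟦ χ ∘ kind ⟧ w) * x ≈ 1# →
        φ (FM.⟦ τ ∘ kind ⟧ w) * x ≈ ⟦ ±1 ∘ ε ∘ kind ⟧ w * φ (FM.⟦ weight ∘ kind ⟧ (word (top {m})))
      longest-scalar {m} {w} {x} w⇝ χx = begin
        φ (FM.⟦ τ ∘ kind ⟧ w) * x
          ≈⟨ *-congʳ (φ-cong (F.trans (FM.⟦⟧-cong (λ i → τ-split (kind i)) w)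
               (F.trans (⟦⟧-* (λ i → sign (kind i) F.* weight (kind i)) (χ ∘ kind) w) (F.*-congʳ (⟦⟧-* (sign ∘ kind) (weight ∘ kind) w))))) ⟩
        φ (FM.⟦ sign ∘ kind ⟧ w F.* FM.⟦ weight ∘ kind ⟧ w F.* FM.⟦ χ ∘ kind ⟧ w) * x
          ≈⟨ trans (*-congʳ (φ-* _ _)) (trans (*-assoc _ _ _) (trans (*-congˡ χx) (*-identityʳ _))) ⟩
        φ (FM.⟦ sign ∘ kind ⟧ w F.* FM.⟦ weight ∘ kind ⟧ w)
          ≈⟨ trans (φ-* _ _) (*-cong (signs w) (φ-cong (FM.⟦⟧-⇝ (FM.kind-braided weight λ a b → F.*-comm (weight a) (weight b)) w⇝))) ⟩
        ⟦ ±1 ∘ ε ∘ kind ⟧ w * φ (FM.⟦ weight ∘ kind ⟧ (word (top {m})))  ∎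
        where open SetoidReasoning setoid

  module _ {m : ℕ} (ℓ : Pt m → Pt m → F.Carrier) (h : Pt m → F.Carrier) where
    ∏roots-split : ∏roots ℓ h F.≈ ∏roots ℓ (λ _ → F.1#) F.* ∏roots (λ _ _ → F.1#) h
    ∏roots-split = F.trans (∏roots-cong (λ p r → F.sym (F.*-identityʳ (ℓ p r))) (λ p → F.sym (F.*-identityˡ (h p))))
      (∏roots-* ℓ (λ _ _ → F.1#) (λ _ → F.1#) h)

    module _ {st dr : F.Carrier} (st≈ : st F.≈ ∏roots ℓ (λ _ → F.1#)) (dr≈ : dr F.≈ ∏roots (λ _ _ → F.1#) h) where

      ∏roots-pickʳ : ∀ a b → ∏roots (λ p r → pick a F.1# (ℓ p r)) (λ p → pick b F.1# (h p)) F.≈ pick a F.1# st F.* pick b F.1# dr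
      ∏roots-pickʳ Sign.+ Sign.+ = F.trans (∏roots-1 {m}) (F.sym (F.*-identityˡ F.1#))
      ∏roots-pickʳ Sign.+ Sign.- = F.trans (F.sym dr≈) (F.sym (F.*-identityˡ dr))
      ∏roots-pickʳ Sign.- Sign.+ = F.trans (F.sym st≈) (F.sym (F.*-identityʳ st))
      ∏roots-pickʳ Sign.- Sign.- = F.trans ∏roots-split (F.sym (F.*-cong st≈ dr≈))

      ∏roots-pickˡ : ∀ a b → ∏roots (λ p r → pick a (ℓ p r) F.1#) (λ p → pick b (h p) F.1#) F.≈ pick a st F.1# F.* pick b dr F.1#
      ∏roots-pickˡ Sign.+ Sign.+ = ∏roots-pickʳ Sign.- Sign.-
      ∏roots-pickˡ Sign.+ Sign.- = ∏roots-pickʳ Sign.- Sign.+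
      ∏roots-pickˡ Sign.- Sign.+ = ∏roots-pickʳ Sign.+ Sign.-
      ∏roots-pickˡ Sign.- Sign.- = ∏roots-pickʳ Sign.+ Sign.+

  reassemble : ∀ {c x c′ E G s wt e S} {κ κ′ ρ ρ′ : F.Carrier} →
    c ≈ c′ → c′ * x ≈ s * φ wt → E ≈ G → φ wt * G ≈ φ κ * S * φ ρ → κ F.≈ κ′ → ρ F.≈ ρ′ → e ≈ S →
    c * (x * E) ≈ s * (φ κ′ * e * φ ρ′)
  reassemble {c} {x} {c′} {E} {G} {s} {wt} {e} {S} {κ} {κ′} {ρ} {ρ′} c≈ cx E≈ factored κ≈ ρ≈ e≈ = begin
    c * (x * E)             ≈⟨ trans (sym (*-assoc _ _ _)) (*-cong (trans (*-congʳ c≈) cx) E≈) ⟩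
    s * φ wt * G            ≈⟨ trans (*-assoc _ _ _) (*-congˡ factored) ⟩
    s * (φ κ * S * φ ρ)     ≈⟨ *-congˡ (*-cong (*-cong (φ-cong κ≈) (sym e≈)) (φ-cong ρ≈)) ⟩
    s * (φ κ′ * e * φ ρ′)   ∎
    where open SetoidReasoning setoid

  φ-identityˡ : ∀ f → φ (F.1# F.* f) ≈ φ f
  φ-identityˡ f = φ-cong (F.*-identityˡ f)

  φ-identityʳ : ∀ f → φ (f F.* F.1#) ≈ φ f
  φ-identityʳ f = φ-cong (F.*-identityʳ f)

  both-right : ∀ {s e} f g → s ≈ 1# → s * (φ (F.1# F.* F.1#) * e * φ (f F.* g)) ≈ e * φ f * φ g
  both-right {s} {e} f g s≈ = trans (*-congʳ s≈) (trans (*-identityˡ _)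
    (trans (*-cong (trans (*-congʳ (trans (φ-identityˡ F.1#) φ-1)) (*-identityˡ e)) (φ-* f g)) (sym (*-assoc e (φ f) (φ g)))))

  both-left : ∀ {s e s′} f g → s ≈ s′ → s * (φ (f F.* g) * e * φ (F.1# F.* F.1#)) ≈ s′ * (φ f * φ g * e)
  both-left f g s≈ = *-cong s≈ (trans (*-cong (*-congʳ (φ-* f g)) (trans (φ-identityˡ F.1#) φ-1)) (*-identityʳ _))

  short-left : ∀ {s e s′} f g → s ≈ s′ → s * (φ (F.1# F.* f) * e * φ (g F.* F.1#)) ≈ s′ * (φ f * e * φ g)
  short-left f g s≈ = *-cong s≈ (*-cong (*-congʳ (φ-identityˡ f)) (φ-identityʳ g))

  long-left : ∀ {s e} f g → s ≈ 1# → s * (φ (f F.* F.1#) * e * φ (F.1# F.* g)) ≈ φ f * e * φ g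
  long-left f g s≈ = trans (*-congʳ s≈) (trans (*-identityˡ _) (*-cong (*-congʳ (φ-identityʳ f)) (φ-identityˡ g)))

open import Defs

-- The products κ and the signs of the characters

module TriangularSum (M : CommutativeMonoid 0ℓ 0ℓ) where
  open CommutativeMonoid M
  open CommutativeMonoidSum M using (sum; sum-cong-≋)

  -- The left-hand side has the shape of κ-st with its first row and first column unfolded, where
  -- the entries in column zero have already been evaluated to the unit.
  triangular : ∀ {m} (f : Fin m → Carrier) (g : Fin m → Fin m → Carrier) (ℓ : Fin (suc m) → Fin (suc m) → Carrier) →
    (∀ j → f j ≈ ℓ zero (suc j)) →
    (∀ i j → g i j ≈ (if does (suc i Fin.<? suc j) then ℓ (suc i) (suc j) else ε)) →
    (ε ∙ sum f) ∙ sum (λ i → ε ∙ sum (g i)) ≈ sum {suc m} λ i → sum {suc m} λ j → if does (i Fin.<? j) then ℓ i j else ε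
  triangular f g ℓ hf hg = ∙-cong (∙-congˡ (sum-cong-≋ hf)) (sum-cong-≋ λ i → ∙-congˡ (sum-cong-≋ (hg i)))

record Same (𝕜 : CommutativeRing 0ℓ 0ℓ) (m : ℕ) (x y : LocalizedDAHA.𝔽 𝕜 m) : Set where
  constructor equal
  field equality : x ≡ y

κ-dr-cong : ∀ 𝕜 m S σ (h : Fin (suc m) → LocalizedDAHA.𝔽 𝕜 m) →
  (∀ i → LocalizedDAHA.𝔽._≈_ 𝕜 m
    (LocalizedDAHA.quotient 𝕜 m S tₙ (LocalizedDAHA.uα 𝕜 m S (LocalizedDAHA.finite LocalizedDAHA.flip))
      (LocalizedDAHA.orient 𝕜 m σ (LocalizedDAHA.e⃗ 𝕜 m i , 0ℤ))
      (LocalizedDAHA.orient-nonconstant 𝕜 m σ {LocalizedDAHA.e⃗ 𝕜 m i , 0ℤ} (LocalizedDAHA.e⃗-nonconstant 𝕜 m i)))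
    (h i)) →
  LocalizedDAHA.𝔽._≈_ 𝕜 m (LocalizedDAHA.κ-dr 𝕜 m S σ) (CommutativeMonoidSum.sum (LocalizedDAHA.𝔽.*-commutativeMonoid 𝕜 m) {suc m} h)
κ-dr-cong 𝕜 m S σ h = CommutativeMonoidSum.sum-cong-≋ (LocalizedDAHA.𝔽.*-commutativeMonoid 𝕜 m) {suc m}
  {λ i → LocalizedDAHA.quotient 𝕜 m S tₙ (LocalizedDAHA.uα 𝕜 m S (LocalizedDAHA.finite LocalizedDAHA.flip))
      (LocalizedDAHA.orient 𝕜 m σ (LocalizedDAHA.e⃗ 𝕜 m i , 0ℤ))
      (LocalizedDAHA.orient-nonconstant 𝕜 m σ {LocalizedDAHA.e⃗ 𝕜 m i , 0ℤ} (LocalizedDAHA.e⃗-nonconstant 𝕜 m i))} {h}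
choose : ∀ 𝕜 m S σ (i j : Fin (suc m)) → Dec (i Fin.< j) → LocalizedDAHA.𝔽 𝕜 m
choose 𝕜 m S σ i j (yes i<j) = LocalizedDAHA.κ-st-factor 𝕜 m S σ i j (Fin.<⇒≢ i<j)
choose 𝕜 m S σ i j (no _)    = LocalizedDAHA.𝔽.1# 𝕜 m

-- The factors of κ-st are given by a local function of its definition; first-row
-- and rest name their values, which are found by unification.
first-row : ∀ 𝕜 m (S : Side) (σ : Sign) (j : Fin m) → LocalizedDAHA.𝔽 𝕜 m
rest : ∀ 𝕜 m (S : Side) (σ : Sign) (i j : Fin m) → LocalizedDAHA.𝔽 𝕜 m
κ-st-rest : ∀ 𝕜 m S σ → LocalizedDAHA.κ-st 𝕜 m S σ ≡
  (LocalizedDAHA.𝔽._*_ 𝕜 m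
    (LocalizedDAHA.𝔽._*_ 𝕜 m (LocalizedDAHA.𝔽.1# 𝕜 m)
      (CommutativeMonoidSum.sum (LocalizedDAHA.𝔽.*-commutativeMonoid 𝕜 m) {m} λ j → first-row 𝕜 m S σ j))
    (CommutativeMonoidSum.sum (LocalizedDAHA.𝔽.*-commutativeMonoid 𝕜 m) {m} λ i →
       LocalizedDAHA.𝔽._*_ 𝕜 m (LocalizedDAHA.𝔽.1# 𝕜 m)
        (CommutativeMonoidSum.sum (LocalizedDAHA.𝔽.*-commutativeMonoid 𝕜 m) {m} λ j → rest 𝕜 m S σ i j)))
first-row 𝕜 m S σ j = _
rest 𝕜 m S σ i j = _
κ-st-rest 𝕜 m S σ = ≡.refl

rest-choose : ∀ 𝕜 m S σ i j → Same 𝕜 m (rest 𝕜 m S σ i j) (choose 𝕜 m S σ (suc i) (suc j) (suc i Fin.<? suc j))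
rest-choose 𝕜 m S σ i j with suc i Fin.<? suc j
... | yes _ = equal ≡.refl
... | no _  = equal ≡.refl

choose-≈ : ∀ 𝕜 m S σ (ℓ : (i j : Fin (suc m)) → LocalizedDAHA.𝔽 𝕜 m) →
  (∀ i j i≢j → LocalizedDAHA.𝔽._≈_ 𝕜 m (LocalizedDAHA.κ-st-factor 𝕜 m S σ i j i≢j) (ℓ i j)) →
  ∀ i j (d : Dec (i Fin.< j)) → LocalizedDAHA.𝔽._≈_ 𝕜 m (choose 𝕜 m S σ i j d) (if does d then ℓ i j else LocalizedDAHA.𝔽.1# 𝕜 m)
choose-≈ 𝕜 m S σ ℓ ℓ-eq i j (yes i<j) = ℓ-eq i j (Fin.<⇒≢ i<j)
choose-≈ 𝕜 m S σ ℓ ℓ-eq i j (no _)    = LocalizedDAHA.𝔽.refl 𝕜 m {LocalizedDAHA.𝔽.1# 𝕜 m}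

Same-≈ : ∀ 𝕜 m {x y z} → Same 𝕜 m x y → LocalizedDAHA.𝔽._≈_ 𝕜 m y z → LocalizedDAHA.𝔽._≈_ 𝕜 m x z
Same-≈ 𝕜 m (equal ≡.refl) y≈z = y≈z

≡-≈ : ∀ 𝕜 m {x y z} → x ≡ y → LocalizedDAHA.𝔽._≈_ 𝕜 m y z → LocalizedDAHA.𝔽._≈_ 𝕜 m x z
≡-≈ 𝕜 m ≡.refl y≈z = y≈z

κ-st-cong : ∀ 𝕜 m S σ (ℓ : (i j : Fin (suc m)) → LocalizedDAHA.𝔽 𝕜 m) →
  (∀ i j i≢j → LocalizedDAHA.𝔽._≈_ 𝕜 m (LocalizedDAHA.κ-st-factor 𝕜 m S σ i j i≢j) (ℓ i j)) →
  LocalizedDAHA.𝔽._≈_ 𝕜 m (LocalizedDAHA.κ-st 𝕜 m S σ)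
    (CommutativeMonoidSum.sum (LocalizedDAHA.𝔽.*-commutativeMonoid 𝕜 m) {suc m} λ i →
     CommutativeMonoidSum.sum (LocalizedDAHA.𝔽.*-commutativeMonoid 𝕜 m) {suc m} λ j →
     if does (i Fin.<? j) then ℓ i j else LocalizedDAHA.𝔽.1# 𝕜 m)
κ-st-cong 𝕜 m S σ ℓ ℓ-eq = ≡-≈ 𝕜 m (κ-st-rest 𝕜 m S σ)
  (TriangularSum.triangular (LocalizedDAHA.𝔽.*-commutativeMonoid 𝕜 m) (first-row 𝕜 m S σ) (rest 𝕜 m S σ) ℓ
    (λ j → ℓ-eq zero (suc j) (Fin.<⇒≢ {_} {zero} {suc j} (ℕ.s≤s ℕ.z≤n)))
    λ i j → Same-≈ 𝕜 m (rest-choose 𝕜 m S σ i j) (choose-≈ 𝕜 m S σ ℓ ℓ-eq (suc i) (suc j) (suc i Fin.<? suc j)))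

characterSigns : Character → Kind → Sign
characterSigns plus      _     = Sign.+
characterSigns minus     _     = Sign.-
characterSigns plusMinus long  = Sign.+
characterSigns plusMinus short = Sign.-
characterSigns minusPlus long  = Sign.-
characterSigns minusPlus short = Sign.+

-- The two sides of the algebra and the factorizations

module FactoredSymmetrizers (𝕜 : CommutativeRing 0ℓ 0ℓ) (m : ℕ) (S : Side) where
  open LocalizedDAHA 𝕜 m
  open Nodes 𝕜
  open Enumeration 𝕜 m
  private
    module LM = LaurentMonomials (Scalars.RatFun 6)
    module SM = LaurentMonomials 𝕜

  RF : CommutativeRing 0ℓ 0ℓ
  RF = Functions.RatFun n

  HR : Ring 0ℓ 0ℓ
  HR = H̃-ring

  private module F = CommutativeRing RF
  open CommutativeSemigroupProperties F.*-commutativeSemigroup using (interchange)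

  φ-1 : fun S F.1# ≈ 1#
  φ-1 = ≈-trans (fun-cong S (F.sym {ι 𝕂.1#} {F.1#} (LM.constant-1 n))) (≈-trans (fun-scalar S 𝕂.1#) scalar-1)

  Φ : FunctionMap RF HR
  Φ = record { φ = fun S ; φ-cong = fun-cong S ; φ-+ = fun-+ S ; φ-* = fun-* S ; φ-1 = φ-1 }

  Tr : H̃ → 𝔽 → 𝔽 → Set
  Tr = Hecke.Tr HR RF Φ

  module B = BraidMonoid (Ring.*-monoid HR)

  ι-central : ∀ c x → fun S (ι c) * x ≈ x * fun S (ι c)
  ι-central c x = ≈-trans (*-cong (fun-scalar S c) ≈-refl)
    (≈-trans (scalar-central c x) (*-cong ≈-refl (≈-sym (fun-scalar S c))))

  ½-0 : ∀ (p : Param) → ⌊ p ½^ 0ℤ ⌋ 𝕂.≈ 𝕂.1#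
  ½-0 p = SM.monomialFun-0 6 zeros
    where
    zeros : ∀ j → single (index p) 0ℤ j ≡ 0ℤ
    zeros j with does (index p Fin.≟ j)
    ... | true  = ≡.refl
    ... | false = ≡.refl

  ½-* : ∀ (p : Param) k l → ⌊ p ½^ k ⌋ 𝕂.* ⌊ p ½^ l ⌋ 𝕂.≈ ⌊ p ½^ (k ℤ.+ l) ⌋
  ½-* p k l = 𝕂.trans {⌊ p ½^ k ⌋ 𝕂.* ⌊ p ½^ l ⌋} {SM.monomialFun 6 (λ j → single (index p) k j ℤ.+ single (index p) l j)} {⌊ p ½^ (k ℤ.+ l) ⌋}
    (SM.monomialFun-* 6 (single (index p) k) (single (index p) l)) (SM.monomialFun-cong 6 sums)
    where
    sums : ∀ j → single (index p) k j ℤ.+ single (index p) l j ≡ single (index p) (k ℤ.+ l) j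
    sums j with does (index p Fin.≟ j)
    ... | true  = ≡.refl
    ... | false = ≡.refl

  Z : (Gen m → ℤ) → 𝔽
  Z = LM.monomialFun n

  mon-Z : ∀ a {k} → k ≡ 0ℤ → mon S (a , k) F.≈ Z a
  mon-Z a ≡.refl = LM.laurent-cong n {⌊ half S 0ℤ ⌋} {𝕂.1#} {a} {a} (half-0 S) λ _ → ≡.refl
    where
    half-0 : ∀ T → ⌊ half T 0ℤ ⌋ 𝕂.≈ 𝕂.1#
    half-0 X = ½-0 q
    half-0 Y = ½-0 q

  sᵍ : Gen m → H̃
  sᵍ i = s S (finite (toNode i))

  Z-transport : ∀ i a → Tr (sᵍ i) (Z a) (Z (i ▹ a))
  Z-transport i a = Hecke.Tr-resp HR RF Φ {sᵍ i} {mon S (a , 0ℤ)} {mon S μ} {Z a} {Z (i ▹ a)} (mon-Z a ≡.refl)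
    (F.trans {mon S μ} {Z (proj₁ μ)} {Z (i ▹ a)} (mon-Z (proj₁ μ) (reflect-finite-δ (toNode i) (a , 0ℤ)))
      (LM.monomialFun-cong n (reflect-toNode i a 0ℤ)))
    (Hecke.tr (s-mon S (finite (toNode i)) (a , 0ℤ)))
    where μ = reflect (finite (toNode i)) (a , 0ℤ)

  position-toNode : ∀ i → position (finite (toNode i)) ≡ suc (toℕ i)
  position-toNode i with toNode i in e
  ... | swap j = cong suc (toℕ-swap i e)
  ... | flip   = cong suc (≡.sym (≡.trans (cong toℕ (≡.trans (≡.sym (from-to i)) (cong fromNode e))) (Fin.toℕ-fromℕ m)))

  toNode-swap : ∀ i → toℕ i ℕ.< m → ∃[ j ] toNode i ≡ swap j
  toNode-swap i i<m with toNode i in e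
  ... | swap j = j , ≡.refl
  ... | flip   = ⊥-elim (ℕ.<-irrefl (≡.trans (cong toℕ (≡.trans (≡.sym (from-to i)) (cong fromNode e))) (Fin.toℕ-fromℕ m)) i<m)

  toNode-flip : ∀ i → toℕ i ≡ m → toNode i ≡ flip
  toNode-flip i i≡m with toNode i in e
  ... | swap j = ⊥-elim (ℕ.<-irrefl (≡.trans (toℕ-swap i e) i≡m) (Fin.toℕ<n j))
  ... | flip   = ≡.refl

  unfold₂ : ∀ {a b c d} → a * (b * 1#) ≈ c * (d * 1#) → a * b ≈ c * d
  unfold₂ h = ≈-trans (*-cong ≈-refl (≈-sym (*-identityʳ _))) (≈-trans h (*-cong ≈-refl (*-identityʳ _)))

  s-braided : B.Braided sᵍ
  s-braided = record { commute = far′ ; triple = triple′ ; quadruple = quadruple′ }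
    where
    far′ : ∀ i j → suc (suc (toℕ i)) ℕ.≤ toℕ j → sᵍ i * sᵍ j ≈ sᵍ j * sᵍ i
    far′ i j h = unfold₂ (s-braid S (distant (begin
        suc (suc (position (finite (toNode i))))  ≡⟨ cong (2 ℕ.+_) (position-toNode i) ⟩
        suc (suc (suc (toℕ i)))                   ≤⟨ s≤s h ⟩
        suc (toℕ j)                               ≡⟨ position-toNode j ⟨
        position (finite (toNode j))              ∎)))
      where open ℕ.≤-Reasoning
    unfold₃ : ∀ {a b} → a * (b * (a * 1#)) ≈ b * (a * (b * 1#)) → a * (b * a) ≈ b * (a * b)
    unfold₃ h = ≈-trans (*-cong ≈-refl (*-cong ≈-refl (≈-sym (*-identityʳ _))))
      (≈-trans h (*-cong ≈-refl (*-cong ≈-refl (*-identityʳ _))))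
    unfold₄ : ∀ {a b} → a * (b * (a * (b * 1#))) ≈ b * (a * (b * (a * 1#))) → a * (b * (a * b)) ≈ b * (a * (b * a))
    unfold₄ h = ≈-trans (*-cong ≈-refl (*-cong ≈-refl (*-cong ≈-refl (≈-sym (*-identityʳ _)))))
      (≈-trans h (*-cong ≈-refl (*-cong ≈-refl (*-cong ≈-refl (*-identityʳ _)))))
    triple′ : ∀ i j → toℕ j ≡ suc (toℕ i) → toℕ j ℕ.< m → sᵍ i * (sᵍ j * sᵍ i) ≈ sᵍ j * (sᵍ i * sᵍ j)
    triple′ i j j≡1+i j<m with toNode-swap i (ℕ.<-trans (ℕ.≤-reflexive (≡.sym j≡1+i)) j<m) | toNode-swap j j<m
    ... | a , e | b , f = ≡.subst₂ (λ x y → s S (finite x) * (s S (finite y) * s S (finite x)) ≈ s S (finite y) * (s S (finite x) * s S (finite y)))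
      (≡.sym e) (≡.sym f) (unfold₃ (s-braid S (inner (≡.trans (toℕ-swap j f) (≡.trans j≡1+i (cong suc (≡.sym (toℕ-swap i e))))))))
    quadruple′ : ∀ i j → toℕ j ≡ suc (toℕ i) → toℕ j ≡ m → sᵍ i * (sᵍ j * (sᵍ i * sᵍ j)) ≈ sᵍ j * (sᵍ i * (sᵍ j * sᵍ i))
    quadruple′ i j j≡1+i j≡m with toNode-swap i (ℕ.≤-reflexive (≡.trans (≡.sym j≡1+i) j≡m)) | toNode-flip j j≡m
    ... | a , e | f = ≡.subst₂ (λ x y → s S (finite x) * (s S (finite y) * (s S (finite x) * s S (finite y))) ≈ s S (finite y) * (s S (finite x) * (s S (finite y) * s S (finite x))))
      (≡.sym e) (≡.sym f) (unfold₄ (s-braid S (right (≡.trans (cong suc (toℕ-swap i e)) (≡.trans (≡.sym j≡1+i) j≡m)))))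

  unit-scalar : 𝕂× → LM.Unit
  unit-scalar c = proj₁ c , 𝕂-Frac.nonzero⇒regular (proj₂ c)

  ▹-zero : ∀ i {a : Gen m → ℤ} → (∀ j → a j ≡ 0ℤ) → ∀ j → (i ▹ a) j ≡ 0ℤ
  ▹-zero i a≡0 j = ≡.trans (ev-cong a≡0 (i · pos j)) (ev-0 (i · pos j))

  ▹-zero⁻¹ : ∀ i {a : Gen m → ℤ} → (∀ j → (i ▹ a) j ≡ 0ℤ) → ∀ j → a j ≡ 0ℤ
  ▹-zero⁻¹ i {a} ia≡0 j = begin
    a j                        ≡⟨ ev-pos a j ⟨
    ev a (pos j)               ≡⟨ cong (ev a) (·-involutive i (pos j)) ⟨
    ev a (i · i · pos j)       ≡⟨ ev-▹ i a (i · pos j) ⟨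
    ev (i ▹ a) (i · pos j)     ≡⟨ ▹-zero i ia≡0 j ⟩
    0ℤ                         ∎
    where open ≡.≡-Reasoning

  torus : Characters.Torus HR RF Φ m
  torus = record
    { s             = sᵍ
    ; s-involutive  = λ i → s-involutive S (finite (toNode i))
    ; s-braided     = s-braided
    ; Scalar        = LM.Unit
    ; ⟪_⟫           = λ c → ι (proj₁ c)
    ; ⟪⟫-central    = λ c → ι-central (proj₁ c)
    ; 1ˢ            = unit-scalar 1×
    ; ⟪1⟫           = LM.constant-1 n
    ; Z             = Z
    ; Z-cong        = LM.monomialFun-cong n
    ; Z-*           = LM.monomialFun-* n
    ; Z-0           = LM.monomialFun-0 n
    ; Z-transport   = Z-transport
    ; lin           = LM.lin n
    ; lin⁻¹         = LM.lin⁻¹ n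
    ; lin-inverse   = LM.lin-inverse n
    ; lin-cong      = LM.lin-cong n
    ; lin-nonzero   = LM.lin-nonzero n
    ; lin-transport = λ i c a → LM.Transport.lin-transport n HR Φ ι-central c (▹-zero i) (▹-zero⁻¹ i) (Z-transport i a)
    }

  module CF = Characters.Functions HR RF Φ torus (direction S)

  KF : CommutativeRing 0ℓ 0ℓ
  KF = Scalars.RatFun 6

  u : Param
  u = uα S (finite flip)

  -- The second numerator factor at a short root is 1 + tₙ^{1/2} u^(-1/2) y. Writing it as 1 - β y
  -- puts the sign into β, and - α β = tₙ.
  θ θ′ α α′ β β′ : LM.Unit
  θ  = unit-scalar (t ½^ 2ℤ)
  θ′ = unit-scalar (t ½^ -[1+ 1 ])
  α  = unit-scalar ((tₙ ½^ 1ℤ) *× (u ½^ 1ℤ))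
  α′ = unit-scalar ((tₙ ½^ -1ℤ) *× (u ½^ -1ℤ))
  β  = unit-scalar (-× ((tₙ ½^ 1ℤ) *× (u ½^ -1ℤ)))
  β′ = unit-scalar (-× ((tₙ ½^ -1ℤ) *× (u ½^ 1ℤ)))

  ½-inverse : ∀ (p : Param) k l → k ℤ.+ l ≡ 0ℤ → ⌊ p ½^ k ⌋ 𝕂.* ⌊ p ½^ l ⌋ 𝕂.≈ 𝕂.1#
  ½-inverse p k l e = 𝕂.trans {⌊ p ½^ k ⌋ 𝕂.* ⌊ p ½^ l ⌋} {⌊ p ½^ (k ℤ.+ l) ⌋} {𝕂.1#} (½-* p k l)
    (subst (λ j → ⌊ p ½^ j ⌋ 𝕂.≈ 𝕂.1#) (≡.sym e) (½-0 p))

  ι-inverse : ∀ c d → c 𝕂.* d 𝕂.≈ 𝕂.1# → ι c F.* ι d F.≈ F.1#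
  ι-inverse c d h = F.trans {ι c F.* ι d} {ι (c 𝕂.* d)} {F.1#} (LM.constant-* n c d)
    (F.trans {ι (c 𝕂.* d)} {ι 𝕂.1#} {F.1#} (LM.constant-cong n h) (LM.constant-1 n))

  αα′ : ι (proj₁ α) F.* ι (proj₁ α′) F.≈ F.1#
  αα′ = ι-inverse (proj₁ α) (proj₁ α′) (Identities.cross-inverse KF {⌊ tₙ ½^ 1ℤ ⌋} {⌊ u ½^ 1ℤ ⌋} {⌊ tₙ ½^ -1ℤ ⌋} {⌊ u ½^ -1ℤ ⌋}
    (½-inverse tₙ 1ℤ -1ℤ ≡.refl) (½-inverse u 1ℤ -1ℤ ≡.refl))

  ββ′ : ι (proj₁ β) F.* ι (proj₁ β′) F.≈ F.1#
  ββ′ = ι-inverse (proj₁ β) (proj₁ β′) (Identities.neg-inverse KF {⌊ tₙ ½^ 1ℤ ⌋ 𝕂.* ⌊ u ½^ -1ℤ ⌋} {⌊ tₙ ½^ -1ℤ ⌋ 𝕂.* ⌊ u ½^ 1ℤ ⌋}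
    (Identities.cross-inverse KF {⌊ tₙ ½^ 1ℤ ⌋} {⌊ u ½^ -1ℤ ⌋} {⌊ tₙ ½^ -1ℤ ⌋} {⌊ u ½^ 1ℤ ⌋}
      (½-inverse tₙ 1ℤ -1ℤ ≡.refl) (½-inverse u -1ℤ 1ℤ ≡.refl)))

  θθ′ : ι (proj₁ θ) F.* ι (proj₁ θ′) F.≈ F.1#
  θθ′ = ι-inverse (proj₁ θ) (proj₁ θ′) (½-inverse t 2ℤ -[1+ 1 ] ≡.refl)

  module M = CF.Mixed θ θ′ α α′ β β′ θθ′ αα′ ββ′
  module P = M.P

  root : Kind → Param
  root long  = t
  root short = tₙ

  τ τ⁻¹ : Kind → 𝔽
  τ κ   = ι ⌊ root κ ½^ 1ℤ ⌋
  τ⁻¹ κ = ι ⌊ root κ ½^ -1ℤ ⌋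

  ττ⁻¹ : ∀ κ → τ κ F.* τ⁻¹ κ F.≈ F.1#
  ττ⁻¹ κ = ι-inverse ⌊ root κ ½^ 1ℤ ⌋ ⌊ root κ ½^ -1ℤ ⌋ (½-inverse (root κ) 1ℤ -1ℤ ≡.refl)

  short-square : ∀ k l → k ℤ.+ l ≡ 0ℤ → (x y : 𝔽) → x F.≈ ι (⌊ tₙ ½^ k ⌋ 𝕂.* ⌊ u ½^ k ⌋) →
    y F.≈ ι (𝕂.- (⌊ tₙ ½^ k ⌋ 𝕂.* ⌊ u ½^ l ⌋)) → ι ⌊ tₙ ½^ k ⌋ F.* ι ⌊ tₙ ½^ k ⌋ F.≈ F.- (x F.* y)
  short-square k l e x y hx hy = Identities.neg-product RF {ι a} {ι b} {ι d} {x} {y}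
    (F.trans {x} {ι (a 𝕂.* b)} {ι a F.* ι b} hx (F.sym {ι a F.* ι b} {ι (a 𝕂.* b)} (LM.constant-* n a b)))
    (F.trans {y} {ι (𝕂.- (a 𝕂.* d))} {F.- (ι a F.* ι d)} hy
      (F.trans {ι (𝕂.- (a 𝕂.* d))} {F.- ι (a 𝕂.* d)} {F.- (ι a F.* ι d)} (LM.constant-neg n (a 𝕂.* d))
        (F.-‿cong {ι (a 𝕂.* d)} {ι a F.* ι d} (F.sym {ι a F.* ι d} {ι (a 𝕂.* d)} (LM.constant-* n a d)))))
    (ι-inverse b d (½-inverse u k l e))
    where
    a = ⌊ tₙ ½^ k ⌋
    b = ⌊ u ½^ k ⌋
    d = ⌊ u ½^ l ⌋

  τ⁻¹τ⁻¹ : ∀ κ → τ⁻¹ κ F.* τ⁻¹ κ F.≈ M.Θ′ κ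
  τ⁻¹τ⁻¹ long = F.trans {ι ⌊ t ½^ -1ℤ ⌋ F.* ι ⌊ t ½^ -1ℤ ⌋} {ι (⌊ t ½^ -1ℤ ⌋ 𝕂.* ⌊ t ½^ -1ℤ ⌋)} {ι ⌊ t ½^ -[1+ 1 ] ⌋}
    (LM.constant-* n ⌊ t ½^ -1ℤ ⌋ ⌊ t ½^ -1ℤ ⌋) (LM.constant-cong n (½-* t -1ℤ -1ℤ))
  τ⁻¹τ⁻¹ short = short-square -1ℤ 1ℤ ≡.refl (ι (proj₁ α′)) (ι (proj₁ β′)) (F.refl {ι (proj₁ α′)}) (F.refl {ι (proj₁ β′)})

  ττ : ∀ κ → τ κ F.* τ κ F.≈ M.Θ κ
  ττ long = F.trans {ι ⌊ t ½^ 1ℤ ⌋ F.* ι ⌊ t ½^ 1ℤ ⌋} {ι (⌊ t ½^ 1ℤ ⌋ 𝕂.* ⌊ t ½^ 1ℤ ⌋)} {ι ⌊ t ½^ 2ℤ ⌋}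
    (LM.constant-* n ⌊ t ½^ 1ℤ ⌋ ⌊ t ½^ 1ℤ ⌋) (LM.constant-cong n (½-* t 1ℤ 1ℤ))
  ττ short = short-square 1ℤ -1ℤ ≡.refl (ι (proj₁ α)) (ι (proj₁ β)) (F.refl {ι (proj₁ α)}) (F.refl {ι (proj₁ β)})

  -- c and κ in terms of ℓ and h

  Z-double : ∀ {a b : Gen m → ℤ} → a ≗ b → Z (λ i → 2ℤ ℤ.* a i) F.≈ Z b F.* Z b
  Z-double {a} {b} a≗b = F.trans {Z (λ i → 2ℤ ℤ.* a i)} {Z (λ i → b i ℤ.+ b i)} {Z b F.* Z b}
    (LM.monomialFun-cong n (λ i → ≡.trans (cong (2ℤ ℤ.*_) (a≗b i)) (double-+ (b i))))
    (F.sym {Z b F.* Z b} {Z (λ i → b i ℤ.+ b i)} (LM.monomialFun-* n b b))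
    where
    double-+ : ∀ k → 2ℤ ℤ.* k ≡ k ℤ.+ k
    double-+ k = ≡.trans (ℤ.*-distribʳ-+ k 1ℤ 1ℤ) (cong₂ ℤ._+_ (ℤ.*-identityˡ k) (ℤ.*-identityˡ k))

  mon-vec : ∀ {a b : Gen m → ℤ} {k} → k ≡ 0ℤ → a ≗ b → mon S (a , k) F.≈ Z b
  mon-vec {a} {b} {k} k≡0 a≗b = F.trans {mon S (a , k)} {Z a} {Z b} (mon-Z a k≡0) (LM.monomialFun-cong n a≗b)

  1/1-mon-inverse : ∀ μ μ≢0 → (F.1# F.- mon S μ) F.* 1/1-mon S μ μ≢0 F.≈ F.1#
  1/1-mon-inverse (a , k) μ≢0 = 𝔽-Frac.inverseʳ (F.1# F.- mon S (a , k))
    (Functions.1-laurent-nonzero n a μ≢0 (𝕂-Frac.nonzero⇒regular (proj₂ (half S k))))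

  double-mon : ∀ {a b : Gen m → ℤ} {k} → k ≡ 0ℤ → a ≗ b → mon S (double (a , k)) F.≈ mon S (a , k) F.* mon S (a , k)
  double-mon {a} {b} {k} k≡0 a≗b = F.trans {mon S (double (a , k))} {Z b F.* Z b} {mon S (a , k) F.* mon S (a , k)}
    (F.trans {mon S (double (a , k))} {Z (λ i → 2ℤ ℤ.* a i)} {Z b F.* Z b} (mon-Z (λ i → 2ℤ ℤ.* a i) (cong (2ℤ ℤ.*_) k≡0)) (Z-double a≗b))
    (F.*-cong {Z b} {mon S (a , k)} {Z b} {mon S (a , k)}
      (F.sym {mon S (a , k)} {Z b} (mon-vec k≡0 a≗b)) (F.sym {mon S (a , k)} {Z b} (mon-vec k≡0 a≗b)))

  quotient-long : ∀ p r a k ne → k ≡ 0ℤ → p ≢ neg r → a ≗ (λ i → CF.w p i ℤ.+ CF.w r i) → quotient S t t (a , k) ne F.≈ P.ℓ p r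
  quotient-long p r a k ne k≡0 p≢ a≗ = P.long-quotient p r {mon S (a , k)} {mon S (double (a , k))}
    {ι (⌊ t ½^ 1ℤ ⌋ 𝕂.* ⌊ t ½^ 1ℤ ⌋)} {ι (⌊ t ½^ 1ℤ ⌋ 𝕂.* ⌊ t ½^ -1ℤ ⌋)} {1/1-mon S (double (a , k)) ne₂}
    p≢ (mon-vec k≡0 a≗) (double-mon k≡0 a≗) (LM.constant-cong n (½-* t 1ℤ 1ℤ))
    (F.trans {ι (⌊ t ½^ 1ℤ ⌋ 𝕂.* ⌊ t ½^ -1ℤ ⌋)} {ι 𝕂.1#} {F.1#} (LM.constant-cong n (½-inverse t 1ℤ -1ℤ ≡.refl)) (LM.constant-1 n))
    (1/1-mon-inverse (double (a , k)) ne₂)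
    where ne₂ = double-nonconstant {a , k} ne

  quotient-short : ∀ p a k ne → k ≡ 0ℤ → a ≗ CF.w p → quotient S tₙ u (a , k) ne F.≈ P.h p
  quotient-short p a k ne k≡0 a≗ = P.short-quotient p {mon S (a , k)} {mon S (double (a , k))}
    {ι (proj₁ α)} {ι (⌊ tₙ ½^ 1ℤ ⌋ 𝕂.* ⌊ u ½^ -1ℤ ⌋)} {1/1-mon S (double (a , k)) ne₂}
    (mon-vec k≡0 a≗) (double-mon k≡0 a≗) (F.refl {ι (proj₁ α)})
    (F.sym {ι (proj₁ β)} {F.- ι (⌊ tₙ ½^ 1ℤ ⌋ 𝕂.* ⌊ u ½^ -1ℤ ⌋)} (LM.constant-neg n (⌊ tₙ ½^ 1ℤ ⌋ 𝕂.* ⌊ u ½^ -1ℤ ⌋)))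
    (1/1-mon-inverse (double (a , k)) ne₂)
    where ne₂ = double-nonconstant {a , k} ne

  orient-vec : ∀ σ {a : Gen m → ℤ} {p} → a ≗ vec p → proj₁ (orient σ (a , 0ℤ)) ≗ vec (turn σ p)
  orient-vec Sign.+ a≗ i = a≗ i
  orient-vec Sign.- {p = p} a≗ i = ≡.trans (cong ℤ.-_ (a≗ i)) (≡.sym (vec-neg p i))

  orient-vec₂ : ∀ σ {a : Gen m → ℤ} {p r} → a ≗ (λ i → vec p i ℤ.+ vec r i) →
                proj₁ (orient σ (a , 0ℤ)) ≗ (λ i → vec (turn σ p) i ℤ.+ vec (turn σ r) i)
  orient-vec₂ Sign.+ a≗ i = a≗ i
  orient-vec₂ Sign.- {p = p} {r} a≗ i = ≡.trans (cong ℤ.-_ (a≗ i)) (≡.trans (ℤ.neg-distrib-+ (vec p i) (vec r i))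
    (cong₂ ℤ._+_ (≡.sym (vec-neg p i)) (≡.sym (vec-neg r i))))

  orient-δ : ∀ σ (a : Gen m → ℤ) → proj₂ (orient σ (a , 0ℤ)) ≡ 0ℤ
  orient-δ Sign.+ a = ≡.refl
  orient-δ Sign.- a = ≡.refl

  tα-finite : ∀ T x → tα T (finite x) ≡ tα X (finite x)
  tα-finite X x        = ≡.refl
  tα-finite Y (swap j) = ≡.refl
  tα-finite Y flip     = ≡.refl

  uα-swap : ∀ T j → uα T (finite (swap j)) ≡ t
  uα-swap X j = ≡.refl
  uα-swap Y j = ≡.refl

  swap-quotient : ∀ j p r → Apart p r →
    (λ k → vec p k ℤ.+ vec r k) ≗ (λ k → single (inject₁ j) 1ℤ k ℤ.- single (suc j) 1ℤ k) →
    c S (finite (swap j)) F.≈ τ⁻¹ long F.* P.ℓ p r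
  swap-quotient j p r p#r v = F.trans {c S (finite (swap j))} {ι ⌊ t ½^ -1ℤ ⌋ F.* quotient S t t μ ne} {τ⁻¹ long F.* P.ℓ p r}
    (F.reflexive (cong₂ (λ a b → ι ⌊ a ½^ -1ℤ ⌋ F.* quotient S a b μ ne) (tα-finite S (swap j)) (uα-swap S j)))
    (F.*-congˡ {ι ⌊ t ½^ -1ℤ ⌋} {quotient S t t μ ne} {P.ℓ p r}
      (quotient-long p r (proj₁ μ) (proj₂ μ) ne (orient-δ (direction S) _) (P.apart-≢ p#r)
        (orient-vec₂ (direction S) {p = p} {r} λ k → ≡.sym (v k))))
    where
    μ = orient (direction S) (LocalizedDAHA.simpleRoot 𝕜 m (finite (swap j)))
    ne = orient-nonconstant (direction S) {LocalizedDAHA.simpleRoot 𝕜 m (finite (swap j))} (simpleRoot-nonconstant (finite (swap j)))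

  flip-quotient : ∀ p → vec p ≗ single (fromℕ m) 1ℤ → c S (finite flip) F.≈ τ⁻¹ short F.* P.h p
  flip-quotient p v = F.trans {c S (finite flip)} {ι ⌊ tₙ ½^ -1ℤ ⌋ F.* quotient S tₙ u μ ne} {τ⁻¹ short F.* P.h p}
    (F.reflexive (cong (λ a → ι ⌊ a ½^ -1ℤ ⌋ F.* quotient S a u μ ne) (tα-finite S flip)))
    (F.*-congˡ {ι ⌊ tₙ ½^ -1ℤ ⌋} {quotient S tₙ u μ ne} {P.h p}
      (quotient-short p (proj₁ μ) (proj₂ μ) ne (orient-δ (direction S) _) (orient-vec (direction S) {p = p} λ k → ≡.sym (v k))))
    where
    μ = orient (direction S) (LocalizedDAHA.simpleRoot 𝕜 m (finite flip))
    ne = orient-nonconstant (direction S) {LocalizedDAHA.simpleRoot 𝕜 m (finite flip)} (simpleRoot-nonconstant (finite flip))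

  Tᵍ : Gen m → H̃
  Tᵍ i = T S (finite (toNode i))

  T-relation : ∀ x κ f → tα X (finite x) ≡ root κ → c S (finite x) F.≈ τ⁻¹ κ F.* f →
    T S (finite x) + fun S (τ⁻¹ κ) ≈ (1# + s S (finite x)) * fun S (τ⁻¹ κ F.* f)
  T-relation x κ f e h = ≈-trans (+-cong ≈-refl (≈-trans (fun-scalar S ⌊ root κ ½^ -1ℤ ⌋)
      (Ring.reflexive HR (cong (λ a → scalar ⌊ a ½^ -1ℤ ⌋) (≡.sym (≡.trans (tα-finite S x) e))))))
    (≈-trans (T-c S (finite x)) (*-cong ≈-refl (fun-cong S h)))

  T-c′ : ∀ i → Tᵍ i + fun S (τ⁻¹ (kind i)) ≈ (1# + sᵍ i) * fun S (τ⁻¹ (kind i) F.* M.k i)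
  T-c′ i = by (nodeRoot i)
    where
    Goal : FiniteNode → Kind → 𝔽 → Set
    Goal x κ f = T S (finite x) + fun S (τ⁻¹ κ) ≈ (1# + s S (finite x)) * fun S (τ⁻¹ κ F.* f)
    transfer : ∀ x κ f → toNode i ≡ x → kind i ≡ κ → M.k i ≡ f → Goal x κ f → Goal (toNode i) (kind i) (M.k i)
    transfer x κ f ex eκ ef goal = subst (λ f → Goal (toNode i) (kind i) f) (≡.sym ef)
      (subst (λ κ → Goal (toNode i) κ f) (≡.sym eκ) (subst (λ x → Goal x κ f) (≡.sym ex) goal))
    by : NodeRoot i → Goal (toNode i) (kind i) (M.k i)
    by (short-node p e κ v f) = transfer flip short (P.h p) e κ (f P.ℓ P.h)
      (T-relation flip short (P.h p) ≡.refl (flip-quotient p v))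
    by (long-node j p r e κ a v f) = transfer (swap j) long (P.ℓ p r) e κ (f P.ℓ P.h)
      (T-relation (swap j) long (P.ℓ p r) ≡.refl (swap-quotient j p r a v))

  FM′ = LocalizedDAHA.𝔽.*-commutativeMonoid 𝕜 m
  module FS = FinSums FM′
  ∏roots : ∀ {m} → (Pt m → Pt m → 𝔽) → (Pt m → 𝔽) → 𝔽
  ∏roots = PointSums.∑roots FM′

  -- The sign ρ tells whether the product runs over the positive roots or over their opposites,
  -- relative to the direction of the side. In this way one computation covers the product in Z and
  -- the product in the inverse variables.
  module _ (σ : Sign) (ρ : Sign) (turns : ∀ (p : Pt m) → turn σ p ≡ turn (direction S) (turn ρ p)) where

    h-turned : Pt m → 𝔽
    h-turned p = P.h (turn ρ p)

    ℓ-turned : Pt m → Pt m → 𝔽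
    ℓ-turned p r = P.ℓ (turn ρ p) (turn ρ r)

    κ-dr-entry : ∀ i → quotient S tₙ u (orient σ (e⃗ i , 0ℤ)) (orient-nonconstant σ {e⃗ i , 0ℤ} (e⃗-nonconstant i)) F.≈ h-turned (pos i)
    κ-dr-entry i = quotient-short (turn ρ (pos i)) _ _ (orient-nonconstant σ {e⃗ i , 0ℤ} (e⃗-nonconstant i))
        (orient-δ σ (e⃗ i)) λ k → ≡.trans (orient-vec σ {p = pos i} (λ k → ≡.sym (vec-pos i k)) k) (cong (λ p → vec p k) (turns (pos i)))

    κ-dr-roots : LocalizedDAHA.𝔽._≈_ 𝕜 m (LocalizedDAHA.κ-dr 𝕜 m S σ) (∏roots (λ _ _ → F.1#) h-turned)
    κ-dr-roots = LocalizedDAHA.𝔽.trans 𝕜 m {LocalizedDAHA.κ-dr 𝕜 m S σ} {CommutativeMonoidSum.sum (LocalizedDAHA.𝔽.*-commutativeMonoid 𝕜 m) {suc m} λ i → h-turned (pos i)} {∏roots (λ _ _ → F.1#) h-turned}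
      (κ-dr-cong 𝕜 m S σ (λ i → h-turned (pos i)) κ-dr-entry)
      (LocalizedDAHA.𝔽.sym 𝕜 m {∏roots (λ _ _ → F.1#) h-turned} {CommutativeMonoidSum.sum (LocalizedDAHA.𝔽.*-commutativeMonoid 𝕜 m) {suc m} λ i → h-turned (pos i)}
        (FS.∑roots-short h-turned))
    turn-apart : ∀ {p r : Pt m} → p ≢ neg r → turn ρ p ≢ neg (turn ρ r)
    turn-apart {p} {r} p≢ e = p≢ (turn-injective ρ (≡.trans e (≡.sym (turn-neg ρ r))))

    axis-pos : ∀ {m} (i : Gen m) → axis (pos i) ≡ i
    axis-pos         zero    = ≡.refl
    axis-pos {suc m} (suc i) = cong suc (axis-pos i)

    factor-roots : ∀ i j (i≢j : i ≢ j) → κ-st-factor S σ i j i≢j F.≈ ℓ-turned (pos i) (neg (pos j)) F.* ℓ-turned (pos i) (pos j)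
    factor-roots i j i≢j = F.trans
      {(F.1# F.- th F.* mon S i-j) F.* (F.1# F.- th F.* mon S i+j) F.* (1/1-mon S i-j ne₁ F.* 1/1-mon S i+j ne₂)}
      {((F.1# F.- th F.* mon S i-j) F.* 1/1-mon S i-j ne₁) F.* ((F.1# F.- th F.* mon S i+j) F.* 1/1-mon S i+j ne₂)}
      {ℓ-turned (pos i) (neg (pos j)) F.* ℓ-turned (pos i) (pos j)}
      (interchange (F.1# F.- th F.* mon S i-j) (F.1# F.- th F.* mon S i+j) (1/1-mon S i-j ne₁) (1/1-mon S i+j ne₂))
      (F.*-cong {(F.1# F.- th F.* mon S i-j) F.* 1/1-mon S i-j ne₁} {ℓ-turned (pos i) (neg (pos j))}
                {(F.1# F.- th F.* mon S i+j) F.* 1/1-mon S i+j ne₂} {ℓ-turned (pos i) (pos j)}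
        (P.long-factor (turn ρ (pos i)) (turn ρ (neg (pos j))) {mon S i-j} {th} {1/1-mon S i-j ne₁}
          (turn-apart (λ e → i≢j (axes (≡.trans (cong axis e) (≡.trans (axis-neg (neg (pos j))) (axis-neg (pos j)))))))
          (mon-vec (orient-δ σ _) (λ k → ≡.trans (orient-vec₂ σ {p = pos i} {neg (pos j)} e-j k)
            (cong₂ (λ p r → vec p k ℤ.+ vec r k) (turns (pos i)) (turns (neg (pos j))))))
          (F.refl {th}) (1/1-mon-inverse i-j ne₁))
        (P.long-factor (turn ρ (pos i)) (turn ρ (pos j)) {mon S i+j} {th} {1/1-mon S i+j ne₂}
          (turn-apart (λ e → i≢j (axes (≡.trans (cong axis e) (axis-neg (pos j))))))
          (mon-vec (orient-δ σ _) (λ k → ≡.trans (orient-vec₂ σ {p = pos i} {pos j} e+j k)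
            (cong₂ (λ p r → vec p k ℤ.+ vec r k) (turns (pos i)) (turns (pos j)))))
          (F.refl {th}) (1/1-mon-inverse i+j ne₂)))
      where
      th = ι ⌊ t ½^ 2ℤ ⌋
      i-j i+j : Lattice
      i-j = orient σ ((λ k → e⃗ i k ℤ.- e⃗ j k) , 0ℤ)
      i+j = orient σ ((λ k → e⃗ i k ℤ.+ e⃗ j k) , 0ℤ)
      ne₁ = orient-nonconstant σ {_ , 0ℤ} (difference-nonconstant i≢j)
      ne₂ = orient-nonconstant σ {_ , 0ℤ} (sum-nonconstant i≢j)
      axes : axis (pos i) ≡ axis (pos j) → i ≡ j
      axes e = ≡.trans (≡.sym (axis-pos i)) (≡.trans e (axis-pos j))
      e-j : (λ k → e⃗ i k ℤ.- e⃗ j k) ≗ (λ k → vec (pos i) k ℤ.+ vec (neg (pos j)) k)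
      e-j k = cong₂ ℤ._+_ (≡.sym (vec-pos i k)) (≡.trans (cong ℤ.-_ (≡.sym (vec-pos j k))) (≡.sym (vec-neg (pos j) k)))
      e+j : (λ k → e⃗ i k ℤ.+ e⃗ j k) ≗ (λ k → vec (pos i) k ℤ.+ vec (pos j) k)
      e+j k = cong₂ ℤ._+_ (≡.sym (vec-pos i k)) (≡.sym (vec-pos j k))

    κ-st-roots : LocalizedDAHA.𝔽._≈_ 𝕜 m (LocalizedDAHA.κ-st 𝕜 m S σ) (∏roots ℓ-turned (λ _ → F.1#))
    κ-st-roots = LocalizedDAHA.𝔽.trans 𝕜 m {LocalizedDAHA.κ-st 𝕜 m S σ} {rows} {∏roots ℓ-turned (λ _ → F.1#)}
      (κ-st-cong 𝕜 m S σ (λ i j → LocalizedDAHA.𝔽._*_ 𝕜 m (ℓ-turned (pos i) (neg (pos j))) (ℓ-turned (pos i) (pos j))) factor-roots)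
      (LocalizedDAHA.𝔽.sym 𝕜 m {∏roots ℓ-turned (λ _ → F.1#)} {rows} (FS.∑roots-long ℓ-turned))
      where
      rows : 𝔽
      rows = CommutativeMonoidSum.sum (LocalizedDAHA.𝔽.*-commutativeMonoid 𝕜 m) {suc m} λ i →
        CommutativeMonoidSum.sum (LocalizedDAHA.𝔽.*-commutativeMonoid 𝕜 m) {suc m} λ j →
        if does (i Fin.<? j) then LocalizedDAHA.𝔽._*_ 𝕜 m (ℓ-turned (pos i) (neg (pos j))) (ℓ-turned (pos i) (pos j)) else LocalizedDAHA.𝔽.1# 𝕜 m

  module SP = SignedProducts HR RF Φ
  module FM = BraidMonoid F.*-monoid
  module PM = Signs HR

  nodeKind : FiniteNode → Kind
  nodeKind (swap _) = long
  nodeKind flip     = short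

  kind-toNode : ∀ (i : Gen m) → kind i ≡ nodeKind (toNode i)
  kind-toNode i with nodeRoot i
  ... | short-node _ e κ _ _       = ≡.trans κ (≡.sym (cong nodeKind e))
  ... | long-node _ _ _ e κ _ _ _  = ≡.trans κ (≡.sym (cong nodeKind e))

  kind-fromNode : ∀ x → kind (fromNode {m} x) ≡ nodeKind x
  kind-fromNode x = ≡.trans (kind-toNode (fromNode x)) (cong nodeKind (to-from x))

  χ-kind : Character → Kind → 𝔽
  χ-kind Ξ = SP.χ (characterSigns Ξ) τ τ⁻¹ M.Θ ττ⁻¹ ττ

  ι-χ : ∀ Ξ x → ι ⌊ χ Ξ x ⌋ F.≈ χ-kind Ξ (nodeKind x)
  ι-χ plus      (swap _) = F.refl {τ long}
  ι-χ plusMinus (swap _) = F.refl {τ long}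
  ι-χ minusPlus (swap _) = LM.constant-neg n ⌊ t ½^ -1ℤ ⌋
  ι-χ minus     (swap _) = LM.constant-neg n ⌊ t ½^ -1ℤ ⌋
  ι-χ plus      flip     = F.refl {τ short}
  ι-χ minusPlus flip     = F.refl {τ short}
  ι-χ plusMinus flip     = LM.constant-neg n ⌊ tₙ ½^ -1ℤ ⌋
  ι-χ minus     flip     = LM.constant-neg n ⌊ tₙ ½^ -1ℤ ⌋

  ι-χ⟦⟧ : ∀ Ξ w → ι ⌊ χ⟦ Ξ ⟧ w ⌋ F.≈ FM.⟦ χ-kind Ξ ∘ kind ⟧ (gens w)
  ι-χ⟦⟧ Ξ []      = LM.constant-1 n
  ι-χ⟦⟧ Ξ (x ∷ w) = F.trans {ι (⌊ χ Ξ x ⌋ 𝕂.* ⌊ χ⟦ Ξ ⟧ w ⌋)} {ι ⌊ χ Ξ x ⌋ F.* ι ⌊ χ⟦ Ξ ⟧ w ⌋} {χ-kind Ξ (kind (fromNode x)) F.* FM.⟦ χ-kind Ξ ∘ kind ⟧ (gens w)}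
    (F.sym {ι ⌊ χ Ξ x ⌋ F.* ι ⌊ χ⟦ Ξ ⟧ w ⌋} {ι (⌊ χ Ξ x ⌋ 𝕂.* ⌊ χ⟦ Ξ ⟧ w ⌋)} (LM.constant-* n ⌊ χ Ξ x ⌋ ⌊ χ⟦ Ξ ⟧ w ⌋))
    (F.*-cong {ι ⌊ χ Ξ x ⌋} {χ-kind Ξ (kind (fromNode x))} {ι ⌊ χ⟦ Ξ ⟧ w ⌋} {FM.⟦ χ-kind Ξ ∘ kind ⟧ (gens w)}
      (subst (λ κ → ι ⌊ χ Ξ x ⌋ F.≈ χ-kind Ξ κ) (≡.sym (kind-fromNode x)) (ι-χ Ξ x)) (ι-χ⟦⟧ Ξ w))

  scalar-χ : ∀ Ξ w → scalar ⌊ χ⟦ Ξ ⟧ w ⌋ ≈ fun S (FM.⟦ χ-kind Ξ ∘ kind ⟧ (gens w))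
  scalar-χ Ξ w = ≈-trans (≈-sym (fun-scalar S ⌊ χ⟦ Ξ ⟧ w ⌋)) (fun-cong S (ι-χ⟦⟧ Ξ w))

  χ-inverse : ∀ Ξ w → fun S (FM.⟦ χ-kind Ξ ∘ kind ⟧ (gens w)) * scalar (χ⟦ Ξ ⟧ w ⁻¹) ≈ 1#
  χ-inverse Ξ w = ≈-trans (*-cong (≈-sym (scalar-χ Ξ w)) ≈-refl) (≈-trans (≈-sym (scalar-* ⌊ χ⟦ Ξ ⟧ w ⌋ (χ⟦ Ξ ⟧ w ⁻¹)))
    (≈-trans (scalar-cong (𝕂-Frac.inverseʳ ⌊ χ⟦ Ξ ⟧ w ⌋ (proj₂ (χ⟦ Ξ ⟧ w)))) scalar-1))

  product-gens : (f : FiniteNode → H̃) (g : Gen m → H̃) → (∀ x → f x ≈ g (fromNode x)) → ∀ w → product f w ≈ B.⟦ g ⟧ (gens w)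
  product-gens f g f≈g []      = ≈-refl
  product-gens f g f≈g (x ∷ w) = *-cong (f≈g x) (product-gens f g f≈g w)

  -- ε is defined by the T's of side X; through this identification the same argument runs on side
  -- Y.
  T-sides : ∀ x → T X (finite x) ≈ T S (finite x)
  T-sides = by S
    where
    by : ∀ R x → T X (finite x) ≈ T R (finite x)
    by X x = ≈-refl
    by Y x = T-finite x

  T⟦⟧ : ∀ w → T⟦ w ⟧ ≈ B.⟦ Tᵍ ⟧ (gens w)
  T⟦⟧ = product-gens (λ x → T X (finite x)) Tᵍ λ x → ≈-trans (T-sides x) (Ring.reflexive HR (cong (λ y → T S (finite y)) (≡.sym (to-from x))))

  s⟦⟧ : ∀ w → s⟦ S ⟧ w ≈ B.⟦ sᵍ ⟧ (gens w)
  s⟦⟧ = product-gens (λ x → s S (finite x)) sᵍ λ x → Ring.reflexive HR (cong (λ y → s S (finite y)) (≡.sym (to-from x)))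

  χT⟦⟧ : ∀ Ξ w → scalar ⌊ χ⟦ Ξ ⟧ w ⌋ * T⟦ w ⟧ ≈ B.⟦ (λ i → fun S (χ-kind Ξ (kind i)) * Tᵍ i) ⟧ (gens w)
  χT⟦⟧ Ξ w = ≈-trans (*-cong (≈-trans (scalar-χ Ξ w) (SP.φ-⟦⟧ (χ-kind Ξ ∘ kind) (gens w))) (T⟦⟧ w))
    (≈-sym (SP.⟦⟧-central-* (λ i → fun S (χ-kind Ξ (kind i))) Tᵍ (λ i → central (kind i)) (gens w)))
    where
    negated : ∀ κ → fun S (F.- τ⁻¹ κ) ≈ fun S (ι (𝕂.- ⌊ root κ ½^ -1ℤ ⌋))
    negated κ = fun-cong S (F.sym {ι (𝕂.- ⌊ root κ ½^ -1ℤ ⌋)} {F.- τ⁻¹ κ} (LM.constant-neg n ⌊ root κ ½^ -1ℤ ⌋))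
    central-pick : ∀ σ κ x → fun S (pick σ (τ κ) (F.- τ⁻¹ κ)) * x ≈ x * fun S (pick σ (τ κ) (F.- τ⁻¹ κ))
    central-pick Sign.+ κ x = ι-central ⌊ root κ ½^ 1ℤ ⌋ x
    central-pick Sign.- κ x = ≈-trans (*-cong (negated κ) ≈-refl)
      (≈-trans (ι-central (𝕂.- ⌊ root κ ½^ -1ℤ ⌋) x) (*-cong ≈-refl (≈-sym (negated κ))))
    central : ∀ κ x → fun S (χ-kind Ξ κ) * x ≈ x * fun S (χ-kind Ξ κ)
    central κ = central-pick (characterSigns Ξ κ) κ

  sgn-∷ : ∀ Ξ x w → sgn Ξ (x ∷ w) ≈ PM.±1 (characterSigns Ξ (nodeKind x)) * sgn Ξ w
  sgn-∷ plus      x        w = ≈-sym (*-identityˡ 1#)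
  sgn-∷ minus     (swap _) w = ≈-refl
  sgn-∷ minus     flip     w = Ring.reflexive HR (cong (λ k → (- 1#) ^ k) (ℕ.+-suc (ℓs w) (ℓd w)))
    where open import Algebra.Properties.Semiring.Exp (Ring.semiring HR) using (_^_)
  sgn-∷ plusMinus (swap _) w = ≈-sym (*-identityˡ _)
  sgn-∷ plusMinus flip     w = ≈-refl
  sgn-∷ minusPlus (swap _) w = ≈-refl
  sgn-∷ minusPlus flip     w = ≈-sym (*-identityˡ _)

  sgn⟦⟧ : ∀ Ξ w → sgn Ξ w ≈ B.⟦ PM.±1 ∘ characterSigns Ξ ∘ kind ⟧ (gens w)
  sgn⟦⟧ plus      [] = ≈-refl
  sgn⟦⟧ minus     [] = ≈-refl
  sgn⟦⟧ plusMinus [] = ≈-refl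
  sgn⟦⟧ minusPlus [] = ≈-refl
  sgn⟦⟧ Ξ (x ∷ w) = ≈-trans (sgn-∷ Ξ x w)
    (*-cong (Ring.reflexive HR (cong (λ κ → PM.±1 (characterSigns Ξ κ)) (≡.sym (kind-fromNode x)))) (sgn⟦⟧ Ξ w))

  sgn-s⟦⟧ : ∀ Ξ w → sgn Ξ w * s⟦ S ⟧ w ≈ B.⟦ (λ i → PM.±1 (characterSigns Ξ (kind i)) * sᵍ i) ⟧ (gens w)
  sgn-s⟦⟧ Ξ w = ≈-trans (*-cong (sgn⟦⟧ Ξ w) (s⟦⟧ w))
    (≈-sym (SP.⟦⟧-central-* (λ i → PM.±1 (characterSigns Ξ (kind i))) sᵍ (λ i → PM.±1-central (characterSigns Ξ (kind i))) (gens w)))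

  τ-central : ∀ κ x → fun S (τ κ) * x ≈ x * fun S (τ κ)
  τ-central κ = ι-central ⌊ root κ ½^ 1ℤ ⌋

  τ⁻¹-central : ∀ κ x → fun S (τ⁻¹ κ) * x ≈ x * fun S (τ⁻¹ κ)
  τ⁻¹-central κ = ι-central ⌊ root κ ½^ -1ℤ ⌋

  module H = Hecke HR RF Φ

  module _ (W : ReducedWords) where
    open Symmetrizers W
    open ReducedWords W

    -- The signed reflections satisfy the braid relations, so each listed reduced word may be
    -- replaced by its normal form.
    e-words : ∀ Ξ → e S Ξ ≈ H.∑words (M.Character.σs (characterSigns Ξ))
    e-words Ξ = sum-words W (Ring.+-commutativeMonoid HR) (λ w → sgn Ξ w * s⟦ S ⟧ w) _
      λ w w⇝ → ≈-trans (sgn-s⟦⟧ Ξ w) (B.⟦⟧-⇝ (M.Character.σs-braided (characterSigns Ξ)) w⇝)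

    ε-words : ∀ Ξ → ∑ words (λ w → scalar ⌊ χ⟦ Ξ ⟧ w ⌋ * T⟦ w ⟧) ≈
      H.∑words (M.Character.Generators.g (characterSigns Ξ) Tᵍ τ τ⁻¹ τ-central τ⁻¹-central ττ⁻¹ τ⁻¹τ⁻¹ T-c′)
    ε-words Ξ = sum-words W (Ring.+-commutativeMonoid HR) (λ w → scalar ⌊ χ⟦ Ξ ⟧ w ⌋ * T⟦ w ⟧) _
      λ w w⇝ → ≈-trans (χT⟦⟧ Ξ w)
        (B.⟦⟧-⇝ (M.Character.Generators.g-braided (characterSigns Ξ) Tᵍ τ τ⁻¹ τ-central τ⁻¹-central ττ⁻¹ τ⁻¹τ⁻¹ T-c′) w⇝)

    module _ (w₀ : Word) (w₀-longest : Longest w₀) where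

      w₀⇝top : gens w₀ ⇝ word (top {m})
      w₀⇝top = longest⇒⇝ W w₀ (proj₁ w₀-longest) (proj₂ w₀-longest)

      normalisation : ∀ Ξ → fun S (FM.⟦ τ ∘ kind ⟧ (gens w₀)) * scalar (χ⟦ Ξ ⟧ w₀ ⁻¹) ≈
        B.⟦ PM.±1 ∘ characterSigns Ξ ∘ kind ⟧ (gens w₀) * fun S (FM.⟦ SP.weight (characterSigns Ξ) τ τ⁻¹ M.Θ ττ⁻¹ ττ ∘ kind ⟧ (word (top {m})))
      normalisation Ξ = SP.longest-scalar (characterSigns Ξ) τ τ⁻¹ M.Θ ττ⁻¹ ττ w₀⇝top (χ-inverse Ξ w₀)

      -- σ⁻ is the sign of the κ's to the left of the symmetrizer, taken at the opposite roots, and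
      -- σ⁺ that of the κ's to its right.
      module _ (σ⁻ σ⁺ : Sign) (turns⁻ : ∀ (p : Pt m) → turn σ⁻ p ≡ turn (direction S) (neg p))
               (turns⁺ : ∀ (p : Pt m) → turn σ⁺ p ≡ turn (direction S) p) where

        ∏-left : ∀ Ξ → H.∏roots (λ p r → pick (characterSigns Ξ long) F.1# (P.ℓ (neg p) (neg r))) (λ p → pick (characterSigns Ξ short) F.1# (P.h (neg p))) F.≈
          pick (characterSigns Ξ long) F.1# (κ-st S σ⁻) F.* pick (characterSigns Ξ short) F.1# (κ-dr S σ⁻)
        ∏-left Ξ = SP.∏roots-pickʳ (λ p r → P.ℓ (neg p) (neg r)) (λ p → P.h (neg p)) {κ-st S σ⁻} {κ-dr S σ⁻}
          (κ-st-roots σ⁻ Sign.- turns⁻) (κ-dr-roots σ⁻ Sign.- turns⁻) (characterSigns Ξ long) (characterSigns Ξ short)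

        ∏-right : ∀ Ξ → H.∏roots (λ p r → pick (characterSigns Ξ long) (P.ℓ p r) F.1#) (λ p → pick (characterSigns Ξ short) (P.h p) F.1#) F.≈
          pick (characterSigns Ξ long) (κ-st S σ⁺) F.1# F.* pick (characterSigns Ξ short) (κ-dr S σ⁺) F.1#
        ∏-right Ξ = SP.∏roots-pickˡ P.ℓ P.h {κ-st S σ⁺} {κ-dr S σ⁺}
          (κ-st-roots σ⁺ Sign.+ turns⁺) (κ-dr-roots σ⁺ Sign.+ turns⁺) (characterSigns Ξ long) (characterSigns Ξ short)

        ε-factorization : ∀ Ξ → scalar ⌊ χ⟦ plus ⟧ w₀ ⌋ * ε w₀ Ξ ≈ B.⟦ PM.±1 ∘ characterSigns Ξ ∘ kind ⟧ (gens w₀) *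
          (fun S (pick (characterSigns Ξ long) F.1# (κ-st S σ⁻) F.* pick (characterSigns Ξ short) F.1# (κ-dr S σ⁻)) * e S Ξ *
           fun S (pick (characterSigns Ξ long) (κ-st S σ⁺) F.1# F.* pick (characterSigns Ξ short) (κ-dr S σ⁺) F.1#))
        ε-factorization Ξ = SP.reassemble (scalar-χ plus w₀) (normalisation Ξ) (ε-words Ξ)
          (M.Character.Generators.weighted-factorization (characterSigns Ξ) Tᵍ τ τ⁻¹ τ-central τ⁻¹-central ττ⁻¹ τ⁻¹τ⁻¹ T-c′)
          (∏-left Ξ) (∏-right Ξ) (e-words Ξ)

        plus-factorization : scalar ⌊ χ⟦ plus ⟧ w₀ ⌋ * ε w₀ plus ≈ e S plus * fun S (κ-st S σ⁺) * fun S (κ-dr S σ⁺)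
        plus-factorization = ≈-trans (ε-factorization plus)
          (SP.both-right (κ-st S σ⁺) (κ-dr S σ⁺) (SP.signs-top (characterSigns plus) ≡.refl w₀⇝top))

        minus-factorization : scalar ⌊ χ⟦ plus ⟧ w₀ ⌋ * ε w₀ minus ≈ sgn minus w₀ * (fun S (κ-st S σ⁻) * fun S (κ-dr S σ⁻) * e S minus)
        minus-factorization = ≈-trans (ε-factorization minus)
          (SP.both-left (κ-st S σ⁻) (κ-dr S σ⁻) (≈-sym (sgn⟦⟧ minus w₀)))

        plusMinus-factorization : scalar ⌊ χ⟦ plus ⟧ w₀ ⌋ * ε w₀ plusMinus ≈
          sgn plusMinus w₀ * (fun S (κ-dr S σ⁻) * e S plusMinus * fun S (κ-st S σ⁺))
        plusMinus-factorization = ≈-trans (ε-factorization plusMinus)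
          (SP.short-left (κ-dr S σ⁻) (κ-st S σ⁺) (≈-sym (sgn⟦⟧ plusMinus w₀)))

        minusPlus-factorization : scalar ⌊ χ⟦ plus ⟧ w₀ ⌋ * ε w₀ minusPlus ≈
          fun S (κ-st S σ⁻) * e S minusPlus * fun S (κ-dr S σ⁺)
        minusPlus-factorization = ≈-trans (ε-factorization minusPlus)
          (SP.long-left (κ-st S σ⁻) (κ-dr S σ⁺) (SP.signs-top (characterSigns minusPlus) ≡.refl w₀⇝top))

proposition2p3 : (m : ℕ) → let open LocalizedDAHA ℂ m in
  (W : ReducedWords) → let open Symmetrizers W in
  (w₀ : Word) → Longest w₀ →
  let χ⁺ = scalar ⌊ χ⟦ plus ⟧ w₀ ⌋
      st = λ S σ → fun S (κ-st S σ)
      dr = λ S σ → fun S (κ-dr S σ)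
  in
  ( χ⁺ * ε w₀ plus ≈ e X plus * st X Sign.- * dr X Sign.-
  × χ⁺ * ε w₀ plus ≈ e Y plus * st Y Sign.+ * dr Y Sign.+ ) ×
  ( χ⁺ * ε w₀ minus ≈ sgn minus w₀ * (st X Sign.+ * dr X Sign.+ * e X minus)
  × χ⁺ * ε w₀ minus ≈ sgn minus w₀ * (st Y Sign.- * dr Y Sign.- * e Y minus) ) ×
  ( χ⁺ * ε w₀ plusMinus ≈ sgn plusMinus w₀ * (dr X Sign.+ * e X plusMinus * st X Sign.-)
  × χ⁺ * ε w₀ plusMinus ≈ sgn plusMinus w₀ * (dr Y Sign.- * e Y plusMinus * st Y Sign.+) ) ×
  ( χ⁺ * ε w₀ minusPlus ≈ st X Sign.+ * e X minusPlus * dr X Sign.-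
  × χ⁺ * ε w₀ minusPlus ≈ st Y Sign.- * e Y minusPlus * dr Y Sign.+ )
proposition2p3 m W w₀ longest =
  -- On side X the function at a root α already involves X^(-α). So the right factors are the κ's in
  -- the inverse variables and the left factors those in the variables themselves, by -(-p) = p. On
  -- side Y it is the other way round.
  ( FactoredSymmetrizers.plus-factorization ℂ m X W w₀ longest Sign.+ Sign.- (λ p → ≡.sym (neg-involutive p)) (λ _ → ≡.refl)
  , FactoredSymmetrizers.plus-factorization ℂ m Y W w₀ longest Sign.- Sign.+ (λ _ → ≡.refl) (λ _ → ≡.refl) ) ,
  ( FactoredSymmetrizers.minus-factorization ℂ m X W w₀ longest Sign.+ Sign.- (λ p → ≡.sym (neg-involutive p)) (λ _ → ≡.refl)
  , FactoredSymmetrizers.minus-factorization ℂ m Y W w₀ longest Sign.- Sign.+ (λ _ → ≡.refl) (λ _ → ≡.refl) ) ,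
  ( FactoredSymmetrizers.plusMinus-factorization ℂ m X W w₀ longest Sign.+ Sign.- (λ p → ≡.sym (neg-involutive p)) (λ _ → ≡.refl)
  , FactoredSymmetrizers.plusMinus-factorization ℂ m Y W w₀ longest Sign.- Sign.+ (λ _ → ≡.refl) (λ _ → ≡.refl) ) ,
  ( FactoredSymmetrizers.minusPlus-factorization ℂ m X W w₀ longest Sign.+ Sign.- (λ p → ≡.sym (neg-involutive p)) (λ _ → ≡.refl)
  , FactoredSymmetrizers.minusPlus-factorization ℂ m Y W w₀ longest Sign.- Sign.+ (λ _ → ≡.refl) (λ _ → ≡.refl) )
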